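{- Fix a positive integer $k$. For any $\delta>0$ there is a sufficiently large $\ell$ such that the following holds with $r^\star=\frac{10k}{\delta}$. Let $U$ be a set of $3J$ variables consisting of the variables of $J$ pairwise variable-disjoint linear equations $e_1,\dots,e_J$ over $\mathbb{F}_2$ (each on $3$ variables, $e_i$ being $\langle x,x_{e_i}\rangle=b_i$), let $H_U=\mathrm{span}(x_{e_1},\dots,x_{e_J})\subseteq\mathbb{F}_2^U$ and let $\psi:H_U\to\mathbb{F}_2$ be the linear map with $\psi(x_{e_i})=b_i$. Let $T_1$ assign to each $L\in\mathrm{Grass}(\mathbb{F}_2^U,2\ell)$ with $L\cap H_U=\{0\}$ a linear function $T_1[L\oplus H_U]:L\oplus H_U\to\mathbb{F}_2$ whose restriction to $H_U$ is $\psi$, and let $T_2$ assign to each $R\in\mathrm{Grass}(\mathbb{F}_2^U,2(1-\delta)\ell)$ with $R\cap H_U=\{0\}$ a linear function $T_2[R]:R\to\mathbb{F}_2$. Suppose \[\Pr[T_1[L_i\oplus H_U]|_R=T_2[R]\ \forall i\in[k]]=\epsilon\ge 2^{ -2(1-1000\delta)\ell k},\] where $R$ is uniform in $\mathrm{Grass}(\mathbb{F}_2^U,2(1-\delta)\ell)$ subject to $R\cap H_U=\{0\}$, and $L_1,\dots,L_k\in\mathrm{Grass}(\mathbb{F}_2^U,2\ell)$ are independent and uniform subject to $L_i\cap H_U=\{0\}$ and $L_i\supseteq R$. Then there are integers $r_1,r_2$ with $r_1+r_2\le r^\star$ such that for at least a $2^{ -6\ell^2}$ fraction of the $r_1$-dimensional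 subspaces $Q\subseteq\mathbb{F}_2^U$, there exist a subspace $W\subseteq\mathbb{F}_2^U$ of codimension $r_2$ containing $Q\oplus H_U$ and a linear function $g_{Q,W}:W\to\mathbb{F}_2$ with $g_{Q,W}|_{H_U}=\psi$ such that \[\Pr_L[g_{Q,W}|_{L\oplus H_U}=T_1[L\oplus H_U]\mid Q\subseteq L\subseteq W]\ge\frac{2^{ -2(1-1000\delta^2)\ell}}{5},\] where $L$ is a uniform $2\ell$-dimensional subspace of $\mathbb{F}_2^U$ with $L\cap H_U=\{0\}$.
   Context: $\mathrm{Grass}(V,m)$ denotes the set of $m$-dimensional subspaces of a vector space $V$ over $\mathbb{F}_2$; $x_{e}\in\mathbb{F}_2^U$ denotes the indicator vector of the three variables of equation $e$. -}

module Defs where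

open import Data.Bool using (Bool; true; false; _∧_; _∨_; _xor_; not; if_then_else_)
open import Data.Nat as ℕ using (ℕ; zero; suc)
open import Data.Integer as ℤ using (ℤ; +_; -[1+_])
open import Data.Rational as ℚ using (ℚ; _/_; _÷_; ↥_; ↧ₙ_; Positive)
open import Data.Rational.Properties using (pos⇒nonZero)
import Data.Nat.Properties as ℕP
import Data.Bool.ListAction as BL
open import Data.Fin using (Fin)
open import Data.Vec as Vec using (Vec; []; _∷_; zipWith; replicate)
open import Data.List as List using (List; []; _∷_; filter; length; map; cartesianProduct; concatMap; foldr)
open import Data.Product using (_×_; _,_)
open import Relation.Nullary.Decidable using (Dec; yes; no)
open import Relation.Binary.PropositionalEquality using (_≡_)

-- Vectors of 𝔽₂^n are Vec Bool n (true = 1); addition is xor.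

V : ℕ → Set
V n = Vec Bool n

_⊕v_ : ∀ {n} → V n → V n → V n
_⊕v_ = zipWith _xor_

0v : ∀ {n} → V n
0v = replicate _ false

_==v_ : ∀ {n} → V n → V n → Bool
[] ==v [] = true
(a ∷ u) ==v (b ∷ v) = not (a xor b) ∧ (u ==v v)

allV : (n : ℕ) → List (V n)
allV zero = [] ∷ []
allV (suc n) = map (false ∷_) (allV n) List.++ map (true ∷_) (allV n)

allᵇ : ∀ {n} → (V n → Bool) → Bool
allᵇ {n} P = BL.all P (allV n)

anyᵇ : ∀ {n} → (V n → Bool) → Bool
anyᵇ {n} P = BL.any P (allV n)

countᵇ : ∀ {n} → (V n → Bool) → ℕ
countᵇ {n} P = length (filter (λ v → P v ≡? true) (allV n))
  where
  _≡?_ : (a b : Bool) → Dec (a ≡ b)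
  a ≡? b = Data.Bool._≟_ a b
    where import Data.Bool

_⇒ᵇ_ : Bool → Bool → Bool
a ⇒ᵇ b = not a ∨ b

-- Subsets of 𝔽₂^n, represented canonically as binary tries of Bools
-- (one Bool per vector), so that they can be enumerated.

VSet : ℕ → Set
VSet zero = Bool
VSet (suc n) = VSet n × VSet n

mem : ∀ {n} → VSet n → V n → Bool
mem {zero} b [] = b
mem {suc n} (s₀ , s₁) (false ∷ v) = mem s₀ v
mem {suc n} (s₀ , s₁) (true ∷ v) = mem s₁ v

tabulateS : ∀ {n} → (V n → Bool) → VSet n
tabulateS {zero} P = P []
tabulateS {suc n} P = tabulateS (λ v → P (false ∷ v)) , tabulateS (λ v → P (true ∷ v))

allSets : (n : ℕ) → List (VSet n)
allSets zero = false ∷ true ∷ []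
allSets (suc n) = cartesianProduct (allSets n) (allSets n)

_⊆ᵇ_ : ∀ {n} → VSet n → VSet n → Bool
A ⊆ᵇ B = allᵇ (λ v → mem A v ⇒ᵇ mem B v)

card : ∀ {n} → VSet n → ℕ
card S = countᵇ (mem S)

isSubspace : ∀ {n} → VSet n → Bool
isSubspace S = mem S 0v ∧ allᵇ (λ u → allᵇ (λ v → (mem S u ∧ mem S v) ⇒ᵇ mem S (u ⊕v v)))

-- S ∈ Grass(𝔽₂^n, d): a subspace with 2^d elements, i.e. of dimension d
isGrass : ∀ {n} → ℕ → VSet n → Bool
isGrass {n} d S = isSubspace S ∧ (card S ℕ.≡ᵇ (2 ℕ.^ d))

-- Grass(𝔽₂^n, d) as a list (each subspace exactly once)
Grass : (n d : ℕ) → List (VSet n)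
Grass n d = filter (λ S → Data.Bool._≟_ (isGrass d S) true) (allSets n)
  where import Data.Bool

sumS : ∀ {n} → VSet n → VSet n → VSet n
sumS A B = tabulateS (λ v → anyᵇ (λ a → mem A a ∧ mem B (a ⊕v v)))

trivInter : ∀ {n} → VSet n → VSet n → Bool
trivInter A B = allᵇ (λ v → (mem A v ∧ mem B v) ⇒ᵇ (v ==v 0v))

LinearOn : ∀ {n} → VSet n → (V n → Bool) → Set
LinearOn S f = ∀ u v → mem S u ≡ true → mem S v ≡ true → f (u ⊕v v) ≡ (f u xor f v)

agreeOnᵇ : ∀ {n} → VSet n → (V n → Bool) → (V n → Bool) → Bool
agreeOnᵇ S f g = allᵇ (λ v → mem S v ⇒ᵇ (f v ==b g v))
  where
  _==b_ : Bool → Bool → Bool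
  a ==b b = not (a xor b)

comb : ∀ {J n} → (Fin J → V n) → V J → V n
comb {zero} e [] = 0v
comb {suc J} e (c ∷ cs) =
  (if c then e Fin.zero else 0v) ⊕v comb (λ i → e (Fin.suc i)) cs
  where import Data.Fin as Fin

combB : ∀ {J} → (Fin J → Bool) → V J → Bool
combB {zero} b [] = false
combB {suc J} b (c ∷ cs) = (c ∧ b Fin.zero) xor combB (λ i → b (Fin.suc i)) cs
  where import Data.Fin as Fin

HU : ∀ {J n} → (Fin J → V n) → VSet n
HU {J} e = tabulateS (λ v → anyᵇ {J} (λ c → v ==v comb e c))

-- g restricted to H_U equals ψ (ψ(x_{e_i}) = b_i, extended linearly)
RestrictsToψ : ∀ {J n} → (Fin J → V n) → (Fin J → Bool) → (V n → Bool) → Set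
RestrictsToψ e b g = ∀ c → g (comb e c) ≡ combB b c

weight : ∀ {n} → V n → ℕ
weight [] = 0
weight (false ∷ v) = weight v
weight (true ∷ v) = suc (weight v)

disjointᵇ : ∀ {n} → V n → V n → Bool
disjointᵇ [] [] = true
disjointᵇ (a ∷ u) (b ∷ v) = not (a ∧ b) ∧ disjointᵇ u v

-- a / b as a rational, 0 if b = 0 (empty sample space)
frac : ℕ → ℕ → ℚ
frac a zero = ℚ.0ℚ
frac a (suc b) = (+ a) / suc b

_^ℚ_ : ℚ → ℕ → ℚ
q ^ℚ zero = ℚ.1ℚ
q ^ℚ suc m = q ℚ.* (q ^ℚ m)

sumℚ : List ℚ → ℚ
sumℚ = foldr ℚ._+_ ℚ.0ℚ

fromℕ : ℕ → ℚ
fromℕ m = (+ m) / 1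

2^ℤ : ℤ → ℚ
2^ℤ (+ m) = fromℕ (2 ℕ.^ m)
2^ℤ -[1+ m ] = (+ 1) / (2 ℕ.^ suc m)
  where instance _ = ℕP.m^n≢0 2 (suc m)

-- 2^(-x) ≤ p  for rational x = a/b (b > 0) and p ≥ 0,
-- i.e. 2^(-a) ≤ p^b  (x ↦ x^b is monotone on ℚ≥0).
TwoPowNeg≤ : ℚ → ℚ → Set
TwoPowNeg≤ x p = 2^ℤ (ℤ.- (↥ x)) ℚ.≤ (p ^ℚ (↧ₙ x))

rStar : ℕ → (δ : ℚ) → Positive δ → ℚ
rStar k δ pos = (fromℕ (10 ℕ.* k) ÷ δ) {{pos⇒nonZero δ {{pos}}}}

module _ {J : ℕ} (ℓ dR : ℕ) (e : Fin J → V (3 ℕ.* J))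
         (T₁ T₂ : VSet (3 ℕ.* J) → V (3 ℕ.* J) → Bool) where

  private
    n = 3 ℕ.* J
    H = HU e
    _≡?_ : (a b : Bool) → Dec (a ≡ b)
    a ≡? b = Data.Bool._≟_ a b
      where import Data.Bool
    select : (VSet n → Bool) → List (VSet n) → List (VSet n)
    select P = filter (λ S → P S ≡? true)

  admissibleR : List (VSet n)
  admissibleR = select (trivInter H) (Grass n dR)

  admissibleL⊇ : VSet n → List (VSet n)
  admissibleL⊇ R = select (λ L → trivInter H L ∧ (R ⊆ᵇ L)) (Grass n (2 ℕ.* ℓ))

  pAgree : VSet n → ℚ
  pAgree R = frac (length (select (λ L → agreeOnᵇ R (T₁ (sumS L H)) (T₂ R)) (admissibleL⊇ R)))
                  (length (admissibleL⊇ R))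

  -- ε = Pr_{R, L₁..L_k}[ ∀ i, T₁[L_i ⊕ H_U]|_R = T₂[R] ]
  --   = E_R [ pAgree(R)^k ]   (L_i independent given R)
  εTest : ℕ → ℚ
  εTest k = frac 1 (length admissibleR) ℚ.* sumℚ (map (λ R → pAgree R ^ℚ k) admissibleR)

  pDecode : VSet n → VSet n → (V n → Bool) → ℚ
  pDecode Q W g = frac (length (select (λ L → agreeOnᵇ (sumS L H) g (T₁ (sumS L H))) cond))
                       (length cond)
    where
    cond = select (λ L → trivInter H L ∧ (Q ⊆ᵇ L) ∧ (L ⊆ᵇ W)) (Grass n (2 ℕ.* ℓ))

{-# OPTIONS --safe #-}

-- Linear functionals are written ⟨x,·⟩ and subspaces are replaced by the matrices of their bases. Put d = 2ℓ, t = 2δℓ, D = d - t,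
-- and r ≈ 2k/δ. Call Q good for (r₁,r₂) if it admits W and g as in the conclusion, and suppose that for all r₁, r₂ ≤ r the good Q
-- have density below 2^(-6ℓ²). Then only a negligible fraction of the L is bad, that is, contains a good Q. After discarding the
-- bad L, the function f_x(N) = [T₁ agrees with ⟨x,·⟩ on span N ⊕ H] is global for every x extending ψ: no restriction by at most r
-- conditions on rows and columns of N raises its density above 2^(-D).
-- Let F_x be the average of f_x over t of the d columns. The part of F_x of Fourier rank below r has small moments, by a level
-- inequality for global functions; the rest has squared norm at most 2^(-tr-D), since f_x depends only on the span of the columns
-- and hence its Fourier coefficients are constant on large sets. So the 2k-th moment of F_x over the R with T₂[R] = ⟨x,·⟩, averaged
-- over x, is small. By Jensen's inequality, however, this moment is at least about 2^(-D-2kt) ε², a contradiction for large ℓ.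
module Submission where

open import Defs
import Data.Bool
open import Data.Bool using (Bool; true; false; _∧_; _∨_; _xor_; not; if_then_else_)
import Data.Bool.ListAction as BL
import Data.Bool.Properties as BP
open import Data.Empty using (⊥; ⊥-elim)
import Data.Fin as Fin
open import Data.Fin using (Fin)
import Data.Integer as ℤ
import Data.Integer.Properties as ZP
open import Data.List using (List; []; _∷_; _++_; map; cartesianProductWith; cartesianProduct; length; filter; upTo)
open import Data.List.Membership.Propositional using (_∈_)
open import Data.List.Membership.Propositional.Properties using (∈-++⁺ˡ; ∈-++⁺ʳ; ∈-map⁺; ∈-cartesianProduct⁺; ∈-cartesianProductWith⁺; ∈-upTo⁺; ∈-upTo⁻)
import Data.List.Properties as LP
import Data.List.Relation.Unary.All as All
open import Data.List.Relation.Unary.All using (All)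
import Data.List.Relation.Unary.All.Properties as AllP
open import Data.List.Relation.Unary.AllPairs using ([]; _∷_)
open import Data.List.Relation.Unary.Any using (here; there)
open import Data.List.Relation.Unary.Unique.Propositional using (Unique)
import Data.List.Relation.Unary.Unique.Propositional.Properties as UniqueP
open import Data.Maybe using (Maybe; just; nothing)
import Data.Nat as ℕ
open import Data.Nat using (ℕ; zero; suc)
import Data.Nat.Coprimality as Cop
import Data.Nat.DivMod as DM
import Data.Nat.Properties as NP
import Data.Nat.Tactic.RingSolver as NS
open import Data.Product using (_×_; _,_; proj₁; proj₂; ∃; Σ; ∃-syntax; ∃₂)
import Data.Rational as ℚ
open import Data.Rational using (ℚ; 0ℚ; 1ℚ; ½; _+_; _*_; _-_; -_; _≤_; _<_; Positive)
import Data.Rational.Properties as QP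
import Data.Rational.Unnormalised as ℚᵘ
import Data.Rational.Unnormalised.Properties as UP
open import Data.Sum using (_⊎_; inj₁; inj₂)
open import Data.Unit using (⊤; tt)
import Data.Vec as Vec
open import Data.Vec using (Vec; []; _∷_; zipWith; replicate)
import Data.Vec.Properties as VP
open import Function using (_∘_; id; case_of_)
open import Level using (0ℓ)
open import Relation.Binary.PropositionalEquality using (_≡_; _≢_; refl; sym; trans; cong; cong₂; subst; subst₂; module ≡-Reasoning)
open import Relation.Nullary using (¬_; Dec; yes; no)
open import Tactic.RingSolver using (solve-∀)
open import Tactic.RingSolver.Core.AlmostCommutativeRing using (AlmostCommutativeRing; fromCommutativeRing)

-- The moment bound is a hypercontractive inequality free of `n` and `d`. The coefficients of
-- `(val Φ)^s` are iterated convolutions of `Φ`, and `op` bounds convolution with `Φ` on matrices of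
-- bounded rank: two of them whose column and row spaces meet trivially are determined by their sum
-- up to boundedly many choices, and a shared direction is removed by a restriction of `Φ`, which
-- lowers the rank. This needs all restrictions of `Φ` to be small, but truncation by rank does not
-- commute with restriction; the defect is an average of shears, and shears keep a function global.
-- So a bound on the low part of every global function yields a better one, and iteration leads from
-- 1 to nearly the square of the density. A second obstacle is that `T₁` sees only L ⊕ H. Goodness
-- of Q and badness of L must therefore depend on them modulo H only, and a zoom to a subspace not
-- containing Q ⊕ H is replaced by one to its sum with Q ⊕ H. In the exponent of ε the constant 1000
-- is room: it yields a slack of 2000 t k, of which the error terms take at most 19 t k.

private variable n d : ℕ
-- Rational arithmetic and finite sums
ℚring : AlmostCommutativeRing 0ℓ 0ℓ
ℚring = fromCommutativeRing QP.+-*-commutativeRing λ x → zero? x (0ℚ QP.≟ x)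
  where
  zero? : ∀ x → Dec (0ℚ ≡ x) → Maybe (0ℚ ≡ x)
  zero? x (yes p) = just p
  zero? x (no _) = nothing

≤-trans = λ {a b c : ℚ} → QP.≤-trans {a} {b} {c}
≤-refl = λ {a : ℚ} → QP.≤-refl {a}

≤≡ : {a b : ℚ} → a ≡ b → a ≤ b
≤≡ refl = ≤-refl

*-monoˡ : {a b : ℚ} (c : ℚ) → 0ℚ ≤ c → a ≤ b → c * a ≤ c * b
*-monoˡ c c≥0 = QP.*-monoˡ-≤-nonNeg c {{ℚ.nonNegative c≥0}}

*-monoʳ : {a b : ℚ} (c : ℚ) → 0ℚ ≤ c → a ≤ b → a * c ≤ b * c
*-monoʳ c c≥0 = QP.*-monoʳ-≤-nonNeg c {{ℚ.nonNegative c≥0}}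

*-≥0 : {a b : ℚ} → 0ℚ ≤ a → 0ℚ ≤ b → 0ℚ ≤ a * b
*-≥0 {a} {b} a≥0 b≥0 = ≤-trans (≤≡ (sym (QP.*-zeroʳ a))) (*-monoˡ a a≥0 b≥0)

+-≥0 : {a b : ℚ} → 0ℚ ≤ a → 0ℚ ≤ b → 0ℚ ≤ a + b
+-≥0 = QP.+-mono-≤

*-mono : {a b c d : ℚ} → 0ℚ ≤ a → 0ℚ ≤ c → a ≤ b → c ≤ d → a * c ≤ b * d
*-mono {a} {b} {c} {d} a≥0 c≥0 a≤b c≤d = ≤-trans (*-monoˡ a a≥0 c≤d) (*-monoʳ d (≤-trans c≥0 c≤d) a≤b)

*-cancelˡ-≤ : {a b : ℚ} (c : ℚ) → 0ℚ < c → c * a ≤ c * b → a ≤ b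
*-cancelˡ-≤ c c>0 = QP.*-cancelˡ-≤-pos c {{ℚ.positive c>0}}

sq≥0 : (x : ℚ) → 0ℚ ≤ x * x
sq≥0 x with QP.≤-total 0ℚ x
... | inj₁ p = *-≥0 p p
... | inj₂ p = ≤-trans (*-≥0 q q) (≤≡ (lem x))
  where
  q : 0ℚ ≤ - x
  q = QP.neg-antimono-≤ p
  lem : ∀ x → (- x) * (- x) ≡ x * x
  lem = solve-∀ ℚring

≤⇒0≤- : {a b : ℚ} → a ≤ b → 0ℚ ≤ b - a
≤⇒0≤- {a} {b} p = ≤-trans (≤≡ (sym (QP.+-inverseʳ a))) (QP.+-monoˡ-≤ (- a) p)

0≤-⇒≤ : {a b : ℚ} → 0ℚ ≤ b - a → a ≤ b
0≤-⇒≤ {a} {b} p = ≤-trans (≤≡ (sym (QP.+-identityˡ a))) (≤-trans (QP.+-monoˡ-≤ a p) (≤≡ (lem a b)))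
  where
  lem : ∀ a b → (b - a) + a ≡ b
  lem = solve-∀ ℚring

-- Inequalities are proved by exhibiting the difference of the two sides as a non-negative quantity.
diff≤ : {a b : ℚ} (c : ℚ) → 0ℚ ≤ c → b ≡ a + c → a ≤ b
diff≤ {a} c c≥0 refl = ≤-trans (≤≡ (sym (QP.+-identityʳ a))) (QP.+-monoʳ-≤ a c≥0)

<⇒≱ : {a b : ℚ} → a < b → ¬ (b ≤ a)
<⇒≱ a<b b≤a = QP.<-irrefl refl (QP.<-≤-trans a<b b≤a)

≤∧≢⇒< : {a b : ℚ} → a ≤ b → a ≢ b → a < b
≤∧≢⇒< {a} {b} p q = QP.≰⇒> λ b≤a → q (QP.≤-antisym p b≤a)

sq-cancel-≤ : {x y : ℚ} → 0ℚ ≤ y → x * x ≤ y * y → x ≤ y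
sq-cancel-≤ {x} {y} y≥0 p with QP.≤-total x y
... | inj₁ q = q
... | inj₂ q with QP.≤-total x 0ℚ
...   | inj₁ r = ≤-trans r y≥0
...   | inj₂ r with x QP.≟ 0ℚ
...     | yes refl = y≥0
...     | no x≢0 = *-cancelˡ-≤ x (≤∧≢⇒< r (x≢0 ∘ sym)) (≤-trans p (*-monoʳ y y≥0 q))

0≤1 : 0ℚ ≤ 1ℚ
0≤1 = QP.nonNegative⁻¹ 1ℚ

0≤½ : 0ℚ ≤ ½
0≤½ = QP.nonNegative⁻¹ ½

two : ℚ
two = 1ℚ + 1ℚ

0≤two : 0ℚ ≤ two
0≤two = +-≥0 0≤1 0≤1

^-≥0 : {q : ℚ} → 0ℚ ≤ q → ∀ m → 0ℚ ≤ q ^ℚ m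
^-≥0 q≥0 zero = 0≤1
^-≥0 q≥0 (suc m) = *-≥0 q≥0 (^-≥0 q≥0 m)

^-mono : {p q : ℚ} → 0ℚ ≤ p → p ≤ q → ∀ m → p ^ℚ m ≤ q ^ℚ m
^-mono p≥0 p≤q zero = ≤-refl
^-mono p≥0 p≤q (suc m) = *-mono p≥0 (^-≥0 p≥0 m) p≤q (^-mono p≥0 p≤q m)

^-+ : ∀ q m n → q ^ℚ (m ℕ.+ n) ≡ q ^ℚ m * q ^ℚ n
^-+ q zero n = sym (QP.*-identityˡ _)
^-+ q (suc m) n = trans (cong (q *_) (^-+ q m n)) (sym (QP.*-assoc q _ _))

^-* : ∀ p q m → (p * q) ^ℚ m ≡ p ^ℚ m * q ^ℚ m
^-* p q zero = sym (QP.*-identityˡ _)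
^-* p q (suc m) = trans (cong (p * q *_) (^-* p q m)) (lem p q (p ^ℚ m) (q ^ℚ m))
  where
  lem : ∀ a b c d → a * b * (c * d) ≡ a * c * (b * d)
  lem = solve-∀ ℚring

1^ : ∀ m → 1ℚ ^ℚ m ≡ 1ℚ
1^ zero = refl
1^ (suc m) = trans (QP.*-identityˡ _) (1^ m)

^-^ : ∀ q m n → q ^ℚ (m ℕ.* n) ≡ (q ^ℚ m) ^ℚ n
^-^ q zero n = sym (1^ n)
^-^ q (suc m) n = begin
  q ^ℚ (n ℕ.+ m ℕ.* n)        ≡⟨ ^-+ q n (m ℕ.* n) ⟩
  q ^ℚ n * q ^ℚ (m ℕ.* n)     ≡⟨ cong (q ^ℚ n *_) (^-^ q m n) ⟩
  q ^ℚ n * (q ^ℚ m) ^ℚ n      ≡⟨ sym (^-* q (q ^ℚ m) n) ⟩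
  (q * q ^ℚ m) ^ℚ n           ∎
  where open ≡-Reasoning

^-cancel-≤ : {p q : ℚ} → 0ℚ ≤ q → ∀ m → p ^ℚ suc m ≤ q ^ℚ suc m → 0ℚ ≤ p → p ≤ q
^-cancel-≤ {p} {q} q≥0 m le p≥0 with QP.≤-total p q
... | inj₁ r = r
... | inj₂ r with p QP.≟ 0ℚ
...   | yes refl = q≥0
...   | no p≢0 = *-cancelˡ-≤ (p ^ℚ m) (^>0 m) (≤-trans (≤≡ (QP.*-comm (p ^ℚ m) p)) (≤-trans le
                   (≤-trans (*-monoˡ q q≥0 (^-mono q≥0 r m)) (≤≡ (QP.*-comm q (p ^ℚ m))))))
  where
  p>0 : 0ℚ < p
  p>0 = ≤∧≢⇒< p≥0 (p≢0 ∘ sym)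
  ^>0 : ∀ m → 0ℚ < p ^ℚ m
  ^>0 zero = QP.positive⁻¹ 1ℚ
  ^>0 (suc m) = QP.positive⁻¹ (p * p ^ℚ m) {{QP.pos*pos⇒pos p {{ℚ.positive p>0}} (p ^ℚ m) {{ℚ.positive (^>0 m)}}}}

pw : ℕ → ℚ
pw m = two ^ℚ m

hp : ℕ → ℚ
hp m = ½ ^ℚ m

pw≥0 : ∀ m → 0ℚ ≤ pw m
pw≥0 = ^-≥0 0≤two

hp≥0 : ∀ m → 0ℚ ≤ hp m
hp≥0 = ^-≥0 0≤½

pw*hp : ∀ m → pw m * hp m ≡ 1ℚ
pw*hp m = trans (sym (^-* two ½ m)) (1^ m)

hp*pw : ∀ m → hp m * pw m ≡ 1ℚ
hp*pw m = trans (QP.*-comm (hp m) (pw m)) (pw*hp m)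

pw>0 : ∀ m → 0ℚ < pw m
pw>0 m = ≤∧≢⇒< (pw≥0 m) λ eq → QP.<⇒≢ (QP.positive⁻¹ 1ℚ) (trans (sym (QP.*-zeroˡ (hp m))) (trans (cong (_* hp m) eq) (pw*hp m)))

hp>0 : ∀ m → 0ℚ < hp m
hp>0 m = ≤∧≢⇒< (hp≥0 m) λ eq → QP.<⇒≢ (QP.positive⁻¹ 1ℚ) (trans (sym (QP.*-zeroʳ (pw m))) (trans (cong (pw m *_) eq) (pw*hp m)))

pw-+ : ∀ m n → pw (m ℕ.+ n) ≡ pw m * pw n
pw-+ = ^-+ two

hp-+ : ∀ m n → hp (m ℕ.+ n) ≡ hp m * hp n
hp-+ = ^-+ ½

1≤pw : ∀ m → 1ℚ ≤ pw m
1≤pw m = ≤-trans (≤≡ (sym (1^ m))) (^-mono 0≤1 (diff≤ 1ℚ 0≤1 refl) m)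

pw-mono : ∀ {m n} → m ℕ.≤ n → pw m ≤ pw n
pw-mono {m} {n} m≤n = subst (λ z → pw m ≤ pw z) (NP.m+[n∸m]≡n m≤n)
  (≤-trans (≤≡ (sym (QP.*-identityʳ _))) (≤-trans (*-monoˡ (pw m) (pw≥0 m) (1≤pw (n ℕ.∸ m))) (≤≡ (sym (pw-+ m (n ℕ.∸ m))))))

hp≤1 : ∀ m → hp m ≤ 1ℚ
hp≤1 m = ≤-trans (^-mono 0≤½ (diff≤ ½ 0≤½ refl) m) (≤≡ (1^ m))

hp-anti : ∀ {m n} → m ℕ.≤ n → hp n ≤ hp m
hp-anti {m} {n} m≤n = subst (λ z → hp z ≤ hp m) (NP.m+[n∸m]≡n m≤n)
  (≤-trans (≤≡ (hp-+ m (n ℕ.∸ m))) (≤-trans (*-monoˡ (hp m) (hp≥0 m) (hp≤1 (n ℕ.∸ m))) (≤≡ (QP.*-identityʳ _))))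

∑ : {A : Set} → List A → (A → ℚ) → ℚ
∑ [] f = 0ℚ
∑ (x ∷ xs) f = f x + ∑ xs f

syntax ∑ xs (λ x → e) = ∑[ x ∈ xs ] e

module _ {A : Set} where

  ∑-cong : (xs : List A) {f g : A → ℚ} → (∀ x → f x ≡ g x) → ∑ xs f ≡ ∑ xs g
  ∑-cong [] e = refl
  ∑-cong (x ∷ xs) e = cong₂ _+_ (e x) (∑-cong xs e)

  ∑-+ : (xs : List A) (f g : A → ℚ) → ∑ xs (λ x → f x + g x) ≡ ∑ xs f + ∑ xs g
  ∑-+ [] f g = refl
  ∑-+ (x ∷ xs) f g = trans (cong (f x + g x +_) (∑-+ xs f g)) (lem (f x) (g x) (∑ xs f) (∑ xs g))
    where
    lem : ∀ a b c d → a + b + (c + d) ≡ a + c + (b + d)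
    lem = solve-∀ ℚring

  ∑-*ˡ : (xs : List A) (c : ℚ) (f : A → ℚ) → ∑ xs (λ x → c * f x) ≡ c * ∑ xs f
  ∑-*ˡ [] c f = sym (QP.*-zeroʳ c)
  ∑-*ˡ (x ∷ xs) c f = trans (cong (c * f x +_) (∑-*ˡ xs c f)) (sym (QP.*-distribˡ-+ c (f x) (∑ xs f)))

  ∑-*ʳ : (xs : List A) (c : ℚ) (f : A → ℚ) → ∑ xs (λ x → f x * c) ≡ ∑ xs f * c
  ∑-*ʳ xs c f = trans (∑-cong xs (λ x → QP.*-comm (f x) c)) (trans (∑-*ˡ xs c f) (QP.*-comm c (∑ xs f)))

  ∑-0 : (xs : List A) {f : A → ℚ} → (∀ x → f x ≡ 0ℚ) → ∑ xs f ≡ 0ℚ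
  ∑-0 [] e = refl
  ∑-0 (x ∷ xs) e = trans (cong₂ _+_ (e x) (∑-0 xs e)) refl

  ∑-mono : (xs : List A) {f g : A → ℚ} → (∀ x → f x ≤ g x) → ∑ xs f ≤ ∑ xs g
  ∑-mono [] e = ≤-refl
  ∑-mono (x ∷ xs) e = QP.+-mono-≤ (e x) (∑-mono xs e)

  ∑-≥0 : (xs : List A) {f : A → ℚ} → (∀ x → 0ℚ ≤ f x) → 0ℚ ≤ ∑ xs f
  ∑-≥0 xs e = ≤-trans (≤≡ (sym (∑-0 xs (λ _ → refl)))) (∑-mono xs e)

  ∑-++ : (xs ys : List A) (f : A → ℚ) → ∑ (xs ++ ys) f ≡ ∑ xs f + ∑ ys f
  ∑-++ [] ys f = sym (QP.+-identityˡ _)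
  ∑-++ (x ∷ xs) ys f = trans (cong (f x +_) (∑-++ xs ys f)) (sym (QP.+-assoc (f x) _ _))

  ∑-map : {B : Set} (xs : List B) (p : B → A) (f : A → ℚ) → ∑ (map p xs) f ≡ ∑ xs (f ∘ p)
  ∑-map [] p f = refl
  ∑-map (x ∷ xs) p f = cong (f (p x) +_) (∑-map xs p f)

∑-swap : {A B : Set} (xs : List A) (ys : List B) (f : A → B → ℚ) →
  ∑[ x ∈ xs ] ∑[ y ∈ ys ] f x y ≡ ∑[ y ∈ ys ] ∑[ x ∈ xs ] f x y
∑-swap [] ys f = sym (∑-0 ys (λ _ → refl))
∑-swap (x ∷ xs) ys f = trans (cong (∑ ys (f x) +_) (∑-swap xs ys f)) (sym (∑-+ ys (f x) _))

∑-prod : {A B : Set} (xs : List A) (ys : List B) (f : A → ℚ) (g : B → ℚ) →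
  ∑ xs f * ∑ ys g ≡ ∑[ x ∈ xs ] ∑[ y ∈ ys ] (f x * g y)
∑-prod xs ys f g = trans (sym (∑-*ʳ xs (∑ ys g) f)) (∑-cong xs λ x → sym (∑-*ˡ ys (f x) g))

∑-cartesian : {A B C : Set} (xs : List A) (ys : List B) (p : A → B → C) (f : C → ℚ) →
  ∑ (cartesianProductWith p xs ys) f ≡ ∑[ x ∈ xs ] ∑[ y ∈ ys ] f (p x y)
∑-cartesian [] ys p f = refl
∑-cartesian (x ∷ xs) ys p f = trans (∑-++ (map (p x) ys) _ f) (cong₂ _+_ (∑-map ys (p x) f) (∑-cartesian xs ys p f))

-- (S + S')² ≤ K (a + a')(b + b') because 2SS' ≤ K (ab' + a'b).
CS₂ : ∀ {K S S' a a' b b'} → 0ℚ ≤ K → 0ℚ ≤ a → 0ℚ ≤ a' → 0ℚ ≤ b → 0ℚ ≤ b' →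
  S * S ≤ K * (a * b) → S' * S' ≤ K * (a' * b') → (S + S') * (S + S') ≤ K * ((a + a') * (b + b'))
CS₂ {K} {S} {S'} {a} {a'} {b} {b'} K≥0 a≥0 a'≥0 b≥0 b'≥0 p p' =
  ≤-trans (≤≡ (e₁ S S')) (≤-trans (QP.+-mono-≤ (QP.+-mono-≤ p p') cross) (≤≡ (e₂ K a a' b b')))
  where
  y = K * (a * b' + a' * b)
  y≥0 : 0ℚ ≤ y
  y≥0 = *-≥0 K≥0 (+-≥0 (*-≥0 a≥0 b'≥0) (*-≥0 a'≥0 b≥0))
  four = two * two
  e₁ : ∀ S S' → (S + S') * (S + S') ≡ S * S + S' * S' + two * (S * S')
  e₁ = solve-∀ ℚring
  e₂ : ∀ K a a' b b' → K * (a * b) + K * (a' * b') + K * (a * b' + a' * b) ≡ K * ((a + a') * (b + b'))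
  e₂ = solve-∀ ℚring
  e₃ : ∀ S S' → (two * (S * S')) * (two * (S * S')) ≡ two * two * ((S * S) * (S' * S'))
  e₃ = solve-∀ ℚring
  e₄ : ∀ K a a' b b' → (K * (a * b' + a' * b)) * (K * (a * b' + a' * b)) ≡
         two * two * ((K * (a * b)) * (K * (a' * b'))) + (K * (a * b' - a' * b)) * (K * (a * b' - a' * b))
  e₄ = solve-∀ ℚring
  cross : two * (S * S') ≤ y
  cross = sq-cancel-≤ y≥0 (≤-trans (≤≡ (e₃ S S')) (≤-trans
    (*-monoˡ four (QP.nonNegative⁻¹ four) (*-mono (sq≥0 S) (sq≥0 S') p p'))
    (diff≤ _ (sq≥0 (K * (a * b' - a' * b))) (e₄ K a a' b b'))))

-- Cauchy-Schwarz in a form that can be nested: `S x` may itself be a sum or a bilinear form already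
-- bounded with constant `K`, and summation leaves `K` unchanged.
∑-CS : {A : Set} (xs : List A) (K : ℚ) (S a b : A → ℚ) → 0ℚ ≤ K → (∀ x → 0ℚ ≤ a x) → (∀ x → 0ℚ ≤ b x) →
  (∀ x → S x * S x ≤ K * (a x * b x)) → ∑ xs S * ∑ xs S ≤ K * (∑ xs a * ∑ xs b)
∑-CS [] K S a b K≥0 a≥0 b≥0 h = ≤≡ (sym (QP.*-zeroʳ K))
∑-CS (x ∷ xs) K S a b K≥0 a≥0 b≥0 h =
  CS₂ {K} {S x} {∑ xs S} {a x} {∑ xs a} {b x} {∑ xs b} K≥0 (a≥0 x) (∑-≥0 xs a≥0) (b≥0 x) (∑-≥0 xs b≥0) (h x) (∑-CS xs K S a b K≥0 a≥0 b≥0 h)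

cauchy-schwarz : {A : Set} (xs : List A) (f g : A → ℚ) →
  ∑ xs (λ x → f x * g x) * ∑ xs (λ x → f x * g x) ≤ ∑ xs (λ x → f x * f x) * ∑ xs (λ x → g x * g x)
cauchy-schwarz xs f g = ≤-trans (∑-CS xs 1ℚ (λ x → f x * g x) (λ x → f x * f x) (λ x → g x * g x) 0≤1 (λ x → sq≥0 (f x)) (λ x → sq≥0 (g x)) λ x → ≤≡ (lem (f x) (g x))) (≤≡ (QP.*-identityˡ _))
  where
  lem : ∀ a b → (a * b) * (a * b) ≡ 1ℚ * ((a * a) * (b * b))
  lem = solve-∀ ℚring

⟦_⟧ : Bool → ℚ
⟦ false ⟧ = 0ℚ
⟦ true ⟧ = 1ℚ

⟦⟧≥0 : ∀ b → 0ℚ ≤ ⟦ b ⟧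
⟦⟧≥0 false = ≤-refl
⟦⟧≥0 true = 0≤1

⟦⟧≤1 : ∀ b → ⟦ b ⟧ ≤ 1ℚ
⟦⟧≤1 false = 0≤1
⟦⟧≤1 true = ≤-refl

⟦∧⟧ : ∀ a b → ⟦ a ∧ b ⟧ ≡ ⟦ a ⟧ * ⟦ b ⟧
⟦∧⟧ false b = sym (QP.*-zeroˡ ⟦ b ⟧)
⟦∧⟧ true b = sym (QP.*-identityˡ ⟦ b ⟧)

⟦⟧*⟦⟧ : ∀ a → ⟦ a ⟧ * ⟦ a ⟧ ≡ ⟦ a ⟧
⟦⟧*⟦⟧ false = refl
⟦⟧*⟦⟧ true = refl

≡-from-iff : ∀ {a b : Bool} → (a ≡ true → b ≡ true) → (b ≡ true → a ≡ true) → a ≡ b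
≡-from-iff {false} {false} f g = refl
≡-from-iff {false} {true} f g = g refl
≡-from-iff {true} {b} f g = sym (f refl)

false≢true : {a : Bool} {X : Set} → a ≡ false → a ≡ true → X
false≢true refl ()

∧-true : ∀ {a b} → a ∧ b ≡ true → a ≡ true × b ≡ true
∧-true {true} {true} _ = refl , refl

∧-intro : ∀ {a b} → a ≡ true → b ≡ true → a ∧ b ≡ true
∧-intro refl refl = refl

-- `∑δ` encodes that `els` lists every element exactly once, directly as the rule for summing
-- against a Kronecker delta. All reindexing of sums goes through it.
record Enum (A : Set) : Set where
  field
    els : List A
    eq : A → A → Bool
    eq-sound : ∀ {x y} → eq x y ≡ true → x ≡ y
    eq-refl : ∀ x → eq x x ≡ true
    ∑δ : ∀ y (h : A → ℚ) → ∑[ x ∈ els ] (⟦ eq x y ⟧ * h x) ≡ h y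

  eq-complete : ∀ {x y} → x ≡ y → eq x y ≡ true
  eq-complete refl = eq-refl _

open Enum public

-- Insert the delta of `p a` and exchange the sums: `b = p a` iff `a = q b`, so the inner sum is
-- again over a delta.
∑-bij : {A B : Set} (EA : Enum A) (EB : Enum B) (p : A → B) (q : B → A) →
  (∀ a → q (p a) ≡ a) → (∀ b → p (q b) ≡ b) → (h : B → ℚ) → ∑ (els EA) (h ∘ p) ≡ ∑ (els EB) h
∑-bij EA EB p q qp pq h = begin
  ∑[ a ∈ els EA ] h (p a)
    ≡⟨ ∑-cong (els EA) (λ a → sym (∑δ EB (p a) h)) ⟩
  ∑[ a ∈ els EA ] ∑[ b ∈ els EB ] (⟦ eq EB b (p a) ⟧ * h b)
    ≡⟨ ∑-swap (els EA) (els EB) _ ⟩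
  ∑[ b ∈ els EB ] ∑[ a ∈ els EA ] (⟦ eq EB b (p a) ⟧ * h b)
    ≡⟨ ∑-cong (els EB) (λ b → ∑-cong (els EA) λ a → cong (λ z → ⟦ z ⟧ * h b)
         (≡-from-iff (λ e → eq-complete EA (trans (sym (qp a)) (cong q (sym (eq-sound EB e)))))
                     (λ e → eq-complete EB (trans (sym (pq b)) (cong p (sym (eq-sound EA e))))))) ⟩
  ∑[ b ∈ els EB ] ∑[ a ∈ els EA ] (⟦ eq EA a (q b) ⟧ * h b)
    ≡⟨ ∑-cong (els EB) (λ b → ∑δ EA (q b) (λ _ → h b)) ⟩
  ∑ (els EB) h ∎
  where open ≡-Reasoning

∑-×δ : {A B C : Set} (xs : List A) (ys : List B) (e₁ : A → Bool) (e₂ : B → Bool) (a₀ : A) (b₀ : B) (p : A → B → C) (h : C → ℚ) →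
  (∀ (k : A → ℚ) → ∑[ x ∈ xs ] (⟦ e₁ x ⟧ * k x) ≡ k a₀) → (∀ (k : B → ℚ) → ∑[ y ∈ ys ] (⟦ e₂ y ⟧ * k y) ≡ k b₀) →
  ∑[ x ∈ xs ] ∑[ y ∈ ys ] (⟦ e₁ x ∧ e₂ y ⟧ * h (p x y)) ≡ h (p a₀ b₀)
∑-×δ xs ys e₁ e₂ a₀ b₀ p h δ₁ δ₂ = begin
  ∑[ x ∈ xs ] ∑[ y ∈ ys ] (⟦ e₁ x ∧ e₂ y ⟧ * h (p x y))
    ≡⟨ ∑-cong xs (λ x → trans (∑-cong ys λ y → trans (cong (_* h (p x y)) (⟦∧⟧ (e₁ x) (e₂ y))) (QP.*-assoc ⟦ e₁ x ⟧ ⟦ e₂ y ⟧ (h (p x y)))) (∑-*ˡ ys ⟦ e₁ x ⟧ _)) ⟩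
  ∑[ x ∈ xs ] (⟦ e₁ x ⟧ * ∑[ y ∈ ys ] (⟦ e₂ y ⟧ * h (p x y)))
    ≡⟨ ∑-cong xs (λ x → cong (⟦ e₁ x ⟧ *_) (δ₂ (λ y → h (p x y)))) ⟩
  ∑[ x ∈ xs ] (⟦ e₁ x ⟧ * h (p x b₀))
    ≡⟨ δ₁ (λ x → h (p x b₀)) ⟩
  h (p a₀ b₀) ∎
  where open ≡-Reasoning

∑-filter : {A : Set} (P : A → Bool) (P? : ∀ x → Dec (P x ≡ true)) (xs : List A) (f : A → ℚ) →
  ∑ (filter P? xs) f ≡ ∑[ x ∈ xs ] (⟦ P x ⟧ * f x)
∑-filter P P? [] f = refl
∑-filter P P? (x ∷ xs) f with P? x
... | yes p = cong₂ _+_ (trans (sym (QP.*-identityˡ (f x))) (cong (λ z → ⟦ z ⟧ * f x) (sym p))) (∑-filter P P? xs f)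
... | no ¬p = trans (∑-filter P P? xs f) (sym (trans (cong₂ _+_ (trans (cong (λ z → ⟦ z ⟧ * f x) (BP.¬-not ¬p)) (QP.*-zeroˡ (f x))) refl) (QP.+-identityˡ _)))

-- Linear algebra over 𝔽₂

⊕-comm : (x y : V n) → x ⊕v y ≡ y ⊕v x
⊕-comm = VP.zipWith-comm BP.xor-comm

⊕-assoc : (x y z : V n) → (x ⊕v y) ⊕v z ≡ x ⊕v (y ⊕v z)
⊕-assoc = VP.zipWith-assoc BP.xor-assoc

⊕-idˡ : (x : V n) → 0v ⊕v x ≡ x
⊕-idˡ = VP.zipWith-identityˡ BP.xor-identityˡ

⊕-idʳ : (x : V n) → x ⊕v 0v ≡ x
⊕-idʳ = VP.zipWith-identityʳ BP.xor-identityʳ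

⊕-self : (x : V n) → x ⊕v x ≡ 0v
⊕-self [] = refl
⊕-self (a ∷ x) = cong₂ _∷_ (BP.xor-same a) (⊕-self x)

⊕-cancel : (x y : V n) → x ⊕v (x ⊕v y) ≡ y
⊕-cancel x y = trans (sym (⊕-assoc x x y)) (trans (cong (_⊕v y) (⊕-self x)) (⊕-idˡ y))

⊕-cancelʳ : (x y : V n) → (y ⊕v x) ⊕v x ≡ y
⊕-cancelʳ x y = trans (⊕-assoc y x x) (trans (cong (y ⊕v_) (⊕-self x)) (⊕-idʳ y))

⊕-swap : (a b c e : V n) → (a ⊕v b) ⊕v (c ⊕v e) ≡ (a ⊕v c) ⊕v (b ⊕v e)
⊕-swap a b c e = trans (⊕-assoc a b (c ⊕v e)) (trans (cong (a ⊕v_) (trans (sym (⊕-assoc b c e)) (trans (cong (_⊕v e) (⊕-comm b c)) (⊕-assoc c b e)))) (sym (⊕-assoc a c (b ⊕v e))))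

⊕≡0 : {x y : V n} → x ⊕v y ≡ 0v → x ≡ y
⊕≡0 {x = x} {y} e = trans (sym (⊕-cancelʳ y x)) (trans (cong (_⊕v y) e) (⊕-idˡ y))

xor-swap : ∀ a b c e → (a xor b) xor (c xor e) ≡ (a xor c) xor (b xor e)
xor-swap a b c e = trans (BP.xor-assoc a b (c xor e)) (trans (cong (a xor_) (trans (sym (BP.xor-assoc b c e)) (trans (cong (_xor e) (BP.xor-comm b c)) (BP.xor-assoc c b e)))) (sym (BP.xor-assoc a c (b xor e))))

==v-sound : {x y : V n} → (x ==v y) ≡ true → x ≡ y
==v-sound {x = []} {[]} _ = refl
==v-sound {x = false ∷ x} {false ∷ y} e = cong (false ∷_) (==v-sound e)
==v-sound {x = true ∷ x} {true ∷ y} e = cong (true ∷_) (==v-sound e)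

==v-refl : (x : V n) → (x ==v x) ≡ true
==v-refl [] = refl
==v-refl (false ∷ x) = ==v-refl x
==v-refl (true ∷ x) = ==v-refl x

∑-allV : (f : V (suc n) → ℚ) → ∑ (allV (suc n)) f ≡ ∑ (allV n) (λ v → f (false ∷ v)) + ∑ (allV n) (λ v → f (true ∷ v))
∑-allV {n} f = trans (∑-++ (map (false ∷_) (allV n)) _ f) (cong₂ _+_ (∑-map (allV n) (false ∷_) f) (∑-map (allV n) (true ∷_) f))

VE : (n : ℕ) → Enum (V n)
els (VE n) = allV n
eq (VE n) = _==v_
eq-sound (VE n) = ==v-sound
eq-refl (VE n) = ==v-refl
∑δ (VE n) = go n
  where
  go : ∀ n (y : V n) (h : V n → ℚ) → ∑[ x ∈ allV n ] (⟦ x ==v y ⟧ * h x) ≡ h y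
  go zero [] h = trans (QP.+-identityʳ _) (QP.*-identityˡ _)
  go (suc n) (false ∷ y) h = trans (∑-allV (λ x → ⟦ x ==v (false ∷ y) ⟧ * h x)) (trans (cong₂ _+_ (go n y (λ v → h (false ∷ v))) (∑-0 (allV n) λ v → QP.*-zeroˡ (h (true ∷ v)))) (QP.+-identityʳ _))
  go (suc n) (true ∷ y) h = trans (∑-allV (λ x → ⟦ x ==v (true ∷ y) ⟧ * h x)) (trans (cong₂ _+_ (∑-0 (allV n) λ v → QP.*-zeroˡ (h (false ∷ v))) (go n y (λ v → h (true ∷ v)))) (QP.+-identityˡ _))

M : ℕ → ℕ → Set
M n d = Vec (V n) d

allM : (n d : ℕ) → List (M n d)
allM n zero = [] ∷ []
allM n (suc d) = cartesianProductWith _∷_ (allV n) (allM n d)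

_==M_ : M n d → M n d → Bool
[] ==M [] = true
(x ∷ X) ==M (y ∷ Y) = (x ==v y) ∧ (X ==M Y)

∑-allM : (f : M n (suc d) → ℚ) → ∑ (allM n (suc d)) f ≡ ∑[ x ∈ allV n ] ∑[ X ∈ allM n d ] f (x ∷ X)
∑-allM {n} {d} f = ∑-cartesian (allV n) (allM n d) _∷_ f

ME : (n d : ℕ) → Enum (M n d)
els (ME n d) = allM n d
eq (ME n d) = _==M_
eq-sound (ME n d) = go
  where
  go : ∀ {d} {x y : M n d} → (x ==M y) ≡ true → x ≡ y
  go {x = []} {[]} _ = refl
  go {x = x ∷ X} {y ∷ Y} e = cong₂ _∷_ (==v-sound (proj₁ (∧-true e))) (go (proj₂ (∧-true {x ==v y} e)))
eq-refl (ME n d) = go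
  where
  go : ∀ {d} (x : M n d) → (x ==M x) ≡ true
  go [] = refl
  go (x ∷ X) = ∧-intro (==v-refl x) (go X)
∑δ (ME n d) = go d
  where
  go : ∀ d (y : M n d) (h : M n d → ℚ) → ∑[ x ∈ allM n d ] (⟦ x ==M y ⟧ * h x) ≡ h y
  go zero [] h = trans (QP.+-identityʳ _) (QP.*-identityˡ _)
  go (suc d) (y ∷ Y) h = trans (∑-allM (λ x → ⟦ x ==M (y ∷ Y) ⟧ * h x)) (∑-×δ (allV n) (allM n d) (_==v y) (_==M Y) y Y _∷_ h (∑δ (VE n) y) (go d Y))

∑-shift : (a : V n) (h : V n → ℚ) → ∑[ x ∈ allV n ] h (a ⊕v x) ≡ ∑ (allV n) h
∑-shift {n} a h = ∑-bij (VE n) (VE n) (a ⊕v_) (a ⊕v_) (⊕-cancel a) (⊕-cancel a) h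

≤∑ : {A : Set} (E : Enum A) (h : A → ℚ) → (∀ x → 0ℚ ≤ h x) → ∀ y → h y ≤ ∑ (els E) h
≤∑ E h h≥0 y = ≤-trans (≤≡ (sym (∑δ E y h))) (∑-mono (els E) λ x →
  ≤-trans (*-monoʳ (h x) (h≥0 x) (⟦⟧≤1 (eq E x y))) (≤≡ (QP.*-identityˡ (h x))))

infixl 6 _⊕_
_⊕_ : M n d → M n d → M n d
_⊕_ = zipWith _⊕v_

0M : M n d
0M = replicate _ 0v

⊕M-cancel : (X Y : M n d) → X ⊕ (X ⊕ Y) ≡ Y
⊕M-cancel [] [] = refl
⊕M-cancel (x ∷ X) (y ∷ Y) = cong₂ _∷_ (⊕-cancel x y) (⊕M-cancel X Y)

⊕M-comm : (X Y : M n d) → X ⊕ Y ≡ Y ⊕ X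
⊕M-comm = VP.zipWith-comm ⊕-comm

⊕M-idˡ : (X : M n d) → 0M ⊕ X ≡ X
⊕M-idˡ = VP.zipWith-identityˡ ⊕-idˡ

∑-shiftM : (A : M n d) (h : M n d → ℚ) → ∑[ X ∈ allM n d ] h (A ⊕ X) ≡ ∑ (allM n d) h
∑-shiftM {n} {d} A h = ∑-bij (ME n d) (ME n d) (A ⊕_) (A ⊕_) (⊕M-cancel A) (⊕M-cancel A) h

dot : V n → V n → Bool
dot [] [] = false
dot (a ∷ x) (b ∷ y) = (a ∧ b) xor dot x y

dot-comm : (x y : V n) → dot x y ≡ dot y x
dot-comm [] [] = refl
dot-comm (a ∷ x) (b ∷ y) = cong₂ _xor_ (BP.∧-comm a b) (dot-comm x y)

dot-⊕ʳ : (x y z : V n) → dot x (y ⊕v z) ≡ dot x y xor dot x z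
dot-⊕ʳ [] [] [] = refl
dot-⊕ʳ (a ∷ x) (b ∷ y) (c ∷ z) = trans (cong₂ _xor_ (BP.∧-distribˡ-xor a b c) (dot-⊕ʳ x y z)) (xor-swap (a ∧ b) (a ∧ c) (dot x y) (dot x z))

dot-⊕ˡ : (x y z : V n) → dot (x ⊕v y) z ≡ dot x z xor dot y z
dot-⊕ˡ x y z = trans (dot-comm (x ⊕v y) z) (trans (dot-⊕ʳ z x y) (cong₂ _xor_ (dot-comm z x) (dot-comm z y)))

dot-0ʳ : (x : V n) → dot x 0v ≡ false
dot-0ʳ [] = refl
dot-0ʳ (a ∷ x) = trans (cong (_xor dot x 0v) (BP.∧-zeroʳ a)) (dot-0ʳ x)

dot-0ˡ : (x : V n) → dot 0v x ≡ false
dot-0ˡ x = trans (dot-comm 0v x) (dot-0ʳ x)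

sc : Bool → V n → V n
sc c x = if c then x else 0v

dot-sc : (x : V n) (c : Bool) (y : V n) → dot x (sc c y) ≡ c ∧ dot x y
dot-sc x false y = dot-0ʳ x
dot-sc x true y = refl

sc-xor : (a b : Bool) (x : V n) → sc (a xor b) x ≡ sc a x ⊕v sc b x
sc-xor false b x = sym (⊕-idˡ _)
sc-xor true false x = sym (⊕-idʳ x)
sc-xor true true x = sym (⊕-self x)

sc-⊕ : (c : Bool) (x y : V n) → sc c (x ⊕v y) ≡ sc c x ⊕v sc c y
sc-⊕ false x y = sym (⊕-idˡ _)
sc-⊕ true x y = refl

infixr 25 _·_
_·_ : M n d → V d → V n
[] · [] = 0v
(x ∷ X) · (c ∷ cs) = sc c x ⊕v X · cs

·-⊕ : (X : M n d) (c e : V d) → X · (c ⊕v e) ≡ X · c ⊕v X · e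
·-⊕ [] [] [] = sym (⊕-idˡ _)
·-⊕ (x ∷ X) (a ∷ c) (b ∷ e) = trans (cong₂ _⊕v_ (sc-xor a b x) (·-⊕ X c e)) (⊕-swap (sc a x) (sc b x) (X · c) (X · e))

·-0 : (X : M n d) → X · 0v ≡ 0v
·-0 [] = refl
·-0 (x ∷ X) = trans (⊕-idˡ _) (·-0 X)

⊕-· : (X Y : M n d) (c : V d) → (X ⊕ Y) · c ≡ X · c ⊕v Y · c
⊕-· [] [] [] = sym (⊕-idˡ _)
⊕-· (x ∷ X) (y ∷ Y) (a ∷ c) = trans (cong₂ _⊕v_ (sc-⊕ a x y) (⊕-· X Y c)) (⊕-swap (sc a x) (sc a y) (X · c) (Y · c))

dot-· : (y : V n) (X : M n d) (u : V d) → dot y (X · u) ≡ dot (Vec.map (dot y) X) u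
dot-· y [] [] = dot-0ʳ y
dot-· y (x ∷ X) (c ∷ u) = trans (dot-⊕ʳ y (sc c x) (X · u)) (cong₂ _xor_ (trans (dot-sc y c x) (BP.∧-comm c (dot y x))) (dot-· y X u))

T : M n d → M d n
T [] = replicate _ []
T (x ∷ X) = zipWith _∷_ x (T X)

T-cons : (x : V n) (Y : M d n) → T (zipWith _∷_ x Y) ≡ x ∷ T Y
T-cons [] [] = refl
T-cons (b ∷ x) (y ∷ Y) = cong (zipWith _∷_ (b ∷ y)) (T-cons x Y)

TT : (X : M n d) → T (T X) ≡ X
TT [] = only (T (T []))
  where
  only : (Y : M n 0) → Y ≡ []
  only [] = refl
TT (x ∷ X) = trans (T-cons x (T X)) (cong (x ∷_) (TT X))

T-⊕ : (X Y : M n d) → T (X ⊕ Y) ≡ T X ⊕ T Y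
T-⊕ {n} [] [] = go n
  where
  go : ∀ n → replicate n [] ≡ replicate n [] ⊕ replicate n []
  go zero = refl
  go (suc n) = cong ([] ∷_) (go n)
T-⊕ (x ∷ X) (y ∷ Y) = trans (cong (zipWith _∷_ (x ⊕v y)) (T-⊕ X Y)) (lem x y (T X) (T Y))
  where
  lem : ∀ {n d} (x y : V n) (P Q : M d n) → zipWith _∷_ (x ⊕v y) (P ⊕ Q) ≡ zipWith _∷_ x P ⊕ zipWith _∷_ y Q
  lem [] [] [] [] = refl
  lem (a ∷ x) (b ∷ y) (p ∷ P) (q ∷ Q) = cong (((a xor b) ∷ (p ⊕v q)) ∷_) (lem x y P Q)

T-· : (X : M n d) (y : V n) → T X · y ≡ Vec.map (dot y) X
T-· [] y = only (T [] · y)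
  where
  only : (v : V 0) → v ≡ []
  only [] = refl
T-· (x ∷ X) y = trans (lem x (T X) y) (cong₂ _∷_ (dot-comm x y) (T-· X y))
  where
  lem : ∀ {n d} (x : V n) (Y : M d n) (y : V n) → zipWith _∷_ x Y · y ≡ dot x y ∷ Y · y
  lem [] [] [] = refl
  lem (a ∷ x) (r ∷ Y) (b ∷ y) = trans (cong₂ _⊕v_ (sc-∷ b a r) (lem x Y y)) (cong₂ _∷_ (cong (_xor dot x y) (BP.∧-comm b a)) refl)
    where
    sc-∷ : ∀ {d} (b a : Bool) (r : V d) → sc b (a ∷ r) ≡ (b ∧ a) ∷ sc b r
    sc-∷ false a r = refl
    sc-∷ true a r = refl

adjoint : (y : V n) (X : M n d) (u : V d) → dot y (X · u) ≡ dot (T X · y) u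
adjoint y X u = trans (dot-· y X u) (cong (λ z → dot z u) (sym (T-· X y)))

-- A transvection. For `⟨f,w⟩ = 0` it is an involution, so each change of coordinates carries its
-- inverse with it and no matrix has to be inverted.
tv : (f w : V n) → V n → V n
tv f w x = x ⊕v sc (dot f x) w

tv-⊕ : (f w x y : V n) → tv f w (x ⊕v y) ≡ tv f w x ⊕v tv f w y
tv-⊕ f w x y = trans (cong ((x ⊕v y) ⊕v_) (trans (cong (λ z → sc z w) (dot-⊕ʳ f x y)) (sc-xor (dot f x) (dot f y) w))) (⊕-swap x y _ _)

tv-0 : (f w : V n) → tv f w 0v ≡ 0v
tv-0 f w = trans (⊕-idˡ _) (cong (λ z → sc z w) (dot-0ʳ f))

tv-inv : (f w : V n) → dot f w ≡ false → ∀ x → tv f w (tv f w x) ≡ x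
tv-inv f w fw x = trans (cong (λ z → tv f w x ⊕v sc z w) e) (⊕-cancelʳ _ x)
  where
  e : dot f (tv f w x) ≡ dot f x
  e = trans (dot-⊕ʳ f x _) (trans (cong (dot f x xor_) (trans (dot-sc f (dot f x) w) (trans (cong (dot f x ∧_) fw) (BP.∧-zeroʳ _)))) (BP.xor-identityʳ _))

tv-adj : (f w x y : V n) → dot (tv f w x) y ≡ dot x (tv w f y)
tv-adj f w x y = begin
  dot (x ⊕v sc (dot f x) w) y            ≡⟨ dot-⊕ˡ x _ y ⟩
  dot x y xor dot (sc (dot f x) w) y     ≡⟨ cong (dot x y xor_) (trans (dot-comm _ y) (trans (dot-sc y (dot f x) w) (cong₂ _∧_ (dot-comm f x) (dot-comm y w)))) ⟩
  dot x y xor (dot x f ∧ dot w y)        ≡⟨ cong (dot x y xor_) (trans (BP.∧-comm (dot x f) (dot w y)) (sym (dot-sc x (dot w y) f))) ⟩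
  dot x y xor dot x (sc (dot w y) f)     ≡⟨ sym (dot-⊕ʳ x y _) ⟩
  dot x (tv w f y) ∎
  where open ≡-Reasoning

tv-· : (f w : V n) (X : M n d) (c : V d) → Vec.map (tv f w) X · c ≡ tv f w (X · c)
tv-· f w [] [] = sym (tv-0 f w)
tv-· f w (x ∷ X) (c ∷ cs) = trans (cong₂ _⊕v_ (lem c) (tv-· f w X cs)) (sym (tv-⊕ f w (sc c x) (X · cs)))
  where
  lem : ∀ c → sc c (tv f w x) ≡ tv f w (sc c x)
  lem false = sym (tv-0 f w)
  lem true = refl

map-tv-inv : (f w : V n) → dot f w ≡ false → (X : M n d) → Vec.map (tv f w) (Vec.map (tv f w) X) ≡ X
map-tv-inv f w fw [] = refl
map-tv-inv f w fw (x ∷ X) = cong₂ _∷_ (tv-inv f w fw x) (map-tv-inv f w fw X)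

map-tv-⊕ : (f w : V n) (X Y : M n d) → Vec.map (tv f w) (X ⊕ Y) ≡ Vec.map (tv f w) X ⊕ Vec.map (tv f w) Y
map-tv-⊕ f w [] [] = refl
map-tv-⊕ f w (x ∷ X) (y ∷ Y) = cong₂ _∷_ (tv-⊕ f w x y) (map-tv-⊕ f w X Y)

inSp : M n d → V n → Bool
inSp [] x = x ==v 0v
inSp (y ∷ Y) x = inSp Y x ∨ inSp Y (x ⊕v y)

∨-true : ∀ {a b} → a ∨ b ≡ true → a ≡ true ⊎ b ≡ true
∨-true {true} _ = inj₁ refl
∨-true {false} e = inj₂ e

∨-introʳ : ∀ a {b} → b ≡ true → a ∨ b ≡ true
∨-introʳ true refl = refl
∨-introʳ false refl = refl

∨-introˡ : ∀ {a} b → a ≡ true → a ∨ b ≡ true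
∨-introˡ b refl = refl

inSp-sound : (X : M n d) (x : V n) → inSp X x ≡ true → ∃ λ c → X · c ≡ x
inSp-sound [] x e = [] , sym (==v-sound e)
inSp-sound (y ∷ Y) x e with ∨-true {inSp Y x} e
... | inj₁ p = let (c , q) = inSp-sound Y x p in (false ∷ c) , trans (⊕-idˡ _) q
... | inj₂ p = let (c , q) = inSp-sound Y (x ⊕v y) p in (true ∷ c) , trans (cong (y ⊕v_) (trans q (⊕-comm x y))) (⊕-cancel y x)

inSp-· : (X : M n d) (c : V d) → inSp X (X · c) ≡ true
inSp-· {n} [] [] = ==v-refl (0v {n})
inSp-· (y ∷ Y) (false ∷ c) = ∨-introˡ _ (subst (λ z → inSp Y z ≡ true) (sym (⊕-idˡ _)) (inSp-· Y c))
inSp-· (y ∷ Y) (true ∷ c) = ∨-introʳ (inSp Y (y ⊕v Y · c)) (subst (λ z → inSp Y z ≡ true) (sym (trans (cong (_⊕v y) (⊕-comm y (Y · c))) (⊕-cancelʳ y _))) (inSp-· Y c))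

inSp-complete : (X : M n d) (c : V d) {x : V n} → X · c ≡ x → inSp X x ≡ true
inSp-complete X c refl = inSp-· X c

inSp-0 : (X : M n d) → inSp X 0v ≡ true
inSp-0 X = inSp-complete X 0v (·-0 X)

inSp-⊕ : (X : M n d) {x y : V n} → inSp X x ≡ true → inSp X y ≡ true → inSp X (x ⊕v y) ≡ true
inSp-⊕ X {x} {y} p q = let (c , e) = inSp-sound X x p ; (c' , e') = inSp-sound X y q in
  inSp-complete X (c ⊕v c') (trans (·-⊕ X c c') (cong₂ _⊕v_ e e'))

-- A greedy count along the order of the columns. That it depends on the span only is recovered by
-- counting: `2^(rk X)` is the size of the column span (`∑-sp`).
rk : M n d → ℕ
rk [] = 0
rk (x ∷ X) = if inSp X x then rk X else suc (rk X)

-- Every point of the column span is `X · c` for exactly `2^(d - rk X)` vectors `c`; both sides are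
-- multiplied out to avoid the subtraction. A first column `Y · μ` inside the span of the others
-- doubles all fibres, by the shift `c ↦ μ + c`; any other first column doubles the span.
∑-fib : (X : M n d) (h : V n → ℚ) → pw (rk X) * ∑[ c ∈ allV d ] h (X · c) ≡ pw d * ∑[ x ∈ allV n ] (⟦ inSp X x ⟧ * h x)
∑-fib {n} [] h = cong (1ℚ *_) (trans (QP.+-identityʳ _) (sym (∑δ (VE n) 0v h)))
∑-fib {n} {suc d} (y ∷ Y) h with inSp Y y in eqy
... | true = begin
  pw (rk Y) * ∑ (allV (suc d)) (λ c → h ((y ∷ Y) · c))
    ≡⟨ cong (pw (rk Y) *_) (trans (∑-allV (λ c → h ((y ∷ Y) · c))) (cong₂ _+_ (∑-cong (allV d) λ c → cong h (⊕-idˡ _)) second)) ⟩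
  pw (rk Y) * (S + S)
    ≡⟨ lem₁ (pw (rk Y)) S ⟩
  two * (pw (rk Y) * S)
    ≡⟨ cong (two *_) (∑-fib Y h) ⟩
  two * (pw d * ∑ (allV n) (λ x → ⟦ inSp Y x ⟧ * h x))
    ≡⟨ sym (QP.*-assoc two (pw d) _) ⟩
  pw (suc d) * ∑ (allV n) (λ x → ⟦ inSp Y x ⟧ * h x)
    ≡⟨ cong (pw (suc d) *_) (∑-cong (allV n) λ x → cong (λ z → ⟦ z ⟧ * h x) (meq x)) ⟩
  pw (suc d) * ∑ (allV n) (λ x → ⟦ inSp (y ∷ Y) x ⟧ * h x) ∎
  where
  open ≡-Reasoning
  μ = proj₁ (inSp-sound Y y eqy)
  Yμ = proj₂ (inSp-sound Y y eqy)
  S = ∑[ c ∈ allV d ] h (Y · c)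
  lem₁ : ∀ a s → a * (s + s) ≡ two * (a * s)
  lem₁ = solve-∀ ℚring
  second : ∑[ c ∈ allV d ] h (y ⊕v Y · c) ≡ S
  second = trans (∑-cong (allV d) λ c → cong h (trans (cong (_⊕v Y · c) (sym Yμ)) (sym (·-⊕ Y μ c)))) (∑-shift μ (λ c → h (Y · c)))
  meq : ∀ x → inSp Y x ≡ inSp (y ∷ Y) x
  meq x = ≡-from-iff (∨-introˡ _) λ e → case ∨-true {inSp Y x} e of λ where
    (inj₁ p) → p
    (inj₂ p) → subst (λ z → inSp Y z ≡ true) (⊕-cancelʳ y x) (inSp-⊕ Y p eqy)
... | false = begin
  pw (suc (rk Y)) * ∑ (allV (suc d)) (λ c → h ((y ∷ Y) · c))
    ≡⟨ cong (pw (suc (rk Y)) *_) (trans (∑-allV (λ c → h ((y ∷ Y) · c))) (cong₂ _+_ (∑-cong (allV d) λ c → cong h (⊕-idˡ _)) refl)) ⟩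
  pw (suc (rk Y)) * (S + S')
    ≡⟨ lem₁ (pw (rk Y)) S S' ⟩
  two * (pw (rk Y) * S + pw (rk Y) * S')
    ≡⟨ cong (two *_) (cong₂ _+_ (∑-fib Y h) (∑-fib Y (λ x → h (y ⊕v x)))) ⟩
  two * (pw d * ∑ (allV n) (λ x → ⟦ inSp Y x ⟧ * h x) + pw d * ∑ (allV n) (λ x → ⟦ inSp Y x ⟧ * h (y ⊕v x)))
    ≡⟨ cong (λ z → two * (pw d * A + pw d * z)) (trans (∑-cong (allV n) λ x → cong (λ z → ⟦ inSp Y z ⟧ * h (y ⊕v x)) (sym (trans (cong (_⊕v y) (⊕-comm y x)) (⊕-cancelʳ y x))))
         (∑-shift y (λ x → ⟦ inSp Y (x ⊕v y) ⟧ * h x))) ⟩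
  two * (pw d * A + pw d * B)
    ≡⟨ lem₂ (pw d) A B ⟩
  pw (suc d) * (A + B)
    ≡⟨ cong (pw (suc d) *_) (trans (sym (∑-+ (allV n) _ _)) (∑-cong (allV n) λ x → trans (sym (QP.*-distribʳ-+ (h x) ⟦ inSp Y x ⟧ ⟦ inSp Y (x ⊕v y) ⟧)) (cong (_* h x) (meq x)))) ⟩
  pw (suc d) * ∑ (allV n) (λ x → ⟦ inSp (y ∷ Y) x ⟧ * h x) ∎
  where
  open ≡-Reasoning
  S = ∑[ c ∈ allV d ] h (Y · c)
  S' = ∑[ c ∈ allV d ] h (y ⊕v Y · c)
  A = ∑[ x ∈ allV n ] (⟦ inSp Y x ⟧ * h x)
  B = ∑[ x ∈ allV n ] (⟦ inSp Y (x ⊕v y) ⟧ * h x)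
  lem₁ : ∀ a s s' → two * a * (s + s') ≡ two * (a * s + a * s')
  lem₁ = solve-∀ ℚring
  lem₂ : ∀ a s s' → two * (a * s + a * s') ≡ two * a * (s + s')
  lem₂ = solve-∀ ℚring
  excl : ∀ x → inSp Y x ≡ true → inSp Y (x ⊕v y) ≡ true → ⊥
  excl x p q = false≢true eqy (subst (λ z → inSp Y z ≡ true) (⊕-cancel x y) (inSp-⊕ Y p q))
  meq : ∀ x → ⟦ inSp Y x ⟧ + ⟦ inSp Y (x ⊕v y) ⟧ ≡ ⟦ inSp (y ∷ Y) x ⟧
  meq x with inSp Y x in e₁ | inSp Y (x ⊕v y) in e₂
  ... | true | true = ⊥-elim (excl x e₁ e₂)
  ... | true | false = refl
  ... | false | true = refl
  ... | false | false = refl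

∑-sp : (X : M n d) → ∑[ x ∈ allV n ] ⟦ inSp X x ⟧ ≡ pw (rk X)
∑-sp {n} {d} X = begin
  ∑ (allV n) (λ x → ⟦ inSp X x ⟧)                         ≡⟨ sym (QP.*-identityˡ _) ⟩
  1ℚ * ∑ (allV n) (λ x → ⟦ inSp X x ⟧)                    ≡⟨ cong₂ _*_ (sym (hp*pw d)) (∑-cong (allV n) λ x → sym (QP.*-identityʳ _)) ⟩
  hp d * pw d * ∑ (allV n) (λ x → ⟦ inSp X x ⟧ * 1ℚ)      ≡⟨ QP.*-assoc (hp d) (pw d) _ ⟩
  hp d * (pw d * ∑ (allV n) (λ x → ⟦ inSp X x ⟧ * 1ℚ))    ≡⟨ cong (hp d *_) (sym (∑-fib X (λ _ → 1ℚ))) ⟩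
  hp d * (pw (rk X) * ∑ (allV d) (λ _ → 1ℚ))              ≡⟨ cong (λ z → hp d * (pw (rk X) * z)) (∑1 d) ⟩
  hp d * (pw (rk X) * pw d)                               ≡⟨ lem (hp d) (pw (rk X)) (pw d) ⟩
  hp d * pw d * pw (rk X)                                 ≡⟨ trans (cong (_* pw (rk X)) (hp*pw d)) (QP.*-identityˡ _) ⟩
  pw (rk X) ∎
  where
  open ≡-Reasoning
  lem : ∀ a b c → a * (b * c) ≡ a * c * b
  lem = solve-∀ ℚring
  ∑1 : ∀ d → ∑ (allV d) (λ _ → 1ℚ) ≡ pw d
  ∑1 zero = refl
  ∑1 (suc d) = trans (∑-allV {d} (λ _ → 1ℚ)) (trans (cong₂ _+_ (∑1 d) (∑1 d)) (lem' (pw d)))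
    where
    lem' : ∀ a → a + a ≡ two * a
    lem' = solve-∀ ℚring

σ : Bool → ℚ
σ false = 1ℚ
σ true = - 1ℚ

σ-xor : ∀ a b → σ (a xor b) ≡ σ a * σ b
σ-xor false false = refl
σ-xor false true = refl
σ-xor true false = refl
σ-xor true true = refl

∑-char : (x : V n) → ∑[ m ∈ allV n ] σ (dot x m) ≡ pw n * ⟦ x ==v 0v ⟧
∑-char [] = refl
∑-char {suc n} (a ∷ x) = trans (∑-allV (λ m → σ (dot (a ∷ x) m))) (trans (cong₂ _+_
   (∑-cong (allV n) λ m → cong (λ z → σ (z xor dot x m)) (BP.∧-zeroʳ a))
   (trans (∑-cong (allV n) λ m → trans (cong (λ z → σ (z xor dot x m)) (BP.∧-identityʳ a)) (σ-xor a (dot x m))) (∑-*ˡ (allV n) (σ a) _)))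
   (trans (cong (λ z → z + σ a * z) (∑-char x)) (fin a)))
  where
  e₁ : ∀ p q → p * q + 1ℚ * (p * q) ≡ two * p * q
  e₁ = solve-∀ ℚring
  e₂ : ∀ p q → p * q + - 1ℚ * (p * q) ≡ two * p * 0ℚ
  e₂ = solve-∀ ℚring
  fin : ∀ a → pw n * ⟦ x ==v 0v ⟧ + σ a * (pw n * ⟦ x ==v 0v ⟧) ≡ pw (suc n) * ⟦ (a ∷ x) ==v 0v ⟧
  fin false = e₁ (pw n) ⟦ x ==v 0v ⟧
  fin true = e₂ (pw n) ⟦ x ==v 0v ⟧

pw-cancel-≤ : ∀ {a b} → pw a ≤ pw b → a ℕ.≤ b
pw-cancel-≤ {a} {b} p with a ℕ.≤? b
... | yes q = q
... | no ¬q = ⊥-elim (<⇒≱ lt (≤-trans (pw-mono (NP.≰⇒> ¬q)) p))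
  where
  lt : pw b < pw (suc b)
  lt = subst₂ _<_ (QP.+-identityʳ (pw b)) (lem (pw b)) (QP.+-monoʳ-< (pw b) (pw>0 b))
    where
    lem : ∀ a → a + a ≡ two * a
    lem = solve-∀ ℚring

pw-inj : ∀ {a b} → pw a ≡ pw b → a ≡ b
pw-inj e = NP.≤-antisym (pw-cancel-≤ (≤≡ e)) (pw-cancel-≤ (≤≡ (sym e)))

kerSize : M n d → ℚ
kerSize {d = d} X = ∑[ u ∈ allV d ] ⟦ X · u ==v 0v ⟧

∑-ker : (X : M n d) → pw (rk X) * kerSize X ≡ pw d
∑-ker {n} {d} X = trans (∑-fib X (λ x → ⟦ x ==v 0v ⟧)) (trans (cong (pw d *_) (trans (∑-cong (allV n) λ x → QP.*-comm ⟦ inSp X x ⟧ _) (trans (∑δ (VE n) 0v (λ x → ⟦ inSp X x ⟧)) (cong ⟦_⟧ (inSp-0 X))))) (QP.*-identityʳ _))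

-- Both ranks are read off from the double character sum Σ_{y,u} (-1)^⟨y,Xu⟩.
rk-T : (X : M n d) → rk (T X) ≡ rk X
rk-T {n} {d} X = pw-inj (sym (begin
  pw (rk X)                                      ≡⟨ sym (QP.*-identityʳ _) ⟩
  pw (rk X) * 1ℚ                                 ≡⟨ cong (pw (rk X) *_) (sym u1) ⟩
  pw (rk X) * (pw (rk (T X)) * (kerSize X * hp d))  ≡⟨ e₁ (pw (rk X)) (pw (rk (T X))) (kerSize X) (hp d) ⟩
  pw (rk (T X)) * (pw (rk X) * kerSize X * hp d) ≡⟨ cong (λ z → pw (rk (T X)) * (z * hp d)) (∑-ker X) ⟩
  pw (rk (T X)) * (pw d * hp d)                  ≡⟨ trans (cong (pw (rk (T X)) *_) (pw*hp d)) (QP.*-identityʳ _) ⟩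
  pw (rk (T X)) ∎))
  where
  open ≡-Reasoning
  e₁ : ∀ a b c e → a * (b * (c * e)) ≡ b * (a * c * e)
  e₁ = solve-∀ ℚring
  e₂ : ∀ a b c e f → b * (c * e) * (f * a) ≡ b * (a * c) * (f * e)
  e₂ = solve-∀ ℚring
  e₃ : ∀ b e c h f → b * (e * c) * (f * h) ≡ b * c * f * (e * h)
  e₃ = solve-∀ ℚring
  dbl : pw n * kerSize X ≡ pw d * kerSize (T X)
  dbl = begin
    pw n * kerSize X
      ≡⟨ sym (∑-*ˡ (allV d) (pw n) _) ⟩
    ∑[ u ∈ allV d ] (pw n * ⟦ X · u ==v 0v ⟧)
      ≡⟨ ∑-cong (allV d) (λ u → sym (∑-char (X · u))) ⟩
    ∑[ u ∈ allV d ] ∑[ y ∈ allV n ] σ (dot (X · u) y)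
      ≡⟨ ∑-swap (allV d) (allV n) _ ⟩
    ∑[ y ∈ allV n ] ∑[ u ∈ allV d ] σ (dot (X · u) y)
      ≡⟨ ∑-cong (allV n) (λ y → ∑-cong (allV d) λ u → cong σ (trans (dot-comm (X · u) y) (adjoint y X u))) ⟩
    ∑[ y ∈ allV n ] ∑[ u ∈ allV d ] σ (dot (T X · y) u)
      ≡⟨ ∑-cong (allV n) (λ y → ∑-char (T X · y)) ⟩
    ∑[ y ∈ allV n ] (pw d * ⟦ T X · y ==v 0v ⟧)
      ≡⟨ ∑-*ˡ (allV n) (pw d) _ ⟩
    pw d * kerSize (T X) ∎
  u1 : pw (rk (T X)) * (kerSize X * hp d) ≡ 1ℚ
  u1 = begin
    pw (rk (T X)) * (kerSize X * hp d)                       ≡⟨ sym (QP.*-identityʳ _) ⟩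
    pw (rk (T X)) * (kerSize X * hp d) * 1ℚ                  ≡⟨ cong (pw (rk (T X)) * (kerSize X * hp d) *_) (sym (hp*pw n)) ⟩
    pw (rk (T X)) * (kerSize X * hp d) * (hp n * pw n)       ≡⟨ e₂ (pw n) (pw (rk (T X))) (kerSize X) (hp d) (hp n) ⟩
    pw (rk (T X)) * (pw n * kerSize X) * (hp n * hp d)       ≡⟨ cong (λ z → pw (rk (T X)) * z * (hp n * hp d)) dbl ⟩
    pw (rk (T X)) * (pw d * kerSize (T X)) * (hp n * hp d)   ≡⟨ e₃ (pw (rk (T X))) (pw d) (kerSize (T X)) (hp d) (hp n) ⟩
    pw (rk (T X)) * kerSize (T X) * hp n * (pw d * hp d)     ≡⟨ cong₂ (λ a b → a * hp n * b) (∑-ker (T X)) (pw*hp d) ⟩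
    pw n * hp n * 1ℚ                                         ≡⟨ trans (QP.*-identityʳ _) (pw*hp n) ⟩
    1ℚ ∎

inSp-tv : (f w : V n) → dot f w ≡ false → (X : M n d) (x : V n) → inSp (Vec.map (tv f w) X) (tv f w x) ≡ inSp X x
inSp-tv f w fw X x = ≡-from-iff
  (λ e → let (c , p) = inSp-sound (Vec.map (tv f w) X) (tv f w x) e in
     inSp-complete X c (trans (sym (tv-inv f w fw (X · c))) (trans (cong (tv f w) (trans (sym (tv-· f w X c)) p)) (tv-inv f w fw x))))
  (λ e → let (c , p) = inSp-sound X x e in inSp-complete (Vec.map (tv f w) X) c (trans (tv-· f w X c) (cong (tv f w) p)))

rk-tv : (f w : V n) → dot f w ≡ false → (X : M n d) → rk (Vec.map (tv f w) X) ≡ rk X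
rk-tv f w fw [] = refl
rk-tv f w fw (x ∷ X) rewrite inSp-tv f w fw X x | rk-tv f w fw X = refl

-- Each vector of the span of `X ⊕ Y` is a sum of one from each span, so there are at most as many
-- of them as pairs.
rk-⊕ : (X Y : M n d) → rk (X ⊕ Y) ℕ.≤ rk X ℕ.+ rk Y
rk-⊕ {n} {d} X Y = pw-cancel-≤ (≤-trans (≤≡ (sym (∑-sp (X ⊕ Y)))) (≤-trans (∑-mono (allV n) step) (≤≡ fin)))
  where
  open ≡-Reasoning
  g : V n → V n → ℚ
  g x y = ⟦ inSp X y ⟧ * ⟦ inSp Y (y ⊕v x) ⟧
  g≥0 : ∀ x y → 0ℚ ≤ g x y
  g≥0 x y = *-≥0 (⟦⟧≥0 (inSp X y)) (⟦⟧≥0 (inSp Y (y ⊕v x)))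
  step : ∀ x → ⟦ inSp (X ⊕ Y) x ⟧ ≤ ∑[ y ∈ allV n ] g x y
  step x with inSp (X ⊕ Y) x in e
  ... | false = ∑-≥0 (allV n) (g≥0 x)
  ... | true = let (c , p) = inSp-sound (X ⊕ Y) x e in
    ≤-trans (≤≡ (sym (cong₂ (λ a b → ⟦ a ⟧ * ⟦ b ⟧) (inSp-· X c)
      (inSp-complete Y c (sym (trans (cong (X · c ⊕v_) (trans (sym p) (⊕-· X Y c))) (⊕-cancel (X · c) (Y · c))))))))
      (≤∑ (VE n) (g x) (g≥0 x) (X · c))
  fin : ∑[ x ∈ allV n ] ∑[ y ∈ allV n ] g x y ≡ pw (rk X ℕ.+ rk Y)
  fin = begin
    ∑[ x ∈ allV n ] ∑[ y ∈ allV n ] g x y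
      ≡⟨ ∑-swap (allV n) (allV n) g ⟩
    ∑[ y ∈ allV n ] ∑[ x ∈ allV n ] g x y
      ≡⟨ ∑-cong (allV n) (λ y → trans (∑-*ˡ (allV n) ⟦ inSp X y ⟧ _) (cong (⟦ inSp X y ⟧ *_) (∑-shift y (λ x → ⟦ inSp Y x ⟧)))) ⟩
    ∑[ y ∈ allV n ] (⟦ inSp X y ⟧ * ∑[ x ∈ allV n ] ⟦ inSp Y x ⟧)
      ≡⟨ ∑-*ʳ (allV n) _ _ ⟩
    ∑[ y ∈ allV n ] ⟦ inSp X y ⟧ * ∑[ x ∈ allV n ] ⟦ inSp Y x ⟧
      ≡⟨ cong₂ _*_ (∑-sp X) (∑-sp Y) ⟩
    pw (rk X) * pw (rk Y)
      ≡⟨ sym (pw-+ (rk X) (rk Y)) ⟩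
    pw (rk X ℕ.+ rk Y) ∎

data Cols {n : ℕ} (S : V n → Bool) : {d : ℕ} → M n d → Set where
  [] : Cols S []
  _∷_ : ∀ {d} {x : V n} {X : M n d} → S x ≡ true → Cols S X → Cols S (x ∷ X)

-- A matrix whose kernel contains that of Z is determined by its columns at the rk Z pivot positions of Z.
count-ker : ∀ {n' d} (Z : M n d) (S : V n' → Bool) (P : M n' d → Bool) →
  (∀ X → P X ≡ true → Cols S X × (∀ u → Z · u ≡ 0v → X · u ≡ 0v)) →
  ∑[ X ∈ allM n' d ] ⟦ P X ⟧ ≤ (∑[ x ∈ allV n' ] ⟦ S x ⟧) ^ℚ rk Z
count-ker [] S P hyp = ≤-trans (≤≡ (QP.+-identityʳ _)) (⟦⟧≤1 (P []))
count-ker {n' = n'} {d = suc d} (z ∷ Z) S P hyp with inSp Z z in e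
... | true = ≤-trans (≤≡ (trans (∑-allM (λ X → ⟦ P X ⟧)) (∑-swap (allV n') (allM n' d) (λ x X → ⟦ P (x ∷ X) ⟧)))) (≤-trans (∑-mono (allM n' d) one)
        (count-ker Z S (λ X → P (X · μ ∷ X)) λ X p → let (cs , k) = hyp (X · μ ∷ X) p in tl cs , λ u Zu → trans (sym (⊕-idˡ _)) (k (false ∷ u) (trans (⊕-idˡ _) Zu))))
  where
  μ = proj₁ (inSp-sound Z z e)
  Zμ = proj₂ (inSp-sound Z z e)
  tl : ∀ {d x} {X : M n' d} → Cols S (x ∷ X) → Cols S X
  tl (_ ∷ cs) = cs
  ptw : ∀ X x → ⟦ P (x ∷ X) ⟧ ≤ ⟦ x ==v (X · μ) ⟧ * ⟦ P (X · μ ∷ X) ⟧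
  ptw X x with P (x ∷ X) in p
  ... | false = *-≥0 (⟦⟧≥0 (x ==v (X · μ))) (⟦⟧≥0 (P (X · μ ∷ X)))
  ... | true with ⊕≡0 (proj₂ (hyp (x ∷ X) p) (true ∷ μ) (trans (cong (z ⊕v_) Zμ) (⊕-self z)))
  ...   | refl = ≤≡ (sym (cong₂ (λ a b → ⟦ a ⟧ * ⟦ b ⟧) (==v-refl (X · μ)) p))
  one : ∀ X → ∑[ x ∈ allV n' ] ⟦ P (x ∷ X) ⟧ ≤ ⟦ P (X · μ ∷ X) ⟧
  one X = ≤-trans (∑-mono (allV n') (ptw X)) (≤≡ (∑δ (VE n') (X · μ) (λ _ → ⟦ P (X · μ ∷ X) ⟧)))
... | false = ≤-trans (≤≡ (∑-allM (λ X → ⟦ P X ⟧))) (≤-trans (∑-mono (allV n') each) (≤≡ (∑-*ʳ (allV n') _ _)))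
  where
  bd = (∑[ x ∈ allV n' ] ⟦ S x ⟧) ^ℚ rk Z
  hd : ∀ {d x} {X : M n' d} → Cols S (x ∷ X) → S x ≡ true
  hd (s ∷ _) = s
  tl : ∀ {d x} {X : M n' d} → Cols S (x ∷ X) → Cols S X
  tl (_ ∷ cs) = cs
  each : ∀ x → ∑[ X ∈ allM n' d ] ⟦ P (x ∷ X) ⟧ ≤ ⟦ S x ⟧ * bd
  each x with S x in s
  ... | true = ≤-trans (count-ker Z S (λ X → P (x ∷ X)) λ X p → let (cs , k) = hyp (x ∷ X) p in tl cs , λ u Zu → trans (sym (⊕-idˡ _)) (k (false ∷ u) (trans (⊕-idˡ _) Zu))) (≤≡ (sym (QP.*-identityˡ _)))
  ... | false = ≤-trans (≤≡ (∑-0 (allM n' d) none)) (≤≡ (sym (QP.*-zeroˡ bd)))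
    where
    none : ∀ X → ⟦ P (x ∷ X) ⟧ ≡ 0ℚ
    none X with P (x ∷ X) in p
    ... | false = refl
    ... | true = false≢true s (hd (proj₁ (hyp (x ∷ X) p)))

-- If the first column of `Z` is `Z · μ` for the others, then `(1, μ)` lies in the kernel and forces
-- the first coordinate to be `⟨x,μ⟩`. Only the `rk Z` pivot coordinates remain free.
count-ann : ∀ {d} (Z : M n d) (P : V d → Bool) →
  (∀ x → P x ≡ true → ∀ u → Z · u ≡ 0v → dot x u ≡ false) → ∑[ x ∈ allV d ] ⟦ P x ⟧ ≤ pw (rk Z)
count-ann [] P hyp = ≤-trans (≤≡ (QP.+-identityʳ _)) (⟦⟧≤1 (P []))
count-ann {d = suc d} (z ∷ Z) P hyp with inSp Z z in e
... | true = ≤-trans (≤≡ (trans (∑-allV (λ x → ⟦ P x ⟧)) (sym (∑-+ (allV d) (λ x → ⟦ P (false ∷ x) ⟧) (λ x → ⟦ P (true ∷ x) ⟧))))) (≤-trans (∑-mono (allV d) one)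
        (count-ann Z (λ x → P (dot x μ ∷ x)) λ x p u Zu → trans (cong (_xor dot x u) (sym (BP.∧-zeroʳ (dot x μ)))) (hyp (dot x μ ∷ x) p (false ∷ u) (trans (⊕-idˡ _) Zu))))
  where
  μ = proj₁ (inSp-sound Z z e)
  Zμ = proj₂ (inSp-sound Z z e)
  forced : ∀ a x → P (a ∷ x) ≡ true → a ≡ dot x μ
  forced a x p = xeq a (dot x μ) (trans (cong (_xor dot x μ) (sym (BP.∧-identityʳ a))) (hyp (a ∷ x) p (true ∷ μ) (trans (cong (z ⊕v_) Zμ) (⊕-self z))))
    where
    xeq : ∀ a b → a xor b ≡ false → a ≡ b
    xeq false b q = sym q
    xeq true true q = refl
  one : ∀ x → ⟦ P (false ∷ x) ⟧ + ⟦ P (true ∷ x) ⟧ ≤ ⟦ P (dot x μ ∷ x) ⟧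
  one x with P (false ∷ x) in p | P (true ∷ x) in q
  ... | false | false = ⟦⟧≥0 (P (dot x μ ∷ x))
  ... | true | true = false≢true (sym (forced false x p)) (sym (forced true x q))
  ... | true | false = ≤≡ (cong ⟦_⟧ (sym (trans (cong (λ z → P (z ∷ x)) (sym (forced false x p))) p)))
  ... | false | true = ≤≡ (cong ⟦_⟧ (sym (trans (cong (λ z → P (z ∷ x)) (sym (forced true x q))) q)))
... | false = ≤-trans (≤≡ (∑-allV (λ x → ⟦ P x ⟧))) (≤-trans (QP.+-mono-≤ (half false) (half true)) (≤≡ (lem (pw (rk Z)))))
  where
  lem : ∀ a → a + a ≡ two * a
  lem = solve-∀ ℚring
  half : ∀ a → ∑[ x ∈ allV d ] ⟦ P (a ∷ x) ⟧ ≤ pw (rk Z)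
  half a = count-ann Z (λ x → P (a ∷ x)) λ x p u Zu → trans (cong (_xor dot x u) (sym (BP.∧-zeroʳ a))) (hyp (a ∷ x) p (false ∷ u) (trans (⊕-idˡ _) Zu))

∈-allV : (v : V n) → v ∈ allV n
∈-allV [] = here refl
∈-allV {suc n} (false ∷ v) = ∈-++⁺ˡ (∈-map⁺ (false ∷_) (∈-allV v))
∈-allV {suc n} (true ∷ v) = ∈-++⁺ʳ (map (false ∷_) (allV n)) (∈-map⁺ (true ∷_) (∈-allV v))

allᵇ-elim : {P : V n → Bool} → allᵇ P ≡ true → ∀ v → P v ≡ true
allᵇ-elim {n} {P} e v = go (allV n) e (∈-allV v)
  where
  go : ∀ xs → BL.all P xs ≡ true → v ∈ xs → P v ≡ true
  go (x ∷ xs) e (here refl) = proj₁ (∧-true e)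
  go (x ∷ xs) e (there m) = go xs (proj₂ (∧-true {P x} e)) m

allᵇ-intro : {P : V n → Bool} → (∀ v → P v ≡ true) → allᵇ P ≡ true
allᵇ-intro {n} {P} h = go (allV n)
  where
  go : ∀ xs → BL.all P xs ≡ true
  go [] = refl
  go (x ∷ xs) = ∧-intro (h x) (go xs)

anyᵇ-elim : {P : V n → Bool} → anyᵇ P ≡ true → ∃ λ v → P v ≡ true
anyᵇ-elim {n} {P} e = go (allV n) e
  where
  go : ∀ xs → BL.any P xs ≡ true → ∃ λ v → P v ≡ true
  go (x ∷ xs) e with ∨-true {P x} e
  ... | inj₁ p = x , p
  ... | inj₂ p = go xs p

anyᵇ-intro : {P : V n → Bool} (v : V n) → P v ≡ true → anyᵇ P ≡ true
anyᵇ-intro {n} {P} v p = go (allV n) (∈-allV v)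
  where
  go : ∀ xs → v ∈ xs → BL.any P xs ≡ true
  go (x ∷ xs) (here refl) = ∨-introˡ _ p
  go (x ∷ xs) (there m) = ∨-introʳ (P x) (go xs m)

-- Fourier analysis on matrices

*-swap : ∀ a b c → a * (b * c) ≡ b * (a * c)
*-swap = solve-∀ ℚring

*-interchange : ∀ a b c e → a * b * (c * e) ≡ a * c * (b * e)
*-interchange = solve-∀ ℚring

ι : ℕ → ℚ
ι zero = 0ℚ
ι (suc k) = 1ℚ + ι k

ι≥0 : ∀ k → 0ℚ ≤ ι k
ι≥0 zero = ≤-refl
ι≥0 (suc k) = +-≥0 0≤1 (ι≥0 k)

ι-+ : ∀ a b → ι (a ℕ.+ b) ≡ ι a + ι b
ι-+ zero b = sym (QP.+-identityˡ _)
ι-+ (suc a) b = trans (cong (1ℚ +_) (ι-+ a b)) (sym (QP.+-assoc 1ℚ (ι a) (ι b)))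

ι-* : ∀ a b → ι (a ℕ.* b) ≡ ι a * ι b
ι-* zero b = sym (QP.*-zeroˡ (ι b))
ι-* (suc a) b = trans (ι-+ b (a ℕ.* b)) (trans (cong (ι b +_) (ι-* a b)) (lem (ι a) (ι b)))
  where
  lem : ∀ a b → b + a * b ≡ (1ℚ + a) * b
  lem = solve-∀ ℚring

ι-2^ : ∀ k → ι (2 ℕ.^ k) ≡ pw k
ι-2^ zero = refl
ι-2^ (suc k) = trans (ι-* 2 (2 ℕ.^ k)) (cong (two *_) (ι-2^ k))

ι-mono : ∀ {a b} → a ℕ.≤ b → ι a ≤ ι b
ι-mono {b = b} ℕ.z≤n = ι≥0 b
ι-mono (ℕ.s≤s p) = QP.+-monoʳ-≤ 1ℚ (ι-mono p)

ι-cancel : ∀ {a b} → ι a ≤ ι b → a ℕ.≤ b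
ι-cancel {a} {b} p with a ℕ.≤? b
... | yes q = q
... | no ¬q = ⊥-elim (<⇒≱ (subst₂ _<_ (QP.+-identityˡ (ι b)) refl (QP.+-monoˡ-< (ι b) (QP.positive⁻¹ 1ℚ))) (≤-trans (ι-mono (NP.≰⇒> ¬q)) p))

-- An elementary abelian 2-group with a perfect pairing. Both vectors and matrices are of this kind,
-- so the Fourier calculus is done once. `ft` is unnormalised; the factor `pw sz` appears upon
-- inversion.
record Char (A : Set) : Set where
  field
    E : Enum A
    _⊞_ : A → A → A
    pair : A → A → Bool
    sz : ℕ
    ⊞-cancel : ∀ x y → x ⊞ (x ⊞ y) ≡ y
    ⊞-comm : ∀ x y → x ⊞ y ≡ y ⊞ x
    pair-⊞ : ∀ x y m → pair (x ⊞ y) m ≡ pair x m xor pair y m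
    orth : ∀ x z → ∑[ m ∈ els E ] (σ (pair x m) * σ (pair z m)) ≡ pw sz * ⟦ eq E z x ⟧

  A* : List A
  A* = els E

  ft : (A → ℚ) → A → ℚ
  ft Φ m = ∑[ z ∈ A* ] (σ (pair z m) * Φ z)

  ft-inv : ∀ Φ x → ∑[ m ∈ A* ] (σ (pair x m) * ft Φ m) ≡ pw sz * Φ x
  ft-inv Φ x = begin
    ∑[ m ∈ A* ] (σ (pair x m) * ft Φ m)
      ≡⟨ ∑-cong A* (λ m → trans (sym (∑-*ˡ A* (σ (pair x m)) _)) (∑-cong A* λ z → lem (σ (pair x m)) (σ (pair z m)) (Φ z))) ⟩
    ∑[ m ∈ A* ] ∑[ z ∈ A* ] (σ (pair x m) * σ (pair z m) * Φ z)
      ≡⟨ ∑-swap A* A* _ ⟩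
    ∑[ z ∈ A* ] ∑[ m ∈ A* ] (σ (pair x m) * σ (pair z m) * Φ z)
      ≡⟨ ∑-cong A* (λ z → trans (∑-*ʳ A* (Φ z) _) (cong (_* Φ z) (orth x z))) ⟩
    ∑[ z ∈ A* ] (pw sz * ⟦ eq E z x ⟧ * Φ z)
      ≡⟨ trans (∑-cong A* λ z → QP.*-assoc (pw sz) _ (Φ z)) (∑-*ˡ A* (pw sz) _) ⟩
    pw sz * ∑[ z ∈ A* ] (⟦ eq E z x ⟧ * Φ z)
      ≡⟨ cong (pw sz *_) (∑δ E x Φ) ⟩
    pw sz * Φ x ∎
    where
    open ≡-Reasoning
    lem : ∀ a b c → a * (b * c) ≡ a * b * c
    lem = solve-∀ ℚring

  plancherel : ∀ F G → ∑[ m ∈ A* ] (ft F m * ft G m) ≡ pw sz * ∑[ x ∈ A* ] (F x * G x)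
  plancherel F G = begin
    ∑[ m ∈ A* ] (ft F m * ft G m)
      ≡⟨ ∑-cong A* (λ m → trans (sym (∑-*ʳ A* (ft G m) _)) (∑-cong A* λ x → lem (σ (pair x m)) (F x) (ft G m))) ⟩
    ∑[ m ∈ A* ] ∑[ x ∈ A* ] (F x * (σ (pair x m) * ft G m))
      ≡⟨ ∑-swap A* A* _ ⟩
    ∑[ x ∈ A* ] ∑[ m ∈ A* ] (F x * (σ (pair x m) * ft G m))
      ≡⟨ ∑-cong A* (λ x → trans (∑-*ˡ A* (F x) _) (trans (cong (F x *_) (ft-inv G x)) (*-swap (F x) (pw sz) (G x)))) ⟩
    ∑[ x ∈ A* ] (pw sz * (F x * G x))
      ≡⟨ ∑-*ˡ A* (pw sz) _ ⟩
    pw sz * ∑[ x ∈ A* ] (F x * G x) ∎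
    where
    open ≡-Reasoning
    lem : ∀ a b c → a * b * c ≡ b * (a * c)
    lem = solve-∀ ℚring

  -- The transform diagonalises convolution forms. Used on the first column alone, it splits a form
  -- on matrices into forms on their restrictions.
  ft-tri : ∀ Φ F G → ∑[ m ∈ A* ] (ft Φ m * (ft F m * ft G m)) ≡ pw sz * ∑[ x ∈ A* ] ∑[ y ∈ A* ] (Φ (x ⊞ y) * (F x * G y))
  ft-tri Φ F G = begin
    ∑[ m ∈ A* ] (ft Φ m * (ft F m * ft G m))
      ≡⟨ ∑-cong A* (λ m → trans (cong (ft Φ m *_) (∑-prod A* A* _ _)) (trans (sym (∑-*ˡ A* (ft Φ m) _)) (∑-cong A* λ x →
           trans (sym (∑-*ˡ A* (ft Φ m) _)) (∑-cong A* λ y → trans (lem (ft Φ m) (σ (pair x m)) (F x) (σ (pair y m)) (G y))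
             (cong (λ z → F x * G y * (z * ft Φ m)) (sym (trans (cong σ (pair-⊞ x y m)) (σ-xor (pair x m) (pair y m))))))))) ⟩
    ∑[ m ∈ A* ] ∑[ x ∈ A* ] ∑[ y ∈ A* ] (F x * G y * (σ (pair (x ⊞ y) m) * ft Φ m))
      ≡⟨ trans (∑-swap A* A* _) (∑-cong A* λ x → ∑-swap A* A* _) ⟩
    ∑[ x ∈ A* ] ∑[ y ∈ A* ] ∑[ m ∈ A* ] (F x * G y * (σ (pair (x ⊞ y) m) * ft Φ m))
      ≡⟨ ∑-cong A* (λ x → trans (∑-cong A* λ y → trans (∑-*ˡ A* (F x * G y) _) (trans (cong (F x * G y *_) (ft-inv Φ (x ⊞ y))) (lem₂ (F x * G y) (pw sz) (Φ (x ⊞ y))))) (∑-*ˡ A* (pw sz) _)) ⟩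
    ∑[ x ∈ A* ] (pw sz * ∑[ y ∈ A* ] (Φ (x ⊞ y) * (F x * G y)))
      ≡⟨ ∑-*ˡ A* (pw sz) _ ⟩
    pw sz * ∑[ x ∈ A* ] ∑[ y ∈ A* ] (Φ (x ⊞ y) * (F x * G y)) ∎
    where
    open ≡-Reasoning
    lem : ∀ p a f b g → p * (a * f * (b * g)) ≡ f * g * (a * b * p)
    lem = solve-∀ ℚring
    lem₂ : ∀ a p q → a * (p * q) ≡ p * (q * a)
    lem₂ = solve-∀ ℚring

  infixl 7 _⋆_
  _⋆_ : (A → ℚ) → (A → ℚ) → A → ℚ
  (Φ ⋆ H) z = ∑[ x ∈ A* ] (Φ (x ⊞ z) * H x)

  ft-⋆ : ∀ Φ H m → ft (Φ ⋆ H) m ≡ ft Φ m * ft H m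
  ft-⋆ Φ H m = begin
    ∑[ z ∈ A* ] (σ (pair z m) * ∑[ x ∈ A* ] (Φ (x ⊞ z) * H x))
      ≡⟨ ∑-cong A* (λ z → sym (∑-*ˡ A* (σ (pair z m)) _)) ⟩
    ∑[ z ∈ A* ] ∑[ x ∈ A* ] (σ (pair z m) * (Φ (x ⊞ z) * H x))
      ≡⟨ ∑-swap A* A* _ ⟩
    ∑[ x ∈ A* ] ∑[ z ∈ A* ] (σ (pair z m) * (Φ (x ⊞ z) * H x))
      ≡⟨ ∑-cong A* (λ x → trans (∑-cong A* λ z → trans (cong (λ t → σ (pair t m) * (Φ (x ⊞ z) * H x)) (sym (⊞-cancel x z)))
            (cong (_* (Φ (x ⊞ z) * H x)) (trans (cong σ (pair-⊞ x (x ⊞ z) m)) (σ-xor (pair x m) (pair (x ⊞ z) m)))))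
          (∑-bij E E (x ⊞_) (x ⊞_) (⊞-cancel x) (⊞-cancel x) (λ z → σ (pair x m) * σ (pair z m) * (Φ z * H x)))) ⟩
    ∑[ x ∈ A* ] ∑[ z ∈ A* ] (σ (pair x m) * σ (pair z m) * (Φ z * H x))
      ≡⟨ ∑-cong A* (λ x → trans (∑-cong A* λ z → lem (σ (pair x m)) (σ (pair z m)) (Φ z) (H x)) (∑-*ʳ A* (σ (pair x m) * H x) _)) ⟩
    ∑[ x ∈ A* ] (ft Φ m * (σ (pair x m) * H x))
      ≡⟨ ∑-*ˡ A* (ft Φ m) _ ⟩
    ft Φ m * ft H m ∎
    where
    open ≡-Reasoning
    lem : ∀ a b c e → a * b * (c * e) ≡ b * c * (a * e)
    lem = solve-∀ ℚring

  norm : (A → ℚ) → ℚ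
  norm φ = ∑[ x ∈ A* ] (φ x * φ x)

  norm≥0 : ∀ φ → 0ℚ ≤ norm φ
  norm≥0 φ = ∑-≥0 A* (λ x → sq≥0 (φ x))

  Bil : (φ α β : A → ℚ) → ℚ
  Bil φ α β = ∑[ x ∈ A* ] ∑[ y ∈ A* ] (φ (x ⊞ y) * (α x * β y))

  norm-cong : ∀ {φ ψ} → (∀ x → φ x ≡ ψ x) → norm φ ≡ norm ψ
  norm-cong e = ∑-cong A* λ x → cong₂ _*_ (e x) (e x)

VC : (n : ℕ) → Char (V n)
VC n = record
  { E = VE n ; _⊞_ = _⊕v_ ; pair = dot ; sz = n ; ⊞-cancel = ⊕-cancel ; ⊞-comm = ⊕-comm ; pair-⊞ = dot-⊕ˡ
  ; orth = λ x z → trans (∑-cong (allV n) λ m → trans (sym (σ-xor (dot x m) (dot z m))) (cong σ (sym (dot-⊕ˡ x z m))))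
             (trans (∑-char (x ⊕v z)) (cong (λ b → pw n * ⟦ b ⟧) (≡-from-iff
               (λ e → eq-complete (VE n) {z} {x} (sym (⊕≡0 (==v-sound e))))
               (λ e → eq-complete (VE n) (trans (cong (x ⊕v_) (==v-sound e)) (⊕-self x)))))) }

dotM : M n d → M n d → Bool
dotM [] [] = false
dotM (x ∷ X) (y ∷ Y) = dot x y xor dotM X Y

dotM-⊕ˡ : (X Y Z : M n d) → dotM (X ⊕ Y) Z ≡ dotM X Z xor dotM Y Z
dotM-⊕ˡ [] [] [] = refl
dotM-⊕ˡ (x ∷ X) (y ∷ Y) (z ∷ Z) = trans (cong₂ _xor_ (dot-⊕ˡ x y z) (dotM-⊕ˡ X Y Z)) (xor-swap (dot x z) (dot y z) (dotM X Z) (dotM Y Z))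

dotM-comm : (X Y : M n d) → dotM X Y ≡ dotM Y X
dotM-comm [] [] = refl
dotM-comm (x ∷ X) (y ∷ Y) = cong₂ _xor_ (dot-comm x y) (dotM-comm X Y)

MC : (n d : ℕ) → Char (M n d)
MC n d = record
  { E = ME n d ; _⊞_ = _⊕_ ; pair = dotM ; sz = d ℕ.* n ; ⊞-cancel = ⊕M-cancel ; ⊞-comm = ⊕M-comm ; pair-⊞ = dotM-⊕ˡ ; orth = go d }
  where
  go : ∀ d (X Z : M n d) → ∑[ m ∈ allM n d ] (σ (dotM X m) * σ (dotM Z m)) ≡ pw (d ℕ.* n) * ⟦ Z ==M X ⟧
  go zero [] [] = refl
  go (suc d) (x ∷ X) (z ∷ Z) = begin
    ∑[ m ∈ allM n (suc d) ] (σ (dotM (x ∷ X) m) * σ (dotM (z ∷ Z) m))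
      ≡⟨ ∑-allM (λ m → σ (dotM (x ∷ X) m) * σ (dotM (z ∷ Z) m)) ⟩
    ∑[ v ∈ allV n ] ∑[ m ∈ allM n d ] (σ (dot x v xor dotM X m) * σ (dot z v xor dotM Z m))
      ≡⟨ ∑-cong (allV n) (λ v → ∑-cong (allM n d) λ m → trans (cong₂ _*_ (σ-xor (dot x v) _) (σ-xor (dot z v) _)) (*-interchange (σ (dot x v)) (σ (dotM X m)) (σ (dot z v)) (σ (dotM Z m)))) ⟩
    ∑[ v ∈ allV n ] ∑[ m ∈ allM n d ] (σ (dot x v) * σ (dot z v) * (σ (dotM X m) * σ (dotM Z m)))
      ≡⟨ sym (∑-prod (allV n) (allM n d) _ _) ⟩
    ∑[ v ∈ allV n ] (σ (dot x v) * σ (dot z v)) * ∑[ m ∈ allM n d ] (σ (dotM X m) * σ (dotM Z m))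
      ≡⟨ cong₂ _*_ (Char.orth (VC n) x z) (go d X Z) ⟩
    pw n * ⟦ z ==v x ⟧ * (pw (d ℕ.* n) * ⟦ Z ==M X ⟧)
      ≡⟨ *-interchange (pw n) ⟦ z ==v x ⟧ _ _ ⟩
    pw n * pw (d ℕ.* n) * (⟦ z ==v x ⟧ * ⟦ Z ==M X ⟧)
      ≡⟨ cong₂ _*_ (sym (pw-+ n (d ℕ.* n))) (sym (⟦∧⟧ (z ==v x) (Z ==M X))) ⟩
    pw (suc d ℕ.* n) * ⟦ (z ∷ Z) ==M (x ∷ X) ⟧ ∎
    where open ≡-Reasoning

-- Restrictions and convolution forms on matrices of low rank

norm² : (M n d → ℚ) → ℚ
norm² {n} {d} = Char.norm (MC n d)

BilM : (φ α β : M n d → ℚ) → ℚ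
BilM {n} {d} = Char.Bil (MC n d)

-- The Fourier transform in the first column only. The functions `φ` of interest are themselves
-- transforms, and for `φ = hat g` this fixes the first column of `g` to `m` (`Res-hat`).
Res : V n → (M n (suc d) → ℚ) → M n d → ℚ
Res {n} m φ X = ∑[ x ∈ allV n ] (σ (dot x m) * φ (x ∷ X))

-- Rows become columns after a transvection of the row coordinates. So `Res` applied to `φ ∘ mv f w`
-- restricts along an arbitrary row direction, and transposing `φ` first gives the column
-- directions.
mv : (f w : V n) → M d n → M n d
mv f w Y = Vec.map (tv f w) (T Y)

mv⁻ : (f w : V n) → M n d → M d n
mv⁻ f w X = T (Vec.map (tv f w) X)

mv-mv⁻ : (f w : V n) → dot f w ≡ false → (X : M n d) → mv f w (mv⁻ f w X) ≡ X
mv-mv⁻ f w fw X = trans (cong (Vec.map (tv f w)) (TT (Vec.map (tv f w) X))) (map-tv-inv f w fw X)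

mv⁻-mv : (f w : V n) → dot f w ≡ false → (Y : M d n) → mv⁻ f w (mv f w Y) ≡ Y
mv⁻-mv f w fw Y = trans (cong T (map-tv-inv f w fw (T Y))) (TT Y)

mv-⊕ : (f w : V n) (X Y : M d n) → mv f w (X ⊕ Y) ≡ mv f w X ⊕ mv f w Y
mv-⊕ f w X Y = trans (cong (Vec.map (tv f w)) (T-⊕ X Y)) (map-tv-⊕ f w (T X) (T Y))

rk-mv : (f w : V n) → dot f w ≡ false → (Y : M d n) → rk (mv f w Y) ≡ rk Y
rk-mv f w fw Y = trans (rk-tv f w fw (T Y)) (rk-T Y)

-- Every restriction of φ to a flat given by at most R linear conditions, each on a row or column
-- direction, has squared norm at most c.
Bnd : ℕ → (M n d → ℚ) → ℚ → Set
RowB : ℕ → (n : ℕ) → (M n d → ℚ) → ℚ → Set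
Bnd zero φ c = norm² φ ≤ c
Bnd {n} {d} (suc R) φ c = norm² φ ≤ c × RowB R n φ c × RowB R d (φ ∘ T) c
RowB R zero φ c = ⊤
RowB R (suc n) φ c = ∀ f w m → dot f w ≡ false → Bnd R (Res m (φ ∘ mv f w)) c

Supp : ℕ → (M n d → ℚ) → Set
Supp R α = ∀ X → R ℕ.≤ rk X → α X ≡ 0ℚ

module _ {I C : Set} (s : C → I → Bool) where

  generic : List C → I → I → Bool
  generic [] x y = true
  generic (c ∷ cs) x y = not (s c x ∧ s c y) ∧ generic cs x y

  cut : C → (I → ℚ) → I → ℚ
  cut c α x = ⟦ s c x ⟧ * α x

  -- This is `Π_c (1 + s_c(x)) - 1`: the total weight at `x` of the nonconstant terms in the
  -- expansion of `Π_c (1 - s_c(x) s_c(y))`, each of which is bounded by Cauchy-Schwarz.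
  wt : List C → I → ℚ
  wt [] x = 0ℚ
  wt (c ∷ cs) x = wt cs x + ⟦ s c x ⟧ + ⟦ s c x ⟧ * wt cs x

  wt≥0 : ∀ cs x → 0ℚ ≤ wt cs x
  wt≥0 [] x = ≤-refl
  wt≥0 (c ∷ cs) x = +-≥0 (+-≥0 (wt≥0 cs x) (⟦⟧≥0 (s c x))) (*-≥0 (⟦⟧≥0 (s c x)) (wt≥0 cs x))

  wt-bound : ∀ cs x (k : ℕ) → ∑[ c ∈ cs ] ⟦ s c x ⟧ ≤ ι k → wt cs x ≤ pw k
  wt-bound cs x k h = ≤-trans (diff≤ 1ℚ 0≤1 refl) (≤-trans (≤≡ (wt-pw cs)) (pw-mono (ι-cancel {cnt cs} {k} (≤-trans (≤≡ (num cs)) h))))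
    where
    cnt : List C → ℕ
    cnt [] = 0
    cnt (c ∷ cs) = if s c x then suc (cnt cs) else cnt cs
    num : ∀ cs → ι (cnt cs) ≡ ∑[ c ∈ cs ] ⟦ s c x ⟧
    num [] = refl
    num (c ∷ cs) with s c x
    ... | true = cong (1ℚ +_) (num cs)
    ... | false = trans (num cs) (sym (QP.+-identityˡ _))
    wt-pw : ∀ cs → wt cs x + 1ℚ ≡ pw (cnt cs)
    wt-pw [] = refl
    wt-pw (c ∷ cs) with s c x
    ... | true = trans (lem (wt cs x)) (cong (two *_) (wt-pw cs))
      where
      lem : ∀ w → w + 1ℚ + 1ℚ * w + 1ℚ ≡ two * (w + 1ℚ)
      lem = solve-∀ ℚring
    ... | false = trans (lem (wt cs x)) (wt-pw cs)
      where
      lem : ∀ w → w + 0ℚ + 0ℚ * w + 1ℚ ≡ w + 1ℚ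
      lem = solve-∀ ℚring

  generic-sound : ∀ cs {x y c} → generic cs x y ≡ true → c ∈ cs → s c x ≡ true → s c y ≡ true → ⊥
  generic-sound (c ∷ cs) {x} {y} g (here refl) p q = false≢true (cong not (∧-intro p q)) (proj₁ (∧-true g))
  generic-sound (c ∷ cs) {x} {y} g (there m) p q = generic-sound cs (proj₂ (∧-true {not (s c x ∧ s c y)} g)) m p q

module _ {I C : Set} (xs : List I) (b : I → I → ℚ) (s : C → I → Bool) where

  form : (α β : I → ℚ) → ℚ
  form α β = ∑[ x ∈ xs ] ∑[ y ∈ xs ] (b x y * (α x * β y))

  gform : List C → (α β : I → ℚ) → ℚ
  gform cs α β = ∑[ x ∈ xs ] ∑[ y ∈ xs ] (⟦ generic s cs x y ⟧ * (b x y * (α x * β y)))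

  sq : (I → ℚ) → I → ℚ
  sq α x = α x * α x

  -- Peeling off the factors of Π_c (1 - s_c(x) s_c(y)) one at a time.
  form-gform : (Low : (I → ℚ) → Set) → (∀ c {α} → Low α → Low (cut s c α)) → (K : ℚ) → 0ℚ ≤ K →
    (∀ c α β → Low α → Low β → form (cut s c α) (cut s c β) * form (cut s c α) (cut s c β) ≤ K * (∑ xs (sq (cut s c α)) * ∑ xs (sq (cut s c β)))) →
    ∀ cs α β → Low α → Low β → (form α β - gform cs α β) * (form α β - gform cs α β) ≤ K * ((∑[ x ∈ xs ] (wt s cs x * sq α x)) * (∑[ x ∈ xs ] (wt s cs x * sq β x)))
  form-gform Low low K K≥0 hyp [] α β _ _ = ≤-trans (≤≡ (trans (cong (λ z → z * z) zero') refl)) (*-≥0 K≥0 (*-≥0 (∑-≥0 xs λ x → *-≥0 ≤-refl (sq≥0 (α x))) (∑-≥0 xs λ x → *-≥0 ≤-refl (sq≥0 (β x)))))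
    where
    zero' : form α β - gform [] α β ≡ 0ℚ
    zero' = trans (cong (λ z → form α β - z) (∑-cong xs λ x → ∑-cong xs λ y → QP.*-identityˡ _)) (QP.+-inverseʳ (form α β))
  form-gform Low low K K≥0 hyp (c ∷ cs) α β lα lβ =
    ≤-trans (≤≡ (cong (λ z → z * z) split)) (≤-trans
      (CS₂ {K} {F - G + Fc} { - (Fc - Gc)} {Aw α + As α} {Aws α} {Aw β + As β} {Aws β} K≥0 (+-≥0 (Aw≥0 α) (As≥0 α)) (Aws≥0 α) (+-≥0 (Aw≥0 β) (As≥0 β)) (Aws≥0 β)
        (CS₂ {K} {F - G} {Fc} {Aw α} {As α} {Aw β} {As β} K≥0 (Aw≥0 α) (As≥0 α) (Aw≥0 β) (As≥0 β)
          (form-gform Low low K K≥0 hyp cs α β lα lβ)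
          (≤-trans (hyp c α β lα lβ) (≤≡ (cong (K *_) (cong₂ _*_ (cutsq α) (cutsq β))))))
        (≤-trans (≤≡ (neg² (Fc - Gc))) (≤-trans (form-gform Low low K K≥0 hyp cs (cut s c α) (cut s c β) (low c lα) (low c lβ)) (≤≡ (cong (K *_) (cong₂ _*_ (wcutsq α) (wcutsq β)))))))
      (≤≡ (cong (K *_) (cong₂ _*_ (tot α) (tot β)))))
    where
    F = form α β
    G = gform cs α β
    Fc = form (cut s c α) (cut s c β)
    Gc = gform cs (cut s c α) (cut s c β)
    Aw As Aws : (I → ℚ) → ℚ
    Aw γ = ∑[ x ∈ xs ] (wt s cs x * sq γ x)
    As γ = ∑[ x ∈ xs ] (⟦ s c x ⟧ * sq γ x)
    Aws γ = ∑[ x ∈ xs ] (⟦ s c x ⟧ * wt s cs x * sq γ x)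
    Aw≥0 : ∀ γ → 0ℚ ≤ Aw γ
    Aw≥0 γ = ∑-≥0 xs λ x → *-≥0 (wt≥0 s cs x) (sq≥0 (γ x))
    As≥0 : ∀ γ → 0ℚ ≤ As γ
    As≥0 γ = ∑-≥0 xs λ x → *-≥0 (⟦⟧≥0 (s c x)) (sq≥0 (γ x))
    Aws≥0 : ∀ γ → 0ℚ ≤ Aws γ
    Aws≥0 γ = ∑-≥0 xs λ x → *-≥0 (*-≥0 (⟦⟧≥0 (s c x)) (wt≥0 s cs x)) (sq≥0 (γ x))
    neg² : ∀ a → (- a) * (- a) ≡ a * a
    neg² = solve-∀ ℚring
    idem : ∀ t → ⟦ t ⟧ * ⟦ t ⟧ ≡ ⟦ t ⟧
    idem = ⟦⟧*⟦⟧
    r₁ : ∀ t a → t * a * (t * a) ≡ t * t * (a * a)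
    r₁ = solve-∀ ℚring
    r₂ : ∀ w t a → w * (t * t * a) ≡ t * t * w * a
    r₂ = solve-∀ ℚring
    r₃ : ∀ w t a → w * a + t * a + t * w * a ≡ (w + t + t * w) * a
    r₃ = solve-∀ ℚring
    cutsq : ∀ γ → ∑ xs (sq (cut s c γ)) ≡ As γ
    cutsq γ = ∑-cong xs λ x → trans (r₁ ⟦ s c x ⟧ (γ x)) (cong (_* sq γ x) (idem (s c x)))
    wcutsq : ∀ γ → ∑[ x ∈ xs ] (wt s cs x * sq (cut s c γ) x) ≡ Aws γ
    wcutsq γ = ∑-cong xs λ x → trans (cong (wt s cs x *_) (r₁ ⟦ s c x ⟧ (γ x))) (trans (r₂ (wt s cs x) ⟦ s c x ⟧ (sq γ x)) (cong (λ z → z * wt s cs x * sq γ x) (idem (s c x))))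
    tot : ∀ γ → Aw γ + As γ + Aws γ ≡ ∑[ x ∈ xs ] (wt s (c ∷ cs) x * sq γ x)
    tot γ = trans (cong (_+ Aws γ) (sym (∑-+ xs _ _))) (trans (sym (∑-+ xs _ _)) (∑-cong xs λ x → r₃ (wt s cs x) ⟦ s c x ⟧ (sq γ x)))
    ptw : ∀ p q g z a e → ⟦ not (p ∧ q) ∧ g ⟧ * (z * (a * e)) + ⟦ g ⟧ * (z * (⟦ p ⟧ * a * (⟦ q ⟧ * e))) ≡ ⟦ g ⟧ * (z * (a * e))
    ptw false q g z a e = lem ⟦ g ⟧ ⟦ q ⟧ z a e
      where
      lem : ∀ g q z a e → g * (z * (a * e)) + g * (z * (0ℚ * a * (q * e))) ≡ g * (z * (a * e))
      lem = solve-∀ ℚring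
    ptw true false g z a e = lem ⟦ g ⟧ z a e
      where
      lem : ∀ g z a e → g * (z * (a * e)) + g * (z * (1ℚ * a * (0ℚ * e))) ≡ g * (z * (a * e))
      lem = solve-∀ ℚring
    ptw true true g z a e = lem ⟦ g ⟧ z a e
      where
      lem : ∀ g z a e → 0ℚ * (z * (a * e)) + g * (z * (1ℚ * a * (1ℚ * e))) ≡ g * (z * (a * e))
      lem = solve-∀ ℚring
    G-step : gform (c ∷ cs) α β + Gc ≡ G
    G-step = trans (sym (∑-+ xs _ _)) (∑-cong xs λ x → trans (sym (∑-+ xs _ _)) (∑-cong xs λ y → ptw (s c x) (s c y) (generic s cs x y) (b x y) (α x) (β y)))
    -- By `G-step` the new generic form is `G - Gc`. The pieces `F - G`, `Fc` and `Fc - Gc` carry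
    -- the weights `wt`, `s` and `s · wt`, which add up to the weight for `c ∷ cs`; hence the two
    -- uses of `CS₂` keep the same `K`.
    split : F - gform (c ∷ cs) α β ≡ F - G + Fc + - (Fc - Gc)
    split = trans (lem F (gform (c ∷ cs) α β) Fc Gc) (cong (λ z → F - z + Fc + - (Fc - Gc)) G-step)
      where
      lem : ∀ f g p q → f - g ≡ f - (g + q) + p + - (p - q)
      lem = solve-∀ ℚring

nonzero-dot : (a : V n) → a ≢ 0v → ∃ λ f → dot f a ≡ true
nonzero-dot [] h = ⊥-elim (h refl)
nonzero-dot {suc n} (true ∷ a) h = (true ∷ 0v) , cong (true xor_) (dot-0ˡ a)
nonzero-dot {suc n} (false ∷ a) h = let (f , p) = nonzero-dot a (h ∘ cong (false ∷_)) in (false ∷ f) , p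

𝐞 : V (suc n)
𝐞 = true ∷ 0v

-- Take `w = a + 𝐞` and `f` with `⟨f,a⟩ = ⟨f,𝐞⟩ = 1`; then `⟨f,w⟩ = 0` and `a` goes to `a + w = 𝐞`.
-- The first entry of `f` is 1 and its tail corrects `⟨f,a⟩`, which is possible because a vector
-- `a ≠ 0` starting with 0 has a nonzero tail.
toE₁ : (a : V (suc n)) → a ≢ 0v → ∃ λ f → ∃ λ w → dot f w ≡ false × tv f w a ≡ 𝐞
toE₁ {n} (b ∷ a) h = (true ∷ f') , w , fw , trans (cong (λ z → (b ∷ a) ⊕v sc z w) fa) (⊕-cancel (b ∷ a) 𝐞)
  where
  pick : ∀ b → (b ∷ a) ≢ 0v → ∃ λ f' → dot f' a ≡ not b
  pick true _ = 0v , dot-0ˡ a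
  pick false h = nonzero-dot a (h ∘ cong (false ∷_))
  f' = proj₁ (pick b h)
  w = (b ∷ a) ⊕v 𝐞
  fa : dot (true ∷ f') (b ∷ a) ≡ true
  fa = trans (cong (b xor_) (proj₂ (pick b h))) (x b)
    where
    x : ∀ b → b xor not b ≡ true
    x false = refl
    x true = refl
  fw : dot (true ∷ f') w ≡ false
  fw = trans (dot-⊕ʳ (true ∷ f') (b ∷ a) 𝐞) (cong₂ _xor_ fa (cong (true xor_) (dot-0ʳ f')))

-- `ft-tri` in the first column, the other columns being held fixed. With `norm-Res`, which scales
-- by the same factor `2^n`, a bound for all restrictions passes to the whole form.
BilM-Res : (φ α β : M n (suc d) → ℚ) → pw n * BilM φ α β ≡ ∑[ m ∈ allV n ] BilM (Res m φ) (Res m α) (Res m β)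
BilM-Res {n} {d} φ α β = sym (begin
  ∑[ m ∈ allV n ] ∑[ X ∈ 𝕄 ] ∑[ Y ∈ 𝕄 ] (Res m φ (X ⊕ Y) * (Res m α X * Res m β Y))
    ≡⟨ trans (∑-swap (allV n) 𝕄 _) (∑-cong 𝕄 λ X → ∑-swap (allV n) 𝕄 _) ⟩
  ∑[ X ∈ 𝕄 ] ∑[ Y ∈ 𝕄 ] ∑[ m ∈ allV n ] (Res m φ (X ⊕ Y) * (Res m α X * Res m β Y))
    ≡⟨ ∑-cong 𝕄 (λ X → ∑-cong 𝕄 λ Y → Char.ft-tri (VC n) (λ z → φ (z ∷ (X ⊕ Y))) (λ x → α (x ∷ X)) (λ y → β (y ∷ Y))) ⟩
  ∑[ X ∈ 𝕄 ] ∑[ Y ∈ 𝕄 ] (pw n * ∑[ x ∈ allV n ] ∑[ y ∈ allV n ] (φ ((x ⊕v y) ∷ (X ⊕ Y)) * (α (x ∷ X) * β (y ∷ Y))))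
    ≡⟨ trans (∑-cong 𝕄 λ X → ∑-*ˡ 𝕄 (pw n) _) (∑-*ˡ 𝕄 (pw n) _) ⟩
  pw n * ∑[ X ∈ 𝕄 ] ∑[ Y ∈ 𝕄 ] ∑[ x ∈ allV n ] ∑[ y ∈ allV n ] (φ ((x ⊕v y) ∷ (X ⊕ Y)) * (α (x ∷ X) * β (y ∷ Y)))
    ≡⟨ cong (pw n *_) (trans (∑-cong 𝕄 λ X → ∑-swap 𝕄 (allV n) _) (trans (∑-swap 𝕄 (allV n) _)
         (∑-cong (allV n) λ x → ∑-cong 𝕄 λ X → ∑-swap 𝕄 (allV n) _))) ⟩
  pw n * ∑[ x ∈ allV n ] ∑[ X ∈ 𝕄 ] ∑[ y ∈ allV n ] ∑[ Y ∈ 𝕄 ] (φ ((x ⊕v y) ∷ (X ⊕ Y)) * (α (x ∷ X) * β (y ∷ Y)))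
    ≡⟨ cong (pw n *_) (sym (trans (∑-allM (λ X → ∑[ Y ∈ allM n (suc d) ] (φ (X ⊕ Y) * (α X * β Y))))
         (∑-cong (allV n) λ x → ∑-cong 𝕄 λ X → ∑-allM (λ Y → φ ((x ∷ X) ⊕ Y) * (α (x ∷ X) * β Y))))) ⟩
  pw n * BilM φ α β ∎)
  where
  open ≡-Reasoning
  𝕄 = allM n d

norm-Res : (φ : M n (suc d) → ℚ) → ∑[ m ∈ allV n ] norm² (Res m φ) ≡ pw n * norm² φ
norm-Res {n} {d} φ = begin
  ∑[ m ∈ allV n ] ∑[ X ∈ allM n d ] (Res m φ X * Res m φ X)
    ≡⟨ ∑-swap (allV n) (allM n d) _ ⟩
  ∑[ X ∈ allM n d ] ∑[ m ∈ allV n ] (Res m φ X * Res m φ X)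
    ≡⟨ ∑-cong (allM n d) (λ X → Char.plancherel (VC n) (λ x → φ (x ∷ X)) (λ x → φ (x ∷ X))) ⟩
  ∑[ X ∈ allM n d ] (pw n * ∑[ x ∈ allV n ] (φ (x ∷ X) * φ (x ∷ X)))
    ≡⟨ ∑-*ˡ (allM n d) (pw n) _ ⟩
  pw n * ∑[ X ∈ allM n d ] ∑[ x ∈ allV n ] (φ (x ∷ X) * φ (x ∷ X))
    ≡⟨ cong (pw n *_) (trans (∑-swap (allM n d) (allV n) _) (sym (∑-allM (λ X → φ X * φ X)))) ⟩
  pw n * norm² φ ∎
  where open ≡-Reasoning

norm-mv : (f w : V n) → dot f w ≡ false → (φ : M n d → ℚ) → norm² (φ ∘ mv f w) ≡ norm² φ
norm-mv {n} {d} f w fw φ = ∑-bij (ME d n) (ME n d) (mv f w) (mv⁻ f w) (mv⁻-mv f w fw) (mv-mv⁻ f w fw) (λ X → φ X * φ X)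

norm-T : (φ : M n d → ℚ) → norm² (φ ∘ T) ≡ norm² φ
norm-T {n} {d} φ = ∑-bij (ME d n) (ME n d) T T TT TT (λ X → φ X * φ X)

Bil-bij : {A B : Set} (CA : Char A) (CB : Char B) (p : A → B) (q : B → A) → (∀ a → q (p a) ≡ a) → (∀ b → p (q b) ≡ b) →
  (∀ x y → p (Char._⊞_ CA x y) ≡ Char._⊞_ CB (p x) (p y)) → ∀ φ α β → Char.Bil CA (φ ∘ p) (α ∘ p) (β ∘ p) ≡ Char.Bil CB φ α β
Bil-bij CA CB p q qp pq add φ α β = trans
  (∑-cong (Char.A* CA) λ x → trans (∑-cong (Char.A* CA) λ y → cong (λ z → φ z * (α (p x) * β (p y))) (add x y))
     (∑-bij (Char.E CA) (Char.E CB) p q qp pq (λ y → φ (Char._⊞_ CB (p x) y) * (α (p x) * β y))))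
  (∑-bij (Char.E CA) (Char.E CB) p q qp pq (λ x → ∑[ y ∈ Char.A* CB ] (φ (Char._⊞_ CB x y) * (α x * β y))))

-- `genC R = 2^((2R)²)` bounds the generic decompositions of one matrix, and `dirC R` the column and
-- row directions of a matrix of rank at most `R`, so that `2^(dirC R)` bounds `wt`. The factor 2
-- comes from separating the generic pairs from the rest. Nothing depends on `n` or `d`.
OPc : ℕ → ℚ
genC : ℕ → ℚ
genC R = pw (R ℕ.+ R) ^ℚ (R ℕ.+ R)
dirC : ℕ → ℕ
dirC R = 2 ℕ.^ R ℕ.+ 2 ℕ.^ R
OPc zero = 0ℚ
OPc (suc R) = two * (genC R + OPc R * (pw (dirC R) * pw (dirC R)))

genC≥0 : ∀ R → 0ℚ ≤ genC R
genC≥0 R = ^-≥0 (pw≥0 (R ℕ.+ R)) (R ℕ.+ R)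

OPc≥0 : ∀ R → 0ℚ ≤ OPc R
OPc≥0 zero = ≤-refl
OPc≥0 (suc R) = *-≥0 0≤two (+-≥0 (genC≥0 R) (*-≥0 (OPc≥0 R) (*-≥0 (pw≥0 (dirC R)) (pw≥0 (dirC R)))))

-- A bound for the operator norm of convolution with `φ`, compressed to matrices of rank below `R`.
-- Being free of the dimensions, it takes the place of hypercontractivity.
OP : ℕ → Set
OP R = ∀ {n d} (φ : M n d → ℚ) c → 0ℚ ≤ c → Bnd R φ c → ∀ α β → Supp R α → Supp R β →
  BilM φ α β * BilM φ α β ≤ OPc R * c * (norm² α * norm² β)

-- Restricting along a column-space direction a shared by all X in the supports lowers their rank by one.
OP-dir : ∀ R → OP R → ∀ {n d} (φ : M n d → ℚ) c → 0ℚ ≤ c → RowB R n φ c → (a : V n) → a ≢ 0v → ∀ α β → Supp (suc R) α → Supp (suc R) β →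
  (∀ X → inSp X a ≡ false → α X ≡ 0ℚ) → (∀ X → inSp X a ≡ false → β X ≡ 0ℚ) →
  BilM φ α β * BilM φ α β ≤ OPc R * c * (norm² α * norm² β)
OP-dir R op {zero} φ c c≥0 rb [] a≢0 = ⊥-elim (a≢0 refl)
OP-dir R op {suc n} {d} φ c c≥0 rb a a≢0 α β sα sβ aα aβ =
  *-cancelˡ-≤ (pw d * pw d) (subst (0ℚ <_) (pw-+ d d) (pw>0 (d ℕ.+ d)))
    (≤-trans (≤≡ (trans (*-interchange (pw d) (pw d) B B) (cong (λ z → z * z) (trans (cong (pw d *_) (sym tr)) (BilM-Res φ' α' β')))))
    (≤-trans (∑-CS (allV d) (OPc R * c) _ _ _ (*-≥0 (OPc≥0 R) c≥0) (λ m → Char.norm≥0 (MC d n) (Res m α')) (λ m → Char.norm≥0 (MC d n) (Res m β'))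
       (λ m → op (Res m φ') c c≥0 (rb f w m fw) (Res m α') (Res m β') (supp α sα aα m) (supp β sβ aβ m)))
     (≤≡ (trans (cong (OPc R * c *_) (cong₂ _*_ (nr α) (nr β))) (lem (OPc R * c) (pw d) (norm² α) (norm² β))))))
  where
  open Σ (toE₁ a a≢0) renaming (proj₁ to f; proj₂ to r₁)
  w = proj₁ r₁
  fw = proj₁ (proj₂ r₁)
  Pa = proj₂ (proj₂ r₁)
  φ' = φ ∘ mv f w
  α' = α ∘ mv f w
  β' = β ∘ mv f w
  B = BilM φ α β
  lem : ∀ k p a b → k * (p * a * (p * b)) ≡ p * p * (k * (a * b))
  lem = solve-∀ ℚring
  tr : BilM φ' α' β' ≡ B
  tr = Bil-bij (MC d (suc n)) (MC (suc n) d) (mv f w) (mv⁻ f w) (mv⁻-mv f w fw) (mv-mv⁻ f w fw) (mv-⊕ f w) φ α β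
  nr : ∀ γ → ∑[ m ∈ allV d ] norm² (Res m (γ ∘ mv f w)) ≡ pw d * norm² γ
  nr γ = trans (norm-Res (γ ∘ mv f w)) (cong (pw d *_) (norm-mv f w fw γ))
  -- Some combination `u` of the columns of `X` equals `a`. In the coordinates where `a` is `𝐞` this
  -- says that `u` pairs to 1 with the row `y` and to 0 with all rows in `Y`, so `y` is not in their
  -- span.
  drop : ∀ y (Y : M d n) → inSp (mv f w (y ∷ Y)) a ≡ true → inSp Y y ≡ false
  drop y Y e with inSp Y y in p
  ... | false = refl
  ... | true = false≢true dy dt
    where
    X = mv f w (y ∷ Y)
    u = proj₁ (inSp-sound X a e)
    Xu : X · u ≡ a
    Xu = proj₂ (inSp-sound X a e)
    rows : Vec.map (dot u) (y ∷ Y) ≡ 𝐞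
    rows = trans (sym (T-· (y ∷ Y) u)) (trans (cong (_· u) (sym (map-tv-inv f w fw (T (y ∷ Y))))) (trans (tv-· f w X u) (trans (cong (tv f w) Xu) Pa)))
    dt : dot u y ≡ true
    dt = VP.∷-injectiveˡ rows
    c' = proj₁ (inSp-sound Y y p)
    dy : dot u y ≡ false
    dy = trans (cong (dot u) (sym (proj₂ (inSp-sound Y y p)))) (trans (dot-· u Y c') (trans (cong (λ z → dot z c') (VP.∷-injectiveʳ rows)) (dot-0ˡ c')))
  supp : ∀ γ → Supp (suc R) γ → (∀ X → inSp X a ≡ false → γ X ≡ 0ℚ) → ∀ m → Supp R (Res m (γ ∘ mv f w))
  supp γ sγ aγ m Y R≤ = ∑-0 (allV d) λ y → trans (cong (σ (dot y m) *_) (z y)) (QP.*-zeroʳ (σ (dot y m)))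
    where
    z : ∀ y → γ (mv f w (y ∷ Y)) ≡ 0ℚ
    z y with inSp (mv f w (y ∷ Y)) a in e
    ... | false = aγ _ e
    ... | true = sγ _ (subst (suc R ℕ.≤_) (sym (trans (rk-mv f w fw (y ∷ Y)) rky)) (ℕ.s≤s R≤))
      where
      rky : rk (y ∷ Y) ≡ suc (rk Y)
      rky rewrite drop y Y e = refl

Dir : ℕ → ℕ → Set
Dir n d = V n ⊎ V d

shared : Dir n d → M n d → Bool
shared (inj₁ a) X = not (a ==v 0v) ∧ inSp X a
shared (inj₂ u) X = not (u ==v 0v) ∧ inSp (T X) u

dirs : (n d : ℕ) → List (Dir n d)
dirs n d = map inj₁ (allV n) ++ map inj₂ (allV d)

dirs-count : (X : M n d) → ∑[ c ∈ dirs n d ] ⟦ shared c X ⟧ ≤ pw (rk X) + pw (rk X)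
dirs-count {n} {d} X = ≤-trans (≤≡ (trans (∑-++ (map inj₁ (allV n)) (map inj₂ (allV d)) _) (cong₂ _+_ (∑-map (allV n) inj₁ _) (∑-map (allV d) inj₂ _))))
  (QP.+-mono-≤ (≤-trans (∑-mono (allV n) λ a → le (not (a ==v 0v)) (inSp X a)) (≤≡ (∑-sp X)))
               (≤-trans (∑-mono (allV d) λ u → le (not (u ==v 0v)) (inSp (T X) u)) (≤≡ (trans (∑-sp (T X)) (cong pw (rk-T X))))))
  where
  le : ∀ a b → ⟦ a ∧ b ⟧ ≤ ⟦ b ⟧
  le false b = ⟦⟧≥0 b
  le true b = ≤-refl

≤ᵇ-sound : ∀ {a b} → (a ℕ.≤ᵇ b) ≡ true → a ℕ.≤ b
≤ᵇ-sound {a} {b} e = NP.≤ᵇ⇒≤ a b (subst Data.Bool.T (sym e) tt)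

≤ᵇ-complete : ∀ {a b} → a ℕ.≤ b → (a ℕ.≤ᵇ b) ≡ true
≤ᵇ-complete {a} {b} p with a ℕ.≤ᵇ b | NP.≤⇒≤ᵇ p
... | true | _ = refl

-- For generic X, Y the kernel and cokernel of Z = X + Y are contained in those of X, so Z has few such decompositions.
generic-count : ∀ R (Z : M n d) → ∑[ X ∈ allM n d ] ⟦ generic shared (dirs n d) X (X ⊕ Z) ∧ ((rk X ℕ.≤ᵇ R) ∧ (rk (X ⊕ Z) ℕ.≤ᵇ R)) ⟧ ≤ genC R
generic-count {n} {d} R Z with rk Z ℕ.≤? R ℕ.+ R
... | no big = ≤-trans (≤≡ (∑-0 (allM n d) none)) (genC≥0 R)
  where
  none : ∀ X → ⟦ generic shared (dirs n d) X (X ⊕ Z) ∧ ((rk X ℕ.≤ᵇ R) ∧ (rk (X ⊕ Z) ℕ.≤ᵇ R)) ⟧ ≡ 0ℚ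
  none X with generic shared (dirs n d) X (X ⊕ Z) | rk X ℕ.≤ᵇ R in p | rk (X ⊕ Z) ℕ.≤ᵇ R in q
  ... | false | _ | _ = refl
  ... | true | false | _ = refl
  ... | true | true | false = refl
  ... | true | true | true = ⊥-elim (big (subst (λ z → rk z ℕ.≤ R ℕ.+ R) (⊕M-cancel X Z)
          (NP.≤-trans (rk-⊕ X (X ⊕ Z)) (NP.+-mono-≤ (≤ᵇ-sound {rk X} {R} p) (≤ᵇ-sound {rk (X ⊕ Z)} {R} q)))))
... | yes small = ≤-trans (count-ker Z S _ hyp) (≤-trans (^-mono (∑-≥0 (allV n) λ x → ⟦⟧≥0 (S x)) cS (rk Z)) grow)
  where
  -- The column space of `Z`, written as the annihilator of its left kernel so that `count-ann`
  -- bounds its size.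
  S : V n → Bool
  S x = allᵇ (λ y → (T Z · y ==v 0v) ⇒ᵇ not (dot y x))
  notfalse : ∀ {a} → not a ≡ true → a ≡ false
  notfalse {false} _ = refl
  S-sound : ∀ x → S x ≡ true → ∀ y → T Z · y ≡ 0v → dot x y ≡ false
  S-sound x s y e = trans (dot-comm x y) (notfalse (subst (λ z → z ⇒ᵇ not (dot y x) ≡ true) (eq-complete (VE d) e) (allᵇ-elim s y)))
  S-intro : ∀ x → (∀ y → T Z · y ≡ 0v → dot y x ≡ false) → S x ≡ true
  S-intro x h = allᵇ-intro λ y → imp y
    where
    imp : ∀ y → (T Z · y ==v 0v) ⇒ᵇ not (dot y x) ≡ true
    imp y with T Z · y ==v 0v in e
    ... | false = refl
    ... | true = cong not (h y (==v-sound e))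
  cS : ∑[ x ∈ allV n ] ⟦ S x ⟧ ≤ pw (rk Z)
  cS = ≤-trans (count-ann (T Z) S S-sound) (≤≡ (cong pw (rk-T Z)))
  grow : pw (rk Z) ^ℚ rk Z ≤ genC R
  grow = ≤-trans (^-mono (pw≥0 (rk Z)) (pw-mono small) (rk Z))
    (≤-trans (≤≡ (sym (^-^ two (R ℕ.+ R) (rk Z)))) (≤-trans (pw-mono (NP.*-monoʳ-≤ (R ℕ.+ R) small)) (≤≡ (^-^ two (R ℕ.+ R) (R ℕ.+ R)))))
  hyp : ∀ X → generic shared (dirs n d) X (X ⊕ Z) ∧ ((rk X ℕ.≤ᵇ R) ∧ (rk (X ⊕ Z) ℕ.≤ᵇ R)) ≡ true →
        Cols S X × (∀ u → Z · u ≡ 0v → X · u ≡ 0v)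
  hyp X g = cols X col , ker
    where
    gen = proj₁ (∧-true g)
    Y = X ⊕ Z
    isz : ∀ {k} (v : V k) → (not (v ==v 0v) ≡ true → ⊥) → v ≡ 0v
    isz v h with v ==v 0v in e
    ... | true = ==v-sound e
    ... | false = ⊥-elim (h refl)
    eqXY : ∀ u → Z · u ≡ 0v → Y · u ≡ X · u
    eqXY u Zu = trans (⊕-· X Z u) (trans (cong (X · u ⊕v_) Zu) (⊕-idʳ _))
    ker : ∀ u → Z · u ≡ 0v → X · u ≡ 0v
    ker u Zu = isz (X · u) λ nz → generic-sound shared (dirs n d) {c = inj₁ (X · u)} gen
      (∈-++⁺ˡ (∈-map⁺ inj₁ (∈-allV (X · u)))) (∧-intro nz (inSp-· X u)) (∧-intro nz (inSp-complete Y u (eqXY u Zu)))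
    eqT : ∀ y → T Z · y ≡ 0v → T Y · y ≡ T X · y
    eqT y e = trans (cong (_· y) (T-⊕ X Z)) (trans (⊕-· (T X) (T Z) y) (trans (cong (T X · y ⊕v_) e) (⊕-idʳ _)))
    col : ∀ y → T Z · y ≡ 0v → Vec.map (dot y) X ≡ 0v
    col y e = trans (sym (T-· X y)) (isz (T X · y) λ nz → generic-sound shared (dirs n d) {c = inj₂ (T X · y)} gen
      (∈-++⁺ʳ (map inj₁ (allV n)) (∈-map⁺ inj₂ (∈-allV (T X · y)))) (∧-intro nz (inSp-· (T X) y)) (∧-intro nz (inSp-complete (T Y) y (eqT y e))))
    cols : ∀ {d'} (X : M n d') → (∀ y → T Z · y ≡ 0v → Vec.map (dot y) X ≡ 0v) → Cols S X
    cols [] h = []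
    cols (x ∷ X) h = S-intro x (λ y e → VP.∷-injectiveˡ (h y e)) ∷ cols X (λ y e → VP.∷-injectiveʳ (h y e))

cauchy-schwarz₂ : {A B : Set} (xs : List A) (ys : List B) (f g : A → B → ℚ) → let S = ∑[ x ∈ xs ] ∑[ y ∈ ys ] (f x y * g x y) in
  S * S ≤ (∑[ x ∈ xs ] ∑[ y ∈ ys ] (f x y * f x y)) * (∑[ x ∈ xs ] ∑[ y ∈ ys ] (g x y * g x y))
cauchy-schwarz₂ xs ys f g = ≤-trans (∑-CS xs 1ℚ _ _ _ 0≤1 (λ x → ∑-≥0 ys λ y → sq≥0 (f x y)) (λ x → ∑-≥0 ys λ y → sq≥0 (g x y))
  λ x → ≤-trans (cauchy-schwarz ys (f x) (g x)) (≤≡ (sym (QP.*-identityˡ _)))) (≤≡ (QP.*-identityˡ _))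

bool-cases : {X : Set} (b : Bool) → (b ≡ true → X) → (b ≡ false → X) → X
bool-cases true f g = f refl
bool-cases false f g = g refl

-- `G` is the part of the form over generic pairs, which share no nonzero vector of their column or
-- row spaces. Cauchy-Schwarz over these pairs and `generic-count` bound it by the norm of `φ`. The
-- rest `F - G` is expanded over shared directions, and each term falls under `OP-dir`, that is,
-- under the case `R` for a restriction of `φ`.
op : ∀ R → OP R
op zero {n} {d} φ c c≥0 b α β sα sβ = ≤-trans (≤≡ (cong (λ z → z * z) zero'))
    (≤≡ (sym (lem c (norm² α * norm² β))))
  where
  lem : ∀ c a → 0ℚ * c * a ≡ 0ℚ * 0ℚ
  lem = solve-∀ ℚring
  lem₂ : ∀ p a → p * (0ℚ * a) ≡ 0ℚ
  lem₂ = solve-∀ ℚring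
  zero' : BilM φ α β ≡ 0ℚ
  zero' = ∑-0 (allM n d) λ X → ∑-0 (allM n d) λ Y → trans (cong (λ z → φ (X ⊕ Y) * (z * β Y)) (sα X ℕ.z≤n)) (lem₂ (φ (X ⊕ Y)) (β Y))
op (suc R) {n} {d} φ c c≥0 (bφ , rowB , colB) α β sα sβ =
  ≤-trans (≤-trans (≤≡ (r₁ F G)) (diff≤ _ (sq≥0 (F - G - G)) (r₂ (F - G) G)))
    (≤-trans (*-monoˡ two 0≤two (QP.+-mono-≤ E-bound G-bound)) (≤≡ (r₃ (OPc R) c (pw D) (norm² α) (norm² β) (genC R))))
  where
  𝕄 = allM n d
  b : M n d → M n d → ℚ
  b X Y = φ (X ⊕ Y)
  F = BilM φ α β
  G = gform 𝕄 b shared (dirs n d) α β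
  D = dirC R
  K = OPc R * c
  K≥0 : 0ℚ ≤ K
  K≥0 = *-≥0 (OPc≥0 R) c≥0
  r₁ : ∀ f g → f * f ≡ (f - g + g) * (f - g + g)
  r₁ = solve-∀ ℚring
  r₂ : ∀ a g → two * (a * a + g * g) ≡ (a + g) * (a + g) + (a - g) * (a - g)
  r₂ = solve-∀ ℚring
  r₃ : ∀ o c p a e g → two * (o * c * (p * a * (p * e)) + g * c * (a * e)) ≡ two * (g + o * (p * p)) * c * (a * e)
  r₃ = solve-∀ ℚring
  low : ∀ (e : Dir n d) {γ : M n d → ℚ} → Supp (suc R) γ → Supp (suc R) (cut shared e γ)
  low e sγ X p = trans (cong (⟦ shared e X ⟧ *_) (sγ X p)) (QP.*-zeroʳ ⟦ shared e X ⟧)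
  off : ∀ e (γ : M n d → ℚ) X → shared e X ≡ false → cut shared e γ X ≡ 0ℚ
  off e γ X p = trans (cong (λ z → ⟦ z ⟧ * γ X) p) (QP.*-zeroˡ (γ X))
  N : (M n d → ℚ) → ℚ
  N = norm²
  trivial : ∀ e → (∀ X → shared e X ≡ false) → ∀ α β → BilM φ (cut shared e α) (cut shared e β) * BilM φ (cut shared e α) (cut shared e β) ≤ K * (N (cut shared e α) * N (cut shared e β))
  trivial e p α β = ≤-trans (≤≡ (cong (λ z → z * z) (∑-0 𝕄 λ X → ∑-0 𝕄 λ Y → trans (cong (λ z → φ (X ⊕ Y) * (z * cut shared e β Y)) (off e α X (p X))) (lem (φ (X ⊕ Y)) (cut shared e β Y)))))
    (*-≥0 K≥0 (*-≥0 (Char.norm≥0 (MC n d) (cut shared e α)) (Char.norm≥0 (MC n d) (cut shared e β))))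
    where
    lem : ∀ p a → p * (0ℚ * a) ≡ 0ℚ
    lem = solve-∀ ℚring
  hyp : ∀ e α β → Supp (suc R) α → Supp (suc R) β → BilM φ (cut shared e α) (cut shared e β) * BilM φ (cut shared e α) (cut shared e β) ≤ K * (N (cut shared e α) * N (cut shared e β))
  hyp (inj₁ a) α β sα sβ = bool-cases (a ==v 0v) (λ z → trivial (inj₁ a) (λ X → cong (λ t → not t ∧ inSp X a) z) α β) λ z →
      OP-dir R (op R) φ c c≥0 rowB a (λ e → false≢true z (eq-complete (VE n) e)) (cut shared (inj₁ a) α) (cut shared (inj₁ a) β)
      (low (inj₁ a) sα) (low (inj₁ a) sβ) (λ X p → off (inj₁ a) α X (nsh X p)) (λ X p → off (inj₁ a) β X (nsh X p))
    where
    nsh : ∀ X → inSp X a ≡ false → shared (inj₁ a) X ≡ false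
    nsh X p = trans (cong (not (a ==v 0v) ∧_) p) (BP.∧-zeroʳ _)
  hyp (inj₂ u) α β sα sβ = bool-cases (u ==v 0v) (λ z → trivial (inj₂ u) (λ X → cong (λ t → not t ∧ inSp (T X) u) z) α β) λ z →
      subst₂ (λ p q → p * p ≤ K * q)
      (Bil-bij (MC d n) (MC n d) T T TT TT T-⊕ φ (cut shared (inj₂ u) α) (cut shared (inj₂ u) β))
      (cong₂ _*_ (norm-T (cut shared (inj₂ u) α)) (norm-T (cut shared (inj₂ u) β)))
      (OP-dir R (op R) (φ ∘ T) c c≥0 colB u (λ e → false≢true z (eq-complete (VE d) e)) (cut shared (inj₂ u) α ∘ T) (cut shared (inj₂ u) β ∘ T)
        (sT α sα) (sT β sβ) (λ X p → off (inj₂ u) α (T X) (nsh X p)) (λ X p → off (inj₂ u) β (T X) (nsh X p)))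
    where
    nsh : ∀ X → inSp X u ≡ false → shared (inj₂ u) (T X) ≡ false
    nsh X p = trans (cong (not (u ==v 0v) ∧_) (trans (cong (λ t → inSp t u) (TT X)) p)) (BP.∧-zeroʳ _)
    sT : ∀ γ → Supp (suc R) γ → Supp (suc R) (cut shared (inj₂ u) γ ∘ T)
    sT γ sγ X p = low (inj₂ u) sγ (T X) (subst (suc R ℕ.≤_) (sym (rk-T X)) p)
  wtα : ∀ γ → Supp (suc R) γ → ∑[ X ∈ 𝕄 ] (wt shared (dirs n d) X * (γ X * γ X)) ≤ pw D * N γ
  wtα γ sγ = ≤-trans (∑-mono 𝕄 ptw) (≤≡ (∑-*ˡ 𝕄 (pw D) _))
    where
    ptw : ∀ X → wt shared (dirs n d) X * (γ X * γ X) ≤ pw D * (γ X * γ X)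
    ptw X with rk X ℕ.≤? R
    ... | yes p = *-monoʳ (γ X * γ X) (sq≥0 (γ X)) (wt-bound shared (dirs n d) X D (≤-trans (dirs-count X)
           (≤-trans (QP.+-mono-≤ (pw-mono p) (pw-mono p)) (≤≡ (sym (trans (ι-+ (2 ℕ.^ R) (2 ℕ.^ R)) (cong₂ _+_ (ι-2^ R) (ι-2^ R))))))))
    ... | no p = ≤≡ (trans (cong (wt shared (dirs n d) X *_) z) (trans (trans (QP.*-zeroʳ (wt shared (dirs n d) X)) (sym (QP.*-zeroʳ (pw D)))) (cong (pw D *_) (sym z))))
      where
      z : γ X * γ X ≡ 0ℚ
      z = cong (λ t → t * t) (sγ X (NP.≰⇒> p))
  wt0 : ∀ γ → 0ℚ ≤ ∑[ X ∈ 𝕄 ] (wt shared (dirs n d) X * (γ X * γ X))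
  wt0 γ = ∑-≥0 𝕄 λ X → *-≥0 (wt≥0 shared (dirs n d) X) (sq≥0 (γ X))
  E-bound : (F - G) * (F - G) ≤ K * (pw D * N α * (pw D * N β))
  E-bound = ≤-trans (form-gform 𝕄 b shared (Supp (suc R)) (λ e {γ} → low e {γ}) K K≥0 hyp (dirs n d) α β sα sβ)
    (*-monoˡ K K≥0 (*-mono (wt0 α) (wt0 β) (wtα α sα) (wtα β sβ)))
  lowᵇ : M n d → M n d → Bool
  lowᵇ X Y = (rk X ℕ.≤ᵇ R) ∧ (rk Y ℕ.≤ᵇ R)
  g : M n d → M n d → Bool
  g X Y = generic shared (dirs n d) X Y ∧ lowᵇ X Y
  Geq : G ≡ ∑[ X ∈ 𝕄 ] ∑[ Y ∈ 𝕄 ] (⟦ g X Y ⟧ * φ (X ⊕ Y) * (α X * β Y))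
  Geq = ∑-cong 𝕄 λ X → ∑-cong 𝕄 λ Y → ptw X Y
    where
    ptw : ∀ X Y → ⟦ generic shared (dirs n d) X Y ⟧ * (φ (X ⊕ Y) * (α X * β Y)) ≡ ⟦ g X Y ⟧ * φ (X ⊕ Y) * (α X * β Y)
    ptw X Y with rk X ℕ.≤ᵇ R in p | rk Y ℕ.≤ᵇ R in q
    ... | true | true = trans (sym (QP.*-assoc ⟦ generic shared (dirs n d) X Y ⟧ (φ (X ⊕ Y)) (α X * β Y))) (cong (λ z → ⟦ z ⟧ * φ (X ⊕ Y) * (α X * β Y)) (sym (BP.∧-identityʳ (generic shared (dirs n d) X Y))))
    ... | false | _ = trans (cong (λ z → ⟦ gg ⟧ * (φ (X ⊕ Y) * (z * β Y))) z) (sym (trans (cong (λ z → ⟦ gg ∧ false ⟧ * φ (X ⊕ Y) * (z * β Y)) z) (lem ⟦ gg ∧ false ⟧ ⟦ gg ⟧ (φ (X ⊕ Y)) (β Y))))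
      where
      gg = generic shared (dirs n d) X Y
      z : α X ≡ 0ℚ
      z = sα X (NP.≰⇒> λ r → false≢true p (≤ᵇ-complete r))
      lem : ∀ a e p q → a * p * (0ℚ * q) ≡ e * (p * (0ℚ * q))
      lem = solve-∀ ℚring
    ... | true | false = trans (cong (λ z → ⟦ gg ⟧ * (φ (X ⊕ Y) * (α X * z))) z) (sym (trans (cong (λ z → ⟦ gg ∧ false ⟧ * φ (X ⊕ Y) * (α X * z)) z) (lem ⟦ gg ∧ false ⟧ ⟦ gg ⟧ (φ (X ⊕ Y)) (α X))))
      where
      gg = generic shared (dirs n d) X Y
      z : β Y ≡ 0ℚ
      z = sβ Y (NP.≰⇒> λ r → false≢true q (≤ᵇ-complete r))
      lem : ∀ a e p q → a * p * (q * 0ℚ) ≡ e * (p * (q * 0ℚ))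
      lem = solve-∀ ℚring
  ∑φ : ∑[ X ∈ 𝕄 ] ∑[ Y ∈ 𝕄 ] (⟦ g X Y ⟧ * φ (X ⊕ Y) * (⟦ g X Y ⟧ * φ (X ⊕ Y))) ≤ genC R * N φ
  ∑φ = ≤-trans (≤≡ (trans (∑-cong 𝕄 λ X → trans (∑-cong 𝕄 λ Y → trans (lem ⟦ g X Y ⟧ (φ (X ⊕ Y))) (trans (cong (_* (φ (X ⊕ Y) * φ (X ⊕ Y))) (⟦⟧*⟦⟧ (g X Y)))
                (cong (λ z → ⟦ g X z ⟧ * (φ (X ⊕ Y) * φ (X ⊕ Y))) (sym (⊕M-cancel X Y)))))
              (∑-shiftM X (λ Z → ⟦ g X (X ⊕ Z) ⟧ * (φ Z * φ Z)))) (∑-swap 𝕄 𝕄 _)))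
      (≤-trans (∑-mono 𝕄 λ Z → ≤-trans (≤≡ (∑-*ʳ 𝕄 (φ Z * φ Z) (λ X → ⟦ g X (X ⊕ Z) ⟧))) (*-monoʳ (φ Z * φ Z) (sq≥0 (φ Z)) (generic-count R Z))) (≤≡ (∑-*ˡ 𝕄 (genC R) _)))
    where
    lem : ∀ a p → a * p * (a * p) ≡ a * a * (p * p)
    lem = solve-∀ ℚring
  ∑αβ : ∑[ X ∈ 𝕄 ] ∑[ Y ∈ 𝕄 ] (α X * β Y * (α X * β Y)) ≡ N α * N β
  ∑αβ = trans (∑-cong 𝕄 λ X → ∑-cong 𝕄 λ Y → *-interchange (α X) (β Y) (α X) (β Y)) (sym (∑-prod 𝕄 𝕄 _ _))
  Nαβ≥0 : 0ℚ ≤ N α * N β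
  Nαβ≥0 = *-≥0 (Char.norm≥0 (MC n d) α) (Char.norm≥0 (MC n d) β)
  G-bound : G * G ≤ genC R * c * (N α * N β)
  G-bound = ≤-trans (≤≡ (cong (λ z → z * z) Geq)) (≤-trans (cauchy-schwarz₂ 𝕄 𝕄 (λ X Y → ⟦ g X Y ⟧ * φ (X ⊕ Y)) (λ X Y → α X * β Y))
    (≤-trans (≤≡ (cong ((∑[ X ∈ 𝕄 ] ∑[ Y ∈ 𝕄 ] (⟦ g X Y ⟧ * φ (X ⊕ Y) * (⟦ g X Y ⟧ * φ (X ⊕ Y)))) *_) ∑αβ)) (*-monoʳ (N α * N β) Nαβ≥0 (≤-trans ∑φ (*-monoˡ (genC R) (genC≥0 R) bφ)))))

-- Global functions and the level inequality

RowB-map : ∀ R {n d} {φ ψ : M n d → ℚ} {c c' : ℚ} →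
  (∀ {n d} {φ' ψ' : M n (suc d) → ℚ} m → (∀ X → φ' X ≡ ψ' X) → Bnd R (Res m φ') c → Bnd R (Res m ψ') c') →
  (∀ X → φ X ≡ ψ X) → RowB R n φ c → RowB R n ψ c'
RowB-map R {zero} k e rb = tt
RowB-map R {suc n} k e rb f w m fw = k m (λ X → e (mv f w X)) (rb f w m fw)

Bnd-cong : ∀ R {φ ψ : M n d → ℚ} {c} → (∀ X → φ X ≡ ψ X) → Bnd R φ c → Bnd R ψ c
Bnd-cong {n} {d} zero e b = ≤-trans (≤≡ (Char.norm-cong (MC n d) (λ X → sym (e X)))) b
Bnd-cong {n} {d} (suc R) {φ} {ψ} e (b , r , c) =
  ≤-trans (≤≡ (Char.norm-cong (MC n d) (λ X → sym (e X)))) b ,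
  RowB-map R {φ = φ} {ψ} step e r , RowB-map R {φ = φ ∘ T} {ψ ∘ T} step (λ X → e (T X)) c
  where
  step : ∀ {n d c} {φ' ψ' : M n (suc d) → ℚ} m → (∀ X → φ' X ≡ ψ' X) → Bnd R (Res m φ') c → Bnd R (Res m ψ') c
  step {n} m e' = Bnd-cong R λ X → ∑-cong (allV n) λ x → cong (σ (dot x m) *_) (e' (x ∷ X))

Bnd-mono : ∀ R {φ : M n d → ℚ} {c c'} → c ≤ c' → Bnd R φ c → Bnd R φ c'
Bnd-mono zero p b = ≤-trans b p
Bnd-mono {n} {d} (suc R) {φ} p (b , r , c) = ≤-trans b p , row n φ r , row d (φ ∘ T) c
  where
  row : ∀ n {d} (φ : M n d → ℚ) → RowB R n φ _ → RowB R n φ _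
  row zero φ rb = tt
  row (suc n) φ rb f w m fw = Bnd-mono R p (rb f w m fw)

lin : {I : Set} → List I → (I → ℚ) → (I → M n d → ℚ) → M n d → ℚ
lin xs ω φ X = ∑[ i ∈ xs ] (ω i * φ i X)

Res-lin : {I : Set} (xs : List I) (ω : I → ℚ) (φ : I → M n (suc d) → ℚ) (m : V n) (X : M n d) →
  lin xs ω (λ i → Res m (φ i)) X ≡ Res m (lin xs ω φ) X
Res-lin {n} xs ω φ m X = begin
  ∑[ i ∈ xs ] (ω i * ∑[ x ∈ allV n ] (σ (dot x m) * φ i (x ∷ X)))
    ≡⟨ ∑-cong xs (λ i → trans (sym (∑-*ˡ (allV n) (ω i) _)) (∑-cong (allV n) λ x → *-swap (ω i) (σ (dot x m)) (φ i (x ∷ X)))) ⟩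
  ∑[ i ∈ xs ] ∑[ x ∈ allV n ] (σ (dot x m) * (ω i * φ i (x ∷ X)))
    ≡⟨ ∑-swap xs (allV n) _ ⟩
  ∑[ x ∈ allV n ] ∑[ i ∈ xs ] (σ (dot x m) * (ω i * φ i (x ∷ X)))
    ≡⟨ ∑-cong (allV n) (λ x → ∑-*ˡ xs (σ (dot x m)) _) ⟩
  Res m (lin xs ω φ) X ∎
  where open ≡-Reasoning

norm-lin : {I : Set} (xs : List I) (ω : I → ℚ) (φ : I → M n d → ℚ) (c : I → ℚ) → (∀ i → norm² (φ i) ≤ c i) →
  norm² (lin xs ω φ) ≤ ∑[ i ∈ xs ] (ω i * ω i) * ∑ xs c
norm-lin {n} {d} xs ω φ c h =
  ≤-trans (∑-mono (allM n d) λ X → cauchy-schwarz xs ω (λ i → φ i X))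
  (≤-trans (≤≡ (trans (∑-*ˡ (allM n d) (∑[ i ∈ xs ] (ω i * ω i)) (λ X → ∑[ i ∈ xs ] (φ i X * φ i X))) (cong (∑[ i ∈ xs ] (ω i * ω i) *_) (∑-swap (allM n d) xs _))))
    (*-monoˡ _ (∑-≥0 xs λ i → sq≥0 (ω i)) (∑-mono xs h)))

-- Cauchy-Schwarz over the index; it passes through all restrictions because `Res` is linear.
Bnd-lin : {I : Set} → ∀ R (xs : List I) (ω : I → ℚ) (φ : I → M n d → ℚ) (c : I → ℚ) → (∀ i → Bnd R (φ i) (c i)) →
  Bnd R (lin xs ω φ) (∑[ i ∈ xs ] (ω i * ω i) * ∑ xs c)
Bnd-lin zero xs ω φ c h = norm-lin xs ω φ c h
Bnd-lin {n} {d} {I} (suc R) xs ω φ c h = norm-lin xs ω φ c (λ i → proj₁ (h i)) , row n φ (λ i → proj₁ (proj₂ (h i))) , row d (λ i → φ i ∘ T) (λ i → proj₂ (proj₂ (h i)))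
  where
  row : ∀ n {d} (φ : I → M n d → ℚ) → (∀ i → RowB R n (φ i) (c i)) → RowB R n (lin xs ω φ) (∑[ i ∈ xs ] (ω i * ω i) * ∑ xs c)
  row zero φ h = tt
  row (suc n) φ h f w m fw = Bnd-cong R (Res-lin xs ω (λ i → φ i ∘ mv f w) m) (Bnd-lin R xs ω (λ i → Res m (φ i ∘ mv f w)) c λ i → h i f w m fw)

Bnd-+ : ∀ R {φ ψ : M n d → ℚ} {a b} → Bnd R φ a → Bnd R ψ b → Bnd R (λ X → φ X + ψ X) (two * (a + b))
Bnd-+ R {φ} {ψ} {a} {b} p q = Bnd-mono R (≤≡ (lem₂ a b)) (Bnd-cong R (λ X → lem (φ X) (ψ X))
  (Bnd-lin R (true ∷ false ∷ []) (λ _ → 1ℚ) (λ t → if t then φ else ψ) (λ t → if t then a else b) λ { true → p ; false → q }))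
  where
  lem : ∀ x y → 1ℚ * x + (1ℚ * y + 0ℚ) ≡ x + y
  lem = solve-∀ ℚring
  lem₂ : ∀ a b → (1ℚ * 1ℚ + (1ℚ * 1ℚ + 0ℚ)) * (a + (b + 0ℚ)) ≡ two * (a + b)
  lem₂ = solve-∀ ℚring

∑-const : ∀ d (c : ℚ) → ∑[ x ∈ allV d ] c ≡ pw d * c
∑-const zero c = trans (QP.+-identityʳ c) (sym (QP.*-identityˡ c))
∑-const (suc d) c = trans (∑-allV {d} (λ _ → c)) (trans (cong₂ _+_ (∑-const d c) (∑-const d c)) (lem (pw d) c))
  where
  lem : ∀ p c → p * c + p * c ≡ two * p * c
  lem = solve-∀ ℚring

-- The cost is `s²`, whatever the number `2^k` of functions averaged. This matters because in
-- `Res-P` the exponent `k` is the number of columns.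
Bnd-avg : ∀ R k (s : ℚ) (φ : V k → M n d → ℚ) (c : ℚ) → (∀ i → Bnd R (φ i) c) → Bnd R (lin (allV k) (λ _ → s * hp k) φ) (s * s * c)
Bnd-avg R k s φ c h = Bnd-mono R (≤≡ (trans (cong₂ _*_ (∑-const k (s * hp k * (s * hp k))) (∑-const k c))
    (trans (lem (pw k) s (hp k) c) (trans (cong (λ z → z * z * (s * s * c)) (pw*hp k)) (lem₂ (s * s * c))))))
  (Bnd-lin R (allV k) (λ _ → s * hp k) φ (λ _ → c) h)
  where
  lem : ∀ p s h c → p * (s * h * (s * h)) * (p * c) ≡ p * h * (p * h) * (s * s * c)
  lem = solve-∀ ℚring
  lem₂ : ∀ a → 1ℚ * 1ℚ * a ≡ a
  lem₂ = solve-∀ ℚring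

P : ℕ → (M n d → ℚ) → M n d → ℚ
P j φ X = ⟦ rk X ℕ.<ᵇ j ⟧ * φ X

<ᵇ-complete : ∀ {a b} → a ℕ.< b → (a ℕ.<ᵇ b) ≡ true
<ᵇ-complete {a} {b} p with a ℕ.<ᵇ b | NP.<⇒<ᵇ p
... | true | _ = refl

<ᵇ-false : ∀ {a b} → b ℕ.≤ a → (a ℕ.<ᵇ b) ≡ false
<ᵇ-false {a} {b} p with a ℕ.<ᵇ b in e
... | false = refl
... | true = ⊥-elim (NP.<⇒≱ (NP.<ᵇ⇒< a b (subst Data.Bool.T (sym e) tt)) p)

Supp-P : ∀ j (φ : M n d → ℚ) → Supp j (P j φ)
Supp-P j φ X p = trans (cong (λ z → ⟦ z ⟧ * φ X) (<ᵇ-false p)) (QP.*-zeroˡ (φ X))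

sh : V n → V d → (M n (suc d) → ℚ) → M n d → ℚ
sh m l φ X = σ (dot (X · l) m) * φ (X · l ∷ X)

-- For rk X = j the vectors x in the span of X are equidistributed as X · l, which turns the sum over them into an average of shears.
Res-P : ∀ j (m : V n) (φ : M n (suc d) → ℚ) (X : M n d) →
  Res m (P (suc j) φ) X ≡ P j (Res m φ) X + (lin (allV d) (λ _ → pw j * hp d) (λ l → P (suc j) (sh m l φ)) X + lin (allV d) (λ _ → - pw j * hp d) (λ l → P j (sh m l φ)) X)
Res-P {n} {d} j m φ X = trans (by (NP.<-cmp (rk X) j)) (sym (cong (P j (Res m φ) X +_) (combine)))
  where
  open import Relation.Binary.Definitions using (tri<; tri≈; tri>; Tri)
  open ≡-Reasoning
  h : V n → ℚ
  h x = σ (dot x m) * φ (x ∷ X)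
  A = ⟦ rk X ℕ.<ᵇ suc j ⟧
  B = ⟦ rk X ℕ.<ᵇ j ⟧
  L = ∑[ l ∈ allV d ] h (X · l)
  combine : lin (allV d) (λ _ → pw j * hp d) (λ l → P (suc j) (sh m l φ)) X + lin (allV d) (λ _ → - pw j * hp d) (λ l → P j (sh m l φ)) X ≡ (A - B) * (pw j * hp d * L)
  combine = trans (cong₂ _+_ (part (pw j * hp d) A) (part (- pw j * hp d) B)) (lem (pw j) (hp d) A B L)
    where
    lem : ∀ p e a b l → p * e * (a * l) + - p * e * (b * l) ≡ (a - b) * (p * e * l)
    lem = solve-∀ ℚring
    part : ∀ s a → ∑[ l ∈ allV d ] (s * (a * sh m l φ X)) ≡ s * (a * L)
    part s a = trans (∑-*ˡ (allV d) s _) (cong (s *_) (∑-*ˡ (allV d) a _))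
  term : ∀ x (t : ℚ) → ⟦ rk (x ∷ X) ℕ.<ᵇ suc j ⟧ ≡ t → σ (dot x m) * P (suc j) φ (x ∷ X) ≡ t * h x
  term x t e = trans (cong (λ z → σ (dot x m) * (z * φ (x ∷ X))) e) (*-swap (σ (dot x m)) t (φ (x ∷ X)))
  rk≤ : ∀ x → rk (x ∷ X) ℕ.≤ suc (rk X)
  rk≤ x with inSp X x
  ... | true = NP.n≤1+n _
  ... | false = NP.≤-refl
  rk≥ : ∀ x → rk X ℕ.≤ rk (x ∷ X)
  rk≥ x with inSp X x
  ... | true = NP.≤-refl
  ... | false = NP.n≤1+n _
  -- A further column raises the rank by at most one. So truncation below `suc j` keeps every `x` if
  -- the rank of `X` is below `j` and none if it is above; only for rank exactly `j` does it single
  -- out the `x` in the span.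
  by : Tri (rk X ℕ.< j) (rk X ≡ j) (rk X ℕ.> j) → Res m (P (suc j) φ) X ≡ P j (Res m φ) X + (A - B) * (pw j * hp d * L)
  by (tri< lt _ _) = begin
    Res m (P (suc j) φ) X
      ≡⟨ ∑-cong (allV n) (λ x → trans (term x 1ℚ (cong ⟦_⟧ (<ᵇ-complete (ℕ.s≤s (NP.≤-trans (rk≤ x) lt))))) (QP.*-identityˡ (h x))) ⟩
    Res m φ X
      ≡⟨ lem (Res m φ X) (pw j * hp d * L) ⟩
    1ℚ * Res m φ X + (1ℚ - 1ℚ) * (pw j * hp d * L)
      ≡⟨ sym (cong₂ (λ a b → ⟦ b ⟧ * Res m φ X + (⟦ a ⟧ - ⟦ b ⟧) * (pw j * hp d * L)) (<ᵇ-complete (NP.≤-trans lt (NP.n≤1+n j))) (<ᵇ-complete lt)) ⟩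
    P j (Res m φ) X + (A - B) * (pw j * hp d * L) ∎
    where
    lem : ∀ r z → r ≡ 1ℚ * r + (1ℚ - 1ℚ) * z
    lem = solve-∀ ℚring
  by (tri≈ _ eq _) = begin
    Res m (P (suc j) φ) X
      ≡⟨ ∑-cong (allV n) (λ x → term x ⟦ inSp X x ⟧ (cong ⟦_⟧ (case' x))) ⟩
    ∑[ x ∈ allV n ] (⟦ inSp X x ⟧ * h x)
      ≡⟨ lem (∑[ x ∈ allV n ] (⟦ inSp X x ⟧ * h x)) (hp d) (pw d) (hp*pw d) ⟩
    hp d * (pw d * ∑[ x ∈ allV n ] (⟦ inSp X x ⟧ * h x))
      ≡⟨ cong (hp d *_) (sym (∑-fib X h)) ⟩
    hp d * (pw (rk X) * L)
      ≡⟨ trans (cong (λ z → hp d * (pw z * L)) eq) (lem₂ (hp d) (pw j) L (Res m φ X)) ⟩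
    0ℚ * Res m φ X + (1ℚ - 0ℚ) * (pw j * hp d * L)
      ≡⟨ sym (cong₂ (λ a b → ⟦ b ⟧ * Res m φ X + (⟦ a ⟧ - ⟦ b ⟧) * (pw j * hp d * L)) (<ᵇ-complete (ℕ.s≤s (NP.≤-reflexive eq))) (<ᵇ-false (NP.≤-reflexive (sym eq)))) ⟩
    P j (Res m φ) X + (A - B) * (pw j * hp d * L) ∎
    where
    lem : ∀ s h p → h * p ≡ 1ℚ → s ≡ h * (p * s)
    lem s h p e = trans (sym (QP.*-identityˡ s)) (trans (cong (_* s) (sym e)) (QP.*-assoc h p s))
    lem₂ : ∀ h p l r → h * (p * l) ≡ 0ℚ * r + (1ℚ - 0ℚ) * (p * h * l)
    lem₂ = solve-∀ ℚring
    case' : ∀ x → (rk (x ∷ X) ℕ.<ᵇ suc j) ≡ inSp X x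
    case' x with inSp X x
    ... | true = <ᵇ-complete (ℕ.s≤s (NP.≤-reflexive eq))
    ... | false = <ᵇ-false {suc (rk X)} {suc j} (ℕ.s≤s (NP.≤-reflexive (sym eq)))
  by (tri> _ _ gt) = begin
    Res m (P (suc j) φ) X
      ≡⟨ ∑-0 (allV n) (λ x → trans (term x 0ℚ (cong ⟦_⟧ (<ᵇ-false (NP.≤-trans gt (rk≥ x))))) (QP.*-zeroˡ (h x))) ⟩
    0ℚ
      ≡⟨ lem (Res m φ X) (pw j * hp d * L) ⟩
    0ℚ * Res m φ X + (0ℚ - 0ℚ) * (pw j * hp d * L)
      ≡⟨ sym (cong₂ (λ a b → ⟦ b ⟧ * Res m φ X + (⟦ a ⟧ - ⟦ b ⟧) * (pw j * hp d * L)) (<ᵇ-false gt) (<ᵇ-false (NP.≤-trans (NP.n≤1+n j) gt))) ⟩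
    P j (Res m φ) X + (A - B) * (pw j * hp d * L) ∎
    where
    lem : ∀ r z → 0ℚ ≡ 0ℚ * r + (0ℚ - 0ℚ) * z
    lem = solve-∀ ℚring

-- Fourier coefficients, shears and zooms

val : (M n d → ℚ) → M n d → ℚ
val {n} {d} = Char.ft (MC n d)

hat : (M n d → ℚ) → M n d → ℚ
hat {n} {d} g X = hp (d ℕ.* n) * val g X

dotM-T : (X Y : M n d) → dotM (T X) (T Y) ≡ dotM X Y
dotM-T {n} [] [] = go n
  where
  go : ∀ n → dotM (replicate n []) (replicate n []) ≡ false
  go zero = refl
  go (suc n) = go n
dotM-T (x ∷ X) (y ∷ Y) = trans (lem x y (T X) (T Y)) (cong (dot x y xor_) (dotM-T X Y))
  where
  lem : ∀ {n d} (x y : V n) (P Q : M d n) → dotM (zipWith _∷_ x P) (zipWith _∷_ y Q) ≡ dot x y xor dotM P Q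
  lem [] [] [] [] = refl
  lem (a ∷ x) (b ∷ y) (p ∷ P) (q ∷ Q) = trans (cong (((a ∧ b) xor dot p q) xor_) (lem x y P Q)) (xor-swap (a ∧ b) (dot p q) (dot x y) (dotM P Q))

dotM-mv : (f w : V n) → dot f w ≡ false → (N Y : M d n) → dotM (mv w f N) (mv f w Y) ≡ dotM N Y
dotM-mv f w fw N Y = trans (adj (T N) (Vec.map (tv f w) (T Y))) (trans (cong (dotM (T N)) (map-tv-inv f w fw (T Y))) (dotM-T N Y))
  where
  adj : ∀ {d} (A B : M _ d) → dotM (Vec.map (tv w f) A) B ≡ dotM A (Vec.map (tv f w) B)
  adj [] [] = refl
  adj (a ∷ A) (b ∷ B) = cong₂ _xor_ (tv-adj w f a b) (adj A B)

-- A coordinate change on the coefficients is the adjoint one on the function; for transvections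
-- this exchanges `f` and `w`.
hat-mv : (f w : V n) → dot f w ≡ false → (g : M n d → ℚ) (Y : M d n) → hat g (mv f w Y) ≡ hat (g ∘ mv w f) Y
hat-mv {n} {d} f w fw g Y = cong₂ _*_ (cong hp (NP.*-comm d n)) (trans
  (sym (∑-bij (ME d n) (ME n d) (mv w f) (mv⁻ w f) (mv⁻-mv w f wf) (mv-mv⁻ w f wf) (λ N → σ (dotM N (mv f w Y)) * g N)))
  (∑-cong (allM d n) λ N → cong (λ z → σ z * g (mv w f N)) (dotM-mv f w fw N Y)))
  where
  wf : dot w f ≡ false
  wf = trans (dot-comm w f) fw

hat-T : (g : M n d → ℚ) (Y : M d n) → hat g (T Y) ≡ hat (g ∘ T) Y
hat-T {n} {d} g Y = cong₂ _*_ (cong hp (NP.*-comm d n)) (trans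
  (sym (∑-bij (ME d n) (ME n d) T T TT TT (λ N → σ (dotM N (T Y)) * g N)))
  (∑-cong (allM d n) λ N → cong (λ z → σ z * g (T N)) (dotM-T N Y)))

val-cons : (g : M n (suc d) → ℚ) (x : V n) (X : M n d) → val g (x ∷ X) ≡ ∑[ N ∈ allM n d ] (σ (dotM N X) * Char.ft (VC n) (λ v → g (v ∷ N)) x)
val-cons {n} {d} g x X = begin
  val g (x ∷ X)
    ≡⟨ ∑-allM (λ N → σ (dotM N (x ∷ X)) * g N) ⟩
  ∑[ v ∈ allV n ] ∑[ N ∈ allM n d ] (σ (dot v x xor dotM N X) * g (v ∷ N))
    ≡⟨ ∑-swap (allV n) (allM n d) _ ⟩
  ∑[ N ∈ allM n d ] ∑[ v ∈ allV n ] (σ (dot v x xor dotM N X) * g (v ∷ N))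
    ≡⟨ ∑-cong (allM n d) (λ N → trans (∑-cong (allV n) λ v → trans (cong (_* g (v ∷ N)) (σ-xor (dot v x) (dotM N X))) (lem (σ (dot v x)) (σ (dotM N X)) (g (v ∷ N)))) (∑-*ˡ (allV n) (σ (dotM N X)) _)) ⟩
  ∑[ N ∈ allM n d ] (σ (dotM N X) * Char.ft (VC n) (λ v → g (v ∷ N)) x) ∎
  where
  open ≡-Reasoning
  lem : ∀ a b c → a * b * c ≡ b * (a * c)
  lem = solve-∀ ℚring

-- `Res` inverts the transform in the first column alone.
Res-hat : (m : V n) (g : M n (suc d) → ℚ) (X : M n d) → Res m (hat g) X ≡ hat (λ N → g (m ∷ N)) X
Res-hat {n} {d} m g X = begin
  ∑[ x ∈ allV n ] (σ (dot x m) * (hp (n ℕ.+ d ℕ.* n) * val g (x ∷ X)))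
    ≡⟨ trans (∑-cong (allV n) λ x → *-swap (σ (dot x m)) (hp (n ℕ.+ d ℕ.* n)) (val g (x ∷ X))) (∑-*ˡ (allV n) (hp (n ℕ.+ d ℕ.* n)) _) ⟩
  hp (n ℕ.+ d ℕ.* n) * ∑[ x ∈ allV n ] (σ (dot x m) * val g (x ∷ X))
    ≡⟨ cong (hp (n ℕ.+ d ℕ.* n) *_) (trans (∑-cong (allV n) λ x → trans (cong (σ (dot x m) *_) (val-cons g x X)) (trans (sym (∑-*ˡ (allM n d) (σ (dot x m)) _))
         (∑-cong (allM n d) λ N → *-swap (σ (dot x m)) (σ (dotM N X)) _))) (∑-swap (allV n) (allM n d) _)) ⟩
  hp (n ℕ.+ d ℕ.* n) * ∑[ N ∈ allM n d ] ∑[ x ∈ allV n ] (σ (dotM N X) * (σ (dot x m) * Char.ft (VC n) (λ v → g (v ∷ N)) x))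
    ≡⟨ cong (hp (n ℕ.+ d ℕ.* n) *_) (∑-cong (allM n d) λ N → trans (∑-*ˡ (allV n) (σ (dotM N X)) _) (cong (σ (dotM N X) *_)
         (trans (∑-cong (allV n) λ x → cong (λ z → σ z * Char.ft (VC n) (λ v → g (v ∷ N)) x) (dot-comm x m)) (Char.ft-inv (VC n) (λ v → g (v ∷ N)) m)))) ⟩
  hp (n ℕ.+ d ℕ.* n) * ∑[ N ∈ allM n d ] (σ (dotM N X) * (pw n * g (m ∷ N)))
    ≡⟨ cong₂ _*_ (hp-+ n (d ℕ.* n)) (trans (∑-cong (allM n d) λ N → *-swap (σ (dotM N X)) (pw n) (g (m ∷ N))) (∑-*ˡ (allM n d) (pw n) _)) ⟩
  hp n * hp (d ℕ.* n) * (pw n * val (λ N → g (m ∷ N)) X)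
    ≡⟨ trans (lem (hp n) (hp (d ℕ.* n)) (pw n) (val (λ N → g (m ∷ N)) X)) (trans (cong (_* (hp (d ℕ.* n) * val (λ N → g (m ∷ N)) X)) (hp*pw n)) (QP.*-identityˡ _)) ⟩
  hat (λ N → g (m ∷ N)) X ∎
  where
  open ≡-Reasoning
  lem : ∀ a b c e → a * b * (c * e) ≡ a * c * (b * e)
  lem = solve-∀ ℚring

outer : V n → V d → M n d
outer v l = Vec.map (λ c → sc c v) l

outer-· : (v : V n) (l u : V d) → outer v l · u ≡ sc (dot l u) v
outer-· v [] [] = refl
outer-· v (a ∷ l) (b ∷ u) = trans (cong₂ _⊕v_ (lem a b) (outer-· v l u)) (sym (sc-xor (a ∧ b) (dot l u) v))
  where
  lem : ∀ a b → sc b (sc a v) ≡ sc (a ∧ b) v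
  lem false false = refl
  lem false true = refl
  lem true false = refl
  lem true true = refl

map-dot-outer : (a v : V n) (l : V d) → Vec.map (dot a) (outer v l) ≡ sc (dot a v) l
map-dot-outer a v [] with dot a v
... | true = refl
... | false = refl
map-dot-outer a v (c ∷ l) = trans (cong₂ _∷_ (dot-sc a c v) (map-dot-outer a v l)) (lem (dot a v) c)
  where
  lem : ∀ t c → (c ∧ t) ∷ sc t l ≡ sc t (c ∷ l)
  lem false c = cong (_∷ 0v) (BP.∧-zeroʳ c)
  lem true c = cong (_∷ l) (BP.∧-identityʳ c)

dotM-outer : (v : V n) (l : V d) (X : M n d) → dotM (outer v l) X ≡ dot v (X · l)
dotM-outer v [] [] = sym (dot-0ʳ v)
dotM-outer v (c ∷ l) (x ∷ X) = sym (trans (dot-⊕ʳ v (sc c x) (X · l)) (cong₂ _xor_ (lem c) (sym (dotM-outer v l X))))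
  where
  lem : ∀ c → dot v (sc c x) ≡ dot (sc c v) x
  lem false = trans (dot-0ʳ v) (sym (dot-0ˡ x))
  lem true = refl

-- The dual of `sh`. Restricting coefficients to the subspace of matrices `X · l ∷ X` averages the
-- function over cosets of its annihilator, which consists of the matrices `v ∷ outer v l`; the
-- character given by `m` selects the coset. For `m = l = 0` the first column is averaged out.
shear : V n → V d → (M n (suc d) → ℚ) → M n d → ℚ
shear {n} m l g N = hp n * ∑[ v ∈ allV n ] g (v ∷ (outer (m ⊕v v) l ⊕ N))

sh-hat : (m : V n) (l : V d) (g : M n (suc d) → ℚ) (X : M n d) → sh m l (hat g) X ≡ hat (shear m l g) X
sh-hat {n} {d} m l g X = sym (begin
  hp (d ℕ.* n) * ∑[ N ∈ allM n d ] (σ (dotM N X) * (hp n * ∑[ v ∈ allV n ] g (v ∷ (O v ⊕ N))))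
    ≡⟨ cong (hp (d ℕ.* n) *_) (trans (∑-cong (allM n d) λ N → trans (*-swap (σ (dotM N X)) (hp n) _) (cong (hp n *_) (sym (∑-*ˡ (allV n) (σ (dotM N X)) _)))) (trans (∑-*ˡ (allM n d) (hp n) _) (cong (hp n *_) (∑-swap (allM n d) (allV n) _)))) ⟩
  hp (d ℕ.* n) * (hp n * ∑[ v ∈ allV n ] ∑[ N ∈ allM n d ] (σ (dotM N X) * g (v ∷ (O v ⊕ N))))
    ≡⟨ cong (λ z → hp (d ℕ.* n) * (hp n * z)) (∑-cong (allV n) λ v → trans (∑-cong (allM n d) λ N → cong (λ z → σ (dotM z X) * g (v ∷ (O v ⊕ N))) (sym (⊕M-cancel (O v) N)))
         (trans (∑-shiftM (O v) (λ N → σ (dotM (O v ⊕ N) X) * g (v ∷ N))) (∑-cong (allM n d) λ N → cong (_* g (v ∷ N)) (ch v N)))) ⟩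
  hp (d ℕ.* n) * (hp n * ∑[ v ∈ allV n ] ∑[ N ∈ allM n d ] (σ (dot xl m) * σ (dot v xl xor dotM N X) * g (v ∷ N)))
    ≡⟨ cong (λ z → hp (d ℕ.* n) * (hp n * z)) (trans (∑-cong (allV n) λ v → trans (∑-cong (allM n d) λ N → QP.*-assoc (σ (dot xl m)) (σ (dot v xl xor dotM N X)) (g (v ∷ N))) (∑-*ˡ (allM n d) (σ (dot xl m)) _)) (trans (∑-*ˡ (allV n) (σ (dot xl m)) _) (cong (σ (dot xl m) *_) (sym (∑-allM (λ N → σ (dotM N (xl ∷ X)) * g N)))))) ⟩
  hp (d ℕ.* n) * (hp n * (σ (dot xl m) * val g (xl ∷ X)))
    ≡⟨ trans (lem (hp (d ℕ.* n)) (hp n) (σ (dot xl m)) (val g (xl ∷ X))) (cong (λ z → σ (dot xl m) * (z * val g (xl ∷ X))) (sym (hp-+ n (d ℕ.* n)))) ⟩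
  sh m l (hat g) X ∎)
  where
  open ≡-Reasoning
  xl = X · l
  O : V n → M n d
  O v = outer (m ⊕v v) l
  lem : ∀ a b c e → a * (b * (c * e)) ≡ c * (b * a * e)
  lem = solve-∀ ℚring
  ch : ∀ v N → σ (dotM (O v ⊕ N) X) ≡ σ (dot xl m) * σ (dot v xl xor dotM N X)
  ch v N = trans (cong σ (trans (dotM-⊕ˡ (O v) N X) (trans (cong (_xor dotM N X) (trans (dotM-outer (m ⊕v v) l X) (trans (dot-⊕ˡ m v xl) (cong (_xor dot v xl) (dot-comm m xl))))) (BP.xor-assoc (dot xl m) (dot v xl) (dotM N X))))) (σ-xor (dot xl m) _)

data Con (n d : ℕ) : Set where
  col : V d → V n → Con n d
  row : V n → V d → Con n d

sat : M n d → Con n d → Bool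
sat N (col u m) = N · u ==v m
sat N (row a e) = Vec.map (dot a) N ==v e

sats : M n d → List (Con n d) → Bool
sats N [] = true
sats N (c ∷ cs) = sat N c ∧ sats N cs

-- Every zoom by at most b conditions has density at most 2^(-h).
Zoom : ℕ → ℕ → (M n d → ℚ) → Set
Zoom {n} {d} b h g = ∀ cs → length cs ℕ.≤ b → pw h * ∑[ N ∈ allM n d ] (⟦ sats N cs ⟧ * g N) ≤ ∑[ N ∈ allM n d ] ⟦ sats N cs ⟧

record Glob (b h : ℕ) {n d : ℕ} (g : M n d → ℚ) : Set where
  constructor glob
  field
    g≥0 : ∀ N → 0ℚ ≤ g N
    g≤1 : ∀ N → g N ≤ 1ℚ
    zoom : Zoom b h g

open Glob

Glob-cong : ∀ {b h} {g g' : M n d → ℚ} → (∀ X → g X ≡ g' X) → Glob b h g → Glob b h g'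
Glob-cong {n} {d} {h = h} e (glob p q z) = glob (λ N → subst (0ℚ ≤_) (e N) (p N)) (λ N → subst (_≤ 1ℚ) (e N) (q N))
  λ cs l → ≤-trans (≤≡ (cong (pw h *_) (∑-cong (allM n d) λ N → cong (⟦ sats N cs ⟧ *_) (sym (e N))))) (z cs l)

Glob-pred : ∀ {b h} {g : M n d → ℚ} → Glob (suc b) h g → Glob b h g
Glob-pred (glob p q z) = glob p q λ cs l → z cs (NP.m≤n⇒m≤1+n l)

==v-∷ : ∀ a b (x y : V n) → ((a ∷ x) ==v (b ∷ y)) ≡ not (a xor b) ∧ (x ==v y)
==v-∷ a b x y = refl

not-xor-refl : ∀ a → not (a xor a) ≡ true
not-xor-refl false = refl
not-xor-refl true = refl

-- Fixing the first column is the one condition `col 𝐞 m`, so one of the allowed conditions is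
-- spent. The others lift to the wider matrix.
Glob-res : ∀ {b h} (m : V n) {g : M n (suc d) → ℚ} → Glob (suc b) h g → Glob b h (λ N → g (m ∷ N))
Glob-res {n} {d} {b} {h} m {g} (glob p q z) = glob (λ N → p (m ∷ N)) (λ N → q (m ∷ N)) λ cs l →
  subst₂ (λ s t → pw h * s ≤ t) (red cs g)
    (trans (∑-cong (allM n (suc d)) λ N → sym (QP.*-identityʳ ⟦ sats N (lifts cs) ⟧)) (trans (red cs (λ _ → 1ℚ)) (∑-cong (allM n d) λ N → QP.*-identityʳ ⟦ sats N cs ⟧)))
    (z (lifts cs) (ℕ.s≤s (subst (ℕ._≤ b) (sym (LP.length-map up cs)) l)))
  where
  up : Con n d → Con n (suc d)
  up (col u m') = col (false ∷ u) m'
  up (row a e) = row a (dot a m ∷ e)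
  lifts : List (Con n d) → List (Con n (suc d))
  lifts cs = col 𝐞 m ∷ map up cs
  sat-up : ∀ N c → sat (m ∷ N) (up c) ≡ sat N c
  sat-up N (col u m') = cong (_==v m') (⊕-idˡ _)
  sat-up N (row a e) = cong (_∧ (Vec.map (dot a) N ==v e)) (not-xor-refl (dot a m))
  sats-up : ∀ N cs → sats (m ∷ N) (map up cs) ≡ sats N cs
  sats-up N [] = refl
  sats-up N (c ∷ cs) = cong₂ _∧_ (sat-up N c) (sats-up N cs)
  split : ∀ v N cs → ⟦ sats (v ∷ N) (lifts cs) ⟧ ≡ ⟦ v ==v m ⟧ * ⟦ sats (v ∷ N) (map up cs) ⟧
  split v N cs = trans (⟦∧⟧ ((v ∷ N) · 𝐞 ==v m) (sats (v ∷ N) (map up cs))) (cong (λ t → ⟦ t ==v m ⟧ * ⟦ sats (v ∷ N) (map up cs) ⟧) (trans (cong (v ⊕v_) (·-0 N)) (⊕-idʳ v)))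
  red : ∀ cs (g : M n (suc d) → ℚ) → ∑[ N ∈ allM n (suc d) ] (⟦ sats N (lifts cs) ⟧ * g N) ≡ ∑[ N ∈ allM n d ] (⟦ sats N cs ⟧ * g (m ∷ N))
  red cs g = begin
    ∑[ N ∈ allM n (suc d) ] (⟦ sats N (lifts cs) ⟧ * g N)
      ≡⟨ ∑-allM (λ N → ⟦ sats N (lifts cs) ⟧ * g N) ⟩
    ∑[ v ∈ allV n ] ∑[ N ∈ allM n d ] (⟦ sats (v ∷ N) (lifts cs) ⟧ * g (v ∷ N))
      ≡⟨ ∑-cong (allV n) (λ v → trans (∑-cong (allM n d) λ N → trans (cong (_* g (v ∷ N)) (split v N cs)) (QP.*-assoc ⟦ v ==v m ⟧ _ (g (v ∷ N)))) (∑-*ˡ (allM n d) ⟦ v ==v m ⟧ _)) ⟩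
    ∑[ v ∈ allV n ] (⟦ v ==v m ⟧ * ∑[ N ∈ allM n d ] (⟦ sats (v ∷ N) (map up cs) ⟧ * g (v ∷ N)))
      ≡⟨ ∑δ (VE n) m (λ v → ∑[ N ∈ allM n d ] (⟦ sats (v ∷ N) (map up cs) ⟧ * g (v ∷ N))) ⟩
    ∑[ N ∈ allM n d ] (⟦ sats (m ∷ N) (map up cs) ⟧ * g (m ∷ N))
      ≡⟨ ∑-cong (allM n d) (λ N → cong (λ t → ⟦ t ⟧ * g (m ∷ N)) (sats-up N cs)) ⟩
    ∑[ N ∈ allM n d ] (⟦ sats N cs ⟧ * g (m ∷ N)) ∎
    where open ≡-Reasoning

-- Row and column conditions exchange their roles one for one, so no condition is spent.
Glob-mv : ∀ {b h} (f w : V n) → dot f w ≡ false → {g : M n d → ℚ} → Glob b h g → Glob b h (g ∘ mv w f)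
Glob-mv {n} {d} {b} {h} f w fw {g} (glob p q z) = glob (λ N → p (mv w f N)) (λ N → q (mv w f N)) λ cs l →
  subst₂ (λ s t → pw h * s ≤ t) (red cs g)
    (trans (∑-cong (allM n d) λ N → sym (QP.*-identityʳ ⟦ sats N (map tr cs) ⟧)) (trans (red cs (λ _ → 1ℚ)) (∑-cong (allM d n) λ N → QP.*-identityʳ ⟦ sats N cs ⟧)))
    (z (map tr cs) (subst (ℕ._≤ b) (sym (LP.length-map tr cs)) l))
  where
  wf : dot w f ≡ false
  wf = trans (dot-comm w f) fw
  tr : Con d n → Con n d
  tr (col u m) = row (tv f w u) m
  tr (row a e) = col a (tv w f e)
  mapdot : ∀ {k} u (X : M n k) → Vec.map (dot (tv f w u)) (Vec.map (tv w f) X) ≡ Vec.map (dot u) X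
  mapdot u [] = refl
  mapdot u (x ∷ X) = cong₂ _∷_ (trans (tv-adj f w u (tv w f x)) (cong (dot u) (tv-inv w f wf x))) (mapdot u X)
  mapdot0 : ∀ {k} u (Y : M k n) → Vec.map (dot u) (T Y) ≡ Y · u
  mapdot0 u Y = trans (sym (T-· (T Y) u)) (cong (_· u) (TT Y))
  sat-tr : ∀ N c → sat (mv w f N) (tr c) ≡ sat N c
  sat-tr N (col u m) = cong (_==v m) (trans (mapdot u (T N)) (mapdot0 u N))
  sat-tr N (row a e) = ≡-from-iff
    (λ t → eq-complete (VE n) (trans (sym (T-· N a)) (trans (sym (tv-inv w f wf (T N · a))) (trans (cong (tv w f) (trans (sym (tv-· w f (T N) a)) (==v-sound t))) (tv-inv w f wf e)))))
    (λ t → eq-complete (VE n) (trans (tv-· w f (T N) a) (cong (tv w f) (trans (T-· N a) (==v-sound t)))))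
  sats-tr : ∀ N cs → sats (mv w f N) (map tr cs) ≡ sats N cs
  sats-tr N [] = refl
  sats-tr N (c ∷ cs) = cong₂ _∧_ (sat-tr N c) (sats-tr N cs)
  red : ∀ cs (g : M n d → ℚ) → ∑[ N ∈ allM n d ] (⟦ sats N (map tr cs) ⟧ * g N) ≡ ∑[ N ∈ allM d n ] (⟦ sats N cs ⟧ * g (mv w f N))
  red cs g = trans (sym (∑-bij (ME d n) (ME n d) (mv w f) (mv⁻ w f) (mv⁻-mv w f wf) (mv-mv⁻ w f wf) (λ N → ⟦ sats N (map tr cs) ⟧ * g N)))
    (∑-cong (allM d n) λ N → cong (λ t → ⟦ t ⟧ * g (mv w f N)) (sats-tr N cs))

mv-00 : (Y : M d n) → mv 0v 0v Y ≡ T Y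
mv-00 Y = go (T Y)
  where
  sc0 : ∀ {n} c → sc c (0v {n}) ≡ 0v
  sc0 false = refl
  sc0 true = refl
  go : ∀ {n k} (X : M n k) → Vec.map (tv 0v 0v) X ≡ X
  go [] = refl
  go (x ∷ X) = cong₂ _∷_ (trans (cong (x ⊕v_) (sc0 (dot 0v x))) (⊕-idʳ x)) (go X)

Glob-T : ∀ {b h} {g : M n d → ℚ} → Glob b h g → Glob b h (g ∘ T)
Glob-T {n} {g = g} G = Glob-cong (λ Y → cong g (mv-00 Y)) (Glob-mv 0v 0v (dot-0ʳ (0v {n})) G)

-- No condition is spent. Seen on `v ∷ N`, a column condition on the sheared matrix is again a
-- single column condition; a row condition in direction `a` splits according to the bit `⟨a,v⟩`
-- into two disjoint cases, each of them a single row condition.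
Glob-shear : ∀ {b h} (m : V n) (l : V d) {g : M n (suc d) → ℚ} → Glob b h g → Glob b h (shear m l g)
Glob-shear {n} {d} {b} {h} m l {g} (glob p q z) = glob
  (λ N → *-≥0 (hp≥0 n) (∑-≥0 (allV n) λ v → p _))
  (λ N → ≤-trans (*-monoˡ (hp n) (hp≥0 n) (∑-mono (allV n) λ v → q (v ∷ (O v ⊕ N)))) (≤≡ (trans (cong (hp n *_) (∑-const n 1ℚ)) (trans (cong (hp n *_) (QP.*-identityʳ (pw n))) (hp*pw n)))))
  λ cs le → *-cancelˡ-≤ (pw n) (pw>0 n) (subst₂ _≤_ (lhs cs) (rhs cs) (key cs [] (subst (ℕ._≤ b) (sym (NP.+-identityʳ _)) le)))
  where
  O : V n → M n d
  O v = outer (m ⊕v v) l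
  -- The conditions `cs` are still to be translated, while `ds` are already conditions on `v ∷ N`.
  -- `key` moves them across one at a time, keeping their total number.
  S : List (Con n d) → List (Con n (suc d)) → (M n (suc d) → ℚ) → ℚ
  S cs ds k = ∑[ v ∈ allV n ] ∑[ N ∈ allM n d ] (⟦ sats (O v ⊕ N) cs ⟧ * (⟦ sats (v ∷ N) ds ⟧ * k (v ∷ N)))
  S-col : ∀ u m' cs ds k → S (col u m' ∷ cs) ds k ≡ S cs (col (dot l u ∷ u) (m' ⊕v sc (dot l u) m) ∷ ds) k
  S-col u m' cs ds k = ∑-cong (allV n) λ v → ∑-cong (allM n d) λ N → trans
    (cong (λ t → t * (⟦ sats (v ∷ N) ds ⟧ * k (v ∷ N))) (trans (⟦∧⟧ (sat (O v ⊕ N) (col u m')) (sats (O v ⊕ N) cs)) (cong (λ t → ⟦ t ⟧ * ⟦ sats (O v ⊕ N) cs ⟧) (sateq v N))))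
    (trans (lem ⟦ sat (v ∷ N) c' ⟧ ⟦ sats (O v ⊕ N) cs ⟧ ⟦ sats (v ∷ N) ds ⟧ (k (v ∷ N)))
      (cong (λ t → ⟦ sats (O v ⊕ N) cs ⟧ * (t * k (v ∷ N))) (sym (⟦∧⟧ (sat (v ∷ N) c') (sats (v ∷ N) ds)))))
    where
    c' = col (dot l u ∷ u) (m' ⊕v sc (dot l u) m)
    lem : ∀ a b c e → a * b * (c * e) ≡ b * (a * c * e)
    lem = solve-∀ ℚring
    val' : ∀ v N → (O v ⊕ N) · u ⊕v sc (dot l u) m ≡ (v ∷ N) · (dot l u ∷ u)
    val' v N = begin
      (O v ⊕ N) · u ⊕v sc (dot l u) m                       ≡⟨ cong (_⊕v sc (dot l u) m) (trans (⊕-· (O v) N u) (cong (_⊕v N · u) (trans (outer-· (m ⊕v v) l u) (sc-⊕ (dot l u) m v)))) ⟩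
      ((sc (dot l u) m ⊕v sc (dot l u) v) ⊕v N · u) ⊕v sc (dot l u) m  ≡⟨ cong (_⊕v sc (dot l u) m) (trans (⊕-assoc _ _ _) (⊕-comm _ _)) ⟩
      ((sc (dot l u) v ⊕v N · u) ⊕v sc (dot l u) m) ⊕v sc (dot l u) m  ≡⟨ ⊕-cancelʳ _ _ ⟩
      sc (dot l u) v ⊕v N · u ∎
      where open ≡-Reasoning
    sateq : ∀ v N → sat (O v ⊕ N) (col u m') ≡ sat (v ∷ N) c'
    sateq v N = ≡-from-iff
      (λ e → eq-complete (VE n) (trans (sym (val' v N)) (cong (_⊕v sc (dot l u) m) (==v-sound e))))
      (λ e → eq-complete (VE n) (trans (sym (⊕-cancelʳ (sc (dot l u) m) _)) (trans (cong (_⊕v sc (dot l u) m) (trans (val' v N) (==v-sound e))) (⊕-cancelʳ _ m'))))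
  S-row : ∀ a e cs ds k → S (row a e ∷ cs) ds k ≡ S cs (row a (false ∷ (e ⊕v sc (dot a m) l)) ∷ ds) k + S cs (row a (true ∷ (e ⊕v sc (not (dot a m)) l)) ∷ ds) k
  S-row a e cs ds k = trans (∑-cong (allV n) λ v → trans (∑-cong (allM n d) λ N → ptw v N) (∑-+ (allM n d) _ _)) (∑-+ (allV n) _ _)
    where
    r₁ r₂ : Con n (suc d)
    r₁ = row a (false ∷ (e ⊕v sc (dot a m) l))
    r₂ = row a (true ∷ (e ⊕v sc (not (dot a m)) l))
    lem₁ : ∀ s c t k → s * c * (t * k) ≡ c * (s * t * k) + c * (0ℚ * t * k)
    lem₁ = solve-∀ ℚring
    lem₂ : ∀ s c t k → s * c * (t * k) ≡ c * (0ℚ * t * k) + c * (s * t * k)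
    lem₂ = solve-∀ ℚring
    rw : ∀ v N → Vec.map (dot a) (O v ⊕ N) ≡ sc (dot a m xor dot a v) l ⊕v Vec.map (dot a) N
    rw v N = trans (addm (O v) N) (cong (_⊕v Vec.map (dot a) N) (trans (map-dot-outer a (m ⊕v v) l) (cong (λ t → sc t l) (dot-⊕ʳ a m v))))
      where
      addm : ∀ {k} (A B : M n k) → Vec.map (dot a) (A ⊕ B) ≡ Vec.map (dot a) A ⊕v Vec.map (dot a) B
      addm [] [] = refl
      addm (x ∷ A) (y ∷ B) = cong₂ _∷_ (dot-⊕ʳ a x y) (addm A B)
    move : ∀ (s x e : V d) → ((s ⊕v x) ==v e) ≡ (x ==v (e ⊕v s))
    move s x e = ≡-from-iff
      (λ t → eq-complete (VE d) (sym (trans (cong (_⊕v s) (trans (sym (==v-sound t)) (⊕-comm s x))) (⊕-cancelʳ s x))))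
      (λ t → eq-complete (VE d) (trans (cong (s ⊕v_) (trans (==v-sound t) (⊕-comm e s))) (⊕-cancel s e)))
    ptw : ∀ v N → ⟦ sat (O v ⊕ N) (row a e) ∧ sats (O v ⊕ N) cs ⟧ * (⟦ sats (v ∷ N) ds ⟧ * k (v ∷ N)) ≡
      ⟦ sats (O v ⊕ N) cs ⟧ * (⟦ sat (v ∷ N) r₁ ∧ sats (v ∷ N) ds ⟧ * k (v ∷ N)) + ⟦ sats (O v ⊕ N) cs ⟧ * (⟦ sat (v ∷ N) r₂ ∧ sats (v ∷ N) ds ⟧ * k (v ∷ N))
    ptw v N = trans (cong (_* (⟦ sats (v ∷ N) ds ⟧ * k (v ∷ N))) (⟦∧⟧ (sat (O v ⊕ N) (row a e)) (sats (O v ⊕ N) cs)))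
      (trans (core (dot a v) refl) (sym (cong₂ (λ s t → ⟦ sats (O v ⊕ N) cs ⟧ * (s * k (v ∷ N)) + ⟦ sats (O v ⊕ N) cs ⟧ * (t * k (v ∷ N))) (⟦∧⟧ (sat (v ∷ N) r₁) (sats (v ∷ N) ds)) (⟦∧⟧ (sat (v ∷ N) r₂) (sats (v ∷ N) ds)))))
      where
      C = ⟦ sats (O v ⊕ N) cs ⟧
      D' = ⟦ sats (v ∷ N) ds ⟧
      K = k (v ∷ N)
      s₀ : ∀ t → dot a v ≡ t → sat (O v ⊕ N) (row a e) ≡ (Vec.map (dot a) N ==v (e ⊕v sc (dot a m xor t) l))
      s₀ t refl = trans (cong (_==v e) (rw v N)) (move _ (Vec.map (dot a) N) e)
      core : ∀ t → dot a v ≡ t → ⟦ sat (O v ⊕ N) (row a e) ⟧ * C * (D' * K) ≡ C * (⟦ sat (v ∷ N) r₁ ⟧ * D' * K) + C * (⟦ sat (v ∷ N) r₂ ⟧ * D' * K)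
      core false et = trans (cong (λ z → ⟦ z ⟧ * C * (D' * K)) (s₀ false et)) (trans (lem₁ ⟦ Vec.map (dot a) N ==v (e ⊕v sc (dot a m xor false) l) ⟧ C D' K)
        (cong₂ (λ x y → C * (⟦ x ⟧ * D' * K) + C * (⟦ y ⟧ * D' * K))
          (trans (cong (λ z → Vec.map (dot a) N ==v (e ⊕v sc z l)) (BP.xor-identityʳ (dot a m))) (sym (cong (λ z → not (z xor false) ∧ (Vec.map (dot a) N ==v (e ⊕v sc (dot a m) l))) et)))
          (sym (cong (λ z → not (z xor true) ∧ (Vec.map (dot a) N ==v (e ⊕v sc (not (dot a m)) l))) et))))
      core true et = trans (cong (λ z → ⟦ z ⟧ * C * (D' * K)) (s₀ true et)) (trans (lem₂ ⟦ Vec.map (dot a) N ==v (e ⊕v sc (dot a m xor true) l) ⟧ C D' K)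
        (cong₂ (λ x y → C * (⟦ x ⟧ * D' * K) + C * (⟦ y ⟧ * D' * K))
          (sym (cong (λ z → not (z xor false) ∧ (Vec.map (dot a) N ==v (e ⊕v sc (dot a m) l))) et))
          (trans (cong (λ z → Vec.map (dot a) N ==v (e ⊕v sc z l)) (trans (BP.xor-comm (dot a m) true) refl)) (sym (cong (λ z → not (z xor true) ∧ (Vec.map (dot a) N ==v (e ⊕v sc (not (dot a m)) l))) et)))))
  key : ∀ cs ds → length cs ℕ.+ length ds ℕ.≤ b → pw h * S cs ds g ≤ S cs ds (λ _ → 1ℚ)
  key [] ds le = subst₂ (λ s t → pw h * s ≤ t)
    (trans (∑-allM (λ N → ⟦ sats N ds ⟧ * g N)) (∑-cong (allV n) λ v → ∑-cong (allM n d) λ N → sym (QP.*-identityˡ _)))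
    (trans (∑-allM (λ N → ⟦ sats N ds ⟧)) (∑-cong (allV n) λ v → ∑-cong (allM n d) λ N → sym (trans (QP.*-identityˡ _) (QP.*-identityʳ _))))
    (z ds le)
  key (col u m' ∷ cs) ds le = subst₂ (λ s t → pw h * s ≤ t) (sym (S-col u m' cs ds g)) (sym (S-col u m' cs ds (λ _ → 1ℚ)))
    (key cs (col (dot l u ∷ u) (m' ⊕v sc (dot l u) m) ∷ ds) (subst (ℕ._≤ b) (sym (NP.+-suc (length cs) (length ds))) le))
  key (row a e ∷ cs) ds le = subst₂ _≤_ (trans (sym (QP.*-distribˡ-+ (pw h) (S cs (r₁ ∷ ds) g) (S cs (r₂ ∷ ds) g))) (cong (pw h *_) (sym (S-row a e cs ds g)))) (sym (S-row a e cs ds (λ _ → 1ℚ)))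
    (QP.+-mono-≤ (key cs (r₁ ∷ ds) le') (key cs (r₂ ∷ ds) le'))
    where
    r₁ r₂ : Con n (suc d)
    r₁ = row a (false ∷ (e ⊕v sc (dot a m) l))
    r₂ = row a (true ∷ (e ⊕v sc (not (dot a m)) l))
    le' = subst (ℕ._≤ b) (sym (NP.+-suc (length cs) (length ds))) le
  unshift : ∀ cs (k : M n (suc d) → ℚ) v → ∑[ N ∈ allM n d ] (⟦ sats (O v ⊕ N) cs ⟧ * (1ℚ * k (v ∷ N))) ≡ ∑[ N ∈ allM n d ] (⟦ sats N cs ⟧ * k (v ∷ (O v ⊕ N)))
  unshift cs k v = trans (∑-cong (allM n d) λ N → cong₂ (λ s t → ⟦ sats (O v ⊕ N) cs ⟧ * s) (trans (QP.*-identityˡ _) (cong (λ t → k (v ∷ t)) (sym (⊕M-cancel (O v) N)))) (refl {x = N}))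
    (∑-shiftM (O v) (λ N → ⟦ sats N cs ⟧ * k (v ∷ (O v ⊕ N))))
  lhs : ∀ cs → pw h * S cs [] g ≡ pw n * (pw h * ∑[ N ∈ allM n d ] (⟦ sats N cs ⟧ * shear m l g N))
  lhs cs = begin
    pw h * S cs [] g
      ≡⟨ cong (pw h *_) (trans (∑-cong (allV n) λ v → unshift cs g v) (∑-swap (allV n) (allM n d) _)) ⟩
    pw h * ∑[ N ∈ allM n d ] ∑[ v ∈ allV n ] (⟦ sats N cs ⟧ * g (v ∷ (O v ⊕ N)))
      ≡⟨ cong (pw h *_) (trans (∑-cong (allM n d) λ N → trans (∑-*ˡ (allV n) ⟦ sats N cs ⟧ _) (unhp ⟦ sats N cs ⟧ (∑[ v ∈ allV n ] g (v ∷ (O v ⊕ N))))) (∑-*ˡ (allM n d) (pw n) _)) ⟩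
    pw h * (pw n * ∑[ N ∈ allM n d ] (⟦ sats N cs ⟧ * shear m l g N))
      ≡⟨ *-swap (pw h) (pw n) _ ⟩
    pw n * (pw h * ∑[ N ∈ allM n d ] (⟦ sats N cs ⟧ * shear m l g N)) ∎
    where
    open ≡-Reasoning
    unhp : ∀ s x → s * x ≡ pw n * (s * (hp n * x))
    unhp s x = trans (sym (QP.*-identityˡ (s * x))) (trans (cong (_* (s * x)) (sym (pw*hp n))) (lem (pw n) (hp n) s x))
      where
      lem : ∀ p h s x → p * h * (s * x) ≡ p * (s * (h * x))
      lem = solve-∀ ℚring
  rhs : ∀ cs → S cs [] (λ _ → 1ℚ) ≡ pw n * ∑[ N ∈ allM n d ] ⟦ sats N cs ⟧
  rhs cs = trans (∑-cong (allV n) λ v → trans (unshift cs (λ _ → 1ℚ) v) (∑-cong (allM n d) λ N → QP.*-identityʳ _)) (∑-const n _)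

-- Quantified over all dimensions and all global functions, so that it also covers the restrictions
-- and shears of `g`. This makes the bound self-improving.
Lev : (r h : ℕ) → ℚ → Set
Lev r h Ω = ∀ {n d} i → i ℕ.≤ r → (g : M n d → ℚ) → Glob i h g → norm² (P i (hat g)) ≤ Ω

-- The growth of the bound under `R` restrictions, with the terms of `Res-P`: the fixed column
-- truncated at `j`, and the two averages of shears with weights `2^j` and `-2^j`. The factors 2
-- come from `Bnd-+`; the summand 1 keeps the value at least 1.
κ : ℕ → ℕ → ℚ
κ zero j = 1ℚ
κ (suc R) zero = 1ℚ
κ (suc R) (suc j) = 1ℚ + two * (κ R j + two * (pw j * pw j * κ R (suc j) + pw j * pw j * κ R j))

κ≥0 : ∀ R j → 0ℚ ≤ κ R j
κ≥0 zero j = 0≤1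
κ≥0 (suc R) zero = 0≤1
κ≥0 (suc R) (suc j) = +-≥0 0≤1 (*-≥0 0≤two (+-≥0 (κ≥0 R j) (*-≥0 0≤two (+-≥0 (*-≥0 (*-≥0 (pw≥0 j) (pw≥0 j)) (κ≥0 R (suc j))) (*-≥0 (*-≥0 (pw≥0 j) (pw≥0 j)) (κ≥0 R j))))))

κ≥1 : ∀ R j → 1ℚ ≤ κ R j
κ≥1 zero j = ≤-refl
κ≥1 (suc R) zero = ≤-refl
κ≥1 (suc R) (suc j) = diff≤ _ (*-≥0 0≤two (+-≥0 (κ≥0 R j) (*-≥0 0≤two (+-≥0 (*-≥0 (*-≥0 (pw≥0 j) (pw≥0 j)) (κ≥0 R (suc j))) (*-≥0 (*-≥0 (pw≥0 j) (pw≥0 j)) (κ≥0 R j)))))) refl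

P-cong : ∀ j {φ ψ : M n d → ℚ} → (∀ X → φ X ≡ ψ X) → ∀ X → P j φ X ≡ P j ψ X
P-cong j e X = cong (⟦ rk X ℕ.<ᵇ j ⟧ *_) (e X)

Bnd-0 : ∀ R c → 0ℚ ≤ c → Bnd R (λ (X : M n d) → 0ℚ) c
Bnd-0 {n} {d} R c c≥0 = Bnd-mono R (≤-trans (≤≡ (QP.*-zeroˡ 0ℚ)) c≥0) (Bnd-lin {I = ⊥} R [] (λ ()) (λ ()) (λ ()) (λ ()))

Res-cong : (m : V n) {φ ψ : M n (suc d) → ℚ} → (∀ X → φ X ≡ ψ X) → ∀ X → Res m φ X ≡ Res m ψ X
Res-cong {n} m e X = ∑-cong (allV n) λ x → cong (σ (dot x m) *_) (e (x ∷ X))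

module _ (r h : ℕ) (Ω : ℚ) (Ω≥0 : 0ℚ ≤ Ω) (lev : Lev r h Ω) where

  private
    step≤ : ∀ R j → Ω ≤ κ R j * Ω
    step≤ R j = ≤-trans (≤≡ (sym (QP.*-identityˡ Ω))) (*-monoʳ Ω Ω≥0 (κ≥1 R j))

  -- Induction on `R`. By `Res-P` a restriction of a truncated transform is a combination of
  -- truncated transforms of the restricted function and of shears, all of them global, to which
  -- fewer restrictions remain to be applied.
  Bnd-P : ∀ R j → j ℕ.≤ r → (g : M n d → ℚ) → Glob j h g → Bnd R (P j (hat g)) (κ R j * Ω)
  Bnd-Res : ∀ R j → j ℕ.≤ r → (m : V n) (g : M n (suc d) → ℚ) → Glob j h g → Bnd R (Res m (P j (hat g))) (κ (suc R) j * Ω)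
  Row-P : ∀ R j → j ℕ.≤ r → ∀ n {d} (g : M n d → ℚ) → Glob j h g → RowB R n (P j (hat g)) (κ (suc R) j * Ω)
  Bnd-P zero j j≤r g G = ≤-trans (lev j j≤r g G) (step≤ 0 j)
  Bnd-P {n} {d} (suc R) j j≤r g G = ≤-trans (lev j j≤r g G) (step≤ (suc R) j) , Row-P R j j≤r n g G ,
    RowB-map R {φ = P j (hat (g ∘ T))} {ψ = P j (hat g) ∘ T} (λ m e → Bnd-cong R (Res-cong m e)) (λ X → cong₂ (λ a b → ⟦ a ℕ.<ᵇ j ⟧ * b) (sym (rk-T X)) (sym (hat-T g X))) (Row-P R j j≤r d (g ∘ T) (Glob-T G))
  Row-P R j j≤r zero g G = tt
  Row-P R j j≤r (suc n) g G f w m fw = Bnd-cong R (Res-cong m λ Y → cong₂ (λ a b → ⟦ a ℕ.<ᵇ j ⟧ * b) (sym (rk-mv f w fw Y)) (sym (hat-mv f w fw g Y)))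
    (Bnd-Res R j j≤r m (g ∘ mv w f) (Glob-mv f w fw G))
  Bnd-Res {n} {d} R zero j≤r m g G = Bnd-cong R (λ X → sym (∑-0 (allV n) λ x → trans (cong (σ (dot x m) *_) (QP.*-zeroˡ (hat g (x ∷ X)))) (QP.*-zeroʳ (σ (dot x m))))) (Bnd-0 R _ (*-≥0 (κ≥0 (suc R) 0) Ω≥0))
  Bnd-Res {n} {d} R (suc j) j≤r m g G = Bnd-mono R le (Bnd-cong R (λ X → sym (Res-P j m (hat g) X))
    (Bnd-+ R (Bnd-cong R (P-cong j λ X → sym (Res-hat m g X)) (Bnd-P R j j'≤r (λ N → g (m ∷ N)) (Glob-res m G)))
      (Bnd-+ R (Bnd-avg R d (pw j) (λ l → P (suc j) (sh m l (hat g))) (κ R (suc j) * Ω) λ l → Bnd-cong R (P-cong (suc j) λ X → sym (sh-hat m l g X)) (Bnd-P R (suc j) j≤r (shear m l g) (Glob-shear m l G)))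
               (Bnd-avg R d (- pw j) (λ l → P j (sh m l (hat g))) (κ R j * Ω) λ l → Bnd-cong R (P-cong j λ X → sym (sh-hat m l g X)) (Bnd-P R j j'≤r (shear m l g) (Glob-shear m l (Glob-pred G)))))))
    where
    j'≤r = NP.≤-trans (NP.n≤1+n j) j≤r
    lem : ∀ a b p Ω → (1ℚ + two * (a + two * (p * p * b + p * p * a))) * Ω ≡ two * (a * Ω + two * (p * p * (b * Ω) + (- p) * (- p) * (a * Ω))) + Ω
    lem = solve-∀ ℚring
    le : two * (κ R j * Ω + two * (pw j * pw j * (κ R (suc j) * Ω) + (- pw j) * (- pw j) * (κ R j * Ω))) ≤ κ (suc R) (suc j) * Ω
    le = diff≤ Ω Ω≥0 (lem (κ R j) (κ R (suc j)) (pw j) Ω)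

-- Convolution powers and moments

module _ {n d : ℕ} where
  open Char (MC n d) using (_⋆_; ft-⋆; plancherel; norm; norm≥0; Bil)

  -- The coefficients of the power `(val Φ)^s`. Built by convolution, they turn the `2s`-th moment
  -- of `val Φ` into a squared norm.
  pow : (M n d → ℚ) → ℕ → M n d → ℚ
  pow Φ zero X = ⟦ X ==M 0M ⟧
  pow Φ (suc s) = Φ ⋆ pow Φ s

  rk-0M : ∀ d → rk (0M {n} {d}) ≡ 0
  rk-0M zero = refl
  rk-0M (suc d) rewrite inSp-0 (0M {n} {d}) = rk-0M d

  Supp-pow : ∀ r (Φ : M n d → ℚ) → Supp r Φ → ∀ s → Supp (suc (s ℕ.* r)) (pow Φ s)
  Supp-pow r Φ sΦ zero X p with X ==M 0M in e
  ... | false = refl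
  ... | true with eq-sound (ME n d) {X} e
  ...   | refl = ⊥-elim (NP.<⇒≱ p (NP.≤-reflexive (rk-0M d)))
  Supp-pow r Φ sΦ (suc s) Z p = ∑-0 (allM n d) term
    where
    term : ∀ X → Φ (X ⊕ Z) * pow Φ s X ≡ 0ℚ
    term X with r ℕ.≤? rk (X ⊕ Z)
    ... | yes q = trans (cong (_* pow Φ s X) (sΦ _ q)) (QP.*-zeroˡ (pow Φ s X))
    ... | no q = trans (cong (Φ (X ⊕ Z) *_) (Supp-pow r Φ sΦ s X big)) (QP.*-zeroʳ (Φ (X ⊕ Z)))
      where
      rkZ : rk Z ℕ.≤ rk X ℕ.+ rk (X ⊕ Z)
      rkZ = subst (λ t → rk t ℕ.≤ rk X ℕ.+ rk (X ⊕ Z)) (⊕M-cancel X Z) (rk-⊕ X (X ⊕ Z))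
      big : suc (s ℕ.* r) ℕ.≤ rk X
      big = NP.≰⇒> λ small → NP.<⇒≱ (NP.≤-trans p rkZ) (subst (rk X ℕ.+ rk (X ⊕ Z) ℕ.≤_) (NP.+-comm (s ℕ.* r) r) (NP.+-mono-≤ small (NP.≰⇒≥ q)))

  val-pow : ∀ Φ s N → val (pow Φ s) N ≡ val Φ N ^ℚ s
  val-pow Φ zero N = trans (∑-cong (allM n d) λ X → QP.*-comm (σ (dotM X N)) ⟦ X ==M 0M ⟧) (trans (∑δ (ME n d) 0M (λ X → σ (dotM X N))) (cong σ (z N)))
    where
    z : ∀ {d} (N : M n d) → dotM 0M N ≡ false
    z [] = refl
    z (x ∷ N) = trans (cong₂ _xor_ (dot-0ˡ x) (z N)) refl
  val-pow Φ (suc s) N = trans (ft-⋆ Φ (pow Φ s) N) (cong (val Φ N *_) (val-pow Φ s N))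

  moment : ∀ Φ s → hp (d ℕ.* n) * ∑[ N ∈ allM n d ] (val Φ N ^ℚ (s ℕ.+ s)) ≡ norm² (pow Φ s)
  moment Φ s = trans (cong (hp (d ℕ.* n) *_) (trans (∑-cong (allM n d) λ N → trans (^-+ (val Φ N) s s) (sym (cong₂ _*_ (val-pow Φ s N) (val-pow Φ s N)))) (plancherel (pow Φ s) (pow Φ s))))
    (trans (sym (QP.*-assoc (hp (d ℕ.* n)) (pw (d ℕ.* n)) (norm² (pow Φ s)))) (trans (cong (_* norm² (pow Φ s)) (hp*pw (d ℕ.* n))) (QP.*-identityˡ _)))

  -- Take `Φ ⋆ H` itself as the second argument of the form and cancel one factor of its squared
  -- norm.
  norm-⋆ : ∀ R Φ c H → 0ℚ ≤ c → Bnd R Φ c → Supp R H → Supp R (Φ ⋆ H) → norm² (Φ ⋆ H) ≤ OPc R * c * norm² H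
  norm-⋆ R Φ c H c≥0 b sH sΦH with norm² (Φ ⋆ H) QP.≟ 0ℚ
  ... | yes z = ≤-trans (≤≡ z) (*-≥0 (*-≥0 (OPc≥0 R) c≥0) (norm≥0 H))
  ... | no nz = *-cancelˡ-≤ (norm² (Φ ⋆ H)) (≤∧≢⇒< (norm≥0 (Φ ⋆ H)) (nz ∘ sym))
      (≤-trans (≤≡ (cong (λ z → z * z) bil)) (≤-trans (op R Φ c c≥0 b H (Φ ⋆ H) sH sΦH) (≤≡ (lem (OPc R * c) (norm² H) (norm² (Φ ⋆ H))))))
    where
    lem : ∀ k a b → k * (a * b) ≡ b * (k * a)
    lem = solve-∀ ℚring
    lem₂ : ∀ a b c → a * b * c ≡ a * (b * c)
    lem₂ = solve-∀ ℚring
    bil : norm² (Φ ⋆ H) ≡ Bil Φ H (Φ ⋆ H)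
    bil = trans (∑-cong (allM n d) λ Z → trans (sym (∑-*ʳ (allM n d) ((Φ ⋆ H) Z) _)) (∑-cong (allM n d) λ X → lem₂ (Φ (X ⊕ Z)) (H X) ((Φ ⋆ H) Z))) (∑-swap (allM n d) (allM n d) _)

rkOf : ℕ → ℕ → ℕ
rkOf r s = suc (s ℕ.* r)

-- A sum of the constants of the single convolutions, hence monotone in `s`: one value serves for
-- all `s` factors of `norm-pow`.
gam : ℕ → ℕ → ℚ
gam r zero = 0ℚ
gam r (suc s) = gam r s + OPc (rkOf r (suc s)) * κ (rkOf r (suc s)) r

gam≥0 : ∀ r s → 0ℚ ≤ gam r s
gam≥0 r zero = ≤-refl
gam≥0 r (suc s) = +-≥0 (gam≥0 r s) (*-≥0 (OPc≥0 (rkOf r (suc s))) (κ≥0 (rkOf r (suc s)) r))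

-- Each convolution with the low part multiplies the squared norm by at most a constant times `Ω`.
-- With `moment` this bounds the `2s`-th moment by `(gam r s * Ω)^s`.
norm-pow : ∀ (r h : ℕ) Ω → 0ℚ ≤ Ω → Lev r h Ω → (g : M n d → ℚ) → Glob r h g → ∀ s → norm² (pow (P r (hat g)) s) ≤ (gam r s * Ω) ^ℚ s
norm-pow {n} {d} r h Ω Ω≥0 lev g G zero = ≤≡ (trans (∑-cong (allM n d) λ X → trans (⟦⟧*⟦⟧ (X ==M 0M)) (sym (QP.*-identityʳ _))) (∑δ (ME n d) 0M (λ _ → 1ℚ)))
norm-pow {n} {d} r h Ω Ω≥0 lev g G (suc s) =
  ≤-trans (norm-⋆ R Φ (κ R r * Ω) (pow Φ s) (*-≥0 (κ≥0 R r) Ω≥0) (Bnd-P r h Ω Ω≥0 lev R r NP.≤-refl g G) sH (Supp-pow r Φ sΦ (suc s)))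
    (*-mono (*-≥0 (OPc≥0 R) (*-≥0 (κ≥0 R r) Ω≥0)) (Char.norm≥0 (MC n d) (pow Φ s))
      (diff≤ (gam r s * Ω) (*-≥0 (gam≥0 r s) Ω≥0) (lem (gam r s) (OPc R) (κ R r) Ω))
      (≤-trans (norm-pow r h Ω Ω≥0 lev g G s) (^-mono (*-≥0 (gam≥0 r s) Ω≥0) (*-monoʳ Ω Ω≥0 (diff≤ {gam r s} {gam r (suc s)} (OPc R * κ R r) (*-≥0 (OPc≥0 R) (κ≥0 R r)) refl)) s)))
  where
  R = rkOf r (suc s)
  Φ = P r (hat g)
  sΦ : Supp r Φ
  sΦ = Supp-P r (hat g)
  sH : Supp R (pow Φ s)
  sH X p = Supp-pow r Φ sΦ s X (NP.≤-trans (ℕ.s≤s (NP.m≤n+m (s ℕ.* r) r)) p)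
  lem : ∀ g o k Ω → (g + o * k) * Ω ≡ o * (k * Ω) + g * Ω
  lem = solve-∀ ℚring

-- Jensen's inequality by repeated Cauchy-Schwarz. `F` may change sign, as truncated functions do;
-- this is why the exponents are powers of two.
weighted-power : {A : Set} (xs : List A) (a F : A → ℚ) (η : ℚ) → (∀ x → 0ℚ ≤ a x) → ∑ xs a ≤ η → ∀ v →
  (∑[ x ∈ xs ] (a x * F x)) ^ℚ (2 ℕ.^ v) ≤ η ^ℚ (2 ℕ.^ v ℕ.∸ 1) * ∑[ x ∈ xs ] (a x * F x ^ℚ (2 ℕ.^ v))
weighted-power xs a F η a≥0 le zero = ≤≡ (trans (QP.*-identityʳ _) (trans (∑-cong xs λ x → cong (a x *_) (sym (QP.*-identityʳ (F x)))) (sym (QP.*-identityˡ _))))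
weighted-power xs a F η a≥0 le (suc v) = begin
  S ^ℚ (2 ℕ.^ suc v)
    ≡⟨ ^-^ S 2 (2 ℕ.^ v) ⟩
  (S ^ℚ 2) ^ℚ (2 ℕ.^ v)
    ≤⟨ ^-mono (≤-trans (sq≥0 S) (≤≡ (cong (S *_) (sym (QP.*-identityʳ S))))) sq≤ (2 ℕ.^ v) ⟩
  (η * S₂) ^ℚ (2 ℕ.^ v)
    ≡⟨ ^-* η S₂ (2 ℕ.^ v) ⟩
  η ^ℚ (2 ℕ.^ v) * S₂ ^ℚ (2 ℕ.^ v)
    ≤⟨ *-monoˡ _ (^-≥0 η≥0 (2 ℕ.^ v)) (weighted-power xs a (λ x → F x ^ℚ 2) η a≥0 le v) ⟩
  η ^ℚ (2 ℕ.^ v) * (η ^ℚ (2 ℕ.^ v ℕ.∸ 1) * ∑[ x ∈ xs ] (a x * (F x ^ℚ 2) ^ℚ (2 ℕ.^ v)))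
    ≡⟨ trans (sym (QP.*-assoc (η ^ℚ (2 ℕ.^ v)) (η ^ℚ (2 ℕ.^ v ℕ.∸ 1)) _)) (cong₂ _*_ (trans (sym (^-+ η (2 ℕ.^ v) (2 ℕ.^ v ℕ.∸ 1))) (cong (η ^ℚ_) expo)) (∑-cong xs λ x → cong (a x *_) (sym (^-^ (F x) 2 (2 ℕ.^ v))))) ⟩
  η ^ℚ (2 ℕ.^ suc v ℕ.∸ 1) * ∑[ x ∈ xs ] (a x * F x ^ℚ (2 ℕ.^ suc v)) ∎
  where
  open QP.≤-Reasoning
  S = ∑[ x ∈ xs ] (a x * F x)
  S₂ = ∑[ x ∈ xs ] (a x * F x ^ℚ 2)
  η≥0 : 0ℚ ≤ η
  η≥0 = ≤-trans (∑-≥0 xs a≥0) le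
  F²≥0 : ∀ x → 0ℚ ≤ F x ^ℚ 2
  F²≥0 x = ≤-trans (sq≥0 (F x)) (≤≡ (cong (F x *_) (sym (QP.*-identityʳ (F x)))))
  lem : ∀ a f → a * f * (a * f) ≡ 1ℚ * (a * (a * (f * (f * 1ℚ))))
  lem = solve-∀ ℚring
  sq≤ : S ^ℚ 2 ≤ η * S₂
  sq≤ = ≤-trans (≤≡ (cong (S *_) (QP.*-identityʳ S))) (≤-trans (∑-CS xs 1ℚ (λ x → a x * F x) a (λ x → a x * F x ^ℚ 2) 0≤1 a≥0 (λ x → *-≥0 (a≥0 x) (F²≥0 x)) (λ x → ≤≡ (lem (a x) (F x))))
    (≤-trans (≤≡ (QP.*-identityˡ _)) (*-monoʳ S₂ (∑-≥0 xs λ x → *-≥0 (a≥0 x) (F²≥0 x)) le)))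
  expo : 2 ℕ.^ v ℕ.+ (2 ℕ.^ v ℕ.∸ 1) ≡ 2 ℕ.^ suc v ℕ.∸ 1
  expo = trans (sym (NP.+-∸-assoc (2 ℕ.^ v) (NP.m^n>0 2 v))) (cong (ℕ._∸ 1) (cong (2 ℕ.^ v ℕ.+_) (sym (NP.+-identityʳ _))))

Glob-mean : ∀ {b h} {g : M n d → ℚ} → Glob b h g → hp (d ℕ.* n) * ∑ (allM n d) g ≤ hp h
Glob-mean {n} {d} {b} {h} {g} G = *-cancelˡ-≤ (pw h) (pw>0 h) (subst₂ _≤_ (*-swap (hp (d ℕ.* n)) (pw h) _) (trans (trans (cong (hp (d ℕ.* n) *_) (one d)) (hp*pw (d ℕ.* n))) (sym (pw*hp h)))
  (*-monoˡ (hp (d ℕ.* n)) (hp≥0 (d ℕ.* n)) (≤-trans (≤≡ (cong (pw h *_) (∑-cong (allM n d) λ N → sym (QP.*-identityˡ (g N))))) (zoom G [] ℕ.z≤n))))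
  where
  one : ∀ d → ∑[ N ∈ allM n d ] 1ℚ ≡ pw (d ℕ.* n)
  one zero = refl
  one (suc d) = trans (∑-allM {n} {d} (λ _ → 1ℚ)) (trans (∑-cong (allV n) λ _ → one d) (trans (∑-const n (pw (d ℕ.* n))) (sym (pw-+ n (d ℕ.* n)))))

-- By Plancherel `norm² Φ` is the mean of `g · F`. Hölder with exponent `q = 2^(v+1)` bounds its
-- `q`-th power by `(2^(-h))^(q-1)` times the `q`-th moment of `F`, which is at most
-- `(2^(c-w))^(q/2)` by `norm-pow`. So `w` may be replaced by `h - h/q + (w - c)/2`.
Lev-step : ∀ (r h v c w w' : ℕ) → (∀ i → i ℕ.≤ r → gam i (2 ℕ.^ v) ≤ pw c) → Lev r h (hp w) →
  (2 ℕ.^ suc v) ℕ.* w' ℕ.+ (2 ℕ.^ v) ℕ.* c ℕ.≤ h ℕ.* (2 ℕ.^ suc v ℕ.∸ 1) ℕ.+ (2 ℕ.^ v) ℕ.* w → Lev r h (hp w')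
Lev-step r h v c w w' gb lev num {n} {d} i i≤r g G = ^-cancel-≤ (hp≥0 w') (2 ℕ.^ suc v ℕ.∸ 1) (subst₂ (λ a b → norm² Φ ^ℚ a ≤ hp w' ^ℚ b) (sym sucpred) (sym sucpred) main) (Char.norm≥0 (MC n d) Φ)
  where
  open QP.≤-Reasoning
  s = 2 ℕ.^ v
  Φ = P i (hat g)
  F = val Φ
  η = hp (d ℕ.* n)
  sucpred : suc (2 ℕ.^ suc v ℕ.∸ 1) ≡ 2 ℕ.^ suc v
  sucpred = NP.suc-pred (2 ℕ.^ suc v) {{NP.m^n≢0 2 (suc v)}}
  lev' : Lev i h (hp w)
  lev' j j≤i g' G' = lev j (NP.≤-trans j≤i i≤r) g' G'
  normE : norm² Φ ≡ ∑[ N ∈ allM n d ] (η * g N * F N)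
  normE = trans (∑-cong (allM n d) λ X → trans (idem (rk X ℕ.<ᵇ i) (hat g X)) (trans (*-swap (Φ X) η (val g X)) (cong (η *_) (sym (∑-*ˡ (allM n d) (Φ X) _)))))
    (trans (∑-*ˡ (allM n d) η _) (trans (cong (η *_) (∑-swap (allM n d) (allM n d) _)) (trans (sym (∑-*ˡ (allM n d) η _)) (∑-cong (allM n d) λ N →
      trans (cong (η *_) (trans (∑-cong (allM n d) λ X → trans (rearr (Φ X) (σ (dotM N X)) (g N)) (cong (λ z → g N * (σ z * Φ X)) (dotM-comm N X))) (∑-*ˡ (allM n d) (g N) _))) (sym (QP.*-assoc η (g N) (F N)))))))
    where
    idem : ∀ b x → ⟦ b ⟧ * x * (⟦ b ⟧ * x) ≡ ⟦ b ⟧ * x * x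
    idem false x = lem x
      where
      lem : ∀ x → 0ℚ * x * (0ℚ * x) ≡ 0ℚ * x * x
      lem = solve-∀ ℚring
    idem true x = cong (1ℚ * x *_) (QP.*-identityˡ x)
    rearr : ∀ a b c → a * (b * c) ≡ c * (b * a)
    rearr = solve-∀ ℚring
  s+s : 2 ℕ.^ suc v ≡ s ℕ.+ s
  s+s = cong (s ℕ.+_) (NP.+-identityʳ s)
  ev : ∀ N → 0ℚ ≤ F N ^ℚ (2 ℕ.^ suc v)
  ev N = subst (λ t → 0ℚ ≤ F N ^ℚ t) (sym s+s) (≤-trans (sq≥0 (F N ^ℚ s)) (≤≡ (sym (^-+ (F N) s s))))
  main : norm² Φ ^ℚ (2 ℕ.^ suc v) ≤ hp w' ^ℚ (2 ℕ.^ suc v)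
  main = begin
    norm² Φ ^ℚ (2 ℕ.^ suc v)
      ≡⟨ cong (_^ℚ (2 ℕ.^ suc v)) normE ⟩
    (∑[ N ∈ allM n d ] (η * g N * F N)) ^ℚ (2 ℕ.^ suc v)
      ≤⟨ weighted-power (allM n d) (λ N → η * g N) F (hp h) (λ N → *-≥0 (hp≥0 (d ℕ.* n)) (g≥0 G N)) (≤-trans (≤≡ (∑-*ˡ (allM n d) η g)) (Glob-mean G)) (suc v) ⟩
    hp h ^ℚ (2 ℕ.^ suc v ℕ.∸ 1) * ∑[ N ∈ allM n d ] (η * g N * F N ^ℚ (2 ℕ.^ suc v))
      ≤⟨ *-monoˡ _ (^-≥0 (hp≥0 h) (2 ℕ.^ suc v ℕ.∸ 1)) (≤-trans (∑-mono (allM n d) λ N → *-monoʳ _ (ev N) (≤-trans (*-monoˡ η (hp≥0 (d ℕ.* n)) (g≤1 G N)) (≤≡ (QP.*-identityʳ η)))) (≤≡ (∑-*ˡ (allM n d) η _))) ⟩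
    hp h ^ℚ (2 ℕ.^ suc v ℕ.∸ 1) * (η * ∑[ N ∈ allM n d ] (F N ^ℚ (2 ℕ.^ suc v)))
      ≡⟨ cong (hp h ^ℚ (2 ℕ.^ suc v ℕ.∸ 1) *_) (trans (cong (η *_) (∑-cong (allM n d) λ N → cong (F N ^ℚ_) s+s)) (moment Φ s)) ⟩
    hp h ^ℚ (2 ℕ.^ suc v ℕ.∸ 1) * norm² (pow Φ s)
      ≤⟨ *-monoˡ _ (^-≥0 (hp≥0 h) (2 ℕ.^ suc v ℕ.∸ 1)) (≤-trans (norm-pow i h (hp w) (hp≥0 w) lev' g G s) (^-mono (*-≥0 (gam≥0 i s) (hp≥0 w)) (*-monoʳ (hp w) (hp≥0 w) (gb i i≤r)) s)) ⟩
    hp h ^ℚ (2 ℕ.^ suc v ℕ.∸ 1) * (pw c * hp w) ^ℚ s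
      ≡⟨ cong₂ _*_ (sym (^-^ ½ h (2 ℕ.^ suc v ℕ.∸ 1))) (trans (^-* (pw c) (hp w) s) (cong₂ _*_ (trans (sym (^-^ two c s)) (cong pw (NP.*-comm c s))) (trans (sym (^-^ ½ w s)) (cong hp (NP.*-comm w s))))) ⟩
    hp (h ℕ.* (2 ℕ.^ suc v ℕ.∸ 1)) * (pw (s ℕ.* c) * hp (s ℕ.* w))
      ≡⟨ trans (*-swap (hp (h ℕ.* (2 ℕ.^ suc v ℕ.∸ 1))) (pw (s ℕ.* c)) (hp (s ℕ.* w))) (cong (pw (s ℕ.* c) *_) (sym (hp-+ (h ℕ.* (2 ℕ.^ suc v ℕ.∸ 1)) (s ℕ.* w)))) ⟩
    pw (s ℕ.* c) * hp (h ℕ.* (2 ℕ.^ suc v ℕ.∸ 1) ℕ.+ s ℕ.* w)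
      ≤⟨ *-monoˡ _ (pw≥0 (s ℕ.* c)) (hp-anti num) ⟩
    pw (s ℕ.* c) * hp ((2 ℕ.^ suc v) ℕ.* w' ℕ.+ s ℕ.* c)
      ≡⟨ trans (cong (pw (s ℕ.* c) *_) (trans (hp-+ ((2 ℕ.^ suc v) ℕ.* w') (s ℕ.* c)) (QP.*-comm _ (hp (s ℕ.* c))))) (trans (sym (QP.*-assoc (pw (s ℕ.* c)) (hp (s ℕ.* c)) _)) (trans (cong (_* hp ((2 ℕ.^ suc v) ℕ.* w')) (pw*hp (s ℕ.* c))) (QP.*-identityˡ _))) ⟩
    hp ((2 ℕ.^ suc v) ℕ.* w')
      ≡⟨ trans (cong hp (NP.*-comm (2 ℕ.^ suc v) w')) (^-^ ½ w' (2 ℕ.^ suc v)) ⟩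
    hp w' ^ℚ (2 ℕ.^ suc v) ∎

-- Constants independent of the dimensions

Bdd : ℚ → Set
Bdd q = ∃ λ c → q ≤ pw c

Bdd-+ : ∀ {p q} → Bdd p → Bdd q → Bdd (p + q)
Bdd-+ {p} {q} (a , pa) (b , qb) = suc (a ℕ.+ b) , ≤-trans (QP.+-mono-≤ (≤-trans pa (pw-mono (NP.m≤m+n a b))) (≤-trans qb (pw-mono (NP.m≤n+m b a)))) (≤≡ (lem (pw (a ℕ.+ b))))
  where
  lem : ∀ x → x + x ≡ two * x
  lem = solve-∀ ℚring

Bdd-* : ∀ {p q} → 0ℚ ≤ p → 0ℚ ≤ q → Bdd p → Bdd q → Bdd (p * q)
Bdd-* p≥0 q≥0 (a , pa) (b , qb) = a ℕ.+ b , ≤-trans (*-mono p≥0 q≥0 pa qb) (≤≡ (sym (pw-+ a b)))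

Bdd-pw : ∀ k → Bdd (pw k)
Bdd-pw k = k , ≤-refl

Bdd-two : Bdd two
Bdd-two = 1 , ≤≡ (sym (QP.*-identityʳ two))

Bdd-OPc : ∀ R → Bdd (OPc R)
Bdd-OPc zero = 0 , 0≤1
Bdd-OPc (suc R) = Bdd-* 0≤two (+-≥0 (genC≥0 R) (*-≥0 (OPc≥0 R) pp≥0)) Bdd-two (Bdd-+ {genC R} ((R ℕ.+ R) ℕ.* (R ℕ.+ R) , ≤≡ (sym (^-^ two (R ℕ.+ R) (R ℕ.+ R))))
    (Bdd-* {OPc R} (OPc≥0 R) pp≥0 (Bdd-OPc R) (Bdd-* (pw≥0 (dirC R)) (pw≥0 (dirC R)) (Bdd-pw (dirC R)) (Bdd-pw (dirC R)))))
  where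
  pp≥0 = *-≥0 (pw≥0 (dirC R)) (pw≥0 (dirC R))

Bdd-κ : ∀ R j → Bdd (κ R j)
Bdd-κ zero j = 0 , ≤-refl
Bdd-κ (suc R) zero = 0 , ≤-refl
Bdd-κ (suc R) (suc j) = Bdd-+ {1ℚ} (0 , ≤-refl) (Bdd-* 0≤two s≥0 Bdd-two (Bdd-+ {κ R j} (Bdd-κ R j) (Bdd-* 0≤two r≥0 Bdd-two
    (Bdd-+ {pw j * pw j * κ R (suc j)} (part (suc j)) (part j)))))
  where
  pp≥0 = *-≥0 (pw≥0 j) (pw≥0 j)
  part : ∀ i → Bdd (pw j * pw j * κ R i)
  part i = Bdd-* pp≥0 (κ≥0 R i) (Bdd-* (pw≥0 j) (pw≥0 j) (Bdd-pw j) (Bdd-pw j)) (Bdd-κ R i)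
  r≥0 = +-≥0 (*-≥0 pp≥0 (κ≥0 R (suc j))) (*-≥0 pp≥0 (κ≥0 R j))
  s≥0 = +-≥0 (κ≥0 R j) (*-≥0 0≤two r≥0)

Bdd-gam : ∀ r s → Bdd (gam r s)
Bdd-gam r zero = 0 , 0≤1
Bdd-gam r (suc s) = Bdd-+ {gam r s} (Bdd-gam r s) (Bdd-* (OPc≥0 (rkOf r (suc s))) (κ≥0 (rkOf r (suc s)) r) (Bdd-OPc (rkOf r (suc s))) (Bdd-κ (rkOf r (suc s)) r))

gam-bound : ∀ r s → ∃ λ c → ∀ i → i ℕ.≤ r → gam i s ≤ pw c
gam-bound zero s = let (c , p) = Bdd-gam 0 s in c , λ { zero ℕ.z≤n → p }
gam-bound (suc r) s = let (c , p) = gam-bound r s ; (c' , p') = Bdd-gam (suc r) s in c ℕ.+ c' , λ i i≤ → case NP.m≤n⇒m<n∨m≡n i≤ of λ where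
  (inj₁ (ℕ.s≤s q)) → ≤-trans (p i q) (pw-mono (NP.m≤m+n c c'))
  (inj₂ refl) → ≤-trans p' (pw-mono (NP.m≤n+m c' c))

-- Iteration of the level inequality

∑M-1 : ∀ n d → ∑[ N ∈ allM n d ] 1ℚ ≡ pw (d ℕ.* n)
∑M-1 n zero = refl
∑M-1 n (suc d) = trans (∑-allM {n} {d} (λ _ → 1ℚ)) (trans (∑-cong (allV n) λ _ → ∑M-1 n d) (trans (∑-const n (pw (d ℕ.* n))) (sym (pw-+ n (d ℕ.* n)))))

norm-hat : (g : M n d → ℚ) → norm² (hat g) ≡ hp (d ℕ.* n) * ∑[ N ∈ allM n d ] (g N * g N)
norm-hat {n} {d} g = begin
  ∑[ X ∈ allM n d ] (η * val g X * (η * val g X))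
    ≡⟨ trans (∑-cong (allM n d) λ X → *-interchange η (val g X) η (val g X)) (∑-*ˡ (allM n d) (η * η) _) ⟩
  η * η * ∑[ X ∈ allM n d ] (val g X * val g X)
    ≡⟨ cong (η * η *_) (Char.plancherel (MC n d) g g) ⟩
  η * η * (pw (d ℕ.* n) * S)
    ≡⟨ trans (lem η (pw (d ℕ.* n)) S) (trans (cong (_* (η * S)) (hp*pw (d ℕ.* n))) (QP.*-identityˡ _)) ⟩
  η * S ∎
  where
  open ≡-Reasoning
  η = hp (d ℕ.* n)
  S = ∑[ N ∈ allM n d ] (g N * g N)
  lem : ∀ a p s → a * a * (p * s) ≡ a * p * (a * s)
  lem = solve-∀ ℚring

sq≤self : ∀ {x} → 0ℚ ≤ x → x ≤ 1ℚ → x * x ≤ x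
sq≤self {x} p q = ≤-trans (*-monoˡ x p q) (≤≡ (QP.*-identityʳ x))

norm-hat-Glob : ∀ {b h} {g : M n d → ℚ} → Glob b h g → norm² (hat g) ≤ hp h
norm-hat-Glob {n} {d} {g = g} G = ≤-trans (≤≡ (norm-hat g)) (≤-trans (*-monoˡ (hp (d ℕ.* n)) (hp≥0 (d ℕ.* n)) (∑-mono (allM n d) λ N → sq≤self (g≥0 G N) (g≤1 G N))) (Glob-mean G))

⟦⟧*≤ : ∀ b {x} → 0ℚ ≤ x → ⟦ b ⟧ * x ≤ x
⟦⟧*≤ b {x} x≥0 = ≤-trans (*-monoʳ x x≥0 (⟦⟧≤1 b)) (≤≡ (QP.*-identityˡ x))

Lev-0 : ∀ r h → Lev r h (hp 0)
Lev-0 r h {n} {d} i i≤r g G = ≤-trans (∑-mono (allM n d) λ X → ≤-trans (≤≡ (*-interchange ⟦ rk X ℕ.<ᵇ i ⟧ (hat g X) ⟦ rk X ℕ.<ᵇ i ⟧ (hat g X))) (≤-trans (≤≡ (cong (_* (hat g X * hat g X)) (⟦⟧*⟦⟧ (rk X ℕ.<ᵇ i)))) (⟦⟧*≤ (rk X ℕ.<ᵇ i) (sq≥0 (hat g X)))))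
  (≤-trans (norm-hat-Glob G) (hp≤1 h))

-- Since `h ≤ 2^v t`, one step reaches `h + (w - c - t)/2`. This map has the fixed point
-- `2h - t - c` and halves the distance to it, here from `2τ` to `τ`.
Lev-conclude : ∀ (r h v c t w' τ : ℕ) → (∀ i → i ℕ.≤ r → gam i (2 ℕ.^ v) ≤ pw c) → h ℕ.≤ 2 ℕ.^ v ℕ.* t → w' ℕ.+ (t ℕ.+ c ℕ.+ τ) ℕ.≤ 2 ℕ.* h →
  ∀ w → Lev r h (hp w) → 2 ℕ.* h ℕ.≤ w ℕ.+ (t ℕ.+ c ℕ.+ 2 ℕ.* τ) → Lev r h (hp w')
Lev-conclude r h v c t w' τ gb h≤ le w lev big = Lev-step r h v c w w' gb lev (NP.+-cancelʳ-≤ h _ _ (begin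
  2 ℕ.* s ℕ.* w' ℕ.+ s ℕ.* c ℕ.+ h             ≤⟨ NP.+-monoʳ-≤ (2 ℕ.* s ℕ.* w' ℕ.+ s ℕ.* c) h≤ ⟩
  2 ℕ.* s ℕ.* w' ℕ.+ s ℕ.* c ℕ.+ s ℕ.* t       ≡⟨ e₁ s w' c t ⟩
  s ℕ.* (2 ℕ.* w' ℕ.+ (t ℕ.+ c))               ≤⟨ NP.*-monoʳ-≤ s core ⟩
  s ℕ.* (2 ℕ.* h ℕ.+ w)                        ≡⟨ e₂ s h w ⟩
  h ℕ.* (2 ℕ.* s) ℕ.+ s ℕ.* w                  ≡⟨ cong (λ z → h ℕ.* z ℕ.+ s ℕ.* w) (sym (NP.m∸n+n≡m (NP.m^n>0 2 (suc v)))) ⟩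
  h ℕ.* (2 ℕ.* s ℕ.∸ 1 ℕ.+ 1) ℕ.+ s ℕ.* w      ≡⟨ e₃ h (2 ℕ.* s ℕ.∸ 1) (s ℕ.* w) ⟩
  h ℕ.* (2 ℕ.* s ℕ.∸ 1) ℕ.+ s ℕ.* w ℕ.+ h ∎))
  where
  open NP.≤-Reasoning
  s = 2 ℕ.^ v
  e₁ : ∀ s w c t → 2 ℕ.* s ℕ.* w ℕ.+ s ℕ.* c ℕ.+ s ℕ.* t ≡ s ℕ.* (2 ℕ.* w ℕ.+ (t ℕ.+ c))
  e₁ = NS.solve-∀
  e₂ : ∀ s h w → s ℕ.* (2 ℕ.* h ℕ.+ w) ≡ h ℕ.* (2 ℕ.* s) ℕ.+ s ℕ.* w
  e₂ = NS.solve-∀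
  e₃ : ∀ h x y → h ℕ.* (x ℕ.+ 1) ℕ.+ y ≡ h ℕ.* x ℕ.+ y ℕ.+ h
  e₃ = NS.solve-∀
  e₄ : ∀ w t c τ → 2 ℕ.* w ℕ.+ (t ℕ.+ c) ℕ.+ (t ℕ.+ c ℕ.+ 2 ℕ.* τ) ≡ 2 ℕ.* (w ℕ.+ (t ℕ.+ c ℕ.+ τ))
  e₄ = NS.solve-∀
  e₅ : ∀ h w k → 2 ℕ.* h ℕ.+ (w ℕ.+ k) ≡ 2 ℕ.* h ℕ.+ w ℕ.+ k
  e₅ = NS.solve-∀
  e₆ : ∀ h → 2 ℕ.* (2 ℕ.* h) ≡ 2 ℕ.* h ℕ.+ 2 ℕ.* h
  e₆ = NS.solve-∀
  core : 2 ℕ.* w' ℕ.+ (t ℕ.+ c) ℕ.≤ 2 ℕ.* h ℕ.+ w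
  core = NP.+-cancelʳ-≤ (t ℕ.+ c ℕ.+ 2 ℕ.* τ) _ _ (begin
    2 ℕ.* w' ℕ.+ (t ℕ.+ c) ℕ.+ (t ℕ.+ c ℕ.+ 2 ℕ.* τ)   ≡⟨ e₄ w' t c τ ⟩
    2 ℕ.* (w' ℕ.+ (t ℕ.+ c ℕ.+ τ))                      ≤⟨ NP.*-monoʳ-≤ 2 le ⟩
    2 ℕ.* (2 ℕ.* h)                                      ≡⟨ e₆ h ⟩
    2 ℕ.* h ℕ.+ 2 ℕ.* h                                  ≤⟨ NP.+-monoʳ-≤ (2 ℕ.* h) big ⟩
    2 ℕ.* h ℕ.+ (w ℕ.+ (t ℕ.+ c ℕ.+ 2 ℕ.* τ))           ≡⟨ e₅ h w (t ℕ.+ c ℕ.+ 2 ℕ.* τ) ⟩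
    2 ℕ.* h ℕ.+ w ℕ.+ (t ℕ.+ c ℕ.+ 2 ℕ.* τ) ∎)

-- Iterating Lev-step halves the distance of w from 2h - t - c.
Level : ∀ (r h v c t : ℕ) → (∀ i → i ℕ.≤ r → gam i (2 ℕ.^ v) ≤ pw c) → h ℕ.≤ 2 ℕ.^ v ℕ.* t →
  ∀ I τ → 2 ℕ.* h ℕ.≤ 2 ℕ.^ I ℕ.* τ → ∀ w → w ℕ.+ (t ℕ.+ c ℕ.+ τ) ℕ.≤ 2 ℕ.* h → Lev r h (hp w)
Level r h v c t gb h≤ zero τ big zero le = Lev-0 r h
-- Without a step left, `2h ≤ τ` allows only `w = 0`.
Level r h v c t gb h≤ zero τ big (suc w) le = ⊥-elim (NP.<⇒≱ (NP.≤-trans (ℕ.s≤s (NP.≤-trans (NP.≤-trans big (NP.≤-reflexive (NP.+-identityʳ τ))) (NP.≤-trans (NP.m≤n+m τ (t ℕ.+ c)) (NP.m≤n+m _ w)))) le) NP.≤-refl)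
Level r h v c t gb h≤ (suc I) τ big w' le with (t ℕ.+ c ℕ.+ 2 ℕ.* τ) ℕ.≤? 2 ℕ.* h
... | yes q = Lev-conclude r h v c t w' τ gb h≤ le (2 ℕ.* h ℕ.∸ (t ℕ.+ c ℕ.+ 2 ℕ.* τ))
    (Level r h v c t gb h≤ I (2 ℕ.* τ) (subst (2 ℕ.* h ℕ.≤_) (trans (cong (ℕ._* τ) (NP.*-comm 2 (2 ℕ.^ I))) (NP.*-assoc (2 ℕ.^ I) 2 τ)) big) (2 ℕ.* h ℕ.∸ (t ℕ.+ c ℕ.+ 2 ℕ.* τ)) (NP.≤-reflexive (NP.m∸n+n≡m q)))
    (NP.≤-reflexive (sym (NP.m∸n+n≡m q)))
... | no q = Lev-conclude r h v c t w' τ gb h≤ le 0 (Lev-0 r h) (NP.≰⇒≥ q)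

-- Functions of the column span and averages over columns

SameSpan : M n d → M n d → Set
SameSpan N N' = ∀ x → inSp N x ≡ inSp N' x

Inv : (M n d → ℚ) → Set
Inv f = ∀ N N' → SameSpan N N' → f N ≡ f N'

-- As a shear, the average inherits globalness from `Glob-shear` and its coefficients from `sh-hat`.
avg₁ : (M n (suc d) → ℚ) → M n d → ℚ
avg₁ = shear 0v 0v

avg₁-eq : (f : M n (suc d) → ℚ) (N : M n d) → avg₁ f N ≡ hp n * ∑[ v ∈ allV n ] f (v ∷ N)
avg₁-eq {n} f N = cong (hp n *_) (∑-cong (allV n) λ v → cong (λ z → f (v ∷ z)) (trans (cong (_⊕ N) (o v)) (⊕M-idˡ N)))
  where
  o : ∀ {d} v → outer {n} {d} (0v ⊕v v) 0v ≡ 0M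
  o {zero} v = refl
  o {suc d} v = cong (0v ∷_) (o v)

SameSpan-∷ : ∀ v (N N' : M n d) → SameSpan N N' → SameSpan (v ∷ N) (v ∷ N')
SameSpan-∷ v N N' s x = cong₂ _∨_ (s x) (s (x ⊕v v))

Inv-avg₁ : {f : M n (suc d) → ℚ} → Inv f → Inv (avg₁ f)
Inv-avg₁ {n} {f = f} inv N N' s = trans (avg₁-eq f N) (trans (cong (hp n *_) (∑-cong (allV n) λ v → inv (v ∷ N) (v ∷ N') (SameSpan-∷ v N N' s))) (sym (avg₁-eq f N')))

SameSpan-outer : ∀ (v : V n) (l : V d) (N : M n d) → SameSpan (v ∷ (outer v l ⊕ N)) (v ∷ N)
SameSpan-outer v l N x = ≡-from-iff
  (λ e → case inSp-sound (v ∷ (outer v l ⊕ N)) x e of λ { (c ∷ u , p) → inSp-complete (v ∷ N) ((c xor dot l u) ∷ u) (trans (sym (conv c u)) p) })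
  (λ e → case inSp-sound (v ∷ N) x e of λ { (c ∷ u , p) → inSp-complete (v ∷ (outer v l ⊕ N)) ((c xor dot l u) ∷ u) (trans (conv (c xor dot l u) u) (trans (cong (λ z → sc z v ⊕v N · u) (xx c (dot l u))) p)) })
  where
  xx : ∀ a b → (a xor b) xor b ≡ a
  xx a b = trans (BP.xor-assoc a b b) (trans (cong (a xor_) (BP.xor-same b)) (BP.xor-identityʳ a))
  conv : ∀ c u → (v ∷ (outer v l ⊕ N)) · (c ∷ u) ≡ (v ∷ N) · ((c xor dot l u) ∷ u)
  conv c u = trans (cong (sc c v ⊕v_) (trans (⊕-· (outer v l) N u) (cong (_⊕v N · u) (outer-· v l u)))) (trans (sym (⊕-assoc (sc c v) (sc (dot l u) v) (N · u))) (cong (_⊕v N · u) (sym (sc-xor c (dot l u) v))))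

-- Adding multiples of the first column to the others preserves the span. On coefficients this
-- substitution translates the first column by `X · l`.
hat-inv : {f : M n (suc d) → ℚ} → Inv f → ∀ (l : V d) (X : M n d) → hat f (X · l ∷ X) ≡ hat f (0v ∷ X)
hat-inv {n} {d} {f} inv l X = sym (cong (hp (suc d ℕ.* n) *_) (begin
  val f (0v ∷ X)
    ≡⟨ ∑-allM (λ N → σ (dotM N (0v ∷ X)) * f N) ⟩
  ∑[ v ∈ allV n ] ∑[ N ∈ allM n d ] (σ (dot v 0v xor dotM N X) * f (v ∷ N))
    ≡⟨ ∑-cong (allV n) (λ v → sym (∑-shiftM (outer v l) (λ N → σ (dot v 0v xor dotM N X) * f (v ∷ N)))) ⟩
  ∑[ v ∈ allV n ] ∑[ N ∈ allM n d ] (σ (dot v 0v xor dotM (outer v l ⊕ N) X) * f (v ∷ (outer v l ⊕ N)))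
    ≡⟨ ∑-cong (allV n) (λ v → ∑-cong (allM n d) λ N → cong₂ (λ a b → σ a * b) (trans (cong₂ _xor_ (dot-0ʳ v) (dotM-⊕ˡ (outer v l) N X)) (cong (_xor dotM N X) (dotM-outer v l X))) (inv _ _ (SameSpan-outer v l N))) ⟩
  ∑[ v ∈ allV n ] ∑[ N ∈ allM n d ] (σ (dot v (X · l) xor dotM N X) * f (v ∷ N))
    ≡⟨ sym (∑-allM (λ N → σ (dotM N (X · l ∷ X)) * f N)) ⟩
  val f (X · l ∷ X) ∎))
  where open ≡-Reasoning

hi : ℕ → (M n d → ℚ) → ℚ
hi {n} {d} r φ = ∑[ X ∈ allM n d ] (⟦ r ℕ.≤ᵇ rk X ⟧ * (φ X * φ X))

-- A column-addition invariant f̂ is constant on the 2^(rk X) points of span X ∷ X, so dropping a column costs a factor 2^(-rk X).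
hi-avg₁ : ∀ r {f : M n (suc d) → ℚ} → Inv f → pw r * hi r (hat (avg₁ f)) ≤ hi r (hat f)
hi-avg₁ {n} {d} r {f} inv = ≤-trans (≤≡ (sym (∑-*ˡ (allM n d) (pw r) _))) (≤-trans (∑-mono (allM n d) ptw)
    (≤≡ (trans (∑-swap (allM n d) (allV n) _) (sym (∑-allM (λ X → ⟦ r ℕ.≤ᵇ rk X ⟧ * (hat f X * hat f X)))))))
  where
  φ = hat f
  φ² : M n (suc d) → ℚ
  φ² X = φ X * φ X
  hatA : ∀ X → hat (avg₁ f) X ≡ φ (0v ∷ X)
  hatA X = trans (sym (sh-hat 0v 0v f X)) (trans (cong₂ (λ a b → σ a * φ (b ∷ X)) (dot-0ʳ (X · 0v)) (·-0 X)) (QP.*-identityˡ _))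
  fib : ∀ X → pw (rk X) * φ² (0v ∷ X) ≡ ∑[ x ∈ allV n ] (⟦ inSp X x ⟧ * φ² (x ∷ X))
  fib X = begin
    pw (rk X) * φ² (0v ∷ X)
      ≡⟨ sym (QP.*-identityˡ _) ⟩
    1ℚ * (pw (rk X) * φ² (0v ∷ X))
      ≡⟨ trans (cong (_* (pw (rk X) * φ² (0v ∷ X))) (sym (hp*pw d))) (lem (hp d) (pw d) (pw (rk X)) (φ² (0v ∷ X))) ⟩
    hp d * (pw (rk X) * (pw d * φ² (0v ∷ X)))
      ≡⟨ cong (λ z → hp d * (pw (rk X) * z)) (trans (sym (∑-const d (φ² (0v ∷ X)))) (∑-cong (allV d) λ l → sym (cong (λ z → z * z) (hat-inv inv l X)))) ⟩
    hp d * (pw (rk X) * ∑[ l ∈ allV d ] φ² (X · l ∷ X))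
      ≡⟨ cong (hp d *_) (∑-fib X (λ x → φ² (x ∷ X))) ⟩
    hp d * (pw d * ∑[ x ∈ allV n ] (⟦ inSp X x ⟧ * φ² (x ∷ X)))
      ≡⟨ trans (sym (QP.*-assoc (hp d) (pw d) _)) (trans (cong (_* ∑[ x ∈ allV n ] (⟦ inSp X x ⟧ * φ² (x ∷ X))) (hp*pw d)) (QP.*-identityˡ _)) ⟩
    ∑[ x ∈ allV n ] (⟦ inSp X x ⟧ * φ² (x ∷ X)) ∎
    where
    open ≡-Reasoning
    lem : ∀ a b c e → a * b * (c * e) ≡ a * (c * (b * e))
    lem = solve-∀ ℚring
  φ²≥0 : ∀ X → 0ℚ ≤ φ² X
  φ²≥0 X = sq≥0 (φ X)
  ptw : ∀ X → pw r * (⟦ r ℕ.≤ᵇ rk X ⟧ * (hat (avg₁ f) X * hat (avg₁ f) X)) ≤ ∑[ x ∈ allV n ] (⟦ r ℕ.≤ᵇ rk (x ∷ X) ⟧ * φ² (x ∷ X))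
  ptw X = bool-cases (r ℕ.≤ᵇ rk X)
    (λ e → ≤-trans (≤≡ (cong (pw r *_) (trans (cong₂ (λ a b → ⟦ a ⟧ * (b * b)) e (hatA X)) (QP.*-identityˡ _))))
       (≤-trans (*-monoʳ (φ² (0v ∷ X)) (φ²≥0 (0v ∷ X)) (pw-mono (≤ᵇ-sound {r} {rk X} e))) (≤-trans (≤≡ (fib X)) (∑-mono (allV n) λ x →
         ≤-trans (⟦⟧*≤ (inSp X x) (φ²≥0 (x ∷ X))) (≤≡ (sym (trans (cong (λ z → ⟦ z ⟧ * φ² (x ∷ X)) (≤ᵇ-complete (NP.≤-trans (≤ᵇ-sound {r} {rk X} e) (rk≥ x)))) (QP.*-identityˡ _))))))))
    (λ e → ≤-trans (≤≡ (trans (cong (λ z → pw r * (⟦ z ⟧ * (hat (avg₁ f) X * hat (avg₁ f) X))) e) (trans (cong (pw r *_) (QP.*-zeroˡ (hat (avg₁ f) X * hat (avg₁ f) X))) (QP.*-zeroʳ (pw r)))))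
       (∑-≥0 (allV n) λ x → *-≥0 (⟦⟧≥0 (r ℕ.≤ᵇ rk (x ∷ X))) (φ²≥0 (x ∷ X))))
    where
    rk≥ : ∀ x → rk X ℕ.≤ rk (x ∷ X)
    rk≥ x with inSp X x
    ... | true = NP.≤-refl
    ... | false = NP.n≤1+n _

avgs : ∀ t → (M n (t ℕ.+ d) → ℚ) → M n d → ℚ
avgs zero f = f
avgs (suc t) f = avgs t (avg₁ f)

Glob-avgs : ∀ {b h} t {f : M n (t ℕ.+ d) → ℚ} → Glob b h f → Glob b h (avgs t f)
Glob-avgs zero G = G
Glob-avgs (suc t) G = Glob-avgs t (Glob-shear 0v 0v G)

hi-avgs : ∀ r t {f : M n (t ℕ.+ d) → ℚ} → Inv f → pw (t ℕ.* r) * hi r (hat (avgs t f)) ≤ hi r (hat f)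
hi-avgs r zero inv = ≤≡ (QP.*-identityˡ _)
hi-avgs r (suc t) {f} inv = ≤-trans (≤≡ (trans (cong (_* hi r (hat (avgs t (avg₁ f)))) (pw-+ r (t ℕ.* r))) (QP.*-assoc (pw r) (pw (t ℕ.* r)) _)))
  (≤-trans (*-monoˡ (pw r) (pw≥0 r) (hi-avgs r t (Inv-avg₁ inv))) (hi-avg₁ r inv))

hi-bound : ∀ {b h} r t {f : M n (t ℕ.+ d) → ℚ} → Inv f → Glob b h f → hi r (hat (avgs t f)) ≤ hp (t ℕ.* r ℕ.+ h)
hi-bound {n} {d} {b} {h} r t {f} inv G = *-cancelˡ-≤ (pw (t ℕ.* r)) (pw>0 (t ℕ.* r)) (≤-trans (hi-avgs r t inv) (≤-trans (∑-mono (allM n (t ℕ.+ d)) λ X → ⟦⟧*≤ (r ℕ.≤ᵇ rk X) (sq≥0 (hat f X)))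
  (≤-trans (norm-hat-Glob G) (≤≡ (sym (trans (cong (pw (t ℕ.* r) *_) (hp-+ (t ℕ.* r) h)) (trans (sym (QP.*-assoc (pw (t ℕ.* r)) (hp (t ℕ.* r)) (hp h))) (trans (cong (_* hp h) (pw*hp (t ℕ.* r))) (QP.*-identityˡ _)))))))))

-- Either `x² ≤ 4 H²`, and then `x^(2k) ≤ x²` because `x ≤ 1`; or `2 H ≤ x`, and then `x ≤ 2 F`.
-- Only the square of the high part is thus needed.
split-power : ∀ {x F H} k → 0ℚ ≤ x → x ≤ 1ℚ → x ≡ F + H → x ^ℚ (2 ℕ.* suc k) ≤ pw (2 ℕ.* suc k) * F ^ℚ (2 ℕ.* suc k) + pw 2 * (H * H)
split-power {x} {F} {H} k x≥0 x≤1 eq with QP.≤-total (x * x) (pw 2 * (H * H))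
... | inj₁ small = ≤-trans (≤-trans (≤≡ (^-^ x 2 (suc k))) (≤-trans (*-monoˡ (x ^ℚ 2) x²≥0 (≤-trans (^-mono x²≥0 (≤-trans (≤≡ x²) (≤-trans (sq≤self x≥0 x≤1) x≤1)) k) (≤≡ (1^ k)))) (≤≡ (trans (QP.*-identityʳ _) x²)))) (≤-trans small (diff≤ (pw K * F ^ℚ K) (*-≥0 (pw≥0 K) even) (QP.+-comm (pw K * F ^ℚ K) _)))
  where
  K = 2 ℕ.* suc k
  x² : x ^ℚ 2 ≡ x * x
  x² = cong (x *_) (QP.*-identityʳ x)
  x²≥0 : 0ℚ ≤ x ^ℚ 2
  x²≥0 = ≤-trans (sq≥0 x) (≤≡ (sym x²))
  even : 0ℚ ≤ F ^ℚ K
  even = ≤-trans (^-≥0 (≤-trans (sq≥0 F) (≤≡ (sym (cong (F *_) (QP.*-identityʳ F))))) (suc k)) (≤≡ (sym (^-^ F 2 (suc k))))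
... | inj₂ H-small = ≤-trans (≤-trans (≤≡ (^-^ x 2 (suc k))) (≤-trans (^-mono x²≥0 x²≤ (suc k)) (≤≡ (trans (^-* (pw 2) (F ^ℚ 2) (suc k)) (cong₂ _*_ (sym (^-^ two 2 (suc k))) (sym (^-^ F 2 (suc k))))))))
    (diff≤ (pw 2 * (H * H)) (*-≥0 (pw≥0 2) (sq≥0 H)) refl)
  where
  sq' : ∀ y → y ^ℚ 2 ≡ y * y
  sq' y = cong (y *_) (QP.*-identityʳ y)
  x²≥0 : 0ℚ ≤ x ^ℚ 2
  x²≥0 = ≤-trans (sq≥0 x) (≤≡ (sym (sq' x)))
  four : ∀ y → pw 2 * (y * y) ≡ two * y * (two * y)
  four = solve-∀ ℚring
  2H≤x : two * H ≤ x
  2H≤x = sq-cancel-≤ x≥0 (≤-trans (≤≡ (sym (four H))) H-small)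
  x≤2F : x ≤ two * F
  x≤2F = ≤-trans (≤-trans (diff≤ (x - two * H) (≤⇒0≤- 2H≤x) (lem x H)) (≤≡ (cong (λ z → two * z - two * H) eq))) (≤≡ (lem₂ F H))
    where
    lem : ∀ x H → two * x - two * H ≡ x + (x - two * H)
    lem = solve-∀ ℚring
    lem₂ : ∀ F H → two * (F + H) - two * H ≡ two * F
    lem₂ = solve-∀ ℚring
  x²≤ : x ^ℚ 2 ≤ pw 2 * F ^ℚ 2
  x²≤ = ≤-trans (≤≡ (sq' x)) (≤-trans (*-mono x≥0 x≥0 x≤2F x≤2F) (≤≡ (trans (sym (four F)) (cong (pw 2 *_) (sym (sq' F))))))

val-hat : (g : M n d → ℚ) (N : M n d) → val (hat g) N ≡ g N
val-hat {n} {d} g N = begin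
  ∑[ X ∈ allM n d ] (σ (dotM X N) * (η * val g X))
    ≡⟨ trans (∑-cong (allM n d) λ X → trans (*-swap (σ (dotM X N)) η (val g X)) (cong (λ z → η * (σ z * val g X)) (dotM-comm X N))) (∑-*ˡ (allM n d) η _) ⟩
  η * ∑[ X ∈ allM n d ] (σ (dotM N X) * val g X)
    ≡⟨ cong (η *_) (Char.ft-inv (MC n d) g N) ⟩
  η * (pw (d ℕ.* n) * g N)
    ≡⟨ trans (sym (QP.*-assoc η (pw (d ℕ.* n)) (g N))) (trans (cong (_* g N) (hp*pw (d ℕ.* n))) (QP.*-identityˡ _)) ⟩
  g N ∎
  where
  open ≡-Reasoning
  η = hp (d ℕ.* n)

val-hi : ∀ r (g : M n d → ℚ) → let H = λ N → g N - val (P r (hat g)) N in hp (d ℕ.* n) * ∑[ N ∈ allM n d ] (H N * H N) ≡ hi r (hat g)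
val-hi {n} {d} r g = begin
  η * ∑[ N ∈ allM n d ] (H N * H N)
    ≡⟨ cong (η *_) (∑-cong (allM n d) λ N → cong (λ z → z * z) (Heq N)) ⟩
  η * ∑[ N ∈ allM n d ] (val Q N * val Q N)
    ≡⟨ cong (η *_) (Char.plancherel (MC n d) Q Q) ⟩
  η * (pw (d ℕ.* n) * norm² Q)
    ≡⟨ trans (sym (QP.*-assoc η (pw (d ℕ.* n)) (norm² Q))) (trans (cong (_* norm² Q) (hp*pw (d ℕ.* n))) (QP.*-identityˡ _)) ⟩
  norm² Q
    ≡⟨ ∑-cong (allM n d) (λ X → trans (*-interchange ⟦ r ℕ.≤ᵇ rk X ⟧ (hat g X) ⟦ r ℕ.≤ᵇ rk X ⟧ (hat g X)) (cong (_* (hat g X * hat g X)) (⟦⟧*⟦⟧ (r ℕ.≤ᵇ rk X)))) ⟩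
  hi r (hat g) ∎
  where
  open ≡-Reasoning
  η = hp (d ℕ.* n)
  H : M n d → ℚ
  H N = g N - val (P r (hat g)) N
  Q : M n d → ℚ
  Q X = ⟦ r ℕ.≤ᵇ rk X ⟧ * hat g X
  compl : ∀ X → ⟦ rk X ℕ.<ᵇ r ⟧ + ⟦ r ℕ.≤ᵇ rk X ⟧ ≡ 1ℚ
  compl X with r ℕ.≤? rk X
  ... | yes p = cong₂ (λ a b → ⟦ a ⟧ + ⟦ b ⟧) (<ᵇ-false p) (≤ᵇ-complete p)
  ... | no p = cong₂ (λ a b → ⟦ a ⟧ + ⟦ b ⟧) (<ᵇ-complete (NP.≰⇒> p)) (BP.¬-not λ e → p (≤ᵇ-sound {r} {rk X} e))
  lem : ∀ s p q x → s * x ≡ s * (p * x) + s * (q * x) + (1ℚ - (p + q)) * (s * x)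
  lem = solve-∀ ℚring
  lem₂ : ∀ a b → a + b - a ≡ b
  lem₂ = solve-∀ ℚring
  lem₃ : ∀ s p q x → p + q ≡ 1ℚ → s * x ≡ s * (p * x) + s * (q * x)
  lem₃ s p q x e = trans (lem s p q x) (trans (cong (λ z → s * (p * x) + s * (q * x) + (1ℚ - z) * (s * x)) e) (trans (cong (s * (p * x) + s * (q * x) +_) (QP.*-zeroˡ (s * x))) (QP.+-identityʳ _)))
  Heq : ∀ N → H N ≡ val Q N
  Heq N = trans (cong (_- val (P r (hat g)) N) (trans (sym (val-hat g N)) (trans (∑-cong (allM n d) λ X → lem₃ (σ (dotM X N)) ⟦ rk X ℕ.<ᵇ r ⟧ ⟦ r ℕ.≤ᵇ rk X ⟧ (hat g X) (compl X)) (∑-+ (allM n d) _ _)))) (lem₂ (val (P r (hat g)) N) (val Q N))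

-- The moment bound for the degree-(r-1) part and the spectral bound for the rest, averaged over a family of global functions.
core : ∀ r k v I → ∃ λ c → ∀ {X : Set} (xs : List X) (γ : ℚ) → 0ℚ ≤ γ → ∑[ x ∈ xs ] γ ≤ 1ℚ →
  ∀ n t D (f : X → M n (t ℕ.+ D) → ℚ) (a : X → M n D → ℚ) → (∀ x → Inv (f x)) → (∀ x → Glob r D (f x)) →
  (∀ x N → 0ℚ ≤ a x N) → (∀ x N → a x N ≤ 1ℚ) → ∑[ x ∈ xs ] ∑[ N ∈ allM n D ] (γ * hp (D ℕ.* n) * a x N) ≤ hp D →
  D ℕ.≤ 2 ℕ.^ v ℕ.* t → 2 ℕ.* D ℕ.≤ 2 ℕ.^ I ℕ.* t → t ℕ.+ c ℕ.+ t ℕ.+ c ℕ.≤ 2 ℕ.* D → t ℕ.≤ D →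
  ∑[ x ∈ xs ] ∑[ N ∈ allM n D ] (γ * hp (D ℕ.* n) * a x N * avgs t (f x) N ^ℚ (2 ℕ.* suc k)) ≤
    pw (2 ℕ.* suc k) * hp (D ℕ.∸ t ℕ.+ suc k ℕ.* (2 ℕ.* D ℕ.∸ (t ℕ.+ c ℕ.+ t) ℕ.∸ c)) + pw 2 * hp (t ℕ.* r ℕ.+ D)
core r k v I = c , main
  where
  s' = suc k ℕ.* 2 ℕ.^ v
  b₁ = gam-bound r (2 ℕ.^ v)
  b₂ = gam-bound r s'
  -- One constant for two uses of the moment bound: with `s = 2^v` in the level inequality and with
  -- `s = k 2^v` in the final estimate.
  c = proj₁ b₁ ℕ.+ proj₁ b₂
  gb : ∀ i → i ℕ.≤ r → gam i (2 ℕ.^ v) ≤ pw c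
  gb i p = ≤-trans (proj₂ b₁ i p) (pw-mono (NP.m≤m+n (proj₁ b₁) (proj₁ b₂)))
  gb' : gam r s' ≤ pw c
  gb' = ≤-trans (proj₂ b₂ r NP.≤-refl) (pw-mono (NP.m≤n+m (proj₁ b₂) (proj₁ b₁)))
  K = 2 ℕ.* suc k
  main : ∀ {X : Set} (xs : List X) (γ : ℚ) → 0ℚ ≤ γ → ∑[ x ∈ xs ] γ ≤ 1ℚ →
    ∀ n t D (f : X → M n (t ℕ.+ D) → ℚ) (a : X → M n D → ℚ) → (∀ x → Inv (f x)) → (∀ x → Glob r D (f x)) →
    (∀ x N → 0ℚ ≤ a x N) → (∀ x N → a x N ≤ 1ℚ) → ∑[ x ∈ xs ] ∑[ N ∈ allM n D ] (γ * hp (D ℕ.* n) * a x N) ≤ hp D →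
    D ℕ.≤ 2 ℕ.^ v ℕ.* t → 2 ℕ.* D ℕ.≤ 2 ℕ.^ I ℕ.* t → t ℕ.+ c ℕ.+ t ℕ.+ c ℕ.≤ 2 ℕ.* D → t ℕ.≤ D →
    ∑[ x ∈ xs ] ∑[ N ∈ allM n D ] (γ * hp (D ℕ.* n) * a x N * avgs t (f x) N ^ℚ K) ≤
      pw K * hp (D ℕ.∸ t ℕ.+ suc k ℕ.* (2 ℕ.* D ℕ.∸ (t ℕ.+ c ℕ.+ t) ℕ.∸ c)) + pw 2 * hp (t ℕ.* r ℕ.+ D)
  main {X} xs γ γ≥0 ∑γ n t D f a inv G a≥0 a≤1 ∑a D≤ 2D≤ small t≤D = begin
    ∑[ x ∈ xs ] ∑[ N ∈ 𝕄 ] (γ * η * a x N * g x N ^ℚ K)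
      ≤⟨ ∑-mono xs (λ x → ∑-mono 𝕄 λ N → ptw x N) ⟩
    ∑[ x ∈ xs ] ∑[ N ∈ 𝕄 ] (pw K * (γ * η * a x N * F x N ^ℚ K) + pw 2 * (γ * (η * (H x N * H x N))))
      ≡⟨ trans (∑-cong xs λ x → trans (∑-+ 𝕄 _ _) (cong₂ _+_ (∑-*ˡ 𝕄 (pw K) _) (trans (∑-*ˡ 𝕄 (pw 2) _) (cong (pw 2 *_) (trans (∑-*ˡ 𝕄 γ _) (cong (γ *_) (trans (∑-*ˡ 𝕄 η _) (val-hi r (g x)))))))))
           (trans (∑-+ xs _ _) (cong₂ _+_ (∑-*ˡ xs (pw K) _) (∑-*ˡ xs (pw 2) _))) ⟩
    pw K * U + pw 2 * ∑[ x ∈ xs ] (γ * hi r (hat (g x)))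
      ≤⟨ QP.+-mono-≤ (*-monoˡ (pw K) (pw≥0 K) U≤) (*-monoˡ (pw 2) (pw≥0 2) (≤-trans (∑-mono xs λ x → *-monoˡ γ γ≥0 (hi-bound r t (inv x) (G x)))
           (≤-trans (≤≡ (∑-*ʳ xs (hp (t ℕ.* r ℕ.+ D)) (λ _ → γ))) (≤-trans (*-monoʳ (hp (t ℕ.* r ℕ.+ D)) (hp≥0 (t ℕ.* r ℕ.+ D)) ∑γ) (≤≡ (QP.*-identityˡ (hp (t ℕ.* r ℕ.+ D)))))))) ⟩
    pw K * hp Ex + pw 2 * hp (t ℕ.* r ℕ.+ D) ∎
    where
    open QP.≤-Reasoning
    𝕄 = allM n D
    η = hp (D ℕ.* n)
    η≥0 : 0ℚ ≤ η
    η≥0 = hp≥0 (D ℕ.* n)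
    w = 2 ℕ.* D ℕ.∸ (t ℕ.+ c ℕ.+ t)
    w-eq : w ℕ.+ (t ℕ.+ c ℕ.+ t) ≡ 2 ℕ.* D
    w-eq = NP.m∸n+n≡m (NP.≤-trans (NP.m≤m+n (t ℕ.+ c ℕ.+ t) c) small)
    c≤w : c ℕ.≤ w
    c≤w = NP.+-cancelˡ-≤ (t ℕ.+ c ℕ.+ t) c w (NP.≤-trans small (NP.≤-reflexive (trans (sym w-eq) (NP.+-comm w _))))
    Ex = D ℕ.∸ t ℕ.+ suc k ℕ.* (w ℕ.∸ c)
    g : X → M n D → ℚ
    g x = avgs t (f x)
    Gg : ∀ x → Glob r D (g x)
    Gg x = Glob-avgs t (G x)
    F H : X → M n D → ℚ
    F x = val (P r (hat (g x)))
    H x N = g x N - F x N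
    U = ∑[ x ∈ xs ] ∑[ N ∈ 𝕄 ] (γ * η * a x N * F x N ^ℚ K)
    lev : Lev r D (hp w)
    lev = Level r D v c t gb D≤ I t 2D≤ w (NP.≤-reflexive w-eq)
    wt≥ : ∀ x N → 0ℚ ≤ γ * η * a x N
    wt≥ x N = *-≥0 (*-≥0 γ≥0 η≥0) (a≥0 x N)
    ptw : ∀ x N → γ * η * a x N * g x N ^ℚ K ≤ pw K * (γ * η * a x N * F x N ^ℚ K) + pw 2 * (γ * (η * (H x N * H x N)))
    ptw x N = ≤-trans (*-monoˡ _ (wt≥ x N) (split-power {g x N} {F x N} {H x N} k (g≥0 (Gg x) N) (g≤1 (Gg x) N) (lem₁ (g x N) (F x N))))
      (≤-trans (≤≡ (lem₂ (γ * η * a x N) (pw K) (F x N ^ℚ K) (pw 2) (H x N * H x N))) (QP.+-monoʳ-≤ (pw K * (γ * η * a x N * F x N ^ℚ K)) (*-monoˡ (pw 2) (pw≥0 2)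
        (≤-trans (*-monoʳ _ (sq≥0 (H x N)) (≤-trans (*-monoˡ (γ * η) (*-≥0 γ≥0 η≥0) (a≤1 x N)) (≤≡ (QP.*-identityʳ (γ * η))))) (≤≡ (QP.*-assoc γ η _))))))
      where
      lem₁ : ∀ g f → g ≡ f + (g - f)
      lem₁ = solve-∀ ℚring
      lem₂ : ∀ w p f q h → w * (p * f + q * h) ≡ p * (w * f) + q * (w * h)
      lem₂ = solve-∀ ℚring
    pairs : List (X × M n D)
    pairs = cartesianProduct xs 𝕄
    ∑∑ : ∀ (h : X → M n D → ℚ) → ∑[ p ∈ pairs ] h (proj₁ p) (proj₂ p) ≡ ∑[ x ∈ xs ] ∑[ N ∈ 𝕄 ] h x N
    ∑∑ h = ∑-cartesian xs 𝕄 _,_ (λ p → h (proj₁ p) (proj₂ p))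
    F^≥0 : ∀ x N m → 0ℚ ≤ F x N ^ℚ (2 ℕ.* m)
    F^≥0 x N m = ≤-trans (^-≥0 (≤-trans (sq≥0 (F x N)) (≤≡ (sym (cong (F x N *_) (QP.*-identityʳ (F x N)))))) m) (≤≡ (sym (^-^ (F x N) 2 m)))
    Kv : K ℕ.* 2 ℕ.^ v ≡ 2 ℕ.* s'
    Kv = NP.*-assoc 2 (suc k) (2 ℕ.^ v)
    -- Hölder with exponent `2^v` against weights of total mass at most `2^(-D)`. This keeps the
    -- factor `2^(-D)` up to the fraction `2^(-v)` of its exponent, whereas bounding `a` by 1 at
    -- once would lose it.
    Upow : U ^ℚ (2 ℕ.^ v) ≤ hp D ^ℚ (2 ℕ.^ v ℕ.∸ 1) * (pw c * hp w) ^ℚ s'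
    Upow = begin
      U ^ℚ (2 ℕ.^ v)
        ≡⟨ cong (_^ℚ (2 ℕ.^ v)) (sym (∑∑ (λ x N → γ * η * a x N * F x N ^ℚ K))) ⟩
      (∑[ p ∈ pairs ] (γ * η * a (proj₁ p) (proj₂ p) * F (proj₁ p) (proj₂ p) ^ℚ K)) ^ℚ (2 ℕ.^ v)
        ≤⟨ weighted-power pairs (λ p → γ * η * a (proj₁ p) (proj₂ p)) (λ p → F (proj₁ p) (proj₂ p) ^ℚ K) (hp D) (λ p → wt≥ (proj₁ p) (proj₂ p)) (≤-trans (≤≡ (∑∑ (λ x N → γ * η * a x N))) ∑a) v ⟩
      hp D ^ℚ (2 ℕ.^ v ℕ.∸ 1) * ∑[ p ∈ pairs ] (γ * η * a (proj₁ p) (proj₂ p) * (F (proj₁ p) (proj₂ p) ^ℚ K) ^ℚ (2 ℕ.^ v))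
        ≤⟨ *-monoˡ _ (^-≥0 (hp≥0 D) (2 ℕ.^ v ℕ.∸ 1)) (≤-trans (≤≡ (∑∑ (λ x N → γ * η * a x N * (F x N ^ℚ K) ^ℚ (2 ℕ.^ v)))) inner) ⟩
      hp D ^ℚ (2 ℕ.^ v ℕ.∸ 1) * (pw c * hp w) ^ℚ s' ∎
      where
      term : ∀ x N → γ * η * a x N * (F x N ^ℚ K) ^ℚ (2 ℕ.^ v) ≤ γ * (η * F x N ^ℚ (s' ℕ.+ s'))
      term x N = ≤-trans (≤≡ (cong (γ * η * a x N *_) (trans (sym (^-^ (F x N) K (2 ℕ.^ v))) (cong (F x N ^ℚ_) Kv))))
        (≤-trans (*-monoʳ _ (F^≥0 x N s') (≤-trans (*-monoˡ (γ * η) (*-≥0 γ≥0 η≥0) (a≤1 x N)) (≤≡ (QP.*-identityʳ (γ * η)))))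
          (≤≡ (trans (QP.*-assoc γ η _) (cong (λ z → γ * (η * F x N ^ℚ z)) (cong (s' ℕ.+_) (NP.+-identityʳ s'))))))
      inner : ∑[ x ∈ xs ] ∑[ N ∈ 𝕄 ] (γ * η * a x N * (F x N ^ℚ K) ^ℚ (2 ℕ.^ v)) ≤ (pw c * hp w) ^ℚ s'
      inner = begin
        ∑[ x ∈ xs ] ∑[ N ∈ 𝕄 ] (γ * η * a x N * (F x N ^ℚ K) ^ℚ (2 ℕ.^ v))
          ≤⟨ ∑-mono xs (λ x → ∑-mono 𝕄 λ N → term x N) ⟩
        ∑[ x ∈ xs ] ∑[ N ∈ 𝕄 ] (γ * (η * F x N ^ℚ (s' ℕ.+ s')))
          ≡⟨ ∑-cong xs (λ x → trans (∑-*ˡ 𝕄 γ _) (cong (γ *_) (trans (∑-*ˡ 𝕄 η _) (moment (P r (hat (g x))) s')))) ⟩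
        ∑[ x ∈ xs ] (γ * norm² (pow (P r (hat (g x))) s'))
          ≤⟨ ∑-mono xs (λ x → *-monoˡ γ γ≥0 (≤-trans (norm-pow r D (hp w) (hp≥0 w) lev (g x) (Gg x) s') (^-mono (*-≥0 (gam≥0 r s') (hp≥0 w)) (*-monoʳ (hp w) (hp≥0 w) gb') s'))) ⟩
        ∑[ x ∈ xs ] (γ * (pw c * hp w) ^ℚ s')
          ≡⟨ ∑-*ʳ xs ((pw c * hp w) ^ℚ s') (λ _ → γ) ⟩
        ∑[ x ∈ xs ] γ * (pw c * hp w) ^ℚ s'
          ≤⟨ *-monoʳ _ (^-≥0 (*-≥0 (pw≥0 c) (hp≥0 w)) s') ∑γ ⟩
        1ℚ * (pw c * hp w) ^ℚ s'
          ≡⟨ QP.*-identityˡ _ ⟩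
        (pw c * hp w) ^ℚ s' ∎
    expo : Ex ℕ.* 2 ℕ.^ v ℕ.+ s' ℕ.* c ℕ.≤ D ℕ.* (2 ℕ.^ v ℕ.∸ 1) ℕ.+ s' ℕ.* w
    expo = NP.≤-trans (NP.≤-reflexive (trans (e₁ (D ℕ.∸ t) (suc k) (w ℕ.∸ c) (2 ℕ.^ v) c) (cong (λ z → (D ℕ.∸ t) ℕ.* 2 ℕ.^ v ℕ.+ suc k ℕ.* 2 ℕ.^ v ℕ.* z) (NP.m∸n+n≡m c≤w)))) (NP.+-monoˡ-≤ (s' ℕ.* w) part)
      where
      e₁ : ∀ p k x v c → (p ℕ.+ k ℕ.* x) ℕ.* v ℕ.+ k ℕ.* v ℕ.* c ≡ p ℕ.* v ℕ.+ k ℕ.* v ℕ.* (x ℕ.+ c)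
      e₁ = NS.solve-∀
      -- The exponent lost by Hölder is `D / 2^v`, which is at most `t`.
      part : (D ℕ.∸ t) ℕ.* 2 ℕ.^ v ℕ.≤ D ℕ.* (2 ℕ.^ v ℕ.∸ 1)
      part = NP.≤-trans (NP.≤-reflexive (NP.*-distribʳ-∸ (2 ℕ.^ v) D t)) (NP.≤-trans (NP.∸-monoʳ-≤ (D ℕ.* 2 ℕ.^ v) (NP.≤-trans D≤ (NP.≤-reflexive (NP.*-comm (2 ℕ.^ v) t))))
        (NP.≤-reflexive (trans (cong (D ℕ.* 2 ℕ.^ v ℕ.∸_) (sym (NP.*-identityʳ D))) (sym (NP.*-distribˡ-∸ D (2 ℕ.^ v) 1)))))
    U≥0 : 0ℚ ≤ U
    U≥0 = ∑-≥0 xs λ x → ∑-≥0 𝕄 λ N → *-≥0 (wt≥ x N) (F^≥0 x N (suc k))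
    U≤ : U ≤ hp Ex
    U≤ = ^-cancel-≤ (hp≥0 Ex) (2 ℕ.^ v ℕ.∸ 1) (subst₂ (λ x y → U ^ℚ x ≤ hp Ex ^ℚ y) (sym sucpred) (sym sucpred) (≤-trans Upow fin)) U≥0
      where
      sucpred : suc (2 ℕ.^ v ℕ.∸ 1) ≡ 2 ℕ.^ v
      sucpred = NP.suc-pred (2 ℕ.^ v) {{NP.m^n≢0 2 v}}
      fin : hp D ^ℚ (2 ℕ.^ v ℕ.∸ 1) * (pw c * hp w) ^ℚ s' ≤ hp Ex ^ℚ (2 ℕ.^ v)
      fin = begin
        hp D ^ℚ (2 ℕ.^ v ℕ.∸ 1) * (pw c * hp w) ^ℚ s'
          ≡⟨ cong₂ _*_ (sym (^-^ ½ D (2 ℕ.^ v ℕ.∸ 1))) (trans (^-* (pw c) (hp w) s') (cong₂ _*_ (trans (sym (^-^ two c s')) (cong pw (NP.*-comm c s'))) (trans (sym (^-^ ½ w s')) (cong hp (NP.*-comm w s'))))) ⟩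
        hp (D ℕ.* (2 ℕ.^ v ℕ.∸ 1)) * (pw (s' ℕ.* c) * hp (s' ℕ.* w))
          ≡⟨ trans (*-swap (hp (D ℕ.* (2 ℕ.^ v ℕ.∸ 1))) (pw (s' ℕ.* c)) (hp (s' ℕ.* w))) (cong (pw (s' ℕ.* c) *_) (sym (hp-+ (D ℕ.* (2 ℕ.^ v ℕ.∸ 1)) (s' ℕ.* w)))) ⟩
        pw (s' ℕ.* c) * hp (D ℕ.* (2 ℕ.^ v ℕ.∸ 1) ℕ.+ s' ℕ.* w)
          ≤⟨ *-monoˡ _ (pw≥0 (s' ℕ.* c)) (hp-anti expo) ⟩
        pw (s' ℕ.* c) * hp (Ex ℕ.* 2 ℕ.^ v ℕ.+ s' ℕ.* c)
          ≡⟨ trans (cong (pw (s' ℕ.* c) *_) (trans (hp-+ (Ex ℕ.* 2 ℕ.^ v) (s' ℕ.* c)) (QP.*-comm _ (hp (s' ℕ.* c))))) (trans (sym (QP.*-assoc (pw (s' ℕ.* c)) (hp (s' ℕ.* c)) _)) (trans (cong (_* hp (Ex ℕ.* 2 ℕ.^ v)) (pw*hp (s' ℕ.* c))) (QP.*-identityˡ _))) ⟩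
        hp (Ex ℕ.* 2 ℕ.^ v)
          ≡⟨ ^-^ ½ Ex (2 ℕ.^ v) ⟩
        hp Ex ^ℚ (2 ℕ.^ v) ∎

-- Subspaces and their bases

infixr 5 _⧺_
_⧺_ : ∀ {a b} → M n a → M n b → M n (a ℕ.+ b)
_⧺_ = Vec._++_

mem-tabulateS : (Q : V n → Bool) (v : V n) → mem (tabulateS Q) v ≡ Q v
mem-tabulateS {zero} Q [] = refl
mem-tabulateS {suc n} Q (false ∷ v) = mem-tabulateS (Q ∘ (false ∷_)) v
mem-tabulateS {suc n} Q (true ∷ v) = mem-tabulateS (Q ∘ (true ∷_)) v

VSet-ext : {A B : VSet n} → (∀ v → mem A v ≡ mem B v) → A ≡ B
VSet-ext {zero} h = h []
VSet-ext {suc n} {A₀ , A₁} {B₀ , B₁} h = cong₂ _,_ (VSet-ext λ v → h (false ∷ v)) (VSet-ext λ v → h (true ∷ v))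

_==S_ : VSet n → VSet n → Bool
_==S_ {zero} a b = not (a xor b)
_==S_ {suc n} (A₀ , A₁) (B₀ , B₁) = (A₀ ==S B₀) ∧ (A₁ ==S B₁)

SE : (n : ℕ) → Enum (VSet n)
els (SE n) = allSets n
eq (SE n) = _==S_ {n}
eq-sound (SE n) {x} {y} = go n x y
  where
  go : ∀ n (x y : VSet n) → _==S_ {n} x y ≡ true → x ≡ y
  go zero false false e = refl
  go zero true true e = refl
  go (suc n) (a , a') (b , b') e = cong₂ _,_ (go n a b (proj₁ (∧-true e))) (go n a' b' (proj₂ (∧-true {_==S_ {n} a b} e)))
eq-refl (SE n) = go n
  where
  go : ∀ n (x : VSet n) → _==S_ {n} x x ≡ true
  go zero false = refl
  go zero true = refl
  go (suc n) (a , b) = ∧-intro (go n a) (go n b)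
∑δ (SE n) = go n
  where
  go : ∀ n (y : VSet n) (h : VSet n → ℚ) → ∑[ x ∈ allSets n ] (⟦ _==S_ {n} x y ⟧ * h x) ≡ h y
  go zero false h = lem (h false) (h true)
    where
    lem : ∀ a b → 1ℚ * a + (0ℚ * b + 0ℚ) ≡ a
    lem = solve-∀ ℚring
  go zero true h = lem (h false) (h true)
    where
    lem : ∀ a b → 0ℚ * a + (1ℚ * b + 0ℚ) ≡ b
    lem = solve-∀ ℚring
  go (suc n) (y , y') h = trans (∑-cartesian (allSets n) (allSets n) _,_ (λ x → ⟦ _==S_ {suc n} x (y , y') ⟧ * h x))
    (∑-×δ (allSets n) (allSets n) (λ x → _==S_ {n} x y) (λ x → _==S_ {n} x y') y y' _,_ h (go n y) (go n y'))

∑-len : {A : Set} (xs : List A) → ∑[ x ∈ xs ] 1ℚ ≡ ι (length xs)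
∑-len [] = refl
∑-len (x ∷ xs) = cong (1ℚ +_) (∑-len xs)

len-filter : {A : Set} (Q : A → Bool) (Q? : ∀ x → Dec (Q x ≡ true)) (xs : List A) → ι (length (filter Q? xs)) ≡ ∑[ x ∈ xs ] ⟦ Q x ⟧
len-filter Q Q? xs = trans (sym (∑-len (filter Q? xs))) (trans (∑-filter Q Q? xs (λ _ → 1ℚ)) (∑-cong xs λ x → QP.*-identityʳ _))

card-∑ : (S : VSet n) → ι (card S) ≡ ∑[ v ∈ allV n ] ⟦ mem S v ⟧
card-∑ {n} S = len-filter (mem S) _ (allV n)

ι-inj : ∀ {a b} → ι a ≡ ι b → a ≡ b
ι-inj e = NP.≤-antisym (ι-cancel (≤≡ e)) (ι-cancel (≤≡ (sym e)))

≡ᵇ-sound : ∀ {a b} → (a ℕ.≡ᵇ b) ≡ true → a ≡ b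
≡ᵇ-sound {a} {b} e = NP.≡ᵇ⇒≡ a b (subst Data.Bool.T (sym e) tt)

≡ᵇ-complete : ∀ {a b} → a ≡ b → (a ℕ.≡ᵇ b) ≡ true
≡ᵇ-complete {a} {b} p with a ℕ.≡ᵇ b | NP.≡⇒≡ᵇ a b p
... | true | _ = refl

⇒ᵇ-elim : ∀ {a b} → (a ⇒ᵇ b) ≡ true → a ≡ true → b ≡ true
⇒ᵇ-elim {true} e refl = e

⇒ᵇ-intro : ∀ a {b} → (a ≡ true → b ≡ true) → (a ⇒ᵇ b) ≡ true
⇒ᵇ-intro false h = refl
⇒ᵇ-intro true h = h refl

⊆-elim : {A B : VSet n} → (A ⊆ᵇ B) ≡ true → ∀ v → mem A v ≡ true → mem B v ≡ true
⊆-elim {A = A} {B} e v = ⇒ᵇ-elim {mem A v} {mem B v} (allᵇ-elim e v)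

⊆-intro : {A B : VSet n} → (∀ v → mem A v ≡ true → mem B v ≡ true) → (A ⊆ᵇ B) ≡ true
⊆-intro {A = A} h = allᵇ-intro λ v → ⇒ᵇ-intro (mem A v) (h v)

record IsSub (S : VSet n) : Set where
  field
    has0 : mem S 0v ≡ true
    has+ : ∀ u v → mem S u ≡ true → mem S v ≡ true → mem S (u ⊕v v) ≡ true

open IsSub public

sub-sound : {S : VSet n} → isSubspace S ≡ true → IsSub S
has0 (sub-sound {S = S} e) = proj₁ (∧-true {mem S 0v} e)
has+ (sub-sound {S = S} e) u v p q = ⇒ᵇ-elim {mem S u ∧ mem S v} (allᵇ-elim (allᵇ-elim (proj₂ (∧-true {mem S 0v} e)) u) v) (∧-intro p q)

sub-complete : {S : VSet n} → IsSub S → isSubspace S ≡ true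
sub-complete {S = S} s = ∧-intro (has0 s) (allᵇ-intro λ u → allᵇ-intro λ v → ⇒ᵇ-intro (mem S u ∧ mem S v) λ e → has+ s u v (proj₁ (∧-true e)) (proj₂ (∧-true {mem S u} e)))

grass-sub : ∀ k (S : VSet n) → isGrass k S ≡ true → IsSub S
grass-sub k S e = sub-sound (proj₁ (∧-true {isSubspace S} e))

grass-card : ∀ k (S : VSet n) → isGrass k S ≡ true → ∑[ v ∈ allV n ] ⟦ mem S v ⟧ ≡ pw k
grass-card k S e = trans (sym (card-∑ S)) (trans (cong ι (≡ᵇ-sound {card S} {2 ℕ.^ k} (proj₂ (∧-true {isSubspace S} e)))) (ι-2^ k))

grass-intro : ∀ k (S : VSet n) → IsSub S → ∑[ v ∈ allV n ] ⟦ mem S v ⟧ ≡ pw k → isGrass k S ≡ true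
grass-intro k S s c = ∧-intro (sub-complete s) (≡ᵇ-complete {card S} {2 ℕ.^ k} (ι-inj (trans (card-∑ S) (trans c (sym (ι-2^ k))))))

trivInter-elim : {A B : VSet n} → trivInter A B ≡ true → ∀ v → mem A v ≡ true → mem B v ≡ true → v ≡ 0v
trivInter-elim {A = A} {B} e v p q = ==v-sound (⇒ᵇ-elim {mem A v ∧ mem B v} (allᵇ-elim e v) (∧-intro p q))

trivInter-intro : {A B : VSet n} → (∀ v → mem A v ≡ true → mem B v ≡ true → v ≡ 0v) → trivInter A B ≡ true
trivInter-intro {n} {A} {B} h = allᵇ-intro λ v → ⇒ᵇ-intro (mem A v ∧ mem B v) λ e → eq-complete (VE n) (h v (proj₁ (∧-true e)) (proj₂ (∧-true {mem A v} e)))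

spS : M n d → VSet n
spS N = tabulateS (inSp N)

mem-spS : (N : M n d) (v : V n) → mem (spS N) v ≡ inSp N v
mem-spS N = mem-tabulateS (inSp N)

sub-spS : (N : M n d) → IsSub (spS N)
has0 (sub-spS N) = trans (mem-spS N 0v) (inSp-0 N)
has+ (sub-spS N) u v p q = trans (mem-spS N (u ⊕v v)) (inSp-⊕ N (trans (sym (mem-spS N u)) p) (trans (sym (mem-spS N v)) q))

inSp-⧺ˡ : ∀ {a b} (A : M n a) (B : M n b) x → inSp A x ≡ true → inSp (A ⧺ B) x ≡ true
inSp-⧺ˡ [] B x e = subst (λ z → inSp B z ≡ true) (sym (==v-sound e)) (inSp-0 B)
inSp-⧺ˡ (y ∷ A) B x e with ∨-true {inSp A x} e
... | inj₁ p = ∨-introˡ _ (inSp-⧺ˡ A B x p)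
... | inj₂ p = ∨-introʳ (inSp (A ⧺ B) x) (inSp-⧺ˡ A B (x ⊕v y) p)

inSp-⧺ʳ : ∀ {a b} (A : M n a) (B : M n b) x → inSp B x ≡ true → inSp (A ⧺ B) x ≡ true
inSp-⧺ʳ [] B x e = e
inSp-⧺ʳ (y ∷ A) B x e = ∨-introˡ _ (inSp-⧺ʳ A B x e)

inSp-⧺-split : ∀ {a b} (A : M n a) (B : M n b) x → inSp (A ⧺ B) x ≡ true → ∃ λ y → inSp A y ≡ true × inSp B (x ⊕v y) ≡ true
inSp-⧺-split {n} [] B x e = 0v , ==v-refl (0v {n}) , subst (λ z → inSp B z ≡ true) (sym (⊕-idʳ x)) e
inSp-⧺-split (y ∷ A) B x e with ∨-true {inSp (A ⧺ B) x} e
... | inj₁ p = let (z , q , r) = inSp-⧺-split A B x p in z , ∨-introˡ _ q , r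
... | inj₂ p = let (z , q , r) = inSp-⧺-split A B (x ⊕v y) p in (z ⊕v y) , ∨-introʳ (inSp A (z ⊕v y)) (subst (λ t → inSp A t ≡ true) (sym (⊕-cancelʳ y z)) q) ,
    subst (λ t → inSp B t ≡ true) (trans (⊕-assoc x y z) (cong (x ⊕v_) (⊕-comm y z))) r

inSp-⧺-intro : ∀ {a b} (A : M n a) (B : M n b) {x y} → inSp A x ≡ true → inSp B y ≡ true → inSp (A ⧺ B) (x ⊕v y) ≡ true
inSp-⧺-intro A B {x} {y} p q = inSp-⊕ (A ⧺ B) (inSp-⧺ˡ A B x p) (inSp-⧺ʳ A B y q)

colsIn : VSet n → M n d → Bool
colsIn L [] = true
colsIn L (v ∷ N) = mem L v ∧ colsIn L N

colsIn-sp : {L : VSet n} → IsSub L → (N : M n d) → colsIn L N ≡ true → ∀ x → inSp N x ≡ true → mem L x ≡ true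
colsIn-sp {L = L} s [] c x e = subst (λ z → mem L z ≡ true) (sym (==v-sound e)) (has0 s)
colsIn-sp {L = L} s (v ∷ N) c x e with ∨-true {inSp N x} e
... | inj₁ p = colsIn-sp s N (proj₂ (∧-true {mem L v} c)) x p
... | inj₂ p = subst (λ z → mem L z ≡ true) (⊕-cancelʳ v x) (has+ s (x ⊕v v) v (colsIn-sp s N (proj₂ (∧-true {mem L v} c)) (x ⊕v v) p) (proj₁ (∧-true {mem L v} c)))

sp-colsIn : (L : VSet n) (N : M n d) → (∀ x → inSp N x ≡ true → mem L x ≡ true) → colsIn L N ≡ true
sp-colsIn L [] h = refl
sp-colsIn L (v ∷ N) h = ∧-intro (h v (∨-introʳ (inSp N v) (trans (cong (inSp N) (⊕-self v)) (inSp-0 N)))) (sp-colsIn L N λ x p → h x (∨-introˡ _ p))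

colsIn-⧺ : ∀ {a b} (L : VSet n) (A : M n a) (B : M n b) → colsIn L (A ⧺ B) ≡ colsIn L A ∧ colsIn L B
colsIn-⧺ L [] B = refl
colsIn-⧺ L (v ∷ A) B = trans (cong (mem L v ∧_) (colsIn-⧺ L A B)) (sym (BP.∧-assoc (mem L v) (colsIn L A) (colsIn L B)))

-- Independence modulo the span of `E`. For a matrix `E` spanning H it says that the span of `N` has
-- dimension `d` and is admissible, that is, meets H trivially (`grass-spS`, `triv-spS`).
ind : ∀ {J} → M n J → M n d → Bool
ind E [] = true
ind E (v ∷ N) = ind E N ∧ not (inSp (N ⧺ E) v)

not-true : ∀ {a} → not a ≡ true → a ≡ false
not-true {false} _ = refl

rk-ind : ∀ {J} (E : M n J) (N : M n d) → ind E N ≡ true → rk (N ⧺ E) ≡ d ℕ.+ rk E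
rk-ind E [] e = refl
rk-ind E (v ∷ N) e rewrite not-true (proj₂ (∧-true {ind E N} e)) = cong suc (rk-ind E N (proj₁ (∧-true {ind E N} e)))

ind-⧺ʳ : ∀ {J a b} (E : M n J) (A : M n a) (B : M n b) → ind E (A ⧺ B) ≡ true → ind E B ≡ true
ind-⧺ʳ E [] B e = e
ind-⧺ʳ E (v ∷ A) B e = ind-⧺ʳ E A B (proj₁ (∧-true {ind E (A ⧺ B)} e))

ind-triv : ∀ {J} (E : M n J) (N : M n d) → ind E N ≡ true → ∀ x → inSp N x ≡ true → inSp E x ≡ true → x ≡ 0v
ind-triv E [] e x p q = ==v-sound p
ind-triv E (v ∷ N) e x p q with ∨-true {inSp N x} p
... | inj₁ r = ind-triv E N (proj₁ (∧-true {ind E N} e)) x r q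
... | inj₂ r = false≢true (not-true (proj₂ (∧-true {ind E N} e))) (subst (λ z → inSp (N ⧺ E) z ≡ true) (trans (cong (_⊕v x) (⊕-comm x v)) (⊕-cancelʳ x v)) (inSp-⧺-intro N E r q))

rk-ind₀ : ∀ {J} (E : M n J) (N : M n d) → ind E N ≡ true → rk N ≡ d
rk-ind₀ E [] e = refl
rk-ind₀ {n} E (v ∷ N) e with inSp N v in p
... | true = false≢true (not-true (proj₂ (∧-true {ind E N} e))) (inSp-⧺ˡ N E v p)
... | false = cong suc (rk-ind₀ E N (proj₁ (∧-true {ind E N} e)))

grass-spS : ∀ {J} (E : M n J) (N : M n d) → ind E N ≡ true → isGrass d (spS N) ≡ true
grass-spS {n} {d} E N e = grass-intro d (spS N) (sub-spS N) (trans (∑-cong (allV n) λ v → cong ⟦_⟧ (mem-spS N v)) (trans (∑-sp N) (cong pw (rk-ind₀ E N e))))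

triv-spS : ∀ {J} (E : M n J) (N : M n d) → ind E N ≡ true → trivInter (spS E) (spS N) ≡ true
triv-spS E N e = trivInter-intro λ v p q → ind-triv E N e v (trans (sym (mem-spS N v)) q) (trans (sym (mem-spS E v)) p)

⊆-card : {A B : V n → Bool} → (∀ v → A v ≡ true → B v ≡ true) → ∑[ v ∈ allV n ] ⟦ A v ⟧ ≡ ∑[ v ∈ allV n ] ⟦ B v ⟧ → ∀ v → A v ≡ B v
⊆-card {n} {A} {B} sub e v with A v in a | B v in b
... | true | true = refl
... | false | false = refl
... | true | false = false≢true b (sub v a)
... | false | true = ⊥-elim (<⇒≱ (QP.positive⁻¹ 1ℚ) (≤-trans (≤≡ (sym (cong₂ (λ x y → ⟦ x ⟧ - ⟦ y ⟧) b a))) (≤-trans (≤∑ (VE n) (λ v → ⟦ B v ⟧ - ⟦ A v ⟧) pos v) (≤≡ zero'))))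
  where
  pos : ∀ v → 0ℚ ≤ ⟦ B v ⟧ - ⟦ A v ⟧
  pos v with A v in a | B v in b
  ... | true | true = ≤-refl
  ... | true | false = false≢true b (sub v a)
  ... | false | true = 0≤1
  ... | false | false = ≤-refl
  zero' : ∑[ v ∈ allV n ] (⟦ B v ⟧ - ⟦ A v ⟧) ≡ 0ℚ
  zero' = begin
    ∑[ v ∈ allV n ] (⟦ B v ⟧ - ⟦ A v ⟧)                          ≡⟨ ∑-cong (allV n) (λ v → lem ⟦ B v ⟧ ⟦ A v ⟧) ⟩
    ∑[ v ∈ allV n ] (⟦ B v ⟧ + - 1ℚ * ⟦ A v ⟧)                   ≡⟨ trans (∑-+ (allV n) _ _) (cong (∑[ v ∈ allV n ] ⟦ B v ⟧ +_) (∑-*ˡ (allV n) (- 1ℚ) _)) ⟩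
    ∑[ v ∈ allV n ] ⟦ B v ⟧ + - 1ℚ * ∑[ v ∈ allV n ] ⟦ A v ⟧     ≡⟨ cong (λ z → ∑[ v ∈ allV n ] ⟦ B v ⟧ + - 1ℚ * z) e ⟩
    ∑[ v ∈ allV n ] ⟦ B v ⟧ + - 1ℚ * ∑[ v ∈ allV n ] ⟦ B v ⟧     ≡⟨ lem₂ (∑[ v ∈ allV n ] ⟦ B v ⟧) ⟩
    0ℚ ∎
    where
    open ≡-Reasoning
    lem : ∀ a b → a - b ≡ a + - 1ℚ * b
    lem = solve-∀ ℚring
    lem₂ : ∀ a → a + - 1ℚ * a ≡ 0ℚ
    lem₂ = solve-∀ ℚring

-- The number of ways to extend p independent vectors of a K-dimensional space by t further ones.
cnt : ℕ → ℕ → ℕ → ℚ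
cnt K zero p = 1ℚ
cnt K (suc t) p = (pw K - pw (t ℕ.+ p)) * cnt K t p

∑-compl : (A B : V n → Bool) → (∀ v → B v ≡ true → A v ≡ true) → ∑[ v ∈ allV n ] ⟦ A v ∧ not (B v) ⟧ ≡ ∑[ v ∈ allV n ] ⟦ A v ⟧ - ∑[ v ∈ allV n ] ⟦ B v ⟧
∑-compl {n} A B sub = trans (∑-cong (allV n) ptw) (trans (∑-+ (allV n) _ _) (trans (cong (∑[ v ∈ allV n ] ⟦ A v ⟧ +_) (∑-*ˡ (allV n) (- 1ℚ) (λ v → ⟦ B v ⟧))) (lem (∑[ v ∈ allV n ] ⟦ A v ⟧) (∑[ v ∈ allV n ] ⟦ B v ⟧))))
  where
  lem : ∀ a b → a + - 1ℚ * b ≡ a - b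
  lem = solve-∀ ℚring
  ptw : ∀ v → ⟦ A v ∧ not (B v) ⟧ ≡ ⟦ A v ⟧ + - 1ℚ * ⟦ B v ⟧
  ptw v with A v in a | B v in b
  ... | true | true = refl
  ... | true | false = refl
  ... | false | true = false≢true a (sub v b)
  ... | false | false = refl

-- `L` meets the span of `E` trivially, so inside `L` independence modulo `E` is plain independence.
-- The next column has to avoid a subspace of dimension `t + p` of `L`.
count-inside : ∀ {J p} (E : M n J) (L : VSet n) K → isGrass K L ≡ true → trivInter (spS E) L ≡ true → (Q : M n p) → ind E Q ≡ true → colsIn L Q ≡ true →
  ∀ t → ∑[ C ∈ allM n t ] (⟦ ind E (C ⧺ Q) ⟧ * ⟦ colsIn L C ⟧) ≡ cnt K t p
count-inside E L K gr tr Q iQ cQ zero = trans (QP.+-identityʳ _) (cong₂ (λ a b → ⟦ a ⟧ * b) iQ refl)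
count-inside {n} {J} {p} E L K gr tr Q iQ cQ (suc t) = begin
  ∑[ C ∈ allM n (suc t) ] (⟦ ind E (C ⧺ Q) ⟧ * ⟦ colsIn L C ⟧)
    ≡⟨ trans (∑-allM (λ C → ⟦ ind E (C ⧺ Q) ⟧ * ⟦ colsIn L C ⟧)) (∑-swap (allV n) (allM n t) _) ⟩
  ∑[ C ∈ allM n t ] ∑[ v ∈ allV n ] (⟦ ind E (C ⧺ Q) ∧ not (inSp ((C ⧺ Q) ⧺ E) v) ⟧ * ⟦ mem L v ∧ colsIn L C ⟧)
    ≡⟨ ∑-cong (allM n t) each ⟩
  ∑[ C ∈ allM n t ] ((pw K - pw (t ℕ.+ p)) * (⟦ ind E (C ⧺ Q) ⟧ * ⟦ colsIn L C ⟧))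
    ≡⟨ trans (∑-*ˡ (allM n t) (pw K - pw (t ℕ.+ p)) _) (cong ((pw K - pw (t ℕ.+ p)) *_) (count-inside E L K gr tr Q iQ cQ t)) ⟩
  cnt K (suc t) p ∎
  where
  open ≡-Reasoning
  S = grass-sub K L gr
  each : ∀ C → ∑[ v ∈ allV n ] (⟦ ind E (C ⧺ Q) ∧ not (inSp ((C ⧺ Q) ⧺ E) v) ⟧ * ⟦ mem L v ∧ colsIn L C ⟧) ≡ (pw K - pw (t ℕ.+ p)) * (⟦ ind E (C ⧺ Q) ⟧ * ⟦ colsIn L C ⟧)
  each C with ind E (C ⧺ Q) in i | colsIn L C in c
  ... | false | cc = trans (∑-0 (allV n) λ v → QP.*-zeroˡ ⟦ mem L v ∧ cc ⟧) (sym (trans (cong ((pw K - pw (t ℕ.+ p)) *_) (QP.*-zeroˡ ⟦ cc ⟧)) (QP.*-zeroʳ (pw K - pw (t ℕ.+ p)))))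
  ... | true | false = trans (∑-0 (allV n) λ v → trans (cong (λ z → ⟦ not (inSp ((C ⧺ Q) ⧺ E) v) ⟧ * ⟦ z ⟧) (BP.∧-zeroʳ (mem L v))) (QP.*-zeroʳ ⟦ not (inSp ((C ⧺ Q) ⧺ E) v) ⟧)) (sym (QP.*-zeroʳ (pw K - pw (t ℕ.+ p))))
  ... | true | true = trans (∑-cong (allV n) ptw) (trans (∑-compl (mem L) (inSp (C ⧺ Q)) inL) (trans (cong₂ _-_ (grass-card K L gr) (trans (∑-sp (C ⧺ Q)) (cong pw (rk-ind₀ E (C ⧺ Q) i)))) (sym (QP.*-identityʳ (pw K - pw (t ℕ.+ p))))))
    where
    CQ : colsIn L (C ⧺ Q) ≡ true
    CQ = trans (colsIn-⧺ L C Q) (∧-intro c cQ)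
    inL : ∀ v → inSp (C ⧺ Q) v ≡ true → mem L v ≡ true
    inL = colsIn-sp S (C ⧺ Q) CQ
    same : ∀ v → mem L v ≡ true → inSp ((C ⧺ Q) ⧺ E) v ≡ inSp (C ⧺ Q) v
    same v m = ≡-from-iff (λ q → let (y , a , b) = inSp-⧺-split (C ⧺ Q) E v q in
        subst (λ z → inSp (C ⧺ Q) z ≡ true) (sym (⊕≡0 (trivInter-elim tr (v ⊕v y) (trans (mem-spS E (v ⊕v y)) b) (has+ S v y m (inL y a))))) a)
      (inSp-⧺ˡ (C ⧺ Q) E v)
    ptw : ∀ v → ⟦ not (inSp ((C ⧺ Q) ⧺ E) v) ⟧ * ⟦ mem L v ∧ true ⟧ ≡ ⟦ mem L v ∧ not (inSp (C ⧺ Q) v) ⟧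
    ptw v with mem L v in m
    ... | false = QP.*-zeroʳ ⟦ not (inSp ((C ⧺ Q) ⧺ E) v) ⟧
    ... | true = trans (QP.*-identityʳ _) (cong (λ z → ⟦ not z ⟧) (same v m))

-- Every admissible L is spanned by the same number of independent extensions of Q.
∑-span : ∀ {J p} (E : M n J) (Q : M n p) → ind E Q ≡ true → ∀ t (F : VSet n → ℚ) →
  ∑[ C ∈ allM n t ] (⟦ ind E (C ⧺ Q) ⟧ * F (spS (C ⧺ Q))) ≡ cnt (t ℕ.+ p) t p * ∑[ L ∈ allSets n ] (⟦ isGrass (t ℕ.+ p) L ∧ (trivInter (spS E) L ∧ (spS Q ⊆ᵇ L)) ⟧ * F L)
∑-span {n} {J} {p} E Q iQ t F = begin
  ∑[ C ∈ allM n t ] (⟦ ind E (C ⧺ Q) ⟧ * F (spS (C ⧺ Q)))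
    ≡⟨ ∑-cong (allM n t) (λ C → trans (cong (⟦ ind E (C ⧺ Q) ⟧ *_) (sym (∑δ (SE n) (spS (C ⧺ Q)) F))) (sym (∑-*ˡ (allSets n) ⟦ ind E (C ⧺ Q) ⟧ _))) ⟩
  ∑[ C ∈ allM n t ] ∑[ L ∈ allSets n ] (⟦ ind E (C ⧺ Q) ⟧ * (⟦ _==S_ {n} L (spS (C ⧺ Q)) ⟧ * F L))
    ≡⟨ ∑-swap (allM n t) (allSets n) _ ⟩
  ∑[ L ∈ allSets n ] ∑[ C ∈ allM n t ] (⟦ ind E (C ⧺ Q) ⟧ * (⟦ _==S_ {n} L (spS (C ⧺ Q)) ⟧ * F L))
    ≡⟨ ∑-cong (allSets n) (λ L → trans (∑-cong (allM n t) λ C → sym (QP.*-assoc ⟦ ind E (C ⧺ Q) ⟧ ⟦ _==S_ {n} L (spS (C ⧺ Q)) ⟧ (F L))) (trans (∑-*ʳ (allM n t) (F L) _) (trans (cong (_* F L) (inner L)) (QP.*-assoc (cnt (t ℕ.+ p) t p) ⟦ cond L ⟧ (F L))))) ⟩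
  ∑[ L ∈ allSets n ] (cnt (t ℕ.+ p) t p * (⟦ cond L ⟧ * F L))
    ≡⟨ ∑-*ˡ (allSets n) (cnt (t ℕ.+ p) t p) _ ⟩
  cnt (t ℕ.+ p) t p * ∑[ L ∈ allSets n ] (⟦ cond L ⟧ * F L) ∎
  where
  open ≡-Reasoning
  cond : VSet n → Bool
  cond L = isGrass (t ℕ.+ p) L ∧ (trivInter (spS E) L ∧ (spS Q ⊆ᵇ L))
  inner : ∀ L → ∑[ C ∈ allM n t ] (⟦ ind E (C ⧺ Q) ⟧ * ⟦ _==S_ {n} L (spS (C ⧺ Q)) ⟧) ≡ cnt (t ℕ.+ p) t p * ⟦ cond L ⟧
  inner L = bool-cases (cond L) yes' no'
    where
    yes' : cond L ≡ true → _
    yes' e = trans (∑-cong (allM n t) ptw) (trans (count-inside E L (t ℕ.+ p) gr tr Q iQ cQ t) (sym (trans (cong (λ z → cnt (t ℕ.+ p) t p * ⟦ z ⟧) e) (QP.*-identityʳ _))))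
      where
      gr = proj₁ (∧-true {isGrass (t ℕ.+ p) L} e)
      tr = proj₁ (∧-true {trivInter (spS E) L} (proj₂ (∧-true {isGrass (t ℕ.+ p) L} e)))
      su = proj₂ (∧-true {trivInter (spS E) L} (proj₂ (∧-true {isGrass (t ℕ.+ p) L} e)))
      cQ : colsIn L Q ≡ true
      cQ = sp-colsIn L Q λ x q → ⊆-elim {A = spS Q} {L} su x (trans (mem-spS Q x) q)
      ptw : ∀ C → ⟦ ind E (C ⧺ Q) ⟧ * ⟦ _==S_ {n} L (spS (C ⧺ Q)) ⟧ ≡ ⟦ ind E (C ⧺ Q) ⟧ * ⟦ colsIn L C ⟧
      ptw C = bool-cases (ind E (C ⧺ Q)) (λ i → cong (⟦ ind E (C ⧺ Q) ⟧ *_) (cong ⟦_⟧ (≡-from-iff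
          (λ q → sp-colsIn L C λ x r → subst (λ z → mem z x ≡ true) (sym (eq-sound (SE n) {L} q)) (trans (mem-spS (C ⧺ Q) x) (inSp-⧺ˡ C Q x r)))
          (λ q → eq-complete (SE n) {L} (VSet-ext λ v → trans (sym (⊆-card {A = inSp (C ⧺ Q)} {mem L} (colsIn-sp (grass-sub (t ℕ.+ p) L gr) (C ⧺ Q) (trans (colsIn-⧺ L C Q) (∧-intro q cQ)))
              (trans (∑-sp (C ⧺ Q)) (trans (cong pw (rk-ind₀ E (C ⧺ Q) i)) (sym (grass-card (t ℕ.+ p) L gr)))) v)) (sym (mem-spS (C ⧺ Q) v)))))))
        (λ i → trans (cong (λ z → ⟦ z ⟧ * ⟦ _==S_ {n} L (spS (C ⧺ Q)) ⟧) i) (trans (QP.*-zeroˡ ⟦ _==S_ {n} L (spS (C ⧺ Q)) ⟧) (sym (trans (cong (λ z → ⟦ z ⟧ * ⟦ colsIn L C ⟧) i) (QP.*-zeroˡ ⟦ colsIn L C ⟧)))))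
    no' : cond L ≡ false → _
    no' e = trans (∑-0 (allM n t) ptw) (sym (trans (cong (λ z → cnt (t ℕ.+ p) t p * ⟦ z ⟧) e) (QP.*-zeroʳ (cnt (t ℕ.+ p) t p))))
      where
      ptw : ∀ C → ⟦ ind E (C ⧺ Q) ⟧ * ⟦ _==S_ {n} L (spS (C ⧺ Q)) ⟧ ≡ 0ℚ
      ptw C with ind E (C ⧺ Q) in i | _==S_ {n} L (spS (C ⧺ Q)) in q
      ... | false | s = QP.*-zeroˡ ⟦ s ⟧
      ... | true | false = refl
      ... | true | true = false≢true (trans (cong cond (sym (eq-sound (SE n) {L} q))) e) (∧-intro (grass-spS E (C ⧺ Q) i) (∧-intro (triv-spS E (C ⧺ Q) i)
                (⊆-intro {A = spS Q} λ v m → trans (mem-spS (C ⧺ Q) v) (inSp-⧺ʳ C Q v (trans (sym (mem-spS Q v)) m)))))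

∑-ind : ∀ {J p} (E : M n J) (Q : M n p) → ind E Q ≡ true → ∀ t → ∑[ C ∈ allM n t ] ⟦ ind E (C ⧺ Q) ⟧ ≡ cnt n t (p ℕ.+ rk E)
∑-ind E Q iQ zero = trans (QP.+-identityʳ _) (cong ⟦_⟧ iQ)
∑-ind {n} {J} {p} E Q iQ (suc t) = begin
  ∑[ C ∈ allM n (suc t) ] ⟦ ind E (C ⧺ Q) ⟧
    ≡⟨ trans (∑-allM (λ C → ⟦ ind E (C ⧺ Q) ⟧)) (∑-swap (allV n) (allM n t) _) ⟩
  ∑[ C ∈ allM n t ] ∑[ v ∈ allV n ] ⟦ ind E (C ⧺ Q) ∧ not (inSp ((C ⧺ Q) ⧺ E) v) ⟧
    ≡⟨ ∑-cong (allM n t) (λ C → bool-cases (ind E (C ⧺ Q))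
         (λ i → trans (∑-cong (allV n) λ v → cong (λ z → ⟦ z ∧ not (inSp ((C ⧺ Q) ⧺ E) v) ⟧) i) (trans (∑-compl (λ _ → true) (inSp ((C ⧺ Q) ⧺ E)) (λ _ _ → refl))
            (trans (cong₂ _-_ (trans (∑-const n 1ℚ) (QP.*-identityʳ (pw n))) (trans (∑-sp ((C ⧺ Q) ⧺ E)) (cong pw (trans (rk-ind E (C ⧺ Q) i) (NP.+-assoc t p (rk E)))))) (sym (trans (cong (λ z → (pw n - pw (t ℕ.+ (p ℕ.+ rk E))) * ⟦ z ⟧) i) (QP.*-identityʳ (pw n - pw (t ℕ.+ (p ℕ.+ rk E)))))))))
         (λ i → trans (∑-0 (allV n) λ v → cong (λ z → ⟦ z ∧ not (inSp ((C ⧺ Q) ⧺ E) v) ⟧) i) (sym (trans (cong (λ z → (pw n - pw (t ℕ.+ (p ℕ.+ rk E))) * ⟦ z ⟧) i) (QP.*-zeroʳ (pw n - pw (t ℕ.+ (p ℕ.+ rk E)))))))) ⟩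
  ∑[ C ∈ allM n t ] ((pw n - pw (t ℕ.+ (p ℕ.+ rk E))) * ⟦ ind E (C ⧺ Q) ⟧)
    ≡⟨ trans (∑-*ˡ (allM n t) (pw n - pw (t ℕ.+ (p ℕ.+ rk E))) _) (cong ((pw n - pw (t ℕ.+ (p ℕ.+ rk E))) *_) (∑-ind E Q iQ t)) ⟩
  cnt n (suc t) (p ℕ.+ rk E) ∎
  where open ≡-Reasoning

¼ : ℚ
¼ = ½ * ½

0≤¼ : 0ℚ ≤ ¼
0≤¼ = *-≥0 0≤½ 0≤½

pw-hp-∸ : ∀ {a K} → a ℕ.≤ K → pw a * hp K ≡ hp (K ℕ.∸ a)
pw-hp-∸ {a} {K} p = trans (cong (λ z → pw a * hp z) (sym (NP.m+[n∸m]≡n p))) (trans (cong (pw a *_) (hp-+ a (K ℕ.∸ a))) (trans (sym (QP.*-assoc (pw a) (hp a) _)) (trans (cong (_* hp (K ℕ.∸ a)) (pw*hp a)) (QP.*-identityˡ _))))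

-- The quantity `x = 2^(t+p-K)` doubles with every further column, and `(1 - x)² ≥ 1 - 2x` absorbs
-- the new factor.
cnt-lower : ∀ K t p → t ℕ.+ p ℕ.≤ K → pw (t ℕ.* K) * (1ℚ - pw (t ℕ.+ p) * hp K) ≤ cnt K t p
cnt-lower K zero p le = ≤-trans (≤≡ (QP.*-identityˡ (1ℚ - pw p * hp K))) (diff≤ (pw p * hp K) (*-≥0 (pw≥0 p) (hp≥0 K)) (lem (pw p * hp K)))
  where
  lem : ∀ x → 1ℚ ≡ 1ℚ - x + x
  lem = solve-∀ ℚring
cnt-lower K (suc t) p le = begin
  pw (K ℕ.+ t ℕ.* K) * (1ℚ - two * pw (t ℕ.+ p) * hp K)
    ≡⟨ cong₂ _*_ (pw-+ K (t ℕ.* K)) (cong (λ z → 1ℚ - z) (QP.*-assoc two (pw (t ℕ.+ p)) (hp K))) ⟩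
  pw K * pw (t ℕ.* K) * (1ℚ - two * x)
    ≤⟨ *-monoˡ _ (*-≥0 (pw≥0 K) (pw≥0 (t ℕ.* K))) (diff≤ (x * x) (sq≥0 x) (lem x)) ⟩
  pw K * pw (t ℕ.* K) * ((1ℚ - x) * (1ℚ - x))
    ≡⟨ lem₂ (pw K) (pw (t ℕ.* K)) (1ℚ - x) ⟩
  pw K * (1ℚ - x) * (pw (t ℕ.* K) * (1ℚ - x))
    ≤⟨ *-monoˡ _ (*-≥0 (pw≥0 K) (≤⇒0≤- x≤1)) (cnt-lower K t p (NP.≤-trans (NP.n≤1+n _) le)) ⟩
  pw K * (1ℚ - x) * cnt K t p
    ≡⟨ cong (_* cnt K t p) (trans (lem₃ (pw K) (pw (t ℕ.+ p)) (hp K)) (trans (cong (λ z → pw K - z * pw (t ℕ.+ p)) (pw*hp K)) (cong (λ z → pw K - z) (QP.*-identityˡ _)))) ⟩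
  cnt K (suc t) p ∎
  where
  open QP.≤-Reasoning
  x = pw (t ℕ.+ p) * hp K
  x≤1 : x ≤ 1ℚ
  x≤1 = ≤-trans (≤≡ (pw-hp-∸ (NP.≤-trans (NP.n≤1+n _) le))) (hp≤1 (K ℕ.∸ (t ℕ.+ p)))
  lem : ∀ x → (1ℚ - x) * (1ℚ - x) ≡ 1ℚ - two * x + x * x
  lem = solve-∀ ℚring
  lem₂ : ∀ a b c → a * b * (c * c) ≡ a * c * (b * c)
  lem₂ = solve-∀ ℚring
  lem₃ : ∀ a b c → a * (1ℚ - b * c) ≡ a - a * c * b
  lem₃ = solve-∀ ℚring

-- One half comes from the last factor, where `t + p < K`, and one half from `cnt-lower` for the
-- others. For all factors together `cnt-lower` would give 0 when the space is filled completely.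
cnt≥¼ : ∀ K t p → t ℕ.+ p ℕ.≤ K → ¼ * pw (t ℕ.* K) ≤ cnt K t p
cnt≥¼ K zero p le = ≤-trans (≤≡ (QP.*-identityʳ ¼)) (diff≤ (½ + ¼) (+-≥0 0≤½ 0≤¼) refl)
cnt≥¼ K (suc t) p le = begin
  ¼ * pw (K ℕ.+ t ℕ.* K)
    ≡⟨ trans (cong (¼ *_) (pw-+ K (t ℕ.* K))) (lem (pw K) (pw (t ℕ.* K))) ⟩
  pw K * ½ * (pw (t ℕ.* K) * ½)
    ≤⟨ *-mono (*-≥0 (pw≥0 K) 0≤½) (*-≥0 (pw≥0 (t ℕ.* K)) 0≤½) (≤-trans (*-monoˡ (pw K) (pw≥0 K) half) (≤≡ eq₁)) (≤-trans (*-monoˡ (pw (t ℕ.* K)) (pw≥0 (t ℕ.* K)) half) (cnt-lower K t p (NP.≤-trans (NP.n≤1+n _) le))) ⟩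
  (pw K - pw (t ℕ.+ p)) * cnt K t p ∎
  where
  open QP.≤-Reasoning
  x = pw (t ℕ.+ p) * hp K
  lem : ∀ a b → ½ * ½ * (a * b) ≡ a * ½ * (b * ½)
  lem = solve-∀ ℚring
  half : ½ ≤ 1ℚ - x
  half = 0≤-⇒≤ (≤-trans (≤⇒0≤- {x} {½} (≤-trans (≤≡ (pw-hp-∸ (NP.≤-trans (NP.n≤1+n _) le))) (≤-trans (hp-anti (NP.m<n⇒0<n∸m le)) (≤≡ (QP.*-identityʳ ½))))) (≤≡ (lem₂ x)))
    where
    lem₂ : ∀ x → ½ - x ≡ 1ℚ - x - ½
    lem₂ = solve-∀ ℚring
  eq₁ : pw K * (1ℚ - x) ≡ pw K - pw (t ℕ.+ p)
  eq₁ = trans (lem₃ (pw K) (pw (t ℕ.+ p)) (hp K)) (trans (cong (λ z → pw K - z * pw (t ℕ.+ p)) (pw*hp K)) (cong (λ z → pw K - z) (QP.*-identityˡ _)))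
    where
    lem₃ : ∀ a b c → a * (1ℚ - b * c) ≡ a - a * c * b
    lem₃ = solve-∀ ℚring

cnt-upper : ∀ K t p → t ℕ.+ p ℕ.≤ K → 0ℚ ≤ cnt K t p × cnt K t p ≤ pw (t ℕ.* K)
cnt-upper K zero p le = 0≤1 , ≤-refl
cnt-upper K (suc t) p le = let (lo , up) = cnt-upper K t p (NP.≤-trans (NP.n≤1+n _) le)
                               pos = ≤⇒0≤- (pw-mono (NP.≤-trans (NP.n≤1+n _) le)) in
  *-≥0 pos lo , ≤-trans (*-mono pos lo (diff≤ (pw (t ℕ.+ p)) (pw≥0 (t ℕ.+ p)) (lem (pw K) (pw (t ℕ.+ p)))) up) (≤≡ (sym (pw-+ K (t ℕ.* K))))
  where
  lem : ∀ a b → a ≡ a - b + b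
  lem = solve-∀ ℚring

-- Column operations and the reduction of zooms to pairs (Q, W)

M-ext : (X Y : M n d) → (∀ c → X · c ≡ Y · c) → X ≡ Y
M-ext [] [] h = refl
M-ext (x ∷ X) (y ∷ Y) h = cong₂ _∷_ (trans (sym (hd x X)) (trans (h 𝐞) (hd y Y))) (M-ext X Y λ c → trans (sym (⊕-idˡ _)) (trans (h (false ∷ c)) (⊕-idˡ _)))
  where
  hd : ∀ {n d} (x : V n) (X : M n d) → (x ∷ X) · 𝐞 ≡ x
  hd x X = trans (cong (x ⊕v_) (·-0 X)) (⊕-idʳ x)

-- Right multiplication by a transvection. It preserves the column span, and it can bring the vector
-- of a column condition, or the right side of a row condition, to `𝐞`.
colop : (f w : V d) → M n d → M n d
colop f w N = N ⊕ outer (N · w) f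

colop-· : (f w : V d) (N : M n d) (x : V d) → colop f w N · x ≡ N · tv f w x
colop-· f w N x = trans (⊕-· N (outer (N · w) f) x) (trans (cong (N · x ⊕v_) (trans (outer-· (N · w) f x) (scN (dot f x)))) (sym (·-⊕ N x (sc (dot f x) w))))
  where
  scN : ∀ c → sc c (N · w) ≡ N · sc c w
  scN false = sym (·-0 N)
  scN true = refl

colop-inv : (f w : V d) → dot f w ≡ false → (N : M n d) → colop f w (colop f w N) ≡ N
colop-inv f w fw N = M-ext _ _ λ x → trans (colop-· f w (colop f w N) x) (trans (colop-· f w N (tv f w x)) (cong (N ·_) (tv-inv f w fw x)))

map-dot-⊕ : (a : V n) (X Y : M n d) → Vec.map (dot a) (X ⊕ Y) ≡ Vec.map (dot a) X ⊕v Vec.map (dot a) Y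
map-dot-⊕ a [] [] = refl
map-dot-⊕ a (x ∷ X) (y ∷ Y) = cong₂ _∷_ (dot-⊕ʳ a x y) (map-dot-⊕ a X Y)

colop-row : (f w : V d) (N : M n d) (a : V n) → Vec.map (dot a) (colop f w N) ≡ tv w f (Vec.map (dot a) N)
colop-row f w N a = trans (map-dot-⊕ a N (outer (N · w) f)) (cong (Vec.map (dot a) N ⊕v_) (trans (map-dot-outer a (N · w) f) (cong (λ z → sc z f) (trans (dot-· a N w) (dot-comm _ w)))))

inSp-colop : (f w : V d) → dot f w ≡ false → (N : M n d) (x : V n) → inSp (colop f w N) x ≡ inSp N x
inSp-colop f w fw N x = ≡-from-iff
  (λ e → let (c , p) = inSp-sound (colop f w N) x e in inSp-complete N (tv f w c) (trans (sym (colop-· f w N c)) p))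
  (λ e → let (c , p) = inSp-sound N x e in inSp-complete (colop f w N) (tv f w c) (trans (colop-· f w N (tv f w c)) (trans (cong (N ·_) (tv-inv f w fw c)) p)))

inSp-⧺-cong : ∀ {a a' b b'} (A : M n a) (A' : M n a') (B : M n b) (B' : M n b') → (∀ x → inSp A x ≡ inSp A' x) → (∀ x → inSp B x ≡ inSp B' x) → ∀ x → inSp (A ⧺ B) x ≡ inSp (A' ⧺ B') x
inSp-⧺-cong A A' B B' p q x = ≡-from-iff (go A A' B B' p q) (go A' A B' B (λ y → sym (p y)) (λ y → sym (q y)))
  where
  go : ∀ {a a' b b'} (A : M _ a) (A' : M _ a') (B : M _ b) (B' : M _ b') → (∀ x → inSp A x ≡ inSp A' x) → (∀ x → inSp B x ≡ inSp B' x) → inSp (A ⧺ B) x ≡ true → inSp (A' ⧺ B') x ≡ true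
  go A A' B B' p q e = let (y , u , v) = inSp-⧺-split A B x e in
    subst (λ z → inSp (A' ⧺ B') z ≡ true) (trans (cong (y ⊕v_) (⊕-comm x y)) (⊕-cancel y x)) (inSp-⧺-intro A' B' (trans (sym (p y)) u) (trans (sym (q (x ⊕v y))) v))

annv : List (V n) → V n → Bool
annv [] v = true
annv (a ∷ A) v = not (dot a v) ∧ annv A v

allCols : (V n → Bool) → M n d → Bool
allCols S [] = true
allCols S (v ∷ N) = S v ∧ allCols S N

ann : List (V n) → M n d → Bool
ann A = allCols (annv A)

row0 : (a : V n) (N : M n d) → sat N (row a 0v) ≡ allCols (λ v → not (dot a v)) N
row0 a [] = refl
row0 a (v ∷ N) = cong₂ _∧_ (cong not (BP.xor-identityʳ (dot a v))) (row0 a N)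

ann-∷ : (a : V n) (A : List (V n)) (N : M n d) → ann (a ∷ A) N ≡ sat N (row a 0v) ∧ ann A N
ann-∷ a A N = trans (go N) (cong (_∧ ann A N) (sym (row0 a N)))
  where
  perm : ∀ p q r s → (p ∧ q) ∧ (r ∧ s) ≡ (p ∧ r) ∧ (q ∧ s)
  perm false q r s = refl
  perm true false false s = refl
  perm true false true s = refl
  perm true true r s = refl
  go : ∀ {d} (N : M _ d) → ann (a ∷ A) N ≡ allCols (λ v → not (dot a v)) N ∧ ann A N
  go [] = refl
  go (v ∷ N) = trans (cong ((not (dot a v) ∧ annv A v) ∧_) (go N)) (perm (not (dot a v)) (annv A v) _ _)

tr-con : (f w : V d) → Con n d → Con n d
tr-con f w (col u m) = col (tv f w u) m
tr-con f w (row a e) = row a (tv w f e)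

sat-colop : (f w : V d) → dot f w ≡ false → (N : M n d) (c : Con n d) → sat (colop f w N) c ≡ sat N (tr-con f w c)
sat-colop f w fw N (col u m) = cong (_==v m) (colop-· f w N u)
sat-colop {d} f w fw N (row a e) = ≡-from-iff
  (λ t → eq-complete (VE d) (trans (sym (tv-inv w f wf _)) (cong (tv w f) (trans (sym (colop-row f w N a)) (==v-sound t)))))
  (λ t → eq-complete (VE d) (trans (colop-row f w N a) (trans (cong (tv w f) (==v-sound t)) (tv-inv w f wf e))))
  where
  wf : dot w f ≡ false
  wf = trans (dot-comm w f) fw

sats-colop : (f w : V d) → dot f w ≡ false → (N : M n d) (cs : List (Con n d)) → sats (colop f w N) cs ≡ sats N (map (tr-con f w) cs)
sats-colop f w fw N [] = refl
sats-colop f w fw N (c ∷ cs) = cong₂ _∧_ (sat-colop f w fw N c) (sats-colop f w fw N cs)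

ann-colop : (f w : V d) → dot f w ≡ false → (A : List (V n)) (N : M n d) → ann A (colop f w N) ≡ ann A N
ann-colop f w fw [] N = trans (triv (colop f w N)) (sym (triv N))
  where
  triv : ∀ {d} (N : M _ d) → ann [] N ≡ true
  triv [] = refl
  triv (v ∷ N) = triv N
ann-colop f w fw (a ∷ A) N = trans (ann-∷ a A (colop f w N)) (trans (cong₂ _∧_ (trans (sat-colop f w fw N (row a 0v)) (cong (λ z → sat N (row a z)) (tv-0 w f))) (ann-colop f w fw A N)) (sym (ann-∷ a A N)))

ok : V n → Con n (suc d) → Bool
ok v (col (c ∷ u) m) = true
ok v (row a (b ∷ e)) = not (dot a v xor b)

down : V n → Con n (suc d) → Con n d
down v (col (c ∷ u) m) = col u (m ⊕v sc c v)
down v (row a (b ∷ e)) = row a e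

sat-down : (v : V n) (N : M n d) (c : Con n (suc d)) → sat (v ∷ N) c ≡ ok v c ∧ sat N (down v c)
sat-down {n} v N (col (c ∷ u) m) = ≡-from-iff
  (λ t → eq-complete (VE n) (trans (sym (⊕-cancel (sc c v) (N · u))) (trans (cong (sc c v ⊕v_) (==v-sound t)) (⊕-comm (sc c v) m))))
  (λ t → eq-complete (VE n) (trans (cong (sc c v ⊕v_) (trans (==v-sound t) (⊕-comm m (sc c v)))) (⊕-cancel (sc c v) m)))
sat-down v N (row a (b ∷ e)) = refl

oks : V n → List (Con n (suc d)) → Bool
oks v [] = true
oks v (c ∷ cs) = ok v c ∧ oks v cs

∧-perm : ∀ p q r s → (p ∧ q) ∧ (r ∧ s) ≡ (p ∧ r) ∧ (q ∧ s)
∧-perm false q r s = refl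
∧-perm true false false s = refl
∧-perm true false true s = refl
∧-perm true true r s = refl

sats-down : (v : V n) (N : M n d) (cs : List (Con n (suc d))) → sats (v ∷ N) cs ≡ oks v cs ∧ sats N (map (down v) cs)
sats-down v N [] = refl
sats-down v N (c ∷ cs) = trans (cong₂ _∧_ (sat-down v N c) (sats-down v N cs)) (∧-perm (ok v c) _ (oks v cs) _)

inSp-move : ∀ {a b} (v : V n) (A : M n a) (B : M n b) x → inSp ((v ∷ A) ⧺ B) x ≡ inSp (A ⧺ (v ∷ B)) x
inSp-move v [] B x = refl
inSp-move v (y ∷ A) B x = trans (perm (inSp (A ⧺ B) x) (inSp (A ⧺ B) (x ⊕v y)) (inSp (A ⧺ B) (x ⊕v v)) (inSp (A ⧺ B) ((x ⊕v v) ⊕v y)))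
  (cong₂ _∨_ (inSp-move v A B x) (trans (cong (λ z → inSp (A ⧺ B) (x ⊕v y) ∨ inSp (A ⧺ B) z) (trans (⊕-assoc x v y) (trans (cong (x ⊕v_) (⊕-comm v y)) (sym (⊕-assoc x y v))))) (inSp-move v A B (x ⊕v y))))
  where
  perm : ∀ p q r s → (p ∨ q) ∨ (r ∨ s) ≡ (p ∨ r) ∨ (q ∨ s)
  perm true q r s = refl
  perm false true true s = refl
  perm false true false s = refl
  perm false false r s = refl

-- Goodness speaks of vectors Q contained in the span and of a subspace W, whereas a zoom allows
-- arbitrary conditions on rows and columns. As `g` depends on the span only, column operations
-- bring every zoom to the form "contains Q, other columns orthogonal to A". `g` accepts matrices of
-- every width because columns move from `N` to `Q`.
module Reduce {n d J : ℕ} (E : M n J) (g : ∀ {m} → M n m → ℚ)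
  (g-inv : ∀ {a b} (N : M n a) (N' : M n b) → a ≡ b → (∀ x → inSp (N ⧺ E) x ≡ inSp (N' ⧺ E) x) → g N ≡ g N')
  (r h : ℕ)
  (std : ∀ {p d'} (Q : M n p) (A : List (V n)) → p ℕ.≤ r → length A ℕ.≤ r → d' ℕ.+ p ≡ d →
    pw h * ∑[ N ∈ allM n d' ] (⟦ ann A N ⟧ * g (N ⧺ Q)) ≤ ∑[ N ∈ allM n d' ] ⟦ ann A N ⟧) where

  -- `k` is `id` for the sum of `g` and constant 1 for the count of matrices, so that both sides of
  -- the inequality are rewritten by the same lemma.
  S : ∀ {p d'} → List (V n) → List (Con n d') → M n p → (ℚ → ℚ) → ℚ
  S {d' = d'} A cs Q k = ∑[ N ∈ allM n d' ] (⟦ ann A N ⟧ * ⟦ sats N cs ⟧ * k (g (N ⧺ Q)))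

  Goal : ∀ {p d'} → List (V n) → List (Con n d') → M n p → Set
  Goal A cs Q = pw h * S A cs Q id ≤ S A cs Q (λ _ → 1ℚ)

  drop-const : ∀ {p d'} (A : List (V n)) (c : Con n d') cs (Q : M n p) (b : Bool) → (∀ N → sat N c ≡ b) → Goal A cs Q → Goal A (c ∷ cs) Q
  drop-const {d' = d'} A c cs Q true e G = subst₂ (λ x y → pw h * x ≤ y) (same id) (same (λ _ → 1ℚ)) G
    where
    same : ∀ k → S A cs Q k ≡ S A (c ∷ cs) Q k
    same k = ∑-cong (allM n d') λ N → cong (λ z → ⟦ ann A N ⟧ * ⟦ z ∧ sats N cs ⟧ * k (g (N ⧺ Q))) (sym (e N))
  drop-const {d' = d'} A c cs Q false e G = ≤≡ (trans (trans (cong (pw h *_) (z id)) (QP.*-zeroʳ (pw h))) (sym (z (λ _ → 1ℚ))))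
    where
    lem : ∀ a b → a * 0ℚ * b ≡ 0ℚ
    lem = solve-∀ ℚring
    z : ∀ k → S A (c ∷ cs) Q k ≡ 0ℚ
    z k = ∑-0 (allM n d') λ N → trans (cong (λ t → ⟦ ann A N ⟧ * ⟦ t ∧ sats N cs ⟧ * k (g (N ⧺ Q))) (e N)) (lem ⟦ ann A N ⟧ (k (g (N ⧺ Q))))

  by-colop : ∀ {p d'} (f w : V d') → dot f w ≡ false → ∀ A cs (Q : M n p) → Goal A (map (tr-con f w) cs) Q → Goal A cs Q
  by-colop {d' = d'} f w fw A cs Q G = subst₂ (λ x y → pw h * x ≤ y) (same id) (same (λ _ → 1ℚ)) G
    where
    same : ∀ k → S A (map (tr-con f w) cs) Q k ≡ S A cs Q k
    same k = trans (∑-cong (allM n d') λ N → cong₂ _*_ (cong₂ (λ x y → ⟦ x ⟧ * ⟦ y ⟧) (sym (ann-colop f w fw A N)) (sym (sats-colop f w fw N cs)))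
        (cong k (g-inv (N ⧺ Q) (colop f w N ⧺ Q) refl (inSp-⧺-cong (N ⧺ Q) (colop f w N ⧺ Q) E E (inSp-⧺-cong N (colop f w N) Q Q (λ x → sym (inSp-colop f w fw N x)) (λ _ → refl)) (λ _ → refl)))))
      (∑-bij (ME n d') (ME n d') (colop f w) (colop f w) (colop-inv f w fw) (colop-inv f w fw) (λ N → ⟦ ann A N ⟧ * ⟦ sats N cs ⟧ * k (g (N ⧺ Q))))

  -- Fixing the first column: the sum over it is a combination, with coefficients in {0,1}, of sums with one more fixed vector.
  peel : ∀ {p d'} (A A' : List (V n)) (cs : List (Con n (suc d'))) (κ : V n → Bool) (cs' : V n → List (Con n d')) (Q : M n p) →
    (∀ v N → ann A (v ∷ N) ∧ sats (v ∷ N) cs ≡ κ v ∧ (ann A' N ∧ sats N (cs' v))) →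
    (∀ v → Goal A' (cs' v) (v ∷ Q)) → Goal A cs Q
  peel {p} {d'} A A' cs κ cs' Q e G = subst₂ _≤_ (trans (∑-cong (allV n) λ v → *-swap ⟦ κ v ⟧ (pw h) _) (trans (∑-*ˡ (allV n) (pw h) _) (cong (pw h *_) (sym (split id))))) (sym (split (λ _ → 1ℚ)))
    (∑-mono (allV n) λ v → *-monoˡ ⟦ κ v ⟧ (⟦⟧≥0 (κ v)) (G v))
    where
    split : ∀ k → S A cs Q k ≡ ∑[ v ∈ allV n ] (⟦ κ v ⟧ * S A' (cs' v) (v ∷ Q) k)
    split k = trans (∑-allM (λ N → ⟦ ann A N ⟧ * ⟦ sats N cs ⟧ * k (g (N ⧺ Q)))) (∑-cong (allV n) λ v → trans (∑-cong (allM n d') λ N →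
        trans (cong₂ _*_ (trans (sym (⟦∧⟧ (ann A (v ∷ N)) (sats (v ∷ N) cs))) (trans (cong ⟦_⟧ (e v N)) (trans (⟦∧⟧ (κ v) _) (cong (⟦ κ v ⟧ *_) (⟦∧⟧ (ann A' N) (sats N (cs' v)))))))
                 (cong k (g-inv ((v ∷ N) ⧺ Q) (N ⧺ (v ∷ Q)) (sym (NP.+-suc d' p)) (inSp-⧺-cong ((v ∷ N) ⧺ Q) (N ⧺ (v ∷ Q)) E E (inSp-move v N Q) (λ _ → refl)))))
          (QP.*-assoc ⟦ κ v ⟧ _ _)) (∑-*ˡ (allM n d') ⟦ κ v ⟧ _))

  -- Two budgets are kept. A column condition moves one vector into `Q`; a row condition with right
  -- side 0 moves its direction into `A`; a row condition with any other right side does both. Hence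
  -- `p + ℓ` and `length A + ℓ` never exceed `r`. A column condition with `u = 0` is constant and is
  -- dropped.
  red : ∀ ℓ {p d'} (cs : List (Con n d')) → length cs ≡ ℓ → (Q : M n p) (A : List (V n)) → p ℕ.+ ℓ ℕ.≤ r → length A ℕ.+ ℓ ℕ.≤ r → d' ℕ.+ p ≡ d → Goal A cs Q
  red zero {d' = d'} [] refl Q A p≤ A≤ e = subst₂ (λ x y → pw h * x ≤ y)
    (∑-cong (allM n d') λ N → cong (_* g (N ⧺ Q)) (sym (QP.*-identityʳ ⟦ ann A N ⟧)))
    (∑-cong (allM n d') λ N → sym (trans (QP.*-identityʳ _) (QP.*-identityʳ ⟦ ann A N ⟧)))
    (std Q A (NP.≤-trans (NP.m≤m+n _ 0) p≤) (NP.≤-trans (NP.m≤m+n _ 0) A≤) e)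
  red (suc ℓ) {p} {d'} (c ∷ cs) le Q A p≤ A≤ e = byCon c
    where
    le' : length cs ≡ ℓ
    le' = NP.suc-injective le
    weak : ∀ {x} → x ℕ.+ suc ℓ ℕ.≤ r → x ℕ.+ ℓ ℕ.≤ r
    weak {x} q = NP.≤-trans (NP.+-monoʳ-≤ x (NP.n≤1+n ℓ)) q
    next : ∀ {x} → x ℕ.+ suc ℓ ℕ.≤ r → suc x ℕ.+ ℓ ℕ.≤ r
    next {x} q = subst (ℕ._≤ r) (NP.+-suc x ℓ) q
    rest : Goal A cs Q
    rest = red ℓ cs le' Q A (weak p≤) (weak A≤) e
    lenmap : ∀ {d₁ d₂} (k : Con n d₁ → Con n d₂) (xs : List (Con n d₁)) → length xs ≡ ℓ → length (map k xs) ≡ ℓ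
    lenmap k xs q = trans (LP.length-map k xs) q
    stepCol : ∀ {d'} (cs : List (Con n (suc d'))) → length cs ≡ ℓ → suc d' ℕ.+ p ≡ d → ∀ m → Goal A (col 𝐞 m ∷ cs) Q
    stepCol {d'} cs lc e m = peel A A (col 𝐞 m ∷ cs) (λ v → (v ==v m) ∧ (annv A v ∧ oks v cs)) (λ v → map (down v) cs) Q eqn
      λ v → red ℓ (map (down v) cs) (lenmap (down v) cs lc) (v ∷ Q) A (next p≤) (weak A≤) (trans (NP.+-suc d' p) e)
      where
      perm : ∀ a b c x y → (a ∧ b) ∧ (x ∧ (c ∧ y)) ≡ (x ∧ (a ∧ c)) ∧ (b ∧ y)
      perm true true c true y = refl
      perm true true c false y = refl
      perm true false false true y = refl
      perm true false true true y = refl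
      perm true false c false y = refl
      perm false b c true y = refl
      perm false b c false y = refl
      eqn : ∀ v N → ann A (v ∷ N) ∧ sats (v ∷ N) (col 𝐞 m ∷ cs) ≡ ((v ==v m) ∧ (annv A v ∧ oks v cs)) ∧ (ann A N ∧ sats N (map (down v) cs))
      eqn v N = trans (cong₂ (λ x y → (annv A v ∧ ann A N) ∧ (x ∧ y)) (cong (_==v m) (trans (cong (v ⊕v_) (·-0 N)) (⊕-idʳ v))) (sats-down v N cs))
        (perm (annv A v) (ann A N) (oks v cs) (v ==v m) (sats N (map (down v) cs)))
    -- With right side `𝐞` the condition says that `⟨a,·⟩` is 1 on the first column and 0 on all
    -- others.
    stepRow : ∀ {d'} (cs : List (Con n (suc d'))) → length cs ≡ ℓ → suc d' ℕ.+ p ≡ d → ∀ a → Goal A (row a 𝐞 ∷ cs) Q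
    stepRow {d'} cs lc e a = peel A (a ∷ A) (row a 𝐞 ∷ cs) (λ v → dot a v ∧ (annv A v ∧ oks v cs)) (λ v → map (down v) cs) Q eqn
      λ v → red ℓ (map (down v) cs) (lenmap (down v) cs lc) (v ∷ Q) (a ∷ A) (next p≤) (next A≤) (trans (NP.+-suc d' p) e)
      where
      perm : ∀ a b c x z y → (a ∧ b) ∧ ((x ∧ z) ∧ (c ∧ y)) ≡ (x ∧ (a ∧ c)) ∧ ((z ∧ b) ∧ y)
      perm true true c true true y = refl
      perm true true false true false y = refl
      perm true true true true false y = refl
      perm true true c false z y = refl
      perm true false false true z y = refl
      perm true false true true true y = refl
      perm true false true true false y = refl
      perm true false c false z y = refl
      perm false b c true z y = refl
      perm false b c false z y = refl
      nx : ∀ b → not (b xor true) ≡ b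
      nx false = refl
      nx true = refl
      eqn : ∀ v N → ann A (v ∷ N) ∧ sats (v ∷ N) (row a 𝐞 ∷ cs) ≡ (dot a v ∧ (annv A v ∧ oks v cs)) ∧ (ann (a ∷ A) N ∧ sats N (map (down v) cs))
      eqn v N = trans (cong₂ (λ x y → (annv A v ∧ ann A N) ∧ ((x ∧ sat N (row a 0v)) ∧ y)) (nx (dot a v)) (sats-down v N cs))
        (trans (perm (annv A v) (ann A N) (oks v cs) (dot a v) (sat N (row a 0v)) (sats N (map (down v) cs)))
          (cong (λ z → (dot a v ∧ (annv A v ∧ oks v cs)) ∧ (z ∧ sats N (map (down v) cs))) (sym (ann-∷ a A N))))
    colCase : ∀ {d'} (u : V d') m (cs : List (Con n d')) → length cs ≡ ℓ → d' ℕ.+ p ≡ d → u ≢ 0v → Goal A (col u m ∷ cs) Q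
    colCase {zero} [] m cs lc e nz = ⊥-elim (nz refl)
    colCase {suc d'} u m cs lc e nz = let (f , w , fw , q) = toE₁ u nz in
      by-colop f w fw A (col u m ∷ cs) Q (subst (λ z → Goal A (col z m ∷ map (tr-con f w) cs) Q) (sym q) (stepCol (map (tr-con f w) cs) (lenmap (tr-con f w) cs lc) e m))
    rowCase : ∀ {d'} a (u : V d') (cs : List (Con n d')) → length cs ≡ ℓ → d' ℕ.+ p ≡ d → u ≢ 0v → Goal A (row a u ∷ cs) Q
    rowCase {zero} a [] cs lc e nz = ⊥-elim (nz refl)
    rowCase {suc d'} a u cs lc e nz = let (f , w , fw , q) = toE₁ u nz in
      by-colop w f (trans (dot-comm w f) fw) A (row a u ∷ cs) Q (subst (λ z → Goal A (row a z ∷ map (tr-con w f) cs) Q) (sym q) (stepRow (map (tr-con w f) cs) (lenmap (tr-con w f) cs lc) e a))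
    byCon : ∀ c → Goal A (c ∷ cs) Q
    byCon (col u m) = bool-cases (u ==v 0v)
      (λ z → drop-const A (col u m) cs Q (0v ==v m) (λ N → cong (_==v m) (trans (cong (N ·_) (==v-sound z)) (·-0 N))) rest)
      (λ z → colCase u m cs le' e (λ q → false≢true z (eq-complete (VE d') q)))
    byCon (row a u) = bool-cases (u ==v 0v)
      (λ z → subst (λ t → Goal A (row a t ∷ cs) Q) (sym (==v-sound z)) (subst₂ (λ x y → pw h * x ≤ y) (absorb id) (absorb (λ _ → 1ℚ)) (red ℓ cs le' Q (a ∷ A) (weak p≤) (next A≤) e)))
      (λ z → rowCase a u cs le' e (λ q → false≢true z (eq-complete (VE d') q)))
      where
      absorb : ∀ k → S (a ∷ A) cs Q k ≡ S A (row a 0v ∷ cs) Q k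
      absorb k = ∑-cong (allM n d') λ N → cong (_* k (g (N ⧺ Q))) (trans (cong (λ z → ⟦ z ⟧ * ⟦ sats N cs ⟧) (ann-∷ a A N)) (trans (cong (_* ⟦ sats N cs ⟧) (⟦∧⟧ (sat N (row a 0v)) (ann A N)))
        (trans (lem ⟦ sat N (row a 0v) ⟧ ⟦ ann A N ⟧ ⟦ sats N cs ⟧) (cong (⟦ ann A N ⟧ *_) (sym (⟦∧⟧ (sat N (row a 0v)) (sats N cs)))))))
        where
        lem : ∀ a b c → a * b * c ≡ b * (a * c)
        lem = solve-∀ ℚring

  zoom-g : Zoom r h (λ (N : M n d) → g N)
  zoom-g cs le = subst₂ (λ x y → pw h * x ≤ y)
    (∑-cong (allM n d) λ N → cong₂ _*_ (trans (cong (λ z → ⟦ z ⟧ * ⟦ sats N cs ⟧) (triv N)) (QP.*-identityˡ ⟦ sats N cs ⟧)) (g-inv (N ⧺ []) N (NP.+-identityʳ d) (inSp-⧺-cong (N ⧺ []) N E E (nil N) (λ _ → refl))))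
    (∑-cong (allM n d) λ N → trans (QP.*-identityʳ _) (trans (cong (λ z → ⟦ z ⟧ * ⟦ sats N cs ⟧) (triv N)) (QP.*-identityˡ _)))
    (red (length cs) cs refl [] [] le le (NP.+-identityʳ d))
    where
    triv : ∀ {d} (N : M n d) → ann [] N ≡ true
    triv [] = refl
    triv (v ∷ N) = triv N
    nil : ∀ {d} (N : M n d) x → inSp (N ⧺ []) x ≡ inSp N x
    nil [] x = refl
    nil (y ∷ N) x = cong₂ _∨_ (nil N x) (nil N (x ⊕v y))

-- Induction on the first coordinate: the vectors of `S` starting with 1 are either none or a coset
-- of those starting with 0.
sub-pow : (S : VSet n) → IsSub S → ∃ λ m → m ℕ.≤ n × ∑[ v ∈ allV n ] ⟦ mem S v ⟧ ≡ pw m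
sub-pow {zero} S s = 0 , ℕ.z≤n , trans (QP.+-identityʳ _) (cong ⟦_⟧ (has0 s))
sub-pow {suc n} (S₀ , S₁) s = bool-cases (anyᵇ (mem S₁))
  (λ e → let (v₁ , q) = anyᵇ-elim {P = mem S₁} e in suc m , ℕ.s≤s m≤n , trans (∑-allV (λ v → ⟦ mem (S₀ , S₁) v ⟧)) (trans (cong₂ _+_ c₀ (trans (trans (∑-cong (allV n) λ v → cong ⟦_⟧ (coset v₁ q v)) (∑-shift v₁ (λ v → ⟦ mem S₀ v ⟧))) c₀)) (lem (pw m))))
  (λ e → m , NP.m≤n⇒m≤1+n m≤n , trans (∑-allV (λ v → ⟦ mem (S₀ , S₁) v ⟧)) (trans (cong₂ _+_ c₀ (∑-0 (allV n) λ v → cong ⟦_⟧ (BP.¬-not λ q → false≢true e (anyᵇ-intro v q)))) (QP.+-identityʳ _)))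
  where
  lem : ∀ a → a + a ≡ two * a
  lem = solve-∀ ℚring
  s₀ : IsSub S₀
  has0 s₀ = has0 s
  has+ s₀ u v p q = has+ s (false ∷ u) (false ∷ v) p q
  ih = sub-pow S₀ s₀
  m = proj₁ ih
  m≤n = proj₁ (proj₂ ih)
  c₀ = proj₂ (proj₂ ih)
  coset : ∀ v₁ → mem S₁ v₁ ≡ true → ∀ v → mem S₁ v ≡ mem S₀ (v₁ ⊕v v)
  coset v₁ q v = ≡-from-iff (λ p → has+ s (true ∷ v₁) (true ∷ v) q p) (λ p → subst (λ z → mem S₁ z ≡ true) (⊕-cancel v₁ v) (has+ s (true ∷ v₁) (false ∷ (v₁ ⊕v v)) q p))

annv-0 : (A : List (V n)) → annv A 0v ≡ true
annv-0 [] = refl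
annv-0 (a ∷ A) = ∧-intro (cong not (dot-0ʳ a)) (annv-0 A)

annv-⊕ : (A : List (V n)) (u v : V n) → annv A u ≡ true → annv A v ≡ true → annv A (u ⊕v v) ≡ true
annv-⊕ [] u v p q = refl
annv-⊕ (a ∷ A) u v p q = ∧-intro (cong not (trans (dot-⊕ʳ a u v) (cong₂ _xor_ (not-true (proj₁ (∧-true {not (dot a u)} p))) (not-true (proj₁ (∧-true {not (dot a v)} q))))))
  (annv-⊕ A u v (proj₂ (∧-true {not (dot a u)} p)) (proj₂ (∧-true {not (dot a v)} q)))

annv-card : (A : List (V n)) → pw n ≤ pw (length A) * ∑[ v ∈ allV n ] ⟦ annv A v ⟧
annv-card {n} [] = ≤≡ (sym (trans (QP.*-identityˡ _) (trans (∑-const n 1ℚ) (QP.*-identityʳ _))))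
annv-card {n} (a ∷ A) = ≤-trans (annv-card A) (≤-trans (*-monoˡ _ (pw≥0 (length A)) half) (≤≡ (lem (pw (length A)) (∑[ v ∈ allV n ] ⟦ annv (a ∷ A) v ⟧))))
  where
  lem : ∀ p x → p * (two * x) ≡ two * p * x
  lem = solve-∀ ℚring
  dbl : ∀ x → x + x ≡ two * x
  dbl = solve-∀ ℚring
  T' = ∑[ v ∈ allV n ] ⟦ annv (a ∷ A) v ⟧
  half : ∑[ v ∈ allV n ] ⟦ annv A v ⟧ ≤ two * T'
  half = bool-cases (anyᵇ (λ v → dot a v ∧ annv A v))
    (λ e → let (v₀ , q) = anyᵇ-elim {P = λ v → dot a v ∧ annv A v} e in
      ≤-trans (∑-mono (allV n) (ptw v₀ (proj₁ (∧-true q)) (proj₂ (∧-true {dot a v₀} q)))) (≤≡ (trans (∑-+ (allV n) _ _) (trans (cong (T' +_) (∑-shift v₀ (λ v → ⟦ annv (a ∷ A) v ⟧))) (dbl T')))))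
    (λ e → ≤-trans (∑-mono (allV n) λ v → all' e v) (diff≤ T' (∑-≥0 (allV n) λ v → ⟦⟧≥0 (annv (a ∷ A) v)) (sym (dbl T'))))
    where
    all' : anyᵇ (λ v → dot a v ∧ annv A v) ≡ false → ∀ v → ⟦ annv A v ⟧ ≤ ⟦ annv (a ∷ A) v ⟧
    all' e v with annv A v in p | dot a v in q
    ... | false | b = ⟦⟧≥0 (not b ∧ false)
    ... | true | false = ≤-refl
    ... | true | true = false≢true e (anyᵇ-intro {P = λ v → dot a v ∧ annv A v} v (∧-intro q p))
    ptw : ∀ v₀ → dot a v₀ ≡ true → annv A v₀ ≡ true → ∀ v → ⟦ annv A v ⟧ ≤ ⟦ annv (a ∷ A) v ⟧ + ⟦ annv (a ∷ A) (v₀ ⊕v v) ⟧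
    ptw v₀ d₀ a₀ v with annv A v in p | dot a v in q
    ... | false | b = +-≥0 (⟦⟧≥0 (not b ∧ false)) (⟦⟧≥0 (not (dot a (v₀ ⊕v v)) ∧ annv A (v₀ ⊕v v)))
    ... | true | false = diff≤ _ (⟦⟧≥0 (not (dot a (v₀ ⊕v v)) ∧ annv A (v₀ ⊕v v))) refl
    ... | true | true = ≤≡ (sym (trans (QP.+-identityˡ _) (cong ⟦_⟧ (∧-intro {not (dot a (v₀ ⊕v v))} (cong not (trans (dot-⊕ʳ a v₀ v) (cong₂ _xor_ d₀ q))) (annv-⊕ A v₀ v a₀ p)))))

∑-allCols : (S : V n → Bool) (d : ℕ) → ∑[ N ∈ allM n d ] ⟦ allCols S N ⟧ ≡ (∑[ v ∈ allV n ] ⟦ S v ⟧) ^ℚ d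
∑-allCols {n} S zero = refl
∑-allCols {n} S (suc d) = trans (∑-allM (λ N → ⟦ allCols S N ⟧)) (trans (∑-cong (allV n) λ v → trans (∑-cong (allM n d) λ N → ⟦∧⟧ (S v) (allCols S N)) (∑-*ˡ (allM n d) ⟦ S v ⟧ _))
  (trans (∑-*ʳ (allV n) _ _) (cong (∑[ v ∈ allV n ] ⟦ S v ⟧ *_) (∑-allCols S d))))

allCols-mem : (L : VSet n) (N : M n d) → colsIn L N ≡ allCols (mem L) N
allCols-mem L [] = refl
allCols-mem L (v ∷ N) = cong (mem L v ∧_) (allCols-mem L N)

allCols-cong : {S S' : V n → Bool} → (∀ v → S v ≡ S' v) → (N : M n d) → allCols S N ≡ allCols S' N
allCols-cong e [] = refl
allCols-cong e (v ∷ N) = cong₂ _∧_ (e v) (allCols-cong e N)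

data Cong {n k : ℕ} (K : M n k) : ∀ {d} → M n d → M n d → Set where
  [] : Cong K [] []
  _∷_ : ∀ {d v v'} {N N' : M n d} → inSp K (v ⊕v v') ≡ true → Cong K N N' → Cong K (v ∷ N) (v' ∷ N')

Cong-refl : ∀ {k} (K : M n k) (N : M n d) → Cong K N N
Cong-refl K [] = []
Cong-refl K (v ∷ N) = trans (cong (inSp K) (⊕-self v)) (inSp-0 K) ∷ Cong-refl K N

Cong-sp : ∀ {k} (K : M n k) (N N' : M n d) → Cong K N N' → ∀ x → inSp (N ⧺ K) x ≡ true → inSp (N' ⧺ K) x ≡ true
Cong-sp K [] [] [] x e = e
Cong-sp K (v ∷ N) (v' ∷ N') (p ∷ c) x e with ∨-true {inSp (N ⧺ K) x} e
... | inj₁ q = ∨-introˡ _ (Cong-sp K N N' c x q)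
... | inj₂ q = ∨-introʳ (inSp (N' ⧺ K) x) (subst (λ z → inSp (N' ⧺ K) z ≡ true) (trans (⊕-assoc x v (v ⊕v v')) (cong (x ⊕v_) (⊕-cancel v v')))
    (inSp-⊕ (N' ⧺ K) (Cong-sp K N N' c (x ⊕v v) q) (inSp-⧺ʳ N' K (v ⊕v v') p)))

Cong-sym : ∀ {k} (K : M n k) (N N' : M n d) → Cong K N N' → Cong K N' N
Cong-sym K [] [] [] = []
Cong-sym K (v ∷ N) (v' ∷ N') (p ∷ c) = trans (cong (inSp K) (⊕-comm v' v)) p ∷ Cong-sym K N N' c

inSp-⧺-assoc : ∀ {a b c} (A : M n a) (B : M n b) (C : M n c) x → inSp ((A ⧺ B) ⧺ C) x ≡ inSp (A ⧺ (B ⧺ C)) x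
inSp-⧺-assoc [] B C x = refl
inSp-⧺-assoc (y ∷ A) B C x = cong₂ _∨_ (inSp-⧺-assoc A B C x) (inSp-⧺-assoc A B C (x ⊕v y))

-- Averages of K-invariant functions over W₀ and over W₀ + K agree.
module Fatten {n k : ℕ} (K : M n k) (A : List (V n)) where

  wmem : V n → Bool
  wmem v = anyᵇ (λ y → inSp K y ∧ annv A (v ⊕v y))

  n₀ n₁ c₀ : ℚ
  n₀ = ∑[ v ∈ allV n ] ⟦ annv A v ⟧
  n₁ = ∑[ v ∈ allV n ] ⟦ wmem v ⟧
  c₀ = ∑[ y ∈ allV n ] (⟦ inSp K y ⟧ * ⟦ annv A y ⟧)

  -- For `v` in W₀ + K, the `y` in K with `v + y` in W₀ form a coset of the intersection of K and
  -- W₀, which has `c₀` elements; for other `v` there are none.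
  fiber : ∀ v → ∑[ y ∈ allV n ] (⟦ inSp K y ⟧ * ⟦ annv A (v ⊕v y) ⟧) ≡ ⟦ wmem v ⟧ * c₀
  fiber v = bool-cases (wmem v)
    (λ e → let (y₀ , q) = anyᵇ-elim {P = λ y → inSp K y ∧ annv A (v ⊕v y)} e
               k₀ = proj₁ (∧-true {inSp K y₀} q)
               a₀ = proj₂ (∧-true {inSp K y₀} q) in
      trans (sym (∑-shift y₀ (λ y → ⟦ inSp K y ⟧ * ⟦ annv A (v ⊕v y) ⟧)))
        (trans (∑-cong (allV n) λ y → cong₂ (λ s t → ⟦ s ⟧ * ⟦ t ⟧)
          (≡-from-iff (λ p → subst (λ z → inSp K z ≡ true) (⊕-cancel y₀ y) (inSp-⊕ K k₀ p)) (λ p → inSp-⊕ K k₀ p))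
          (≡-from-iff (λ p → subst (λ z → annv A z ≡ true) (trans (cong ((v ⊕v y₀) ⊕v_) (sym (⊕-assoc v y₀ y))) (⊕-cancel (v ⊕v y₀) y)) (annv-⊕ A _ _ a₀ p))
                      (λ p → subst (λ z → annv A z ≡ true) (⊕-assoc v y₀ y) (annv-⊕ A _ _ a₀ p))))
          (sym (trans (cong (λ z → ⟦ z ⟧ * c₀) e) (QP.*-identityˡ c₀)))))
    (λ e → trans (∑-0 (allV n) λ y → trans (sym (⟦∧⟧ (inSp K y) (annv A (v ⊕v y)))) (cong ⟦_⟧ (BP.¬-not λ q → false≢true e (anyᵇ-intro {P = λ y → inSp K y ∧ annv A (v ⊕v y)} y q))))
      (sym (trans (cong (λ z → ⟦ z ⟧ * c₀) e) (QP.*-zeroˡ c₀))))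

  InvK : (V n → ℚ) → Set
  InvK φ = ∀ v y → inSp K y ≡ true → φ (y ⊕v v) ≡ φ v

  transfer : ∀ φ → InvK φ → pw (rk K) * ∑[ v ∈ allV n ] (⟦ annv A v ⟧ * φ v) ≡ c₀ * ∑[ v ∈ allV n ] (⟦ wmem v ⟧ * φ v)
  transfer φ inv = begin
    pw (rk K) * ∑[ v ∈ allV n ] (⟦ annv A v ⟧ * φ v)
      ≡⟨ trans (cong (_* ∑[ v ∈ allV n ] (⟦ annv A v ⟧ * φ v)) (sym (∑-sp K))) (sym (∑-*ʳ (allV n) _ _)) ⟩
    ∑[ y ∈ allV n ] (⟦ inSp K y ⟧ * ∑[ v ∈ allV n ] (⟦ annv A v ⟧ * φ v))
      ≡⟨ ∑-cong (allV n) (λ y → bool-cases (inSp K y)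
           (λ e → cong (⟦ inSp K y ⟧ *_) (trans (∑-cong (allV n) λ v → cong₂ (λ s t → ⟦ annv A s ⟧ * t) (sym (trans (cong (_⊕v y) (⊕-comm y v)) (⊕-cancelʳ y v))) (sym (inv v y e))) (∑-shift y (λ v → ⟦ annv A (v ⊕v y) ⟧ * φ v))))
           (λ e → trans (cong (λ z → ⟦ z ⟧ * ∑[ v ∈ allV n ] (⟦ annv A v ⟧ * φ v)) e) (trans (QP.*-zeroˡ (∑[ v ∈ allV n ] (⟦ annv A v ⟧ * φ v))) (sym (trans (cong (λ z → ⟦ z ⟧ * ∑[ v ∈ allV n ] (⟦ annv A (v ⊕v y) ⟧ * φ v)) e) (QP.*-zeroˡ (∑[ v ∈ allV n ] (⟦ annv A (v ⊕v y) ⟧ * φ v)))))))) ⟩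
    ∑[ y ∈ allV n ] (⟦ inSp K y ⟧ * ∑[ v ∈ allV n ] (⟦ annv A (v ⊕v y) ⟧ * φ v))
      ≡⟨ trans (∑-cong (allV n) λ y → sym (∑-*ˡ (allV n) ⟦ inSp K y ⟧ _)) (∑-swap (allV n) (allV n) _) ⟩
    ∑[ v ∈ allV n ] ∑[ y ∈ allV n ] (⟦ inSp K y ⟧ * (⟦ annv A (v ⊕v y) ⟧ * φ v))
      ≡⟨ ∑-cong (allV n) (λ v → trans (∑-cong (allV n) λ y → sym (QP.*-assoc ⟦ inSp K y ⟧ ⟦ annv A (v ⊕v y) ⟧ (φ v))) (trans (∑-*ʳ (allV n) (φ v) _) (trans (cong (_* φ v) (fiber v)) (lem ⟦ wmem v ⟧ c₀ (φ v))))) ⟩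
    ∑[ v ∈ allV n ] (c₀ * (⟦ wmem v ⟧ * φ v))
      ≡⟨ ∑-*ˡ (allV n) c₀ _ ⟩
    c₀ * ∑[ v ∈ allV n ] (⟦ wmem v ⟧ * φ v) ∎
    where
    open ≡-Reasoning
    lem : ∀ a b c → a * b * c ≡ b * (a * c)
    lem = solve-∀ ℚring

  pwK≥ : 0ℚ < pw (rk K)
  pwK≥ = pw>0 (rk K)

  cancelK : ∀ {a b} → pw (rk K) * a ≡ pw (rk K) * b → a ≡ b
  cancelK e = QP.≤-antisym (*-cancelˡ-≤ (pw (rk K)) pwK≥ (≤≡ e)) (*-cancelˡ-≤ (pw (rk K)) pwK≥ (≤≡ (sym e)))

  transfer₁ : ∀ φ → InvK φ → n₁ * ∑[ v ∈ allV n ] (⟦ annv A v ⟧ * φ v) ≡ n₀ * ∑[ v ∈ allV n ] (⟦ wmem v ⟧ * φ v)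
  transfer₁ φ inv = cancelK (begin
    pw (rk K) * (n₁ * X)   ≡⟨ *-swap (pw (rk K)) n₁ X ⟩
    n₁ * (pw (rk K) * X)   ≡⟨ cong (n₁ *_) (transfer φ inv) ⟩
    n₁ * (c₀ * Y)          ≡⟨ lem n₁ c₀ Y ⟩
    c₀ * n₁ * Y            ≡⟨ cong (_* Y) (sym sizes) ⟩
    pw (rk K) * n₀ * Y     ≡⟨ QP.*-assoc (pw (rk K)) n₀ Y ⟩
    pw (rk K) * (n₀ * Y) ∎)
    where
    open ≡-Reasoning
    X = ∑[ v ∈ allV n ] (⟦ annv A v ⟧ * φ v)
    Y = ∑[ v ∈ allV n ] (⟦ wmem v ⟧ * φ v)
    lem : ∀ a b c → a * (b * c) ≡ b * a * c
    lem = solve-∀ ℚring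
    sizes : pw (rk K) * n₀ ≡ c₀ * n₁
    sizes = trans (cong (pw (rk K) *_) (∑-cong (allV n) λ v → sym (QP.*-identityʳ ⟦ annv A v ⟧))) (trans (transfer (λ _ → 1ℚ) (λ _ _ _ → refl)) (cong (c₀ *_) (∑-cong (allV n) λ v → QP.*-identityʳ ⟦ wmem v ⟧)))

  transfers : ∀ d (G : M n d → ℚ) → (∀ N N' → Cong K N N' → G N ≡ G N') →
    n₁ ^ℚ d * ∑[ N ∈ allM n d ] (⟦ ann A N ⟧ * G N) ≡ n₀ ^ℚ d * ∑[ N ∈ allM n d ] (⟦ allCols wmem N ⟧ * G N)
  transfers zero G inv = refl
  transfers (suc d) G inv = begin
    n₁ * n₁ ^ℚ d * ∑[ N ∈ allM n (suc d) ] (⟦ ann A N ⟧ * G N)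
      ≡⟨ cong (n₁ * n₁ ^ℚ d *_) (split (annv A)) ⟩
    n₁ * n₁ ^ℚ d * ∑[ v ∈ allV n ] (⟦ annv A v ⟧ * ∑[ N ∈ allM n d ] (⟦ ann A N ⟧ * G (v ∷ N)))
      ≡⟨ trans (QP.*-assoc n₁ (n₁ ^ℚ d) _) (cong (n₁ *_) (sym (∑-*ˡ (allV n) (n₁ ^ℚ d) _))) ⟩
    n₁ * ∑[ v ∈ allV n ] (n₁ ^ℚ d * (⟦ annv A v ⟧ * ∑[ N ∈ allM n d ] (⟦ ann A N ⟧ * G (v ∷ N))))
      ≡⟨ cong (n₁ *_) (∑-cong (allV n) λ v → trans (*-swap (n₁ ^ℚ d) ⟦ annv A v ⟧ _) (cong (⟦ annv A v ⟧ *_) (transfers d (λ N → G (v ∷ N)) λ N N' c → inv (v ∷ N) (v ∷ N') (trans (cong (inSp K) (⊕-self v)) (inSp-0 K) ∷ c)))) ⟩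
    n₁ * ∑[ v ∈ allV n ] (⟦ annv A v ⟧ * φ v)
      ≡⟨ transfer₁ φ (λ v y e → cong (n₀ ^ℚ d *_) (∑-cong (allM n d) λ N → cong (⟦ allCols wmem N ⟧ *_) (inv _ _ (subst (λ z → inSp K z ≡ true) (sym (⊕-cancelʳ v y)) e ∷ Cong-refl K N)))) ⟩
    n₀ * ∑[ v ∈ allV n ] (⟦ wmem v ⟧ * φ v)
      ≡⟨ cong (n₀ *_) (trans (∑-cong (allV n) λ v → *-swap ⟦ wmem v ⟧ (n₀ ^ℚ d) _) (trans (∑-*ˡ (allV n) (n₀ ^ℚ d) _) (cong (n₀ ^ℚ d *_) (sym (split wmem))))) ⟩
    n₀ * (n₀ ^ℚ d * ∑[ N ∈ allM n (suc d) ] (⟦ allCols wmem N ⟧ * G N))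
      ≡⟨ sym (QP.*-assoc n₀ (n₀ ^ℚ d) _) ⟩
    n₀ * n₀ ^ℚ d * ∑[ N ∈ allM n (suc d) ] (⟦ allCols wmem N ⟧ * G N) ∎
    where
    open ≡-Reasoning
    φ : V n → ℚ
    φ v = n₀ ^ℚ d * ∑[ N ∈ allM n d ] (⟦ allCols wmem N ⟧ * G (v ∷ N))
    split : ∀ (S : V n → Bool) → ∑[ N ∈ allM n (suc d) ] (⟦ allCols S N ⟧ * G N) ≡ ∑[ v ∈ allV n ] (⟦ S v ⟧ * ∑[ N ∈ allM n d ] (⟦ allCols S N ⟧ * G (v ∷ N)))
    split S = trans (∑-allM (λ N → ⟦ allCols S N ⟧ * G N)) (∑-cong (allV n) λ v → trans (∑-cong (allM n d) λ N → trans (cong (_* G (v ∷ N)) (⟦∧⟧ (S v) (allCols S N))) (QP.*-assoc ⟦ S v ⟧ _ _)) (∑-*ˡ (allM n d) ⟦ S v ⟧ _))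

  W : VSet n
  W = tabulateS wmem

  memW : ∀ v → mem W v ≡ wmem v
  memW = mem-tabulateS wmem

  W-intro : ∀ y v → inSp K y ≡ true → annv A (v ⊕v y) ≡ true → mem W v ≡ true
  W-intro y v p q = trans (memW v) (anyᵇ-intro {P = λ y → inSp K y ∧ annv A (v ⊕v y)} y (∧-intro p q))

  W-elim : ∀ v → mem W v ≡ true → ∃ λ y → inSp K y ≡ true × annv A (v ⊕v y) ≡ true
  W-elim v e = let (y , q) = anyᵇ-elim {P = λ y → inSp K y ∧ annv A (v ⊕v y)} (trans (sym (memW v)) e) in y , proj₁ (∧-true {inSp K y} q) , proj₂ (∧-true {inSp K y} q)

  subW : IsSub W
  has0 subW = W-intro 0v 0v (inSp-0 K) (trans (cong (annv A) (⊕-idˡ 0v)) (annv-0 A))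
  has+ subW u v p q = let (y , a , b) = W-elim u p ; (y' , a' , b') = W-elim v q in
    W-intro (y ⊕v y') (u ⊕v v) (inSp-⊕ K a a') (subst (λ z → annv A z ≡ true) (⊕-swap u y v y') (annv-⊕ A _ _ b b'))

  K⊆W : ∀ y → inSp K y ≡ true → mem W y ≡ true
  K⊆W y e = W-intro y y e (trans (cong (annv A) (⊕-self y)) (annv-0 A))

  n₀≤n₁ : n₀ ≤ n₁
  n₀≤n₁ = ∑-mono (allV n) λ v → le v
    where
    le : ∀ v → ⟦ annv A v ⟧ ≤ ⟦ wmem v ⟧
    le v with annv A v in e
    ... | false = ⟦⟧≥0 (wmem v)
    ... | true = ≤≡ (cong ⟦_⟧ (sym (trans (sym (memW v)) (W-intro 0v v (inSp-0 K) (trans (cong (annv A) (⊕-idʳ v)) e)))))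

-- The annihilator W₀ of `A` need not contain Q and H, as goodness demands. But `N ↦ g (N ⧺ Q)` is
-- invariant under changes of columns by K = span (Q ⧺ E), so W₀ may be replaced by W₀ + K without
-- changing averages, and the codimension does not grow beyond `length A`.
module Standard {n d J : ℕ} (E : M n J) (g : ∀ {m} → M n m → ℚ)
  (g-inv : ∀ {a b} (N : M n a) (N' : M n b) → a ≡ b → (∀ x → inSp (N ⧺ E) x ≡ inSp (N' ⧺ E) x) → g N ≡ g N')
  (r h : ℕ)
  (ng : ∀ {p d'} (Q : M n p) → p ℕ.≤ r → d' ℕ.+ p ≡ d → ∀ r₂ → r₂ ℕ.≤ r → r₂ ℕ.≤ n → ∀ W → isGrass (n ℕ.∸ r₂) W ≡ true →
    colsIn W Q ≡ true → colsIn W E ≡ true → pw h * ∑[ N ∈ allM n d' ] (⟦ colsIn W N ⟧ * g (N ⧺ Q)) ≤ ∑[ N ∈ allM n d' ] ⟦ colsIn W N ⟧) where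

  std : ∀ {p d'} (Q : M n p) (A : List (V n)) → p ℕ.≤ r → length A ℕ.≤ r → d' ℕ.+ p ≡ d →
    pw h * ∑[ N ∈ allM n d' ] (⟦ ann A N ⟧ * g (N ⧺ Q)) ≤ ∑[ N ∈ allM n d' ] ⟦ ann A N ⟧
  std {p} {d'} Q A p≤ A≤ e = *-cancelˡ-≤ (n₁ ^ℚ d') n₁^>0 (begin
    n₁ ^ℚ d' * (pw h * ∑[ N ∈ allM n d' ] (⟦ ann A N ⟧ * g (N ⧺ Q)))
      ≡⟨ trans (*-swap (n₁ ^ℚ d') (pw h) _) (cong (pw h *_) (transfers d' (λ N → g (N ⧺ Q)) inv)) ⟩
    pw h * (n₀ ^ℚ d' * ∑[ N ∈ allM n d' ] (⟦ allCols wmem N ⟧ * g (N ⧺ Q)))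
      ≡⟨ trans (*-swap (pw h) (n₀ ^ℚ d') _) (cong (λ z → n₀ ^ℚ d' * (pw h * z)) (∑-cong (allM n d') λ N → cong (λ z → ⟦ z ⟧ * g (N ⧺ Q)) (sym (cw N)))) ⟩
    n₀ ^ℚ d' * (pw h * ∑[ N ∈ allM n d' ] (⟦ colsIn W N ⟧ * g (N ⧺ Q)))
      ≤⟨ *-monoˡ _ n₀^≥0 (ng Q p≤ e r₂ r₂≤r (NP.m∸n≤m n m) W gr (sp-colsIn W Q λ x q → K⊆W x (inSp-⧺ˡ Q E x q)) (sp-colsIn W E λ x q → K⊆W x (inSp-⧺ʳ Q E x q))) ⟩
    n₀ ^ℚ d' * ∑[ N ∈ allM n d' ] ⟦ colsIn W N ⟧
      ≡⟨ cong (n₀ ^ℚ d' *_) (trans (∑-cong (allM n d') λ N → cong ⟦_⟧ (cw N)) (∑-allCols wmem d')) ⟩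
    n₀ ^ℚ d' * n₁ ^ℚ d'
      ≡⟨ trans (QP.*-comm (n₀ ^ℚ d') (n₁ ^ℚ d')) (cong (n₁ ^ℚ d' *_) (sym (∑-allCols (annv A) d'))) ⟩
    n₁ ^ℚ d' * ∑[ N ∈ allM n d' ] ⟦ ann A N ⟧ ∎)
    where
    open QP.≤-Reasoning
    open Fatten (Q ⧺ E) A
    pz = sub-pow W subW
    m = proj₁ pz
    m≤n = proj₁ (proj₂ pz)
    cardW : ∑[ v ∈ allV n ] ⟦ mem W v ⟧ ≡ pw m
    cardW = proj₂ (proj₂ pz)
    n₁≡ : n₁ ≡ pw m
    n₁≡ = trans (∑-cong (allV n) λ v → cong ⟦_⟧ (sym (memW v))) cardW
    n₁^>0 : 0ℚ < n₁ ^ℚ d'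
    n₁^>0 = subst (0ℚ <_) (trans (^-^ two m d') (cong (_^ℚ d') (sym n₁≡))) (pw>0 (m ℕ.* d'))
    n₀^≥0 : 0ℚ ≤ n₀ ^ℚ d'
    n₀^≥0 = ^-≥0 (∑-≥0 (allV n) λ v → ⟦⟧≥0 (annv A v)) d'
    r₂ = n ℕ.∸ m
    big : n ℕ.≤ length A ℕ.+ m
    big = pw-cancel-≤ (≤-trans (annv-card A) (≤-trans (*-monoˡ _ (pw≥0 (length A)) (≤-trans n₀≤n₁ (≤≡ n₁≡))) (≤≡ (sym (pw-+ (length A) m)))))
    r₂≤r : r₂ ℕ.≤ r
    r₂≤r = NP.≤-trans (NP.m≤n+o⇒m∸n≤o n m (subst (n ℕ.≤_) (NP.+-comm (length A) m) big)) A≤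
    gr : isGrass (n ℕ.∸ r₂) W ≡ true
    gr = subst (λ z → isGrass z W ≡ true) (sym (NP.m∸[m∸n]≡n m≤n)) (grass-intro m W subW cardW)
    cw : ∀ N → colsIn W N ≡ allCols wmem N
    cw N = trans (allCols-mem W N) (allCols-cong memW N)
    inv : ∀ N N' → Cong (Q ⧺ E) N N' → g (N ⧺ Q) ≡ g (N' ⧺ Q)
    inv N N' c = g-inv (N ⧺ Q) (N' ⧺ Q) refl λ x → trans (inSp-⧺-assoc N Q E x) (trans (≡-from-iff (Cong-sp (Q ⧺ E) N N' c x) (Cong-sp (Q ⧺ E) N' N (Cong-sym (Q ⧺ E) N N' c) x)) (sym (inSp-⧺-assoc N' Q E x)))

  zoom-std : Zoom r h (λ (N : M n d) → g N)
  zoom-std = Reduce.zoom-g {n} {d} {J} E g g-inv r h std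

-- Fractions, powers of two, H and bases

private
  int : ℤ.ℤ → ℚ
  int i = i ℚ./ 1

int-mk : ∀ i → int i ≡ ℚ.mkℚ i 0 (Cop.sym (Cop.1-coprimeTo ℤ.∣ i ∣))
int-mk i = QP.↥p/↧p≡p (ℚ.mkℚ i 0 (Cop.sym (Cop.1-coprimeTo ℤ.∣ i ∣)))

int-+ : ∀ i j → int i + int j ≡ int (i ℤ.+ j)
int-+ i j = QP.toℚᵘ-injective (UP.≃-trans (QP.toℚᵘ-homo-+ (int i) (int j)) (UP.≃-trans (UP.+-cong (QP.toℚᵘ-fromℚᵘ (ℚᵘ.mkℚᵘ i 0)) (QP.toℚᵘ-fromℚᵘ (ℚᵘ.mkℚᵘ j 0)))
  (UP.≃-trans (ℚᵘ.*≡* (cong (ℤ._* ℤ.+ 1) (cong₂ ℤ._+_ (ZP.*-identityʳ i) (ZP.*-identityʳ j)))) (UP.≃-sym (QP.toℚᵘ-fromℚᵘ (ℚᵘ.mkℚᵘ (i ℤ.+ j) 0))))))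

ι-int : ∀ k → ι k ≡ fromℕ k
ι-int zero = refl
ι-int (suc k) = trans (cong (1ℚ +_) (ι-int k)) (int-+ (ℤ.+ 1) (ℤ.+ k))

frac-suc : ∀ a b → frac a (suc b) * ι (suc b) ≡ ι a
frac-suc a b = trans (cong (frac a (suc b) *_) (ι-int (suc b))) (trans (QP.toℚᵘ-injective (UP.≃-trans (QP.toℚᵘ-homo-* (ℤ.+ a ℚ./ suc b) (int (ℤ.+ suc b)))
  (UP.≃-trans (UP.*-cong (QP.toℚᵘ-fromℚᵘ (ℚᵘ.mkℚᵘ (ℤ.+ a) b)) (QP.toℚᵘ-fromℚᵘ (ℚᵘ.mkℚᵘ (ℤ.+ suc b) 0)))
    (UP.≃-trans (ℚᵘ.*≡* (trans (ZP.*-identityʳ _) (cong (ℤ.+ a ℤ.*_) (cong (λ z → ℤ.+ suc z) (sym (NP.*-identityʳ b)))))) (UP.≃-sym (QP.toℚᵘ-fromℚᵘ (ℚᵘ.mkℚᵘ (ℤ.+ a) 0)))))))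
  (sym (ι-int a)))

ι>0 : ∀ b → 0ℚ < ι (suc b)
ι>0 b = ≤∧≢⇒< (ι≥0 (suc b)) λ e → NP.1+n≰n (NP.≤-trans (ι-cancel {suc b} {0} (≤≡ (sym e))) (ℕ.z≤n {b}))

frac-mul : ∀ a b → a ℕ.≤ b → frac a b * ι b ≡ ι a
frac-mul zero zero p = refl
frac-mul a (suc b) p = frac-suc a b

frac-≤ : ∀ a b c → 0ℚ ≤ c → ι a ≤ c * ι b → frac a b ≤ c
frac-≤ a zero c c≥0 p = c≥0
frac-≤ a (suc b) c c≥0 p = *-cancelˡ-≤ (ι (suc b)) (ι>0 b) (subst₂ _≤_ (sym (trans (QP.*-comm (ι (suc b)) _) (frac-suc a b))) (QP.*-comm c (ι (suc b))) p)

frac-≥0 : ∀ a b → 0ℚ ≤ frac a b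
frac-≥0 a zero = ≤-refl
frac-≥0 a (suc b) = *-cancelˡ-≤ (ι (suc b)) (ι>0 b) (subst₂ _≤_ (sym (QP.*-zeroʳ (ι (suc b)))) (sym (trans (QP.*-comm (ι (suc b)) _) (frac-suc a b))) (ι≥0 a))

frac-≤1 : ∀ a b → a ℕ.≤ b → frac a b ≤ 1ℚ
frac-≤1 a b p = frac-≤ a b 1ℚ 0≤1 (≤-trans (ι-mono p) (≤≡ (sym (QP.*-identityˡ (ι b)))))

pw≡2^ℤ : ∀ m → 2^ℤ (ℤ.+ m) ≡ pw m
pw≡2^ℤ m = trans (sym (ι-int (2 ℕ.^ m))) (ι-2^ m)

hp≡2^ℤ : ∀ m → 2^ℤ (ℤ.- (ℤ.+ m)) ≡ hp m
hp≡2^ℤ zero = refl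
hp≡2^ℤ (suc m) = go (2 ℕ.^ suc m) {{NP.m^n≢0 2 (suc m)}} refl
  where
  go : ∀ k .{{_ : ℕ.NonZero k}} → k ≡ 2 ℕ.^ suc m → (ℤ.+ 1) ℚ./ k ≡ hp (suc m)
  go (suc k) e = begin
    x                                        ≡⟨ sym (QP.*-identityʳ x) ⟩
    x * 1ℚ                                   ≡⟨ cong (x *_) (sym (pw*hp (suc m))) ⟩
    x * (pw (suc m) * hp (suc m))            ≡⟨ sym (QP.*-assoc x (pw (suc m)) (hp (suc m))) ⟩
    x * pw (suc m) * hp (suc m)              ≡⟨ cong (λ z → x * z * hp (suc m)) (trans (sym (ι-2^ (suc m))) (cong ι (sym e))) ⟩
    x * ι (suc k) * hp (suc m)               ≡⟨ cong (_* hp (suc m)) (frac-suc 1 k) ⟩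
    (1ℚ + 0ℚ) * hp (suc m)                   ≡⟨ QP.*-identityˡ (hp (suc m)) ⟩
    hp (suc m) ∎
    where
    open ≡-Reasoning
    x = (ℤ.+ 1) ℚ./ suc k

mat : ∀ {J} → (Fin J → V n) → M n J
mat e = Vec.tabulate e

mat-comb : ∀ {J} (e : Fin J → V n) (c : V J) → mat e · c ≡ comb e c
mat-comb {J = zero} e [] = refl
mat-comb {J = suc J} e (c ∷ cs) = cong (sc c (e Fin.zero) ⊕v_) (mat-comb (λ i → e (Fin.suc i)) cs)

HU-spS : ∀ {J} (e : Fin J → V n) → HU e ≡ spS (mat e)
HU-spS {n} {J} e = VSet-ext λ v → trans (mem-tabulateS _ v) (trans (≡-from-iff
  (λ p → let (c , q) = anyᵇ-elim {P = λ c → v ==v comb e c} p in inSp-complete (mat e) c (trans (mat-comb e c) (sym (==v-sound q))))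
  (λ p → let (c , q) = inSp-sound (mat e) v p in anyᵇ-intro {P = λ c → v ==v comb e c} c (eq-complete (VE n) (trans (sym q) (mat-comb e c))))) (sym (mem-spS (mat e) v)))

pick : (u : V n) → 0 ℕ.< weight u → ∃ λ y → dot y u ≡ true × (∀ w → disjointᵇ u w ≡ true → dot y w ≡ false)
pick (true ∷ u) p = (true ∷ 0v) , cong (true xor_) (dot-0ˡ u) , λ { (false ∷ w) q → dot-0ˡ w }
pick (false ∷ u) p = let (y , a , b) = pick u p in (false ∷ y) , a , λ { (c ∷ w) q → b w q }

dot-comb : ∀ {J} (e : Fin J → V n) (b : Fin J → Bool) (x : V n) → (∀ i → dot x (e i) ≡ b i) → ∀ c → dot x (comb e c) ≡ combB b c
dot-comb {J = zero} e b x h [] = dot-0ʳ x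
dot-comb {J = suc J} e b x h (c ∷ cs) = trans (dot-⊕ʳ x (sc c (e Fin.zero)) _) (cong₂ _xor_ (trans (dot-sc x c (e Fin.zero)) (cong (c ∧_) (h Fin.zero))) (dot-comb (λ i → e (Fin.suc i)) (λ i → b (Fin.suc i)) x (λ i → h (Fin.suc i)) cs))

combB-0 : ∀ {J} (c : V J) → combB (λ _ → false) c ≡ false
combB-0 [] = refl
combB-0 (c ∷ cs) = trans (cong (_xor combB (λ _ → false) cs) (BP.∧-zeroʳ c)) (combB-0 cs)

-- The vector of `pick` sits at a variable of the first equation, which occurs in no other one;
-- pairing with it reads off the first coefficient.
comb-indep : ∀ {J} (e : Fin J → V n) → (∀ i → 0 ℕ.< weight (e i)) → (∀ i j → i ≢ j → disjointᵇ (e i) (e j) ≡ true) → ∀ c → comb e c ≡ 0v → c ≡ 0v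
comb-indep {J = zero} e w d [] p = refl
comb-indep {n} {suc J} e w d (c ∷ cs) p = cong₂ _∷_ c0 (comb-indep (λ i → e (Fin.suc i)) (λ i → w (Fin.suc i)) (λ i j ne → d (Fin.suc i) (Fin.suc j) λ { refl → ne refl }) cs rest)
  where
  open Σ (pick (e Fin.zero) (w Fin.zero)) renaming (proj₁ to y; proj₂ to yp)
  val0 : dot y (comb e (c ∷ cs)) ≡ c
  val0 = trans (dot-⊕ʳ y (sc c (e Fin.zero)) _) (trans (cong₂ _xor_ (trans (dot-sc y c (e Fin.zero)) (trans (cong (c ∧_) (proj₁ yp)) (BP.∧-identityʳ c)))
    (trans (dot-comb (λ i → e (Fin.suc i)) (λ _ → false) y (λ i → proj₂ yp (e (Fin.suc i)) (d Fin.zero (Fin.suc i) λ ())) cs) (combB-0 cs))) (BP.xor-identityʳ c))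
  c0 : c ≡ false
  c0 = trans (sym val0) (trans (cong (dot y) p) (dot-0ʳ y))
  rest : comb (λ i → e (Fin.suc i)) cs ≡ 0v
  rest = trans (sym (⊕-idˡ _)) (trans (cong (λ z → sc z (e Fin.zero) ⊕v comb (λ i → e (Fin.suc i)) cs) (sym c0)) p)

rk-indep : (X : M n d) → (∀ c → X · c ≡ 0v → c ≡ 0v) → rk X ≡ d
rk-indep {n} {d} X h = pw-inj (trans (sym (QP.*-identityʳ _)) (trans (cong (pw (rk X) *_) (sym one)) (∑-ker X)))
  where
  one : kerSize X ≡ 1ℚ
  one = trans (∑-cong (allV d) λ u → trans (cong ⟦_⟧ (≡-from-iff (λ p → eq-complete (VE d) (h u (==v-sound p))) (λ p → eq-complete (VE n) (trans (cong (X ·_) (==v-sound p)) (·-0 X))))) (sym (QP.*-identityʳ ⟦ u ==v 0v ⟧))) (∑δ (VE d) 0v (λ _ → 1ℚ))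

-- `T W` has rank `q` and is therefore onto, and by `∑-fib` every value is attained equally often.
count-system : ∀ {q} (W : M n q) → rk W ≡ q → (c : V q) → pw q * ∑[ x ∈ allV n ] ⟦ Vec.map (dot x) W ==v c ⟧ ≡ pw n
count-system {n} {q} W rkW c = trans (cong₂ _*_ (cong pw (sym rkT)) (∑-cong (allV n) λ x → cong (λ z → ⟦ z ==v c ⟧) (sym (T-· W x))))
  (trans (∑-fib (T W) (λ y → ⟦ y ==v c ⟧)) (trans (cong (pw n *_) (trans (∑-cong (allV q) λ y → trans (cong (λ z → ⟦ z ⟧ * ⟦ y ==v c ⟧) (full y)) (QP.*-comm 1ℚ ⟦ y ==v c ⟧)) (∑δ (VE q) c (λ _ → 1ℚ)))) (QP.*-identityʳ (pw n))))
  where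
  rkT : rk (T W) ≡ q
  rkT = trans (rk-T W) rkW
  full : ∀ y → inSp (T W) y ≡ true
  full = ⊆-card {A = inSp (T W)} {λ _ → true} (λ _ _ → refl) (trans (∑-sp (T W)) (trans (cong pw rkT) (sym (trans (∑-const q 1ℚ) (QP.*-identityʳ (pw q))))))

any-elim : {A : Set} {Q : A → Bool} (xs : List A) → BL.any Q xs ≡ true → ∃ λ x → x ∈ xs × Q x ≡ true
any-elim {Q = Q} (x ∷ xs) e with ∨-true {Q x} e
... | inj₁ p = x , here refl , p
... | inj₂ p = let (y , m , q) = any-elim xs p in y , there m , q

any-intro : {A : Set} {Q : A → Bool} (xs : List A) {x : A} → x ∈ xs → Q x ≡ true → BL.any Q xs ≡ true
any-intro (x ∷ xs) (here refl) p = ∨-introˡ _ p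
any-intro {Q = Q} (x ∷ xs) (there m) p = ∨-introʳ (Q x) (any-intro xs m p)

∈-allSets : (S : VSet n) → S ∈ allSets n
∈-allSets {zero} false = here refl
∈-allSets {zero} true = there (here refl)
∈-allSets {suc n} (A , B) = ∈-cartesianProduct⁺ (∈-allSets A) (∈-allSets B)

∈-allM : (N : M n d) → N ∈ allM n d
∈-allM [] = here refl
∈-allM (v ∷ N) = ∈-cartesianProductWith⁺ _∷_ (∈-allV v) (∈-allM N)

rk-⧺ : ∀ {J} (E : M n J) (N : M n d) → rk (N ⧺ E) ℕ.≤ d ℕ.+ rk E
rk-⧺ E [] = NP.≤-refl
rk-⧺ E (v ∷ N) with inSp (N ⧺ E) v
... | true = NP.m≤n⇒m≤1+n (rk-⧺ E N)
... | false = ℕ.s≤s (rk-⧺ E N)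

ind-rk : ∀ {J} (E : M n J) (N : M n d) → rk (N ⧺ E) ≡ d ℕ.+ rk E → ind E N ≡ true
ind-rk E [] e = refl
ind-rk {d = suc d} E (v ∷ N) e with inSp (N ⧺ E) v
... | true = ⊥-elim (NP.1+n≰n (subst (ℕ._≤ d ℕ.+ rk E) e (rk-⧺ E N)))
... | false = trans (BP.∧-identityʳ _) (ind-rk E N (NP.suc-injective e))

rk-span : ∀ {a b} (N : M n a) (N' : M n b) → (∀ x → inSp N x ≡ inSp N' x) → rk N ≡ rk N'
rk-span {n} N N' h = pw-inj (trans (sym (∑-sp N)) (trans (∑-cong (allV n) λ x → cong ⟦_⟧ (h x)) (∑-sp N')))

-- `ind` is built along an order of the columns, but it holds iff the rank of `N ⧺ E` is as large as
-- possible, and the rank is a function of the span.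
ind-inv : ∀ {J} (E : M n J) (N N' : M n d) → (∀ x → inSp (N ⧺ E) x ≡ inSp (N' ⧺ E) x) → ind E N ≡ ind E N'
ind-inv E N N' h = ≡-from-iff
  (λ i → ind-rk E N' (trans (sym (rk-span (N ⧺ E) (N' ⧺ E) h)) (rk-ind E N i)))
  (λ i → ind-rk E N (trans (rk-span (N ⧺ E) (N' ⧺ E) h) (rk-ind E N' i)))

mem-sumS : ∀ {J} (E : M n J) (N : M n d) (v : V n) → mem (sumS (spS N) (spS E)) v ≡ inSp (N ⧺ E) v
mem-sumS E N v = trans (mem-tabulateS _ v) (≡-from-iff
  (λ p → let (a , q) = anyᵇ-elim {P = λ a → mem (spS N) a ∧ mem (spS E) (a ⊕v v)} p in
     subst (λ z → inSp (N ⧺ E) z ≡ true) (⊕-cancel a v) (inSp-⧺-intro N E (trans (sym (mem-spS N a)) (proj₁ (∧-true {mem (spS N) a} q))) (trans (sym (mem-spS E (a ⊕v v))) (proj₂ (∧-true {mem (spS N) a} q)))))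
  (λ p → let (y , q , s) = inSp-⧺-split N E v p in anyᵇ-intro {P = λ a → mem (spS N) a ∧ mem (spS E) (a ⊕v v)} y (∧-intro (trans (mem-spS N y) q) (trans (mem-spS E (y ⊕v v)) (subst (λ z → inSp E z ≡ true) (⊕-comm v y) s)))))

-- Split each column of `B` into a vector of the span of `N'` and one of the span of `E`, and keep
-- the former. In this way a good Q inside L is moved into any L' with the same sum with H.
lift-cols : ∀ {J k m} (E : M n J) (N' : M n m) (B : M n k) → (∀ x → inSp B x ≡ true → inSp (N' ⧺ E) x ≡ true) → ∃ λ B' → Cong E B B' × colsIn (spS N') B' ≡ true
lift-cols E N' [] h = [] , [] , refl
lift-cols E N' (v ∷ B) h =
  let (y , p , q) = inSp-⧺-split N' E v (h v (∨-introʳ (inSp B v) (trans (cong (inSp B) (⊕-self v)) (inSp-0 B))))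
      (B' , c , i) = lift-cols E N' B (λ x e → h x (∨-introˡ _ e)) in
  y ∷ B' , q ∷ c , ∧-intro (trans (mem-spS N' y) p) i

Cong-span : ∀ {k} (K : M n k) (N N' : M n d) → Cong K N N' → ∀ x → inSp (N ⧺ K) x ≡ inSp (N' ⧺ K) x
Cong-span K N N' c x = ≡-from-iff (Cong-sp K N N' c x) (Cong-sp K N' N (Cong-sym K N N' c) x)

⊆-colsIn : ∀ {k p} {W : VSet n} → IsSub W → (N : M n k) (B : M n p) → colsIn W B ≡ true → (spS (N ⧺ B) ⊆ᵇ W) ≡ colsIn W N
⊆-colsIn {W = W} s N B cB = ≡-from-iff
  (λ e → sp-colsIn W N λ x p → ⊆-elim {A = spS (N ⧺ B)} {W} e x (trans (mem-spS (N ⧺ B) x) (inSp-⧺ˡ N B x p)))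
  (λ e → ⊆-intro {A = spS (N ⧺ B)} λ v p → colsIn-sp s (N ⧺ B) (trans (colsIn-⧺ W N B) (∧-intro e cB)) v (trans (sym (mem-spS (N ⧺ B) v)) p))

decB : {X : Set} → Dec X → Bool
decB (yes _) = true
decB (no _) = false

decB-sound : {X : Set} (p : Dec X) → decB p ≡ true → X
decB-sound (yes x) _ = x

decB-false : {X : Set} (p : Dec X) → decB p ≡ false → ¬ X
decB-false (no x) _ = x

TwoPowNeg≤? : ∀ x p → Dec (TwoPowNeg≤ x p)
TwoPowNeg≤? x p = _ QP.≤? _

len-filter² : {A : Set} (P Q : A → Bool) (P? : ∀ x → Dec (P x ≡ true)) (Q? : ∀ x → Dec (Q x ≡ true)) (xs : List A) →
  ι (length (filter P? (filter Q? xs))) ≡ ∑[ x ∈ xs ] (⟦ Q x ⟧ * ⟦ P x ⟧)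
len-filter² P Q P? Q? xs = trans (len-filter P P? (filter Q? xs)) (∑-filter Q Q? xs (λ x → ⟦ P x ⟧))

len-filter³ : {A : Set} (O P Q : A → Bool) (O? : ∀ x → Dec (O x ≡ true)) (P? : ∀ x → Dec (P x ≡ true)) (Q? : ∀ x → Dec (Q x ≡ true)) (xs : List A) →
  ι (length (filter O? (filter P? (filter Q? xs)))) ≡ ∑[ x ∈ xs ] (⟦ Q x ⟧ * (⟦ P x ⟧ * ⟦ O x ⟧))
len-filter³ O P Q O? P? Q? xs = trans (len-filter O O? (filter P? (filter Q? xs))) (trans (∑-filter P P? (filter Q? xs) (λ x → ⟦ O x ⟧)) (∑-filter Q Q? xs (λ x → ⟦ P x ⟧ * ⟦ O x ⟧)))

cnt>0 : ∀ K t p → t ℕ.+ p ℕ.≤ K → 0ℚ < cnt K t p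
cnt>0 K t p le = QP.<-≤-trans (subst₂ _<_ (QP.*-zeroʳ ¼) refl (QP.*-monoʳ-<-pos ¼ (pw>0 (t ℕ.* K)))) (cnt≥¼ K t p le)

cancel-cnt : ∀ {c a b} → 0ℚ < c → c * ι a ≡ c * ι b → a ≡ b
cancel-cnt {c} c>0 e = NP.≤-antisym (ι-cancel (*-cancelˡ-≤ c c>0 (≤≡ e))) (ι-cancel (*-cancelˡ-≤ c c>0 (≤≡ (sym e))))

-- Power means and counts of bases

same-order : ∀ {x y} m → 0ℚ ≤ x → 0ℚ ≤ y → x * y ^ℚ m + y * x ^ℚ m ≤ x * x ^ℚ m + y * y ^ℚ m
same-order {x} {y} m x≥0 y≥0 with QP.≤-total x y
... | inj₁ p = diff≤ _ (*-≥0 (≤⇒0≤- p) (≤⇒0≤- (^-mono x≥0 p m))) (lem x y (x ^ℚ m) (y ^ℚ m))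
  where
  lem : ∀ x y a b → x * a + y * b ≡ x * b + y * a + (y - x) * (b - a)
  lem = solve-∀ ℚring
... | inj₂ p = diff≤ _ (*-≥0 (≤⇒0≤- p) (≤⇒0≤- (^-mono y≥0 p m))) (lem x y (x ^ℚ m) (y ^ℚ m))
  where
  lem : ∀ x y a b → x * a + y * b ≡ x * b + y * a + (x - y) * (a - b)
  lem = solve-∀ ℚring

-- Chebyshev's sum inequality: `F` and `F^m` are ordered alike, so symmetrising the double sum
-- leaves a non-negative difference.
chebyshev : {A : Set} (xs : List A) (w F : A → ℚ) → (∀ x → 0ℚ ≤ w x) → (∀ x → 0ℚ ≤ F x) → ∀ m →
  ∑[ x ∈ xs ] (w x * F x) * ∑[ x ∈ xs ] (w x * F x ^ℚ m) ≤ ∑ xs w * ∑[ x ∈ xs ] (w x * F x ^ℚ suc m)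
chebyshev xs w F w≥0 F≥0 m = *-cancelˡ-≤ two (QP.positive⁻¹ two) (begin
  two * (S * Sm)
    ≡⟨ lem₁ S Sm ⟩
  S * Sm + Sm * S
    ≡⟨ trans (cong₂ _+_ (∑-prod xs xs (λ x → w x * F x) (λ y → w y * F y ^ℚ m)) (∑-prod xs xs (λ x → w x * F x ^ℚ m) (λ y → w y * F y))) (trans (sym (∑-+ xs _ _)) (∑-cong xs λ x → sym (∑-+ xs _ _))) ⟩
  ∑[ x ∈ xs ] ∑[ y ∈ xs ] (w x * F x * (w y * F y ^ℚ m) + w x * F x ^ℚ m * (w y * F y))
    ≤⟨ ∑-mono xs (λ x → ∑-mono xs λ y → ≤-trans (≤≡ (lem₂ (w x) (w y) (F x) (F y) (F x ^ℚ m) (F y ^ℚ m)))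
         (≤-trans (*-monoˡ (w x * w y) (*-≥0 (w≥0 x) (w≥0 y)) (same-order m (F≥0 x) (F≥0 y))) (≤≡ (lem₃ (w x) (w y) (F x ^ℚ suc m) (F y ^ℚ suc m))))) ⟩
  ∑[ x ∈ xs ] ∑[ y ∈ xs ] (w x * (w y * F y ^ℚ suc m) + w x * F x ^ℚ suc m * w y)
    ≡⟨ sym (trans (cong₂ _+_ (∑-prod xs xs w (λ y → w y * F y ^ℚ suc m)) (∑-prod xs xs (λ x → w x * F x ^ℚ suc m) w)) (trans (sym (∑-+ xs _ _)) (∑-cong xs λ x → sym (∑-+ xs _ _)))) ⟩
  ∑ xs w * S' + S' * ∑ xs w
    ≡⟨ sym (lem₁ (∑ xs w) S') ⟩
  two * (∑ xs w * S') ∎)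
  where
  open QP.≤-Reasoning
  S = ∑[ x ∈ xs ] (w x * F x)
  Sm = ∑[ x ∈ xs ] (w x * F x ^ℚ m)
  S' = ∑[ x ∈ xs ] (w x * F x ^ℚ suc m)
  lem₁ : ∀ a b → two * (a * b) ≡ a * b + b * a
  lem₁ = solve-∀ ℚring
  lem₂ : ∀ w v f g a b → w * f * (v * b) + w * a * (v * g) ≡ w * v * (f * b + g * a)
  lem₂ = solve-∀ ℚring
  lem₃ : ∀ w v a b → w * v * (a + b) ≡ w * (v * b) + w * a * v
  lem₃ = solve-∀ ℚring

-- Every exponent is reached here, not only powers of two, at the price of `F ≥ 0`. It is applied
-- with exponent `2k`.
power-mean : {A : Set} (xs : List A) (w F : A → ℚ) (c : ℚ) → (∀ x → 0ℚ ≤ w x) → (∀ x → 0ℚ ≤ F x) → ∑ xs w ≤ c → ∀ m →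
  (∑[ x ∈ xs ] (w x * F x)) ^ℚ suc m ≤ c ^ℚ m * ∑[ x ∈ xs ] (w x * F x ^ℚ suc m)
power-mean xs w F c w≥0 F≥0 le zero = ≤≡ (trans (QP.*-identityʳ _) (trans (∑-cong xs λ x → cong (w x *_) (sym (QP.*-identityʳ (F x)))) (sym (QP.*-identityˡ _))))
power-mean xs w F c w≥0 F≥0 le (suc m) = begin
  S * S ^ℚ suc m
    ≤⟨ *-monoˡ S (∑-≥0 xs λ x → *-≥0 (w≥0 x) (F≥0 x)) (power-mean xs w F c w≥0 F≥0 le m) ⟩
  S * (c ^ℚ m * S₁)
    ≡⟨ *-swap S (c ^ℚ m) S₁ ⟩
  c ^ℚ m * (S * S₁)
    ≤⟨ *-monoˡ (c ^ℚ m) (^-≥0 c≥0 m) (≤-trans (chebyshev xs w F w≥0 F≥0 (suc m)) (*-monoʳ S₂ (∑-≥0 xs λ x → *-≥0 (w≥0 x) (^-≥0 (F≥0 x) (suc (suc m)))) le)) ⟩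
  c ^ℚ m * (c * S₂)
    ≡⟨ trans (*-swap (c ^ℚ m) c S₂) (sym (QP.*-assoc c (c ^ℚ m) S₂)) ⟩
  c * c ^ℚ m * S₂ ∎
  where
  open QP.≤-Reasoning
  S = ∑[ x ∈ xs ] (w x * F x)
  S₁ = ∑[ x ∈ xs ] (w x * F x ^ℚ suc m)
  S₂ = ∑[ x ∈ xs ] (w x * F x ^ℚ suc (suc m))
  c≥0 = ≤-trans (∑-≥0 xs w≥0) le

pow-diff : ∀ {a b} → 0ℚ ≤ b → b ≤ a → a ≤ 1ℚ → ∀ m → a ^ℚ m ≤ b ^ℚ m + ι m * (a - b)
pow-diff {a} {b} b≥0 b≤a a≤1 zero = ≤≡ (sym (trans (cong (1ℚ +_) (QP.*-zeroˡ (a - b))) refl))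
pow-diff {a} {b} b≥0 b≤a a≤1 (suc m) = begin
  a * a ^ℚ m
    ≤⟨ *-monoˡ a a≥0 (pow-diff b≥0 b≤a a≤1 m) ⟩
  a * (b ^ℚ m + ι m * (a - b))
    ≡⟨ lem a b (b ^ℚ m) (ι m) ⟩
  b * b ^ℚ m + (b ^ℚ m * (a - b) + ι m * (a * (a - b)))
    ≤⟨ QP.+-monoʳ-≤ (b * b ^ℚ m) (QP.+-mono-≤ (*-monoʳ (a - b) df (≤-trans (^-mono b≥0 (≤-trans b≤a a≤1) m) (≤≡ (1^ m)))) (*-monoˡ (ι m) (ι≥0 m) (*-monoʳ (a - b) df a≤1))) ⟩
  b * b ^ℚ m + (1ℚ * (a - b) + ι m * (1ℚ * (a - b)))
    ≡⟨ lem₂ (b * b ^ℚ m) (a - b) (ι m) ⟩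
  b * b ^ℚ m + (1ℚ + ι m) * (a - b) ∎
  where
  open QP.≤-Reasoning
  a≥0 = ≤-trans b≥0 b≤a
  df = ≤⇒0≤- b≤a
  lem : ∀ a b x i → a * (x + i * (a - b)) ≡ b * x + (x * (a - b) + i * (a * (a - b)))
  lem = solve-∀ ℚring
  lem₂ : ∀ x c i → x + (1ℚ * c + i * (1ℚ * c)) ≡ x + (1ℚ + i) * c
  lem₂ = solve-∀ ℚring

∑-allM-⧺ : ∀ {D} t (F : M n (t ℕ.+ D) → ℚ) → ∑ (allM n (t ℕ.+ D)) F ≡ ∑[ N ∈ allM n D ] ∑[ C ∈ allM n t ] F (C ⧺ N)
∑-allM-⧺ {n} {D} zero F = ∑-cong (allM n D) λ N → sym (QP.+-identityʳ _)
∑-allM-⧺ {n} {D} (suc t) F = begin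
  ∑ (allM n (suc (t ℕ.+ D))) F
    ≡⟨ ∑-allM F ⟩
  ∑[ v ∈ allV n ] ∑[ X ∈ allM n (t ℕ.+ D) ] F (v ∷ X)
    ≡⟨ ∑-cong (allV n) (λ v → ∑-allM-⧺ t (λ X → F (v ∷ X))) ⟩
  ∑[ v ∈ allV n ] ∑[ N ∈ allM n D ] ∑[ C ∈ allM n t ] F (v ∷ C ⧺ N)
    ≡⟨ ∑-swap (allV n) (allM n D) _ ⟩
  ∑[ N ∈ allM n D ] ∑[ v ∈ allV n ] ∑[ C ∈ allM n t ] F (v ∷ C ⧺ N)
    ≡⟨ ∑-cong (allM n D) (λ N → sym (∑-allM (λ C → F (C ⧺ N)))) ⟩
  ∑[ N ∈ allM n D ] ∑[ C ∈ allM n (suc t) ] F (C ⧺ N) ∎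
  where open ≡-Reasoning

avgs-eq : ∀ {D} t (f : M n (t ℕ.+ D) → ℚ) (N : M n D) → avgs t f N ≡ hp (t ℕ.* n) * ∑[ C ∈ allM n t ] f (C ⧺ N)
avgs-eq zero f N = trans (sym (QP.+-identityʳ _)) (sym (QP.*-identityˡ (f N + 0ℚ)))
avgs-eq {n} (suc t) f N = begin
  avgs t (avg₁ f) N
    ≡⟨ avgs-eq t (avg₁ f) N ⟩
  hp (t ℕ.* n) * ∑[ C ∈ allM n t ] avg₁ f (C ⧺ N)
    ≡⟨ cong (hp (t ℕ.* n) *_) (trans (∑-cong (allM n t) λ C → avg₁-eq f (C ⧺ N)) (∑-*ˡ (allM n t) (hp n) (λ C → ∑[ v ∈ allV n ] f (v ∷ C ⧺ N)))) ⟩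
  hp (t ℕ.* n) * (hp n * ∑[ C ∈ allM n t ] ∑[ v ∈ allV n ] f (v ∷ C ⧺ N))
    ≡⟨ trans (*-swap (hp (t ℕ.* n)) (hp n) S) (trans (sym (QP.*-assoc (hp n) (hp (t ℕ.* n)) S)) (cong (_* S) (sym (hp-+ n (t ℕ.* n))))) ⟩
  hp (n ℕ.+ t ℕ.* n) * ∑[ C ∈ allM n t ] ∑[ v ∈ allV n ] f (v ∷ C ⧺ N)
    ≡⟨ cong (hp (n ℕ.+ t ℕ.* n) *_) (trans (∑-swap (allM n t) (allV n) _) (sym (∑-allM (λ C → f (C ⧺ N))))) ⟩
  hp (n ℕ.+ t ℕ.* n) * ∑[ C ∈ allM n (suc t) ] f (C ⧺ N) ∎
  where
  open ≡-Reasoning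
  S = ∑[ C ∈ allM n t ] ∑[ v ∈ allV n ] f (v ∷ C ⧺ N)

lin-agree : (N : M n d) (f : V n → Bool) → (∀ u v → inSp N u ≡ true → inSp N v ≡ true → f (u ⊕v v) ≡ (f u xor f v)) →
  ∀ x → Vec.map (dot x) N ≡ Vec.map f N → ∀ v → inSp N v ≡ true → dot x v ≡ f v
lin-agree {n} [] f lin x e v p = subst (λ z → dot x z ≡ f z) (sym (==v-sound p)) (trans (dot-0ʳ x) (sym f0))
  where
  z0 = ==v-refl (0v {n})
  f0 : f 0v ≡ false
  f0 = trans (cong f (sym (⊕-self 0v))) (trans (lin 0v 0v z0 z0) (BP.xor-same (f 0v)))
lin-agree (y ∷ N) f lin x e v p with ∨-true {inSp N v} p
... | inj₁ q = lin-agree N f (λ u v a b → lin u v (∨-introˡ _ a) (∨-introˡ _ b)) x (VP.∷-injectiveʳ e) v q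
... | inj₂ q = begin
  dot x v                        ≡⟨ cong (dot x) (sym (⊕-cancelʳ y v)) ⟩
  dot x ((v ⊕v y) ⊕v y)          ≡⟨ dot-⊕ʳ x (v ⊕v y) y ⟩
  dot x (v ⊕v y) xor dot x y     ≡⟨ cong₂ _xor_ (lin-agree N f (λ u v a b → lin u v (∨-introˡ _ a) (∨-introˡ _ b)) x (VP.∷-injectiveʳ e) (v ⊕v y) q) (VP.∷-injectiveˡ e) ⟩
  f (v ⊕v y) xor f y             ≡⟨ sym (lin (v ⊕v y) y (∨-introˡ _ q) (∨-introʳ (inSp N y) (trans (cong (inSp N) (⊕-self y)) (inSp-0 N)))) ⟩
  f ((v ⊕v y) ⊕v y)              ≡⟨ cong f (⊕-cancelʳ y v) ⟩
  f v ∎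
  where open ≡-Reasoning

sp-map : (f g : V n → Bool) (N : M n d) → (∀ v → inSp N v ≡ true → f v ≡ g v) → Vec.map f N ≡ Vec.map g N
sp-map f g [] h = refl
sp-map f g (y ∷ N) h = cong₂ _∷_ (h y (∨-introʳ (inSp N y) (trans (cong (inSp N) (⊕-self y)) (inSp-0 N)))) (sp-map f g N λ v p → h v (∨-introˡ _ p))

agree-elim : (S : VSet n) (f g : V n → Bool) → agreeOnᵇ S f g ≡ true → ∀ v → mem S v ≡ true → f v ≡ g v
agree-elim S f g e v m = eqb (f v) (g v) (⇒ᵇ-elim {mem S v} (allᵇ-elim {P = λ v → mem S v ⇒ᵇ not (f v xor g v)} e v) m)
  where
  eqb : ∀ a b → not (a xor b) ≡ true → a ≡ b
  eqb false false _ = refl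
  eqb true true _ = refl

agree-intro : (S : VSet n) (f g : V n → Bool) → (∀ v → mem S v ≡ true → f v ≡ g v) → agreeOnᵇ S f g ≡ true
agree-intro S f g h = allᵇ-intro {P = λ v → mem S v ⇒ᵇ not (f v xor g v)} λ v → ⇒ᵇ-intro (mem S v) λ m → trans (cong (λ z → not (z xor g v)) (h v m)) (cong not (BP.xor-same (g v)))

count-solutions : ∀ {q} (W : M n q) → rk W ≡ q → (c : V q) → hp n * ∑[ x ∈ allV n ] ⟦ Vec.map (dot x) W ==v c ⟧ ≡ hp q
count-solutions {n} {q} W rkW c = begin
  hp n * S                   ≡⟨ sym (QP.*-identityˡ (hp n * S)) ⟩
  1ℚ * (hp n * S)            ≡⟨ cong (_* (hp n * S)) (sym (hp*pw q)) ⟩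
  hp q * pw q * (hp n * S)   ≡⟨ lem (hp q) (pw q) (hp n) S ⟩
  hp q * (hp n * (pw q * S)) ≡⟨ cong (λ z → hp q * (hp n * z)) (count-system W rkW c) ⟩
  hp q * (hp n * pw n)       ≡⟨ trans (cong (hp q *_) (hp*pw n)) (QP.*-identityʳ (hp q)) ⟩
  hp q ∎
  where
  open ≡-Reasoning
  S = ∑[ x ∈ allV n ] ⟦ Vec.map (dot x) W ==v c ⟧
  lem : ∀ a b c s → a * b * (c * s) ≡ a * (c * (b * s))
  lem = solve-∀ ℚring

⟦⟧-mono : ∀ {a b} → (a ≡ true → b ≡ true) → ⟦ a ⟧ ≤ ⟦ b ⟧
⟦⟧-mono {false} {b} h = ⟦⟧≥0 b
⟦⟧-mono {true} {b} h = ≤≡ (cong ⟦_⟧ (sym (h refl)))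

any-≤-∑ : {A : Set} (Q : A → Bool) (xs : List A) → ⟦ BL.any Q xs ⟧ ≤ ∑[ x ∈ xs ] ⟦ Q x ⟧
any-≤-∑ Q [] = ≤-refl
any-≤-∑ Q (x ∷ xs) = ≤-trans (∨-≤-+ (Q x) (BL.any Q xs)) (QP.+-monoʳ-≤ ⟦ Q x ⟧ (any-≤-∑ Q xs))
  where
  ∨-≤-+ : ∀ a b → ⟦ a ∨ b ⟧ ≤ ⟦ a ⟧ + ⟦ b ⟧
  ∨-≤-+ false b = ≤≡ (sym (QP.+-identityˡ ⟦ b ⟧))
  ∨-≤-+ true b = diff≤ ⟦ b ⟧ (⟦⟧≥0 b) refl

∑-span₀ : ∀ {J} (E : M n J) d (F : VSet n → ℚ) →
  ∑[ N ∈ allM n d ] (⟦ ind E N ⟧ * F (spS N)) ≡ cnt d d 0 * ∑[ L ∈ allSets n ] (⟦ isGrass d L ∧ trivInter (spS E) L ⟧ * F L)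
∑-span₀ {n} E d F = begin
  ∑[ N ∈ allM n d ] (⟦ ind E N ⟧ * F (spS N))
    ≡⟨ cong (λ m → ∑[ N ∈ allM n m ] (⟦ ind E N ⟧ * F (spS N))) (sym (NP.+-identityʳ d)) ⟩
  ∑[ N ∈ allM n (d ℕ.+ 0) ] (⟦ ind E N ⟧ * F (spS N))
    ≡⟨ trans (∑-allM-⧺ {n} {0} d (λ N → ⟦ ind E N ⟧ * F (spS N))) (QP.+-identityʳ _) ⟩
  ∑[ C ∈ allM n d ] (⟦ ind E (C ⧺ []) ⟧ * F (spS (C ⧺ [])))
    ≡⟨ ∑-span E [] refl d F ⟩
  cnt (d ℕ.+ 0) d 0 * ∑[ L ∈ allSets n ] (⟦ isGrass (d ℕ.+ 0) L ∧ (trivInter (spS E) L ∧ (spS {d = 0} [] ⊆ᵇ L)) ⟧ * F L)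
    ≡⟨ cong (λ m → cnt m d 0 * ∑[ L ∈ allSets n ] (⟦ isGrass m L ∧ (trivInter (spS E) L ∧ (spS {d = 0} [] ⊆ᵇ L)) ⟧ * F L)) (NP.+-identityʳ d) ⟩
  cnt d d 0 * ∑[ L ∈ allSets n ] (⟦ isGrass d L ∧ (trivInter (spS E) L ∧ (spS {d = 0} [] ⊆ᵇ L)) ⟧ * F L)
    ≡⟨ cong (cnt d d 0 *_) (∑-cong (allSets n) λ L → cong (λ z → ⟦ z ⟧ * F L) (≡-from-iff
         (λ q → let (g , r) = ∧-true {isGrass d L} q in ∧-intro g (proj₁ (∧-true {trivInter (spS E) L} r)))
         (λ q → let (g , r) = ∧-true {isGrass d L} q in ∧-intro g (∧-intro r (⊆-intro {A = spS {d = 0} []} {L} λ v m →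
            subst (λ z → mem L z ≡ true) (sym (==v-sound (trans (sym (mem-spS [] v)) m))) (IsSub.has0 (grass-sub d L g))))))) ⟩
  cnt d d 0 * ∑[ L ∈ allSets n ] (⟦ isGrass d L ∧ trivInter (spS E) L ⟧ * F L) ∎
  where open ≡-Reasoning

∑-ind₀ : ∀ {J} (E : M n J) d → ∑[ N ∈ allM n d ] ⟦ ind E N ⟧ ≡ cnt n d (rk E)
∑-ind₀ {n} E d = trans (cong (λ m → ∑[ N ∈ allM n m ] ⟦ ind E N ⟧) (sym (NP.+-identityʳ d)))
  (trans (∑-allM-⧺ {n} {0} d (λ N → ⟦ ind E N ⟧)) (trans (QP.+-identityʳ _) (∑-ind E [] refl d)))

∑-mono-∈ : {A : Set} (xs : List A) {f g : A → ℚ} → (∀ x → x ∈ xs → f x ≤ g x) → ∑ xs f ≤ ∑ xs g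
∑-mono-∈ [] h = ≤-refl
∑-mono-∈ (x ∷ xs) h = QP.+-mono-≤ (h x (here refl)) (∑-mono-∈ xs λ y m → h y (there m))

colsIn-⊆ : ∀ {k} (L : VSet n) → IsSub L → (B : M n k) → colsIn L B ≡ (spS B ⊆ᵇ L)
colsIn-⊆ L s B = ≡-from-iff (λ c → ⊆-intro {A = spS B} {L} λ v m → colsIn-sp s B c v (trans (sym (mem-spS B v)) m))
  (λ c → sp-colsIn L B λ x p → ⊆-elim {A = spS B} {L} c x (trans (mem-spS B x) p))

4*¼ : ∀ x → pw 2 * (¼ * x) ≡ x
4*¼ x = trans (sym (QP.*-assoc (pw 2) ¼ x)) (QP.*-identityˡ x)

-- The admissible `L` containing `B` are counted once by all their bases and once by extensions of
-- `B` only; comparing the counts shows that `B` lies in the span of a random `N` with probability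
-- at most `4 · 2^(r₁(m - n))`, where `m = d' + r₁`.
count-containing : ∀ {J r₁} (E : M n J) (B : M n r₁) → ind E B ≡ true → ∀ d' → d' ℕ.+ (r₁ ℕ.+ rk E) ℕ.≤ n →
  ∑[ N ∈ allM n (d' ℕ.+ r₁) ] (⟦ ind E N ⟧ * ⟦ colsIn (spS N) B ⟧) ≤ pw 2 * (pw (r₁ ℕ.* (d' ℕ.+ r₁)) * pw (d' ℕ.* n))
count-containing {n} {J} {r₁} E B iB d' le = *-cancelˡ-≤ (pw (d' ℕ.* m)) (pw>0 (d' ℕ.* m)) (begin
  pw (d' ℕ.* m) * X
    ≡⟨ trans (cong (_* X) (sym (4*¼ (pw (d' ℕ.* m))))) (QP.*-assoc (pw 2) (¼ * pw (d' ℕ.* m)) X) ⟩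
  pw 2 * (¼ * pw (d' ℕ.* m) * X)
    ≤⟨ *-monoˡ (pw 2) (pw≥0 2) (*-monoʳ X X≥0 (cnt≥¼ m d' r₁ NP.≤-refl)) ⟩
  pw 2 * (cnt m d' r₁ * X)
    ≡⟨ cong (pw 2 *_) (trans (cong (cnt m d' r₁ *_) eqX) (trans (*-swap (cnt m d' r₁) (cnt m m 0) Y) (cong (cnt m m 0 *_) (sym eqY)))) ⟩
  pw 2 * (cnt m m 0 * cnt n d' (r₁ ℕ.+ rk E))
    ≤⟨ *-monoˡ (pw 2) (pw≥0 2) (*-mono (proj₁ u₁) (proj₁ u₂) (proj₂ u₁) (proj₂ u₂)) ⟩
  pw 2 * (pw (m ℕ.* m) * pw (d' ℕ.* n))
    ≡⟨ cong (λ z → pw 2 * (z * pw (d' ℕ.* n))) (trans (cong pw (NP.*-distribʳ-+ m d' r₁)) (pw-+ (d' ℕ.* m) (r₁ ℕ.* m))) ⟩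
  pw 2 * (pw (d' ℕ.* m) * pw (r₁ ℕ.* m) * pw (d' ℕ.* n))
    ≡⟨ lem (pw 2) (pw (d' ℕ.* m)) (pw (r₁ ℕ.* m)) (pw (d' ℕ.* n)) ⟩
  pw (d' ℕ.* m) * (pw 2 * (pw (r₁ ℕ.* m) * pw (d' ℕ.* n))) ∎)
  where
  open QP.≤-Reasoning
  m = d' ℕ.+ r₁
  X = ∑[ N ∈ allM n m ] (⟦ ind E N ⟧ * ⟦ colsIn (spS N) B ⟧)
  Y = ∑[ L ∈ allSets n ] (⟦ isGrass m L ∧ trivInter (spS E) L ⟧ * ⟦ spS B ⊆ᵇ L ⟧)
  X≥0 : 0ℚ ≤ X
  X≥0 = ∑-≥0 (allM n m) λ N → *-≥0 (⟦⟧≥0 (ind E N)) (⟦⟧≥0 (colsIn (spS N) B))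
  u₁ = cnt-upper m m 0 (NP.≤-reflexive (NP.+-identityʳ m))
  u₂ = cnt-upper n d' (r₁ ℕ.+ rk E) le
  eqX : X ≡ cnt m m 0 * Y
  eqX = trans (∑-cong (allM n m) λ N → cong (λ z → ⟦ ind E N ⟧ * ⟦ z ⟧) (colsIn-⊆ (spS N) (sub-spS N) B)) (∑-span₀ E m (λ L → ⟦ spS B ⊆ᵇ L ⟧))
  split : ∀ a b c → ⟦ a ∧ (b ∧ c) ⟧ * 1ℚ ≡ ⟦ a ∧ b ⟧ * ⟦ c ⟧
  split a b c = trans (QP.*-identityʳ ⟦ a ∧ (b ∧ c) ⟧) (trans (cong ⟦_⟧ (sym (BP.∧-assoc a b c))) (⟦∧⟧ (a ∧ b) c))
  eqY : cnt n d' (r₁ ℕ.+ rk E) ≡ cnt m d' r₁ * Y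
  eqY = trans (sym (∑-ind E B iB d')) (trans (∑-cong (allM n d') λ C → sym (QP.*-identityʳ ⟦ ind E (C ⧺ B) ⟧)) (trans (∑-span E B iB d' (λ _ → 1ℚ))
    (cong (cnt m d' r₁ *_) (∑-cong (allSets n) λ L → split (isGrass m L) (trivInter (spS E) L) (spS B ⊆ᵇ L)))))
  lem : ∀ q a b c → q * (a * b * c) ≡ a * (q * (b * c))
  lem = solve-∀ ℚring

-- All `r₁`-dimensional subspaces have the same number of ordered bases, and there are at most
-- `2^(r₁ n)` such bases altogether. The condition `ind E B` only removes some of them.
count-bases : ∀ {J} (E : M n J) r₁ (S : VSet n → Bool) (η : ℚ) → 0ℚ ≤ η → r₁ ℕ.≤ n → ∑[ Q ∈ allSets n ] ⟦ S Q ⟧ ≤ η * ∑[ Q ∈ allSets n ] ⟦ isGrass r₁ Q ⟧ →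
  ∑[ B ∈ allM n r₁ ] (⟦ ind E B ⟧ * ⟦ S (spS B) ⟧) ≤ η * pw (r₁ ℕ.* n)
count-bases {n} E r₁ S η η≥0 r₁≤n sp = begin
  ∑[ B ∈ allM n r₁ ] (⟦ ind E B ⟧ * ⟦ S (spS B) ⟧)
    ≡⟨ ∑-span₀ E r₁ (λ L → ⟦ S L ⟧) ⟩
  c * ∑[ L ∈ allSets n ] (⟦ isGrass r₁ L ∧ trivInter (spS E) L ⟧ * ⟦ S L ⟧)
    ≤⟨ *-monoˡ c c≥0 (≤-trans (∑-mono (allSets n) λ L → ⟦⟧*≤ (isGrass r₁ L ∧ trivInter (spS E) L) (⟦⟧≥0 (S L))) sp) ⟩
  c * (η * ∑[ Q ∈ allSets n ] ⟦ isGrass r₁ Q ⟧)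
    ≡⟨ trans (*-swap c η _) (cong (λ z → η * (c * z)) (∑-cong (allSets n) λ Q → trans (cong ⟦_⟧ (≡-from-iff {isGrass r₁ Q} {isGrass r₁ Q ∧ trivInter (spS {d = 0} []) Q} (λ g → ∧-intro g (triv₀ Q)) (λ p → proj₁ (∧-true {isGrass r₁ Q} p)))) (sym (QP.*-identityʳ _)))) ⟩
  η * (c * ∑[ Q ∈ allSets n ] (⟦ isGrass r₁ Q ∧ trivInter (spS {d = 0} []) Q ⟧ * 1ℚ))
    ≡⟨ cong (η *_) (sym (∑-span₀ [] r₁ (λ _ → 1ℚ))) ⟩
  η * ∑[ B ∈ allM n r₁ ] (⟦ ind {d = r₁} {J = 0} [] B ⟧ * 1ℚ)
    ≤⟨ *-monoˡ η η≥0 (≤-trans (∑-mono (allM n r₁) λ B → ⟦⟧*≤ (ind {d = r₁} {J = 0} [] B) 0≤1) (≤≡ (∑M-1 n r₁))) ⟩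
  η * pw (r₁ ℕ.* n) ∎
  where
  open QP.≤-Reasoning
  c = cnt r₁ r₁ 0
  c≥0 = proj₁ (cnt-upper r₁ r₁ 0 (NP.≤-reflexive (NP.+-identityʳ r₁)))
  triv₀ : ∀ Q → trivInter (spS {n} {0} []) Q ≡ true
  triv₀ Q = trivInter-intro {A = spS {n} {0} []} {Q} λ v m _ → ==v-sound (trans (sym (mem-spS [] v)) m)

∑-list-const : {A : Set} (xs : List A) (c : ℚ) → ∑[ x ∈ xs ] c ≡ ι (length xs) * c
∑-list-const xs c = trans (∑-cong xs λ _ → sym (QP.*-identityˡ c)) (trans (∑-*ʳ xs c (λ _ → 1ℚ)) (cong (_* c) (∑-len xs)))

-- Cauchy-Schwarz leads from the `k`-th to the `2k`-th moment of `p` over independent `N`. One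
-- factor ¼ accounts for the share of independent matrices, and `¼^(2k)` for the passage from `p` to
-- `PP`.
ε-low : ∀ {J} (E : M n J) D k (p PP : M n D → ℚ) (ε : ℚ) → (∀ N → 0ℚ ≤ p N) → (∀ N → 0ℚ ≤ PP N) → (∀ N → ind E N ≡ true → ¼ * p N ≤ PP N) →
  D ℕ.+ rk E ℕ.≤ n → cnt n D (rk E) * ε ≡ ∑[ N ∈ allM n D ] (⟦ ind E N ⟧ * p N ^ℚ k) →
  ¼ ^ℚ suc (2 ℕ.* k) * (ε * ε) ≤ hp (D ℕ.* n) * ∑[ N ∈ allM n D ] (PP N ^ℚ (2 ℕ.* k))
ε-low {n} E D k p PP ε p≥0 PP≥0 lo le eq = begin
  ¼ * ¼ ^ℚ K * (ε * ε)
    ≡⟨ lem₀ ¼ (¼ ^ℚ K) (ε * ε) ⟩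
  ¼ * (¼ ^ℚ K * (ε * ε))
    ≡⟨ cong (_* (¼ ^ℚ K * (ε * ε))) (trans (sym (QP.*-identityʳ ¼)) (trans (cong (¼ *_) (sym (pw*hp (D ℕ.* n)))) (sym (QP.*-assoc ¼ (pw (D ℕ.* n)) (hp (D ℕ.* n)))))) ⟩
  ¼ * pw (D ℕ.* n) * hp (D ℕ.* n) * (¼ ^ℚ K * (ε * ε))
    ≤⟨ *-monoʳ (¼ ^ℚ K * (ε * ε)) (*-≥0 (^-≥0 0≤¼ K) (sq≥0 ε)) (*-monoʳ (hp (D ℕ.* n)) (hp≥0 (D ℕ.* n)) (cnt≥¼ n D (rk E) le)) ⟩
  c * hp (D ℕ.* n) * (¼ ^ℚ K * (ε * ε))
    ≡⟨ lem₁ c (hp (D ℕ.* n)) (¼ ^ℚ K) (ε * ε) ⟩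
  hp (D ℕ.* n) * (¼ ^ℚ K * (c * (ε * ε)))
    ≤⟨ *-monoˡ (hp (D ℕ.* n)) (hp≥0 (D ℕ.* n)) (*-monoˡ (¼ ^ℚ K) (^-≥0 0≤¼ K) second) ⟩
  hp (D ℕ.* n) * (¼ ^ℚ K * ∑[ N ∈ allM n D ] (⟦ ind E N ⟧ * p N ^ℚ K))
    ≤⟨ *-monoˡ (hp (D ℕ.* n)) (hp≥0 (D ℕ.* n)) (≤-trans (≤≡ (sym (∑-*ˡ (allM n D) (¼ ^ℚ K) (λ N → ⟦ ind E N ⟧ * p N ^ℚ K)))) (∑-mono (allM n D) ptw)) ⟩
  hp (D ℕ.* n) * ∑[ N ∈ allM n D ] (PP N ^ℚ K) ∎
  where
  open QP.≤-Reasoning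
  K = 2 ℕ.* k
  c = cnt n D (rk E)
  lem₀ : ∀ a b e → a * b * e ≡ a * (b * e)
  lem₀ = solve-∀ ℚring
  lem₁ : ∀ c h q e → c * h * (q * e) ≡ h * (q * (c * e))
  lem₁ = solve-∀ ℚring
  lem₂ : ∀ i x → i * i * (x * x) ≡ i * x * (i * x)
  lem₂ = solve-∀ ℚring
  lem₃ : ∀ c e → c * (c * (e * e)) ≡ c * e * (c * e)
  lem₃ = solve-∀ ℚring
  dbl : ∀ x → x ^ℚ K ≡ x ^ℚ k * x ^ℚ k
  dbl x = trans (^-+ x k (k ℕ.+ 0)) (cong (λ z → x ^ℚ k * x ^ℚ z) (NP.+-identityʳ k))
  ptw : ∀ N → ¼ ^ℚ K * (⟦ ind E N ⟧ * p N ^ℚ K) ≤ PP N ^ℚ K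
  ptw N = bool-cases (ind E N)
    (λ i → ≤-trans (≤≡ (trans (cong (λ z → ¼ ^ℚ K * (⟦ z ⟧ * p N ^ℚ K)) i) (trans (cong (¼ ^ℚ K *_) (QP.*-identityˡ (p N ^ℚ K))) (sym (^-* ¼ (p N) K))))) (^-mono (*-≥0 0≤¼ (p≥0 N)) (lo N i) K))
    (λ i → ≤-trans (≤≡ (trans (cong (λ z → ¼ ^ℚ K * (⟦ z ⟧ * p N ^ℚ K)) i) (trans (cong (¼ ^ℚ K *_) (QP.*-zeroˡ (p N ^ℚ K))) (QP.*-zeroʳ (¼ ^ℚ K))))) (^-≥0 (PP≥0 N) K))
  second : c * (ε * ε) ≤ ∑[ N ∈ allM n D ] (⟦ ind E N ⟧ * p N ^ℚ K)
  second = *-cancelˡ-≤ c (cnt>0 n D (rk E) le) (≤-trans (≤≡ (trans (lem₃ c ε) (cong (λ z → z * z) (trans eq (∑-cong (allM n D) λ N → trans (cong (_* p N ^ℚ k) (sym (⟦⟧*⟦⟧ (ind E N)))) (QP.*-assoc ⟦ ind E N ⟧ ⟦ ind E N ⟧ (p N ^ℚ k)))))))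
    (≤-trans (cauchy-schwarz (allM n D) (λ N → ⟦ ind E N ⟧) (λ N → ⟦ ind E N ⟧ * p N ^ℚ k)) (≤≡ (cong₂ _*_ (trans (∑-cong (allM n D) λ N → ⟦⟧*⟦⟧ (ind E N)) (∑-ind₀ E D))
      (∑-cong (allM n D) λ N → trans (sym (lem₂ ⟦ ind E N ⟧ (p N ^ℚ k))) (cong₂ _*_ (⟦⟧*⟦⟧ (ind E N)) (sym (dbl (p N)))))))))

-- Comparison of exponents

ι≤pw : ∀ m → ι m ≤ pw m
ι≤pw zero = 0≤1
ι≤pw (suc m) = ≤-trans (QP.+-mono-≤ (1≤pw m) (ι≤pw m)) (≤≡ (dbl (pw m)))
  where
  dbl : ∀ x → x + x ≡ two * x
  dbl = solve-∀ ℚring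

pw*hp≤ : ∀ a b c → c ℕ.+ a ℕ.≤ b → pw a * hp b ≤ hp c
pw*hp≤ a b c le = ≤-trans (*-monoˡ (pw a) (pw≥0 a) (hp-anti le)) (≤≡ (trans (cong (pw a *_) (trans (cong hp (NP.+-comm c a)) (hp-+ a c))) (trans (sym (QP.*-assoc (pw a) (hp a) (hp c))) (trans (cong (_* hp c) (pw*hp a)) (QP.*-identityˡ (hp c))))))

-- `x` is the exponent in `ε ≥ 2^(-x)`, and `2^(-Λ)` is the lower bound for the moment that results
-- from it. Each of the three upper terms (low rank, high rank, bad L) is shown to be at most a
-- quarter of this, and three quarters do not suffice. The slack is `2000 y` with `y = t k`, by the
-- equation `2x`: the low-rank term uses `19 y` of it and the high-rank term `12 y`, while the bad L
-- are paid for by `s`.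
module Numeric (k' r t c m x : ℕ) (c<t : c ℕ.< t)
  (xeq : x ℕ.+ 1000 ℕ.* (t ℕ.* suc k') ≡ (t ℕ.+ (t ℕ.+ (c ℕ.+ m))) ℕ.* suc k')
  (tr : 2 ℕ.* suc k' ℕ.* (t ℕ.+ (t ℕ.+ (c ℕ.+ m))) ℕ.≤ t ℕ.* r) (s : ℕ)
  (s-big : (8 ℕ.* suc k' ℕ.+ 3 ℕ.* r ℕ.+ 8) ℕ.* (t ℕ.+ (t ℕ.+ (c ℕ.+ m))) ℕ.≤ s) where

  k K D d₁ y Λ : ℕ
  k = suc k'
  K = 2 ℕ.* k
  D = t ℕ.+ (c ℕ.+ m)
  d₁ = t ℕ.+ D
  y = t ℕ.* k
  Λ = t ℕ.* K ℕ.+ D ℕ.+ 2 ℕ.* suc K ℕ.+ (x ℕ.+ x)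

  t≤y : t ℕ.≤ y
  t≤y = NP.m≤m*n t k

  k≤y : k ℕ.≤ y
  k≤y = NP.m≤n*m k t {{ℕ.>-nonZero (NP.≤-trans (ℕ.s≤s ℕ.z≤n) c<t)}}

  1≤y : 1 ℕ.≤ y
  1≤y = NP.≤-trans (ℕ.s≤s ℕ.z≤n) k≤y

  ck≤y : c ℕ.* k ℕ.≤ y
  ck≤y = NP.*-monoˡ-≤ k (NP.<⇒≤ c<t)

  2x : x ℕ.+ x ℕ.+ 2000 ℕ.* y ≡ d₁ ℕ.* k ℕ.+ d₁ ℕ.* k
  2x = trans (lem x y) (cong₂ ℕ._+_ xeq xeq)
    where
    lem : ∀ x y → x ℕ.+ x ℕ.+ 2000 ℕ.* y ≡ x ℕ.+ 1000 ℕ.* y ℕ.+ (x ℕ.+ 1000 ℕ.* y)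
    lem = NS.solve-∀

  e₁ : ℕ
  e₁ = D ℕ.∸ t ℕ.+ k ℕ.* (2 ℕ.* D ℕ.∸ (t ℕ.+ c ℕ.+ t) ℕ.∸ c)

  e₁-eq : e₁ ≡ c ℕ.+ m ℕ.+ k ℕ.* (m ℕ.+ m)
  e₁-eq = cong₂ (λ a b → a ℕ.+ k ℕ.* b) (NP.m+n∸m≡n t (c ℕ.+ m))
    (trans (cong (ℕ._∸ c) (trans (cong (ℕ._∸ (t ℕ.+ c ℕ.+ t)) (lem t c m)) (NP.m+n∸m≡n (t ℕ.+ c ℕ.+ t) (c ℕ.+ (m ℕ.+ m))))) (NP.m+n∸m≡n c (m ℕ.+ m)))
    where
    lem : ∀ t c m → 2 ℕ.* (t ℕ.+ (c ℕ.+ m)) ≡ t ℕ.+ c ℕ.+ t ℕ.+ (c ℕ.+ (m ℕ.+ m))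
    lem = NS.solve-∀

  ≤₁ : Λ ℕ.+ 2 ℕ.+ K ℕ.≤ e₁
  ≤₁ = subst (Λ ℕ.+ 2 ℕ.+ K ℕ.≤_) (sym e₁-eq) (NP.+-cancelʳ-≤ (2000 ℕ.* y) (Λ ℕ.+ 2 ℕ.+ K) _ (begin
    Λ ℕ.+ 2 ℕ.+ K ℕ.+ 2000 ℕ.* y
      ≡⟨ lem₁ t k D (x ℕ.+ x) (2000 ℕ.* y) ⟩
    2 ℕ.* (t ℕ.* k) ℕ.+ D ℕ.+ 6 ℕ.* k ℕ.+ 4 ℕ.+ (x ℕ.+ x ℕ.+ 2000 ℕ.* y)
      ≡⟨ cong (2 ℕ.* (t ℕ.* k) ℕ.+ D ℕ.+ 6 ℕ.* k ℕ.+ 4 ℕ.+_) 2x ⟩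
    2 ℕ.* (t ℕ.* k) ℕ.+ D ℕ.+ 6 ℕ.* k ℕ.+ 4 ℕ.+ (d₁ ℕ.* k ℕ.+ d₁ ℕ.* k)
      ≡⟨ lem₂ t c m k ⟩
    c ℕ.+ m ℕ.+ k ℕ.* (m ℕ.+ m) ℕ.+ (t ℕ.+ 6 ℕ.* k ℕ.+ 4 ℕ.* 1 ℕ.+ 2 ℕ.* (c ℕ.* k) ℕ.+ 6 ℕ.* (t ℕ.* k))
      ≤⟨ NP.+-monoʳ-≤ (c ℕ.+ m ℕ.+ k ℕ.* (m ℕ.+ m)) (NP.+-monoˡ-≤ (6 ℕ.* y) (NP.+-mono-≤ (NP.+-mono-≤ (NP.+-mono-≤ t≤y (NP.*-monoʳ-≤ 6 k≤y)) (NP.*-monoʳ-≤ 4 1≤y)) (NP.*-monoʳ-≤ 2 ck≤y))) ⟩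
    c ℕ.+ m ℕ.+ k ℕ.* (m ℕ.+ m) ℕ.+ (y ℕ.+ 6 ℕ.* y ℕ.+ 4 ℕ.* y ℕ.+ 2 ℕ.* y ℕ.+ 6 ℕ.* y)
      ≤⟨ NP.+-monoʳ-≤ (c ℕ.+ m ℕ.+ k ℕ.* (m ℕ.+ m)) (NP.≤-trans (NP.m≤m+n _ (1981 ℕ.* y)) (NP.≤-reflexive (lem₃ y))) ⟩
    c ℕ.+ m ℕ.+ k ℕ.* (m ℕ.+ m) ℕ.+ 2000 ℕ.* y ∎))
    where
    open NP.≤-Reasoning
    lem₁ : ∀ t k D x z → t ℕ.* (2 ℕ.* k) ℕ.+ D ℕ.+ 2 ℕ.* suc (2 ℕ.* k) ℕ.+ x ℕ.+ 2 ℕ.+ 2 ℕ.* k ℕ.+ z ≡ 2 ℕ.* (t ℕ.* k) ℕ.+ D ℕ.+ 6 ℕ.* k ℕ.+ 4 ℕ.+ (x ℕ.+ z)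
    lem₁ = NS.solve-∀
    lem₂ : ∀ t c m k → 2 ℕ.* (t ℕ.* k) ℕ.+ (t ℕ.+ (c ℕ.+ m)) ℕ.+ 6 ℕ.* k ℕ.+ 4 ℕ.+ ((t ℕ.+ (t ℕ.+ (c ℕ.+ m))) ℕ.* k ℕ.+ (t ℕ.+ (t ℕ.+ (c ℕ.+ m))) ℕ.* k) ≡
      c ℕ.+ m ℕ.+ k ℕ.* (m ℕ.+ m) ℕ.+ (t ℕ.+ 6 ℕ.* k ℕ.+ 4 ℕ.* 1 ℕ.+ 2 ℕ.* (c ℕ.* k) ℕ.+ 6 ℕ.* (t ℕ.* k))
    lem₂ = NS.solve-∀
    lem₃ : ∀ y → y ℕ.+ 6 ℕ.* y ℕ.+ 4 ℕ.* y ℕ.+ 2 ℕ.* y ℕ.+ 6 ℕ.* y ℕ.+ 1981 ℕ.* y ≡ 2000 ℕ.* y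
    lem₃ = NS.solve-∀

  ≤₂ : Λ ℕ.+ 2 ℕ.+ 2 ℕ.≤ t ℕ.* r ℕ.+ D
  ≤₂ = NP.≤-trans (NP.+-cancelʳ-≤ (2000 ℕ.* y) (Λ ℕ.+ 2 ℕ.+ 2) _ (begin
    Λ ℕ.+ 2 ℕ.+ 2 ℕ.+ 2000 ℕ.* y
      ≡⟨ lem₁ t k D (x ℕ.+ x) (2000 ℕ.* y) ⟩
    2 ℕ.* (t ℕ.* k) ℕ.+ D ℕ.+ 4 ℕ.* k ℕ.+ 6 ℕ.* 1 ℕ.+ (x ℕ.+ x ℕ.+ 2000 ℕ.* y)
      ≤⟨ NP.+-mono-≤ (NP.+-mono-≤ (NP.+-monoʳ-≤ (2 ℕ.* (t ℕ.* k) ℕ.+ D) (NP.*-monoʳ-≤ 4 k≤y)) (NP.*-monoʳ-≤ 6 1≤y)) (NP.≤-reflexive 2x) ⟩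
    2 ℕ.* y ℕ.+ D ℕ.+ 4 ℕ.* y ℕ.+ 6 ℕ.* y ℕ.+ (d₁ ℕ.* k ℕ.+ d₁ ℕ.* k)
      ≤⟨ NP.m≤m+n _ (1988 ℕ.* y) ⟩
    2 ℕ.* y ℕ.+ D ℕ.+ 4 ℕ.* y ℕ.+ 6 ℕ.* y ℕ.+ (d₁ ℕ.* k ℕ.+ d₁ ℕ.* k) ℕ.+ 1988 ℕ.* y
      ≡⟨ lem₂ y D k d₁ ⟩
    2 ℕ.* k ℕ.* d₁ ℕ.+ D ℕ.+ 2000 ℕ.* y ∎)) (NP.+-monoˡ-≤ D tr)
    where
    open NP.≤-Reasoning
    lem₁ : ∀ t k D x z → t ℕ.* (2 ℕ.* k) ℕ.+ D ℕ.+ 2 ℕ.* suc (2 ℕ.* k) ℕ.+ x ℕ.+ 2 ℕ.+ 2 ℕ.+ z ≡ 2 ℕ.* (t ℕ.* k) ℕ.+ D ℕ.+ 4 ℕ.* k ℕ.+ 6 ℕ.* 1 ℕ.+ (x ℕ.+ z)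
    lem₁ = NS.solve-∀
    lem₂ : ∀ y D k d₁ → 2 ℕ.* y ℕ.+ D ℕ.+ 4 ℕ.* y ℕ.+ 6 ℕ.* y ℕ.+ (d₁ ℕ.* k ℕ.+ d₁ ℕ.* k) ℕ.+ 1988 ℕ.* y ≡ 2 ℕ.* k ℕ.* d₁ ℕ.+ D ℕ.+ 2000 ℕ.* y
    lem₂ = NS.solve-∀

  loss : ℕ
  loss = K ℕ.+ (suc r ℕ.+ (suc r ℕ.+ (2 ℕ.+ r ℕ.* d₁)))

  ≤₃ : Λ ℕ.+ 2 ℕ.+ loss ℕ.≤ t ℕ.* K ℕ.+ D ℕ.+ s
  ≤₃ = begin
    Λ ℕ.+ 2 ℕ.+ loss
      ≡⟨ lem₁ (t ℕ.* K ℕ.+ D) k r (r ℕ.* d₁) (x ℕ.+ x) ⟩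
    t ℕ.* K ℕ.+ D ℕ.+ ((6 ℕ.* k ℕ.+ 2 ℕ.* r ℕ.+ 8) ℕ.* 1 ℕ.+ r ℕ.* d₁ ℕ.+ (x ℕ.+ x))
      ≤⟨ NP.+-monoʳ-≤ (t ℕ.* K ℕ.+ D) (NP.+-mono-≤ (NP.+-monoˡ-≤ (r ℕ.* d₁) (NP.*-monoʳ-≤ (6 ℕ.* k ℕ.+ 2 ℕ.* r ℕ.+ 8) 1≤d)) (NP.≤-trans (NP.m≤m+n (x ℕ.+ x) (2000 ℕ.* y)) (NP.≤-reflexive 2x))) ⟩
    t ℕ.* K ℕ.+ D ℕ.+ ((6 ℕ.* k ℕ.+ 2 ℕ.* r ℕ.+ 8) ℕ.* d₁ ℕ.+ r ℕ.* d₁ ℕ.+ (d₁ ℕ.* k ℕ.+ d₁ ℕ.* k))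
      ≡⟨ cong (t ℕ.* K ℕ.+ D ℕ.+_) (lem₂ k r d₁) ⟩
    t ℕ.* K ℕ.+ D ℕ.+ (8 ℕ.* k ℕ.+ 3 ℕ.* r ℕ.+ 8) ℕ.* d₁
      ≤⟨ NP.+-monoʳ-≤ (t ℕ.* K ℕ.+ D) s-big ⟩
    t ℕ.* K ℕ.+ D ℕ.+ s ∎
    where
    open NP.≤-Reasoning
    1≤d : 1 ℕ.≤ d₁
    1≤d = NP.≤-trans (NP.≤-trans (ℕ.s≤s ℕ.z≤n) c<t) (NP.m≤m+n t D)
    lem₁ : ∀ a k r q x → a ℕ.+ 2 ℕ.* suc (2 ℕ.* k) ℕ.+ x ℕ.+ 2 ℕ.+ (2 ℕ.* k ℕ.+ (suc r ℕ.+ (suc r ℕ.+ (2 ℕ.+ q)))) ≡ a ℕ.+ ((6 ℕ.* k ℕ.+ 2 ℕ.* r ℕ.+ 8) ℕ.* 1 ℕ.+ q ℕ.+ x)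
    lem₁ = NS.solve-∀
    lem₂ : ∀ k r d₁ → (6 ℕ.* k ℕ.+ 2 ℕ.* r ℕ.+ 8) ℕ.* d₁ ℕ.+ r ℕ.* d₁ ℕ.+ (d₁ ℕ.* k ℕ.+ d₁ ℕ.* k) ≡ (8 ℕ.* k ℕ.+ 3 ℕ.* r ℕ.+ 8) ℕ.* d₁
    lem₂ = NS.solve-∀

  impossible : ∀ {ε Y β} → hp x ≤ ε → ¼ ^ℚ suc K * (ε * ε) ≤ Y → β ≤ ι (suc r) * (ι (suc r) * (pw 2 * (pw (r ℕ.* d₁) * hp s))) →
    hp (t ℕ.* K) * hp D * Y ≤ (pw K * hp e₁ + pw 2 * hp (t ℕ.* r ℕ.+ D)) + hp (t ℕ.* K) * hp D * (ι K * β) → ⊥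
  impossible {ε} {Y} {β} hx low βle le = <⇒≱ three (begin
    hp Λ
      ≡⟨ trans (hp-+ (t ℕ.* K ℕ.+ D ℕ.+ 2 ℕ.* suc K) (x ℕ.+ x)) (trans (cong₂ _*_ (trans (hp-+ (t ℕ.* K ℕ.+ D) (2 ℕ.* suc K)) (cong₂ _*_ (hp-+ (t ℕ.* K) D) (^-^ ½ 2 (suc K)))) (hp-+ x x)) (QP.*-assoc l ((½ * (½ * 1ℚ)) ^ℚ suc K) (hp x * hp x))) ⟩
    l * (¼ ^ℚ suc K * (hp x * hp x))
      ≤⟨ *-monoˡ l l≥0 (≤-trans (*-monoˡ (¼ ^ℚ suc K) (^-≥0 0≤¼ (suc K)) (*-mono (hp≥0 x) (hp≥0 x) hx hx)) low) ⟩
    l * Y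
      ≤⟨ le ⟩
    (pw K * hp e₁ + pw 2 * hp (t ℕ.* r ℕ.+ D)) + l * (ι K * β)
      ≤⟨ QP.+-mono-≤ (QP.+-mono-≤ (pw*hp≤ K e₁ (Λ ℕ.+ 2) ≤₁) (pw*hp≤ 2 (t ℕ.* r ℕ.+ D) (Λ ℕ.+ 2) ≤₂)) third ⟩
    hp (Λ ℕ.+ 2) + hp (Λ ℕ.+ 2) + hp (Λ ℕ.+ 2) ∎)
    where
    open QP.≤-Reasoning
    l = hp (t ℕ.* K) * hp D
    l≥0 : 0ℚ ≤ l
    l≥0 = *-≥0 (hp≥0 (t ℕ.* K)) (hp≥0 D)
    q = hp (Λ ℕ.+ 2)
    three : q + q + q < hp Λ
    three = subst₂ _<_ (QP.+-identityʳ (q + q + q)) (trans (four q) (trans (cong (pw 2 *_) (trans (cong hp (NP.+-comm Λ 2)) (hp-+ 2 Λ))) (trans (sym (QP.*-assoc (pw 2) (hp 2) (hp Λ))) (QP.*-identityˡ (hp Λ))))) (QP.+-monoʳ-< (q + q + q) (hp>0 (Λ ℕ.+ 2)))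
      where
      four : ∀ q → q + q + q + q ≡ pw 2 * q
      four = solve-∀ ℚring
    reorder : ∀ a b c e p s l → l * (a * (b * (c * (e * (p * s))))) ≡ a * (b * (c * (e * p))) * (l * s)
    reorder = solve-∀ ℚring
    pull : hp (t ℕ.* K) * hp D * hp s ≡ hp (t ℕ.* K ℕ.+ D ℕ.+ s)
    pull = sym (trans (hp-+ (t ℕ.* K ℕ.+ D) s) (cong (_* hp s) (hp-+ (t ℕ.* K) D)))
    ipw : ∀ a b m → 0ℚ ≤ a → a ≤ pw b → ι m * a ≤ pw (m ℕ.+ b)
    ipw a b m a≥0 p = ≤-trans (*-mono (ι≥0 m) a≥0 (ι≤pw m) p) (≤≡ (sym (pw-+ m b)))
    w = pw 2 * pw (r ℕ.* d₁)
    u₀ : 0ℚ ≤ w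
    u₀ = *-≥0 (pw≥0 2) (pw≥0 (r ℕ.* d₁))
    u₁ : 0ℚ ≤ ι (suc r) * w
    u₁ = *-≥0 (ι≥0 (suc r)) u₀
    u₂ : 0ℚ ≤ ι (suc r) * (ι (suc r) * w)
    u₂ = *-≥0 (ι≥0 (suc r)) u₁
    third : l * (ι K * β) ≤ q
    third = ≤-trans (*-monoˡ l l≥0 (*-monoˡ (ι K) (ι≥0 K) βle)) (≤-trans (≤≡ (reorder (ι K) (ι (suc r)) (ι (suc r)) (pw 2) (pw (r ℕ.* d₁)) (hp s) l))
      (≤-trans (*-mono (*-≥0 (ι≥0 K) u₂) (*-≥0 l≥0 (hp≥0 s)) (ipw (ι (suc r) * (ι (suc r) * w)) (suc r ℕ.+ (suc r ℕ.+ (2 ℕ.+ r ℕ.* d₁))) K u₂ (ipw (ι (suc r) * w) (suc r ℕ.+ (2 ℕ.+ r ℕ.* d₁)) (suc r) u₁ (ipw w (2 ℕ.+ r ℕ.* d₁) (suc r) u₀ (≤≡ (sym (pw-+ 2 (r ℕ.* d₁))))))) (≤≡ pull)) (pw*hp≤ loss (t ℕ.* K ℕ.+ D ℕ.+ s) (Λ ℕ.+ 2) ≤₃)))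

numeric-⊥ : ∀ k' r t c m x s D → D ≡ t ℕ.+ (c ℕ.+ m) → c ℕ.< t → x ℕ.+ 1000 ℕ.* (t ℕ.* suc k') ≡ (t ℕ.+ D) ℕ.* suc k' →
  2 ℕ.* suc k' ℕ.* (t ℕ.+ D) ℕ.≤ t ℕ.* r → (8 ℕ.* suc k' ℕ.+ 3 ℕ.* r ℕ.+ 8) ℕ.* (t ℕ.+ D) ℕ.≤ s → let K = 2 ℕ.* suc k' in
  ∀ {ε Y β} → hp x ≤ ε → ¼ ^ℚ suc K * (ε * ε) ≤ Y → β ≤ ι (suc r) * (ι (suc r) * (pw 2 * (pw (r ℕ.* (t ℕ.+ D)) * hp s))) →
  hp (t ℕ.* K) * hp D * Y ≤ (pw K * hp (D ℕ.∸ t ℕ.+ suc k' ℕ.* (2 ℕ.* D ℕ.∸ (t ℕ.+ c ℕ.+ t) ℕ.∸ c)) + pw 2 * hp (t ℕ.* r ℕ.+ D)) + hp (t ℕ.* K) * hp D * (ι K * β) → ⊥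
numeric-⊥ k' r t c m x s _ refl c<t xeq tr sb {ε} {Y} {β} = Numeric.impossible k' r t c m x c<t xeq tr s sb {ε} {Y} {β}

-- The acceptance probability in terms of bases

sumℚ-map : {A : Set} (xs : List A) (f : A → ℚ) → sumℚ (map f xs) ≡ ∑ xs f
sumℚ-map [] f = refl
sumℚ-map (x ∷ xs) f = cong (f x +_) (sumℚ-map xs f)

rk≤ : ∀ {n d} (X : M n d) → rk X ℕ.≤ n
rk≤ {n} X = pw-cancel-≤ (≤-trans (≤≡ (sym (∑-sp X))) (≤-trans (∑-mono (allV n) λ x → ⟦⟧≤1 (inSp X x)) (≤≡ (trans (∑-const n 1ℚ) (QP.*-identityʳ (pw n))))))

module Test {n J : ℕ} (d D : ℕ) (E : M n J) (H : VSet n) (H≡ : H ≡ spS E) (T₁ T₂ : VSet n → V n → Bool) where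

  admR : List (VSet n)
  admR = filter (λ R → trivInter H R Data.Bool.≟ true) (Grass n D)

  admL agrL : VSet n → List (VSet n)
  admL R = filter (λ L → (trivInter H L ∧ (R ⊆ᵇ L)) Data.Bool.≟ true) (Grass n d)
  agrL R = filter (λ L → agreeOnᵇ R (T₁ (sumS L H)) (T₂ R) Data.Bool.≟ true) (admL R)

  pA : VSet n → ℚ
  pA R = frac (length (agrL R)) (length (admL R))

  -- For `E = mat e` and `H = HU e` this unfolds to the same expression as `εTest`, so the two are
  -- identified by computation.
  εT : ℕ → ℚ
  εT k = frac 1 (length admR) * sumℚ (map (λ R → pA R ^ℚ k) admR)

  agr≤adm : ∀ R → length (agrL R) ℕ.≤ length (admL R)
  agr≤adm R = LP.length-filter (λ L → agreeOnᵇ R (T₁ (sumS L H)) (T₂ R) Data.Bool.≟ true) (admL R)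

  pA≥0 : ∀ R → 0ℚ ≤ pA R
  pA≥0 R = frac-≥0 (length (agrL R)) (length (admL R))

  pA≤1 : ∀ R → pA R ≤ 1ℚ
  pA≤1 R = frac-≤1 (length (agrL R)) (length (admL R)) (agr≤adm R)

  admL-∑ : ∀ R → ι (length (admL R)) ≡ ∑[ L ∈ allSets n ] (⟦ isGrass d L ⟧ * ⟦ trivInter H L ∧ (R ⊆ᵇ L) ⟧)
  admL-∑ R = len-filter² (λ L → trivInter H L ∧ (R ⊆ᵇ L)) (isGrass d) (λ L → (trivInter H L ∧ (R ⊆ᵇ L)) Data.Bool.≟ true) (λ L → isGrass d L Data.Bool.≟ true) (allSets n)

  agrL-∑ : ∀ R → ι (length (agrL R)) ≡ ∑[ L ∈ allSets n ] (⟦ isGrass d L ⟧ * (⟦ trivInter H L ∧ (R ⊆ᵇ L) ⟧ * ⟦ agreeOnᵇ R (T₁ (sumS L H)) (T₂ R) ⟧))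
  agrL-∑ R = len-filter³ (λ L → agreeOnᵇ R (T₁ (sumS L H)) (T₂ R)) (λ L → trivInter H L ∧ (R ⊆ᵇ L)) (isGrass d) (λ L → agreeOnᵇ R (T₁ (sumS L H)) (T₂ R) Data.Bool.≟ true) (λ L → (trivInter H L ∧ (R ⊆ᵇ L)) Data.Bool.≟ true) (λ L → isGrass d L Data.Bool.≟ true) (allSets n)

  admR-∑ : ∀ f → ∑ admR f ≡ ∑[ R ∈ allSets n ] (⟦ isGrass D R ∧ trivInter (spS E) R ⟧ * f R)
  admR-∑ f = trans (∑-filter (trivInter H) (λ R → trivInter H R Data.Bool.≟ true) (Grass n D) f) (trans (∑-filter (isGrass D) (λ R → isGrass D R Data.Bool.≟ true) (allSets n) _)
    (∑-cong (allSets n) λ R → trans (sym (QP.*-assoc ⟦ isGrass D R ⟧ ⟦ trivInter H R ⟧ (f R))) (cong (_* f R) (trans (sym (⟦∧⟧ (isGrass D R) (trivInter H R))) (cong (λ z → ⟦ isGrass D R ∧ trivInter z R ⟧) H≡)))))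

  εT-eq : D ℕ.+ rk E ℕ.≤ n → ∀ k → cnt n D (rk E) * εT k ≡ ∑[ N ∈ allM n D ] (⟦ ind E N ⟧ * pA (spS N) ^ℚ k)
  εT-eq le k = begin
    cnt n D (rk E) * (frac 1 (length admR) * sumℚ (map (λ R → pA R ^ℚ k) admR))
      ≡⟨ cong₂ (λ a b → a * (frac 1 (length admR) * b)) total (sumℚ-map admR (λ R → pA R ^ℚ k)) ⟩
    cnt D D 0 * ι (length admR) * (frac 1 (length admR) * ∑[ R ∈ admR ] (pA R ^ℚ k))
      ≡⟨ lem (cnt D D 0) (ι (length admR)) (frac 1 (length admR)) (∑[ R ∈ admR ] (pA R ^ℚ k)) ⟩
    frac 1 (length admR) * ι (length admR) * (cnt D D 0 * ∑[ R ∈ admR ] (pA R ^ℚ k))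
      ≡⟨ trans (cong (_* (cnt D D 0 * ∑[ R ∈ admR ] (pA R ^ℚ k))) (trans (frac-mul 1 (length admR) nonempty) (QP.+-identityʳ 1ℚ))) (QP.*-identityˡ _) ⟩
    cnt D D 0 * ∑[ R ∈ admR ] (pA R ^ℚ k)
      ≡⟨ cong (cnt D D 0 *_) (admR-∑ (λ R → pA R ^ℚ k)) ⟩
    cnt D D 0 * ∑[ R ∈ allSets n ] (⟦ isGrass D R ∧ trivInter (spS E) R ⟧ * pA R ^ℚ k)
      ≡⟨ sym (∑-span₀ E D (λ R → pA R ^ℚ k)) ⟩
    ∑[ N ∈ allM n D ] (⟦ ind E N ⟧ * pA (spS N) ^ℚ k) ∎
    where
    open ≡-Reasoning
    lem : ∀ c a f s → c * a * (f * s) ≡ f * a * (c * s)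
    lem = solve-∀ ℚring
    total : cnt n D (rk E) ≡ cnt D D 0 * ι (length admR)
    total = trans (sym (∑-ind₀ E D)) (trans (∑-cong (allM n D) λ N → sym (QP.*-identityʳ ⟦ ind E N ⟧)) (trans (∑-span₀ E D (λ _ → 1ℚ)) (cong (cnt D D 0 *_) (trans (sym (admR-∑ (λ _ → 1ℚ))) (∑-len admR)))))
    -- An empty `admR` would make the positive number `cnt n D (rk E)` vanish. This excludes the
    -- default value 0 of `frac`.
    pos : ∀ m → cnt n D (rk E) ≡ cnt D D 0 * ι m → 1 ℕ.≤ m
    pos zero e = ⊥-elim (QP.<⇒≢ (cnt>0 n D (rk E) le) (sym (trans e (QP.*-zeroʳ (cnt D D 0)))))
    pos (suc m) e = ℕ.s≤s ℕ.z≤n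
    nonempty : 1 ℕ.≤ length admR
    nonempty = pos (length admR) total

  pA-eq : ∀ t → t ℕ.+ D ≡ d → ∀ (N : M n D) → ind E N ≡ true → cnt n t (D ℕ.+ rk E) * pA (spS N) ≡ ∑[ C ∈ allM n t ] ⟦ ind E (C ⧺ N) ∧ agreeOnᵇ (spS N) (T₁ (sumS (spS (C ⧺ N)) H)) (T₂ (spS N)) ⟧
  pA-eq t refl N i = begin
    cnt n t (D ℕ.+ rk E) * pA R
      ≡⟨ cong (_* pA R) total ⟩
    cnt d t D * ι (length (admL R)) * pA R
      ≡⟨ trans (QP.*-assoc (cnt d t D) (ι (length (admL R))) (pA R)) (cong (cnt d t D *_) (trans (QP.*-comm (ι (length (admL R))) (pA R)) (frac-mul (length (agrL R)) (length (admL R)) (agr≤adm R)))) ⟩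
    cnt d t D * ι (length (agrL R))
      ≡⟨ cong (cnt d t D *_) (trans (agrL-∑ R) (∑-cong (allSets n) λ L → conv L ⟦ agreeOnᵇ R (T₁ (sumS L H)) (T₂ R) ⟧)) ⟩
    cnt d t D * ∑[ L ∈ allSets n ] (⟦ isGrass d L ∧ (trivInter (spS E) L ∧ (R ⊆ᵇ L)) ⟧ * ⟦ agreeOnᵇ R (T₁ (sumS L H)) (T₂ R) ⟧)
      ≡⟨ sym (∑-span E N i t (λ L → ⟦ agreeOnᵇ R (T₁ (sumS L H)) (T₂ R) ⟧)) ⟩
    ∑[ C ∈ allM n t ] (⟦ ind E (C ⧺ N) ⟧ * ⟦ agreeOnᵇ R (T₁ (sumS (spS (C ⧺ N)) H)) (T₂ R) ⟧)
      ≡⟨ ∑-cong (allM n t) (λ C → sym (⟦∧⟧ (ind E (C ⧺ N)) (agreeOnᵇ R (T₁ (sumS (spS (C ⧺ N)) H)) (T₂ R)))) ⟩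
    ∑[ C ∈ allM n t ] ⟦ ind E (C ⧺ N) ∧ agreeOnᵇ R (T₁ (sumS (spS (C ⧺ N)) H)) (T₂ R) ⟧ ∎
    where
    open ≡-Reasoning
    R = spS N
    conv : ∀ L x → ⟦ isGrass d L ⟧ * (⟦ trivInter H L ∧ (R ⊆ᵇ L) ⟧ * x) ≡ ⟦ isGrass d L ∧ (trivInter (spS E) L ∧ (R ⊆ᵇ L)) ⟧ * x
    conv L x = trans (sym (QP.*-assoc ⟦ isGrass d L ⟧ ⟦ trivInter H L ∧ (R ⊆ᵇ L) ⟧ x)) (cong (_* x) (trans (sym (⟦∧⟧ (isGrass d L) (trivInter H L ∧ (R ⊆ᵇ L)))) (cong (λ z → ⟦ isGrass d L ∧ (trivInter z L ∧ (R ⊆ᵇ L)) ⟧) H≡)))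
    total : cnt n t (D ℕ.+ rk E) ≡ cnt d t D * ι (length (admL R))
    total = trans (sym (∑-ind E N i t)) (trans (∑-cong (allM n t) λ C → sym (QP.*-identityʳ ⟦ ind E (C ⧺ N) ⟧)) (trans (∑-span E N i t (λ _ → 1ℚ))
      (cong (cnt d t D *_) (trans (∑-cong (allSets n) λ L → trans (sym (conv L 1ℚ)) (cong (⟦ isGrass d L ⟧ *_) (QP.*-identityʳ _))) (sym (admL-∑ R))))))

  εT≤1 : ∀ k → εT k ≤ 1ℚ
  εT≤1 k = bound (length admR) refl
    where
    sum≤ : sumℚ (map (λ R → pA R ^ℚ k) admR) ≤ ι (length admR)
    sum≤ = ≤-trans (≤≡ (sumℚ-map admR (λ R → pA R ^ℚ k))) (≤-trans (∑-mono admR λ R → ≤-trans (^-mono (pA≥0 R) (pA≤1 R) k) (≤≡ (1^ k))) (≤≡ (∑-len admR)))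
    bound : ∀ m → length admR ≡ m → εT k ≤ 1ℚ
    bound zero e = ≤-trans (≤≡ (trans (cong (λ z → frac 1 z * sumℚ (map (λ R → pA R ^ℚ k) admR)) e) (QP.*-zeroˡ (sumℚ (map (λ R → pA R ^ℚ k) admR))))) 0≤1
    bound (suc m) e = ≤-trans (*-monoˡ (frac 1 (length admR)) (frac-≥0 1 (length admR)) sum≤)
      (≤≡ (trans (frac-mul 1 (length admR) (subst (1 ℕ.≤_) (sym e) (ℕ.s≤s ℕ.z≤n))) (QP.+-identityʳ 1ℚ)))

  -- A positive acceptance probability forces an admissible L, hence enough room in the ambient space.
  room : ∀ k → 0ℚ < εT (suc k) → d ℕ.+ rk E ℕ.≤ n
  room k ε>0 with (d ℕ.+ rk E) NP.≤? n
  ... | yes p = p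
  ... | no ¬p = ⊥-elim (QP.<⇒≢ ε>0 (sym ε≡0))
    where
    noind : ∀ (N : M n d) → ind E N ≡ false
    noind N = BP.¬-not λ i → ¬p (subst (ℕ._≤ n) (rk-ind E N i) (rk≤ (N ⧺ E)))
    sum0 : ∑[ L ∈ allSets n ] (⟦ isGrass d L ∧ trivInter (spS E) L ⟧ * 1ℚ) ≡ 0ℚ
    sum0 = QP.≤-antisym (*-cancelˡ-≤ (cnt d d 0) (cnt>0 d d 0 (NP.≤-reflexive (NP.+-identityʳ d)))
        (≤≡ (trans (sym (∑-span₀ E d (λ _ → 1ℚ))) (trans (∑-0 (allM n d) λ N → trans (cong (λ z → ⟦ z ⟧ * 1ℚ) (noind N)) refl) (sym (QP.*-zeroʳ (cnt d d 0)))))))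
      (∑-≥0 (allSets n) λ L → *-≥0 (⟦⟧≥0 (isGrass d L ∧ trivInter (spS E) L)) 0≤1)
    admL0 : ∀ R → length (admL R) ≡ 0
    admL0 R = NP.n≤0⇒n≡0 (ι-cancel (≤-trans (≤≡ (admL-∑ R)) (≤-trans (∑-mono (allSets n) λ L → ≤-trans (≤≡ (sym (⟦∧⟧ (isGrass d L) (trivInter H L ∧ (R ⊆ᵇ L))))) (≤-trans (⟦⟧-mono (weaken L)) (≤≡ (sym (QP.*-identityʳ _))))) (≤≡ sum0))))
      where
      weaken : ∀ L → isGrass d L ∧ (trivInter H L ∧ (R ⊆ᵇ L)) ≡ true → isGrass d L ∧ trivInter (spS E) L ≡ true
      weaken L q = let (a , b) = ∧-true {isGrass d L} q in ∧-intro a (trans (cong (λ z → trivInter z L) (sym H≡)) (proj₁ (∧-true {trivInter H L} b)))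
    pA0 : ∀ R → pA R ≡ 0ℚ
    pA0 R = cong (frac (length (agrL R))) (admL0 R)
    ε≡0 : εT (suc k) ≡ 0ℚ
    ε≡0 = trans (cong (frac 1 (length admR) *_) (trans (sumℚ-map admR (λ R → pA R ^ℚ suc k)) (∑-0 admR λ R → trans (cong (_* pA R ^ℚ k) (pA0 R)) (QP.*-zeroˡ (pA R ^ℚ k))))) (QP.*-zeroʳ (frac 1 (length admR)))

-- Rational exponents and natural ones

ι-mk : ∀ m → ι m ≡ ℚ.mkℚ (ℤ.+ m) 0 (Cop.sym (Cop.1-coprimeTo m))
ι-mk m = trans (ι-int m) (int-mk (ℤ.+ m))

TwoPowNeg-ι : ∀ m p → TwoPowNeg≤ (ι m) p → hp m ≤ p
TwoPowNeg-ι m p h = subst₂ _≤_ (hp≡2^ℤ m) (QP.*-identityʳ p) (subst (λ z → TwoPowNeg≤ z p) (ι-mk m) h)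

ι-TwoPowNeg : ∀ m p → hp m ≤ p → TwoPowNeg≤ (ι m) p
ι-TwoPowNeg m p h = subst (λ z → TwoPowNeg≤ z p) (sym (ι-mk m)) (subst₂ _≤_ (sym (hp≡2^ℤ m)) (sym (QP.*-identityʳ p)) h)

TwoPowNeg-neg : ∀ m p → TwoPowNeg≤ (- ι (suc m)) p → pw (suc m) ≤ p
TwoPowNeg-neg m p h = subst₂ _≤_ (pw≡2^ℤ (suc m)) (QP.*-identityʳ p) (subst (λ z → TwoPowNeg≤ (- z) p) (ι-mk (suc m)) h)

-- For `ξ = a / (b+1)` the failed inequality says `p^(b+1) < 2^(-a)`, while `D (b+1) ≤ a`; the root
-- is taken by `^-cancel-≤`. A negative `ξ` contradicts `ι D ≤ ξ`.
below-threshold : ∀ ξ D p → ι D ≤ ξ → 0ℚ ≤ p → ¬ TwoPowNeg≤ ξ p → p ≤ hp D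
below-threshold (ℚ.mkℚ (ℤ.+ a) b cop) D p le p≥0 nt = ^-cancel-≤ (hp≥0 D) b (≤-trans (QP.<⇒≤ (QP.≰⇒> λ q → nt (≤-trans (≤≡ (hp≡2^ℤ a)) q))) (≤-trans (hp-anti Db≤a) (≤≡ (^-^ ½ D (suc b))))) p≥0
  where
  Db≤a : D ℕ.* suc b ℕ.≤ a
  Db≤a = ZP.drop‿+≤+ (subst₂ ℤ._≤_ (sym (ZP.pos-* D (suc b))) (ZP.*-identityʳ (ℤ.+ a)) (QP.drop-*≤* (subst (ℚ._≤ ℚ.mkℚ (ℤ.+ a) b cop) (ι-mk D) le)))
below-threshold (ℚ.mkℚ ℤ.-[1+ a ] b cop) D p le p≥0 nt with subst₂ ℤ._≤_ (sym (ZP.pos-* D (suc b))) (ZP.*-identityʳ ℤ.-[1+ a ]) (QP.drop-*≤* (subst (ℚ._≤ ℚ.mkℚ ℤ.-[1+ a ] b cop) (ι-mk D) le))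
... | ()

numden : ∀ δ → ℚ.Positive δ → ∃ λ p → ∃ λ q → δ * ι (suc q) ≡ ι (suc p)
numden δ@(ℚ.mkℚ ℤ.+[1+ p ] q cop) _ = p , q , trans (cong (_* ι (suc q)) (sym (QP.↥p/↧p≡p δ))) (frac-suc (suc p) q)

ι-sub : ∀ {a b} → b ℕ.≤ a → ι a - ι b ≡ ι (a ℕ.∸ b)
ι-sub {a} {b} le = trans (cong (λ z → ι z - ι b) (sym (NP.m∸n+n≡m le))) (trans (cong (_- ι b) (ι-+ (a ℕ.∸ b) b)) (lem (ι (a ℕ.∸ b)) (ι b)))
  where
  lem : ∀ x y → x + y - y ≡ x
  lem = solve-∀ ℚring

n≤2^n : ∀ m → m ℕ.≤ 2 ℕ.^ m
n≤2^n m = ι-cancel (≤-trans (ι≤pw m) (≤≡ (sym (ι-2^ m))))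

allSets-unique : ∀ n → Unique (allSets n)
allSets-unique zero = ((λ ()) All.∷ All.[]) ∷ (All.[] ∷ [])
allSets-unique (suc n) = UniqueP.cartesianProduct⁺ (allSets-unique n) (allSets-unique n)

restrict-basis : ∀ {J} (e : Fin J → V n) (b : Fin J → Bool) (f : V n → Bool) → RestrictsToψ e b f → ∀ i → f (e i) ≡ b i
restrict-basis e b f h i = trans (cong f (sym (comb-unit e i))) (trans (h (unit i)) (combB-unit b i))
  where
  unit : ∀ {J} → Fin J → V J
  unit Fin.zero = 𝐞
  unit (Fin.suc i) = false ∷ unit i
  comb-0 : ∀ {J} (e : Fin J → V _) → comb e 0v ≡ 0v
  comb-0 e = trans (sym (mat-comb e 0v)) (·-0 (mat e))
  combB-0v : ∀ {J} (b : Fin J → Bool) → combB b 0v ≡ false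
  combB-0v {zero} b = refl
  combB-0v {suc J} b = combB-0v (λ i → b (Fin.suc i))
  comb-unit : ∀ {J} (e : Fin J → V _) i → comb e (unit i) ≡ e i
  comb-unit e Fin.zero = trans (cong (e Fin.zero ⊕v_) (comb-0 (λ i → e (Fin.suc i)))) (⊕-idʳ (e Fin.zero))
  comb-unit e (Fin.suc i) = trans (⊕-idˡ _) (comb-unit (λ i → e (Fin.suc i)) i)
  combB-unit : ∀ {J} (b : Fin J → Bool) i → combB b (unit i) ≡ b i
  combB-unit b Fin.zero = trans (cong (b Fin.zero xor_) (combB-0v (λ i → b (Fin.suc i)))) (BP.xor-identityʳ (b Fin.zero))
  combB-unit b (Fin.suc i) = combB-unit (λ i → b (Fin.suc i)) i

-- The test and its decoding

-- The ambient space is kept abstract. A x S stands for "⟨x,·⟩ agrees with T₁ on S", restr x for "⟨x,·⟩ restricts to ψ on H",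
-- num / den for the success probability of decoding, and big for the threshold it has to exceed.
module Decoding (N₀ d₀ D t J : ℕ) (td : t ℕ.+ D ≡ d₀) (E : M N₀ J) (H : VSet N₀) (H≡ : H ≡ spS E)
  (A : V N₀ → VSet N₀ → Bool) (restr : V N₀ → Bool) (num den : VSet N₀ → VSet N₀ → V N₀ → ℕ)
  (num≤den : ∀ Q W x → num Q W x ℕ.≤ den Q W x)
  (num-len : ∀ Q W x → ι (num Q W x) ≡ ∑[ L ∈ allSets N₀ ] (⟦ isGrass d₀ L ⟧ * (⟦ trivInter H L ∧ (Q ⊆ᵇ L) ∧ (L ⊆ᵇ W) ⟧ * ⟦ A x (sumS L H) ⟧)))
  (den-len : ∀ Q W x → ι (den Q W x) ≡ ∑[ L ∈ allSets N₀ ] (⟦ isGrass d₀ L ⟧ * ⟦ trivInter H L ∧ (Q ⊆ᵇ L) ∧ (L ⊆ᵇ W) ⟧))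
  (r : ℕ) (r≤d : r ℕ.≤ d₀) (big : ℚ → Bool) (thr : ∀ q → 0ℚ ≤ q → big q ≡ false → q ≤ hp D) where

  agr : V N₀ → VSet N₀ → Bool
  agr x L = A x (sumS L H)

  pD : VSet N₀ → VSet N₀ → V N₀ → ℚ
  pD Q W x = frac (num Q W x) (den Q W x)

  -- A decision procedure, so that good Q can be counted in sums and collected in a list; the
  -- existential quantifiers are searches over finite sets.
  good : ℕ → ℕ → VSet N₀ → Bool
  good r₁ r₂ Q = isGrass r₁ Q ∧ ((r₂ ℕ.≤ᵇ N₀) ∧ BL.any (λ W → isGrass (N₀ ℕ.∸ r₂) W ∧ ((sumS Q H ⊆ᵇ W) ∧
    anyᵇ (λ x → restr x ∧ big (pD Q W x)))) (allSets N₀))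

  record Good (r₁ r₂ : ℕ) (Q : VSet N₀) : Set where
    constructor mkGood
    field
      gQ : isGrass r₁ Q ≡ true
      r₂≤ : r₂ ℕ.≤ N₀
      W : VSet N₀
      gW : isGrass (N₀ ℕ.∸ r₂) W ≡ true
      QW : (sumS Q H ⊆ᵇ W) ≡ true
      x : V N₀
      rx : restr x ≡ true
      tp : big (pD Q W x) ≡ true

  good-sound : ∀ r₁ r₂ Q → good r₁ r₂ Q ≡ true → Good r₁ r₂ Q
  good-sound r₁ r₂ Q g =
    let (p₁ , g₁) = ∧-true {isGrass r₁ Q} g
        (p₂ , g₂) = ∧-true {r₂ ℕ.≤ᵇ N₀} g₁
        (W , _ , g₃) = any-elim (allSets N₀) g₂
        (p₃ , g₄) = ∧-true {isGrass (N₀ ℕ.∸ r₂) W} g₃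
        (p₄ , g₅) = ∧-true {sumS Q H ⊆ᵇ W} g₄
        (x , g₆) = anyᵇ-elim {P = λ x → restr x ∧ big (pD Q W x)} g₅
        (p₅ , p₆) = ∧-true {restr x} g₆ in
    mkGood p₁ (≤ᵇ-sound {r₂} {N₀} p₂) W p₃ p₄ x p₅ p₆

  good-complete : ∀ r₁ r₂ Q → Good r₁ r₂ Q → good r₁ r₂ Q ≡ true
  good-complete r₁ r₂ Q (mkGood p₁ p₂ W p₃ p₄ x p₅ p₆) = ∧-intro p₁ (∧-intro (≤ᵇ-complete p₂) (any-intro {Q = λ W → isGrass (N₀ ℕ.∸ r₂) W ∧ ((sumS Q H ⊆ᵇ W) ∧ anyᵇ (λ x → restr x ∧ big (pD Q W x)))} (allSets N₀) (∈-allSets W) (∧-intro p₃ (∧-intro p₄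
    (anyᵇ-intro {P = λ x → restr x ∧ big (pD Q W x)} x (∧-intro p₅ p₆))))))

  condᵇ : VSet N₀ → VSet N₀ → VSet N₀ → Bool
  condᵇ Q W L = trivInter H L ∧ (Q ⊆ᵇ L) ∧ (L ⊆ᵇ W)

  count-L : ∀ {p d'} (B : M N₀ p) → ind E B ≡ true → d' ℕ.+ p ≡ d₀ → ∀ W → IsSub W → colsIn W B ≡ true → (Γ : VSet N₀ → Bool) →
    cnt (d' ℕ.+ p) d' p * ∑[ L ∈ allSets N₀ ] (⟦ isGrass (d₀) L ⟧ * (⟦ condᵇ (spS B) W L ⟧ * ⟦ Γ L ⟧)) ≡
      ∑[ N ∈ allM N₀ d' ] (⟦ ind E (N ⧺ B) ⟧ * (⟦ colsIn W N ⟧ * ⟦ Γ (spS (N ⧺ B)) ⟧))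
  count-L {p} {d'} B iB de W sW cB Γ = sym (trans (∑-cong (allM N₀ d') λ N → cong (λ z → ⟦ ind E (N ⧺ B) ⟧ * (⟦ z ⟧ * ⟦ Γ (spS (N ⧺ B)) ⟧)) (sym (⊆-colsIn sW N B cB)))
    (trans (∑-span E B iB d' (λ L → ⟦ L ⊆ᵇ W ⟧ * ⟦ Γ L ⟧)) (cong (cnt (d' ℕ.+ p) d' p *_) (∑-cong (allSets N₀) λ L →
      trans (cong (λ z → ⟦ isGrass z L ∧ (trivInter (spS E) L ∧ (spS B ⊆ᵇ L)) ⟧ * (⟦ L ⊆ᵇ W ⟧ * ⟦ Γ L ⟧)) de) (trans (cong (λ z → ⟦ isGrass (d₀) L ∧ (trivInter z L ∧ (spS B ⊆ᵇ L)) ⟧ * (⟦ L ⊆ᵇ W ⟧ * ⟦ Γ L ⟧)) (sym H≡))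
        (reassoc (isGrass (d₀) L) (trivInter H L) (spS B ⊆ᵇ L) (L ⊆ᵇ W) ⟦ Γ L ⟧))))))
    where
    lem : ∀ a b c w g → a * (b * c) * (w * g) ≡ a * (b * (c * w) * g)
    lem = solve-∀ ℚring
    reassoc : ∀ a b c w (g : ℚ) → ⟦ a ∧ (b ∧ c) ⟧ * (⟦ w ⟧ * g) ≡ ⟦ a ⟧ * (⟦ b ∧ (c ∧ w) ⟧ * g)
    reassoc a b c w g = trans (cong (_* (⟦ w ⟧ * g)) (trans (⟦∧⟧ a (b ∧ c)) (cong (⟦ a ⟧ *_) (⟦∧⟧ b c)))) (trans (lem ⟦ a ⟧ ⟦ b ⟧ ⟦ c ⟧ ⟦ w ⟧ g)
      (cong (λ z → ⟦ a ⟧ * (z * g)) (sym (trans (⟦∧⟧ b (c ∧ w)) (cong (⟦ b ⟧ *_) (⟦∧⟧ c w))))))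

  num-∑ : ∀ {p d'} (B : M N₀ p) → ind E B ≡ true → d' ℕ.+ p ≡ d₀ → ∀ W → IsSub W → colsIn W B ≡ true → ∀ x →
    cnt (d' ℕ.+ p) d' p * ι (num (spS B) W x) ≡ ∑[ N ∈ allM N₀ d' ] (⟦ ind E (N ⧺ B) ⟧ * (⟦ colsIn W N ⟧ * ⟦ agr x (spS (N ⧺ B)) ⟧))
  num-∑ {p} {d'} B iB de W sW cB x = trans (cong (cnt (d' ℕ.+ p) d' p *_) (num-len (spS B) W x)) (count-L B iB de W sW cB (agr x))

  den-∑ : ∀ {p d'} (B : M N₀ p) → ind E B ≡ true → d' ℕ.+ p ≡ d₀ → ∀ W → IsSub W → colsIn W B ≡ true → ∀ g →
    cnt (d' ℕ.+ p) d' p * ι (den (spS B) W g) ≡ ∑[ N ∈ allM N₀ d' ] (⟦ ind E (N ⧺ B) ⟧ * ⟦ colsIn W N ⟧)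
  den-∑ {p} {d'} B iB de W sW cB g = trans (cong (cnt (d' ℕ.+ p) d' p *_) (trans (den-len (spS B) W g) (∑-cong (allSets N₀) λ L → cong (⟦ isGrass (d₀) L ⟧ *_) (sym (QP.*-identityʳ _)))))
    (trans (count-L B iB de W sW cB (λ _ → true)) (∑-cong (allM N₀ d') λ N → cong (⟦ ind E (N ⧺ B) ⟧ *_) (QP.*-identityʳ _)))

  sumS-cong : ∀ {a b} (N : M N₀ a) (N' : M N₀ b) → (∀ x → inSp (N ⧺ E) x ≡ inSp (N' ⧺ E) x) → sumS (spS N) H ≡ sumS (spS N') H
  sumS-cong N N' h = VSet-ext λ v → trans (cong (λ z → mem (sumS (spS N) z) v) H≡) (trans (mem-sumS E N v) (trans (h v) (sym (trans (cong (λ z → mem (sumS (spS N') z) v) H≡) (mem-sumS E N' v)))))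

  sum⊆ : ∀ {p} (B : M N₀ p) W → IsSub W → (sumS (spS B) H ⊆ᵇ W) ≡ colsIn W B ∧ colsIn W E
  sum⊆ B W sW = ≡-from-iff
    (λ q → let sub = λ x z → ⊆-elim {A = sumS (spS B) H} {W} q x (trans (cong (λ z → mem (sumS (spS B) z) x) H≡) (trans (mem-sumS E B x) z)) in
       ∧-intro (sp-colsIn W B λ x z → sub x (inSp-⧺ˡ B E x z)) (sp-colsIn W E λ x z → sub x (inSp-⧺ʳ B E x z)))
    (λ q → ⊆-intro {A = sumS (spS B) H} λ v m → colsIn-sp sW (B ⧺ E) (trans (colsIn-⧺ W B E) q) v (trans (sym (mem-sumS E B v)) (trans (cong (λ z → mem (sumS (spS B) z) v) (sym H≡)) m)))

  agr-cong : ∀ x {a b} (N : M N₀ a) (N' : M N₀ b) → (∀ y → inSp (N ⧺ E) y ≡ inSp (N' ⧺ E) y) → agr x (spS N) ≡ agr x (spS N')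
  agr-cong x N N' h = cong (A x) (sumS-cong N N' h)

  -- By `num-∑` and `den-∑` both counts run over extensions `N` of the basis, and their terms depend
  -- on the span of `N ⧺ B ⧺ E` only. So the decoding probability depends on Q only through Q ⊕ H.
  pD-inv : ∀ {p} (B B' : M N₀ p) → p ℕ.≤ d₀ → ind E B ≡ true → ind E B' ≡ true → (∀ x → inSp (B ⧺ E) x ≡ inSp (B' ⧺ E) x) → ∀ W → IsSub W → colsIn W B ≡ true → colsIn W B' ≡ true → ∀ x → pD (spS B) W x ≡ pD (spS B') W x
  pD-inv {p} B B' p≤ iB iB' h W sW cB cB' x = cong₂ frac
    (cancel-cnt {a = num (spS B) W x} {num (spS B') W x} c>0 (trans (num-∑ B iB de W sW cB x) (trans (∑-cong (allM N₀ d') λ N → cong₂ (λ a z → ⟦ a ⟧ * (⟦ colsIn W N ⟧ * ⟦ z ⟧)) (ind-inv E (N ⧺ B) (N ⧺ B') (ext N)) (agr-cong x (N ⧺ B) (N ⧺ B') (ext N))) (sym (num-∑ B' iB' de W sW cB' x)))))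
    (cancel-cnt {a = den (spS B) W x} {den (spS B') W x} c>0 (trans (den-∑ B iB de W sW cB x) (trans (∑-cong (allM N₀ d') λ N → cong (λ a → ⟦ a ⟧ * ⟦ colsIn W N ⟧) (ind-inv E (N ⧺ B) (N ⧺ B') (ext N))) (sym (den-∑ B' iB' de W sW cB' x)))))
    where
    d' = d₀ ℕ.∸ p
    de : d' ℕ.+ p ≡ d₀
    de = NP.m∸n+n≡m p≤
    c>0 : 0ℚ < cnt (d' ℕ.+ p) d' p
    c>0 = cnt>0 (d' ℕ.+ p) d' p NP.≤-refl
    ext : ∀ N y → inSp ((N ⧺ B) ⧺ E) y ≡ inSp ((N ⧺ B') ⧺ E) y
    ext N y = trans (inSp-⧺-assoc N B E y) (trans (inSp-⧺-cong N N (B ⧺ E) (B' ⧺ E) (λ _ → refl) h y) (sym (inSp-⧺-assoc N B' E y)))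

  good-inv : ∀ {p} r₂ (B B' : M N₀ p) → p ℕ.≤ d₀ → ind E B ≡ true → ind E B' ≡ true → (∀ x → inSp (B ⧺ E) x ≡ inSp (B' ⧺ E) x) → good p r₂ (spS B) ≡ true → good p r₂ (spS B') ≡ true
  good-inv {p} r₂ B B' p≤ iB iB' h g = good-complete p r₂ (spS B') (mkGood (grass-spS E B' iB') (Good.r₂≤ gd) W (Good.gW gd) p₄' (Good.x gd) (Good.rx gd)
      (subst (λ z → big z ≡ true) (pD-inv B B' p≤ iB iB' h W sW (proj₁ (∧-true {colsIn W B} (trans (sym (sum⊆ B W sW)) (Good.QW gd)))) (proj₁ (∧-true {colsIn W B'} (trans (sym (sum⊆ B' W sW)) p₄'))) (Good.x gd)) (Good.tp gd)))
    where
    gd = good-sound p r₂ (spS B) g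
    W = Good.W gd
    sW = grass-sub (N₀ ℕ.∸ r₂) W (Good.gW gd)
    p₄' : (sumS (spS B') H ⊆ᵇ W) ≡ true
    p₄' = trans (cong (_⊆ᵇ W) (sym (sumS-cong B B' h))) (Good.QW gd)

  -- `ind E B` restricts to Q meeting H trivially, as every Q inside an admissible L does.
  badB : ∀ r₁ r₂ → VSet N₀ → M N₀ r₁ → Bool
  badB r₁ r₂ L B = colsIn L B ∧ (ind E B ∧ good r₁ r₂ (spS B))

  rs : List ℕ
  rs = upTo (suc r)

  badR : ℕ → VSet N₀ → ℕ → Bool
  badR r₁ L r₂ = BL.any (badB r₁ r₂ L) (allM N₀ r₁)

  badS : VSet N₀ → ℕ → Bool
  badS L r₁ = BL.any (badR r₁ L) rs

  bad : VSet N₀ → Bool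
  bad L = BL.any (badS L) rs

  bad-intro : ∀ L {r₁} r₂ (B : M N₀ r₁) → r₁ ℕ.≤ r → r₂ ℕ.≤ r → colsIn L B ≡ true → ind E B ≡ true → good r₁ r₂ (spS B) ≡ true → bad L ≡ true
  bad-intro L {r₁} r₂ B p q c i g = any-intro {Q = badS L} rs (∈-upTo⁺ (ℕ.s≤s p)) (any-intro {Q = badR r₁ L} rs (∈-upTo⁺ (ℕ.s≤s q))
    (any-intro {Q = badB r₁ r₂ L} (allM N₀ r₁) (∈-allM B) (∧-intro {colsIn L B} c (∧-intro {ind E B} i g))))

  record Bad (L : VSet N₀) : Set where
    constructor mkBad
    field
      r₁ r₂ : ℕ
      r₁≤ : r₁ ℕ.≤ r
      r₂≤ : r₂ ℕ.≤ r
      B : M N₀ r₁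
      cB : colsIn L B ≡ true
      iB : ind E B ≡ true
      gB : good r₁ r₂ (spS B) ≡ true

  bad-elim : ∀ L → bad L ≡ true → Bad L
  bad-elim L e =
    let (r₁ , m₁ , e₁) = any-elim {Q = badS L} rs e
        (r₂ , m₂ , e₂) = any-elim {Q = badR r₁ L} rs e₁
        (B , _ , e₃) = any-elim {Q = badB r₁ r₂ L} (allM N₀ r₁) e₂
        (c , e₄) = ∧-true {colsIn L B} e₃
        (i , g) = ∧-true {ind E B} e₄ in
    mkBad r₁ r₂ (NP.≤-pred (∈-upTo⁻ m₁)) (NP.≤-pred (∈-upTo⁻ m₂)) B c i g

  -- Zooms are compared modulo H, so badness must be a property of L ⊕ H. The good Q inside L need
  -- not lie in L', but `lift-cols` yields a congruent Q' inside L', and `good-inv` makes it good as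
  -- well.
  bad-half : ∀ {a b} (N : M N₀ a) (N' : M N₀ b) → (∀ x → inSp (N ⧺ E) x ≡ inSp (N' ⧺ E) x) → bad (spS N) ≡ true → bad (spS N') ≡ true
  bad-half N N' h e = bad-intro (spS N') (Bad.r₂ be) B' (Bad.r₁≤ be) (Bad.r₂≤ be) cB' iB' (good-inv (Bad.r₂ be) B B' (NP.≤-trans (Bad.r₁≤ be) r≤d) (Bad.iB be) iB' (Cong-span E B B' cg) (Bad.gB be))
    where
    be = bad-elim (spS N) e
    B = Bad.B be
    lc = lift-cols E N' B λ x z → trans (sym (h x)) (inSp-⧺ˡ N E x (trans (sym (mem-spS N x)) (colsIn-sp (sub-spS N) B (Bad.cB be) x z)))
    B' = proj₁ lc
    cg = proj₁ (proj₂ lc)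
    cB' = proj₂ (proj₂ lc)
    iB' : ind E B' ≡ true
    iB' = trans (sym (ind-inv E B B' (Cong-span E B B' cg))) (Bad.iB be)

  F : V N₀ → VSet N₀ → Bool
  F x L = restr x ∧ (not (bad L) ∧ agr x L)

  F-inv : ∀ x {a b} (N : M N₀ a) (N' : M N₀ b) → (∀ y → inSp (N ⧺ E) y ≡ inSp (N' ⧺ E) y) → F x (spS N) ≡ F x (spS N')
  F-inv x N N' h = cong₂ (λ p q → restr x ∧ (not p ∧ q)) (≡-from-iff (bad-half N N' h) (bad-half N' N (λ y → sym (h y)))) (agr-cong x N N' h)

  g : V N₀ → ∀ {m} → M N₀ m → ℚ
  g x N = ⟦ ind E N ⟧ * ⟦ F x (spS N) ⟧

  g-inv : ∀ x {a b} (N : M N₀ a) (N' : M N₀ b) → a ≡ b → (∀ y → inSp (N ⧺ E) y ≡ inSp (N' ⧺ E) y) → g x N ≡ g x N'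
  g-inv x N N' refl h = cong₂ (λ p q → ⟦ p ⟧ * ⟦ q ⟧) (ind-inv E N N' h) (F-inv x N N' h)

  -- If Q is good, every L containing it is bad and the left side vanishes. If it is not, decoding
  -- fails for this W and `x`, and its success probability is below `2^(-D)` by `thr`. If `x` does
  -- not restrict to ψ, or Q is not independent modulo H, the left side vanishes as well.
  ng : ∀ x {p d'} (Q : M N₀ p) → p ℕ.≤ r → d' ℕ.+ p ≡ t ℕ.+ D → ∀ r₂ → r₂ ℕ.≤ r → r₂ ℕ.≤ N₀ → ∀ W → isGrass (N₀ ℕ.∸ r₂) W ≡ true →
    colsIn W Q ≡ true → colsIn W E ≡ true → pw D * ∑[ N ∈ allM N₀ d' ] (⟦ colsIn W N ⟧ * g x (N ⧺ Q)) ≤ ∑[ N ∈ allM N₀ d' ] ⟦ colsIn W N ⟧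
  ng x {p} {d'} Q p≤r de r₂ r₂≤r r₂≤n W gW cQ cE = bool-cases (ind E Q)
    (λ iQ → bool-cases (restr x) (λ rx → bool-cases (good p r₂ (spS Q)) (λ gd → trivial λ N → isBad N gd iQ) (λ ngd → main iQ rx ngd))
              (λ rx → trivial λ N → cong (λ z → ⟦ z ∧ (not (bad (spS (N ⧺ Q))) ∧ agr x (spS (N ⧺ Q))) ⟧) rx))
    (λ iQ → trivial' λ N → cong ⟦_⟧ (BP.¬-not λ i → false≢true iQ (ind-⧺ʳ E N Q i)))
    where
    sW = grass-sub (N₀ ℕ.∸ r₂) W gW
    lem₀ : ∀ a b → a * (b * 0ℚ) ≡ 0ℚ
    lem₀ = solve-∀ ℚring
    lem₁ : ∀ a b → a * (0ℚ * b) ≡ 0ℚ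
    lem₁ = solve-∀ ℚring
    zeroSum : (∀ N → ⟦ colsIn W N ⟧ * g x (N ⧺ Q) ≡ 0ℚ) → pw D * ∑[ N ∈ allM N₀ d' ] (⟦ colsIn W N ⟧ * g x (N ⧺ Q)) ≤ ∑[ N ∈ allM N₀ d' ] ⟦ colsIn W N ⟧
    zeroSum z = ≤-trans (≤≡ (trans (cong (pw D *_) (∑-0 (allM N₀ d') z)) (QP.*-zeroʳ (pw D)))) (∑-≥0 (allM N₀ d') λ N → ⟦⟧≥0 (colsIn W N))
    trivial : (∀ N → ⟦ F x (spS (N ⧺ Q)) ⟧ ≡ 0ℚ) → pw D * ∑[ N ∈ allM N₀ d' ] (⟦ colsIn W N ⟧ * g x (N ⧺ Q)) ≤ ∑[ N ∈ allM N₀ d' ] ⟦ colsIn W N ⟧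
    trivial z = zeroSum λ N → trans (cong (λ q → ⟦ colsIn W N ⟧ * (⟦ ind E (N ⧺ Q) ⟧ * q)) (z N)) (lem₀ ⟦ colsIn W N ⟧ ⟦ ind E (N ⧺ Q) ⟧)
    trivial' : (∀ N → ⟦ ind E (N ⧺ Q) ⟧ ≡ 0ℚ) → pw D * ∑[ N ∈ allM N₀ d' ] (⟦ colsIn W N ⟧ * g x (N ⧺ Q)) ≤ ∑[ N ∈ allM N₀ d' ] ⟦ colsIn W N ⟧
    trivial' z = zeroSum λ N → trans (cong (λ q → ⟦ colsIn W N ⟧ * (q * ⟦ F x (spS (N ⧺ Q)) ⟧)) (z N)) (lem₁ ⟦ colsIn W N ⟧ ⟦ F x (spS (N ⧺ Q)) ⟧)
    isBad : ∀ (N : M N₀ d') → good p r₂ (spS Q) ≡ true → ind E Q ≡ true → ⟦ F x (spS (N ⧺ Q)) ⟧ ≡ 0ℚ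
    isBad N gd iQ = cong ⟦_⟧ (trans (cong (λ z → restr x ∧ (not z ∧ agr x (spS (N ⧺ Q)))) (bad-intro (spS (N ⧺ Q)) r₂ Q p≤r r₂≤r (sp-colsIn (spS (N ⧺ Q)) Q λ y q → trans (mem-spS (N ⧺ Q) y) (inSp-⧺ʳ N Q y q)) iQ gd)) (BP.∧-zeroʳ (restr x)))
    de' : d' ℕ.+ p ≡ d₀
    de' = trans de td
    main : ind E Q ≡ true → restr x ≡ true → good p r₂ (spS Q) ≡ false → pw D * ∑[ N ∈ allM N₀ d' ] (⟦ colsIn W N ⟧ * g x (N ⧺ Q)) ≤ ∑[ N ∈ allM N₀ d' ] ⟦ colsIn W N ⟧
    main iQ rx ngd = begin
      pw D * ∑[ N ∈ allM N₀ d' ] (⟦ colsIn W N ⟧ * g x (N ⧺ Q))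
        ≤⟨ *-monoˡ (pw D) (pw≥0 D) (∑-mono (allM N₀ d') λ N → ≤-trans (≤≡ (*-swap ⟦ colsIn W N ⟧ ⟦ ind E (N ⧺ Q) ⟧ _)) (*-monoˡ _ (⟦⟧≥0 (ind E (N ⧺ Q))) (*-monoˡ _ (⟦⟧≥0 (colsIn W N)) (drop' (restr x) (bad (spS (N ⧺ Q))) (agr x (spS (N ⧺ Q))))))) ⟩
      pw D * ∑[ N ∈ allM N₀ d' ] (⟦ ind E (N ⧺ Q) ⟧ * (⟦ colsIn W N ⟧ * ⟦ agr x (spS (N ⧺ Q)) ⟧))
        ≡⟨ cong (pw D *_) (sym (num-∑ Q iQ de' W sW cQ x)) ⟩
      pw D * (c * ι nm)
        ≤⟨ *-monoˡ (pw D) (pw≥0 D) (*-monoˡ c (proj₁ (cnt-upper (d' ℕ.+ p) d' p NP.≤-refl)) ratio) ⟩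
      pw D * (c * (hp D * ι dn))
        ≡⟨ trans (lem₂ (pw D) c (hp D) (ι dn)) (trans (cong (_* (c * ι dn)) (pw*hp D)) (QP.*-identityˡ (c * ι dn))) ⟩
      c * ι dn
        ≡⟨ den-∑ Q iQ de' W sW cQ x ⟩
      ∑[ N ∈ allM N₀ d' ] (⟦ ind E (N ⧺ Q) ⟧ * ⟦ colsIn W N ⟧)
        ≤⟨ ∑-mono (allM N₀ d') (λ N → ⟦⟧*≤ (ind E (N ⧺ Q)) (⟦⟧≥0 (colsIn W N))) ⟩
      ∑[ N ∈ allM N₀ d' ] ⟦ colsIn W N ⟧ ∎
      where
      open QP.≤-Reasoning
      c = cnt (d' ℕ.+ p) d' p
      nm = num (spS Q) W x
      dn = den (spS Q) W x
      lem₂ : ∀ a b c e → a * (b * (c * e)) ≡ a * c * (b * e)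
      lem₂ = solve-∀ ℚring
      drop' : ∀ a b c → ⟦ a ∧ (not b ∧ c) ⟧ ≤ ⟦ c ⟧
      drop' false b c = ⟦⟧≥0 c
      drop' true true c = ⟦⟧≥0 c
      drop' true false c = ≤-refl
      small : pD (spS Q) W x ≤ hp D
      small = thr (pD (spS Q) W x) (frac-≥0 nm dn) (BP.¬-not λ tp → false≢true ngd (good-complete p r₂ (spS Q) (mkGood (grass-spS E Q iQ) r₂≤n W gW (trans (sum⊆ Q W sW) (∧-intro cQ cE)) x rx tp)))
      ratio : ι nm ≤ hp D * ι dn
      ratio = ≤-trans (≤≡ (sym (frac-mul nm dn (num≤den (spS Q) W x)))) (*-monoʳ (ι dn) (ι≥0 dn) small)

  gₓ≥0 : ∀ x {m} (N : M N₀ m) → 0ℚ ≤ g x N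
  gₓ≥0 x N = *-≥0 (⟦⟧≥0 (ind E N)) (⟦⟧≥0 (F x (spS N)))

  gₓ≤1 : ∀ x {m} (N : M N₀ m) → g x N ≤ 1ℚ
  gₓ≤1 x N = ≤-trans (⟦⟧*≤ (ind E N) (⟦⟧≥0 (F x (spS N)))) (⟦⟧≤1 (F x (spS N)))

  Glob-g : ∀ x → Glob r D (λ (N : M N₀ (t ℕ.+ D)) → g x N)
  Glob-g x = glob (gₓ≥0 x) (gₓ≤1 x) (Standard.zoom-std {N₀} {t ℕ.+ D} {J} E (g x) (g-inv x) r D (ng x))

  Inv-g : ∀ x → Inv (λ (N : M N₀ (t ℕ.+ D)) → g x N)
  Inv-g x N N' h = g-inv x N N' refl (inSp-⧺-cong N N' E E h (λ _ → refl))

  module Acceptance (T₁ T₂ : VSet N₀ → V N₀ → Bool) (ψ : V J)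
    (A-intro : ∀ x S → (∀ v → mem S v ≡ true → dot x v ≡ T₁ S v) → A x S ≡ true)
    (restr-sound : ∀ x → restr x ≡ true → Vec.map (dot x) E ≡ ψ) (restr-complete : ∀ x → Vec.map (dot x) E ≡ ψ → restr x ≡ true)
    (rkE : rk E ≡ J)
    (hT₁ : ∀ (N : M N₀ (t ℕ.+ D)) → ind E N ≡ true → LinearOn (sumS (spS N) H) (T₁ (sumS (spS N) H)) × Vec.map (T₁ (sumS (spS N) H)) E ≡ ψ) where

    agT : V N₀ → VSet N₀ → Bool
    agT x R = agreeOnᵇ R (dot x) (T₂ R)

    Pr : VSet N₀ → VSet N₀ → Bool
    Pr R L = agreeOnᵇ R (T₁ (sumS L H)) (T₂ R)

    a : V N₀ → M N₀ D → ℚ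
    a x N = ⟦ ind E N ∧ agT x (spS N) ⟧

    -- The uniform probability of a functional extending ψ: there are `2^(N₀ - J)` of them, as `E`
    -- has rank `J`.
    γ : ℚ
    γ = pw J * hp N₀

    γ≥0 : 0ℚ ≤ γ
    γ≥0 = *-≥0 (pw≥0 J) (hp≥0 N₀)

    xs : List (V N₀)
    xs = filter (λ x → restr x Data.Bool.≟ true) (allV N₀)

    ∑xs : ∀ f → ∑ xs f ≡ ∑[ x ∈ allV N₀ ] (⟦ restr x ⟧ * f x)
    ∑xs = ∑-filter restr (λ x → restr x Data.Bool.≟ true) (allV N₀)

    solutions : ∀ {m} (N : M N₀ m) → ind E N ≡ true → (c : V m) → γ * ∑[ x ∈ allV N₀ ] ⟦ Vec.map (dot x) (N ⧺ E) ==v (c Vec.++ ψ) ⟧ ≡ hp m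
    solutions {m} N i c = begin
      pw J * hp N₀ * S       ≡⟨ QP.*-assoc (pw J) (hp N₀) S ⟩
      pw J * (hp N₀ * S)     ≡⟨ cong (pw J *_) (count-solutions (N ⧺ E) (trans (rk-ind E N i) (cong (m ℕ.+_) rkE)) (c Vec.++ ψ)) ⟩
      pw J * hp (m ℕ.+ J)    ≡⟨ cong (pw J *_) (trans (cong hp (NP.+-comm m J)) (hp-+ J m)) ⟩
      pw J * (hp J * hp m)   ≡⟨ trans (sym (QP.*-assoc (pw J) (hp J) (hp m))) (trans (cong (_* hp m) (pw*hp J)) (QP.*-identityˡ (hp m))) ⟩
      hp m ∎
      where
      open ≡-Reasoning
      S = ∑[ x ∈ allV N₀ ] ⟦ Vec.map (dot x) (N ⧺ E) ==v (c Vec.++ ψ) ⟧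

    γ-sum : ∑[ x ∈ xs ] γ ≤ 1ℚ
    γ-sum = ≤-trans (≤≡ (trans (∑xs (λ _ → γ)) (trans (∑-*ʳ (allV N₀) γ (λ x → ⟦ restr x ⟧)) (QP.*-comm _ γ))))
      (≤-trans (*-monoˡ γ γ≥0 (∑-mono (allV N₀) λ x → ⟦⟧-mono λ rx → eq-complete (VE J) (restr-sound x rx))) (≤≡ (solutions [] refl [])))

    -- Besides ψ on `E`, the values on the `D` columns of `N` are prescribed by `T₂`, and all these
    -- columns together are independent.
    a-sum : ∀ N → ∑[ x ∈ xs ] (γ * a x N) ≤ hp D
    a-sum N = bool-cases (ind E N)
      (λ i → ≤-trans (≤≡ (trans (∑xs (λ x → γ * a x N)) (trans (∑-cong (allV N₀) λ x → trans (*-swap ⟦ restr x ⟧ γ (a x N)) (cong (γ *_) (sym (⟦∧⟧ (restr x) (ind E N ∧ agT x (spS N)))))) (∑-*ˡ (allV N₀) γ (λ x → ⟦ restr x ∧ (ind E N ∧ agT x (spS N)) ⟧)))))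
        (≤-trans (*-monoˡ γ γ≥0 (∑-mono (allV N₀) λ x → ⟦⟧-mono (sol x))) (≤≡ (solutions N i (Vec.map (T₂ (spS N)) N)))))
      (λ i → ≤-trans (≤≡ (∑-0 xs λ x → trans (cong (λ z → γ * ⟦ z ∧ agT x (spS N) ⟧) i) (QP.*-zeroʳ γ))) (hp≥0 D))
      where
      sol : ∀ x → restr x ∧ (ind E N ∧ agT x (spS N)) ≡ true → (Vec.map (dot x) (N ⧺ E) ==v (Vec.map (T₂ (spS N)) N Vec.++ ψ)) ≡ true
      sol x p = let (rx , q) = ∧-true {restr x} p
                    (_ , ag) = ∧-true {ind E N} q in
        eq-complete (VE (D ℕ.+ J)) (trans (VP.map-++ (dot x) N E) (cong₂ Vec._++_ (sp-map (dot x) (T₂ (spS N)) N λ v m → agree-elim (spS N) (dot x) (T₂ (spS N)) ag v (trans (mem-spS N v) m)) (restr-sound x rx)))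

    a-total : ∑[ x ∈ xs ] ∑[ N ∈ allM N₀ D ] (γ * hp (D ℕ.* N₀) * a x N) ≤ hp D
    a-total = begin
      ∑[ x ∈ xs ] ∑[ N ∈ allM N₀ D ] (γ * hp (D ℕ.* N₀) * a x N)
        ≡⟨ ∑-swap xs (allM N₀ D) _ ⟩
      ∑[ N ∈ allM N₀ D ] ∑[ x ∈ xs ] (γ * hp (D ℕ.* N₀) * a x N)
        ≡⟨ ∑-cong (allM N₀ D) (λ N → trans (∑-cong xs λ x → lem γ (hp (D ℕ.* N₀)) (a x N)) (∑-*ˡ xs (hp (D ℕ.* N₀)) (λ x → γ * a x N))) ⟩
      ∑[ N ∈ allM N₀ D ] (hp (D ℕ.* N₀) * ∑[ x ∈ xs ] (γ * a x N))
        ≤⟨ ∑-mono (allM N₀ D) (λ N → *-monoˡ (hp (D ℕ.* N₀)) (hp≥0 (D ℕ.* N₀)) (≤-trans (a-sum N) (≤≡ (sym (QP.*-identityˡ (hp D)))))) ⟩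
      ∑[ N ∈ allM N₀ D ] (hp (D ℕ.* N₀) * (1ℚ * hp D))
        ≡⟨ trans (∑-*ˡ (allM N₀ D) (hp (D ℕ.* N₀)) (λ _ → 1ℚ * hp D)) (cong (hp (D ℕ.* N₀) *_) (∑-*ʳ (allM N₀ D) (hp D) (λ _ → 1ℚ))) ⟩
      hp (D ℕ.* N₀) * (∑[ N ∈ allM N₀ D ] 1ℚ * hp D)
        ≡⟨ trans (cong (λ z → hp (D ℕ.* N₀) * (z * hp D)) (∑M-1 N₀ D)) (trans (sym (QP.*-assoc (hp (D ℕ.* N₀)) (pw (D ℕ.* N₀)) (hp D))) (trans (cong (_* hp D) (hp*pw (D ℕ.* N₀))) (QP.*-identityˡ (hp D)))) ⟩
      hp D ∎
      where
      open QP.≤-Reasoning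
      lem : ∀ c h a → c * h * a ≡ h * (c * a)
      lem = solve-∀ ℚring

    Gᵇ : M N₀ t → M N₀ D → Bool
    Gᵇ C N = ind E (C ⧺ N) ∧ (not (bad (spS (C ⧺ N))) ∧ Pr (spS N) (spS (C ⧺ N)))

    mem-sum : ∀ {m} (N : M N₀ m) v → mem (sumS (spS N) H) v ≡ inSp (N ⧺ E) v
    mem-sum N v = trans (cong (λ z → mem (sumS (spS N) z) v) H≡) (mem-sumS E N v)

    -- A fraction `2^(-(t+D))` of the functionals extending ψ takes the values of `T₁` on the
    -- columns of `C ⧺ N`. By linearity such an `x` agrees with `T₁` on all of L ⊕ H, and with `T₂`
    -- on R since the test accepts, so it contributes on the right.
    G-low : ∀ C N → hp (t ℕ.+ D) * ⟦ Gᵇ C N ⟧ ≤ ∑[ x ∈ xs ] (γ * a x N * g x (C ⧺ N))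
    G-low C N = bool-cases (Gᵇ C N) case₁ (λ e → ≤-trans (≤≡ (trans (cong (λ z → hp (t ℕ.+ D) * ⟦ z ⟧) e) (QP.*-zeroʳ (hp (t ℕ.+ D))))) (∑-≥0 xs λ x → *-≥0 (*-≥0 γ≥0 (⟦⟧≥0 (ind E N ∧ agT x (spS N)))) (gₓ≥0 x (C ⧺ N))))
      where
      L = spS (C ⧺ N)
      S = sumS L H
      lem : ∀ r γ a i f → r * (γ * a * (i * f)) ≡ γ * (r * (a * (i * f)))
      lem = solve-∀ ℚring
      case₁ : Gᵇ C N ≡ true → hp (t ℕ.+ D) * ⟦ Gᵇ C N ⟧ ≤ ∑[ x ∈ xs ] (γ * a x N * g x (C ⧺ N))
      case₁ e = begin
        hp (t ℕ.+ D) * ⟦ Gᵇ C N ⟧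
          ≡⟨ trans (cong (λ z → hp (t ℕ.+ D) * ⟦ z ⟧) e) (QP.*-identityʳ (hp (t ℕ.+ D))) ⟩
        hp (t ℕ.+ D)
          ≡⟨ sym (solutions (C ⧺ N) i vals) ⟩
        γ * ∑[ x ∈ allV N₀ ] ⟦ Vec.map (dot x) ((C ⧺ N) ⧺ E) ==v (vals Vec.++ ψ) ⟧
          ≤⟨ *-monoˡ γ γ≥0 (∑-mono (allV N₀) λ x → ⟦⟧-mono (sol x)) ⟩
        γ * ∑[ x ∈ allV N₀ ] ⟦ restr x ∧ ((ind E N ∧ agT x (spS N)) ∧ (ind E (C ⧺ N) ∧ F x L)) ⟧
          ≡⟨ sym (∑-*ˡ (allV N₀) γ (λ x → ⟦ restr x ∧ ((ind E N ∧ agT x (spS N)) ∧ (ind E (C ⧺ N) ∧ F x L)) ⟧)) ⟩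
        ∑[ x ∈ allV N₀ ] (γ * ⟦ restr x ∧ ((ind E N ∧ agT x (spS N)) ∧ (ind E (C ⧺ N) ∧ F x L)) ⟧)
          ≡⟨ ∑-cong (allV N₀) (λ x → trans (cong (γ *_) (trans (⟦∧⟧ (restr x) _) (cong (⟦ restr x ⟧ *_) (trans (⟦∧⟧ (ind E N ∧ agT x (spS N)) _) (cong (a x N *_) (⟦∧⟧ (ind E (C ⧺ N)) (F x L)))))))
               (sym (lem ⟦ restr x ⟧ γ (a x N) ⟦ ind E (C ⧺ N) ⟧ ⟦ F x L ⟧))) ⟩
        ∑[ x ∈ allV N₀ ] (⟦ restr x ⟧ * (γ * a x N * g x (C ⧺ N)))
          ≡⟨ sym (∑xs (λ x → γ * a x N * g x (C ⧺ N))) ⟩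
        ∑[ x ∈ xs ] (γ * a x N * g x (C ⧺ N)) ∎
        where
        open QP.≤-Reasoning
        i = proj₁ (∧-true {ind E (C ⧺ N)} e)
        e₂ = proj₂ (∧-true {ind E (C ⧺ N)} e)
        nb = proj₁ (∧-true {not (bad L)} e₂)
        pr = proj₂ (∧-true {not (bad L)} e₂)
        vals = Vec.map (T₁ S) (C ⧺ N)
        sol : ∀ x → (Vec.map (dot x) ((C ⧺ N) ⧺ E) ==v (vals Vec.++ ψ)) ≡ true → restr x ∧ ((ind E N ∧ agT x (spS N)) ∧ (ind E (C ⧺ N) ∧ F x L)) ≡ true
        sol x q = ∧-intro rx (∧-intro (∧-intro (ind-⧺ʳ E C N i) ag) (∧-intro i (∧-intro rx (∧-intro nb (A-intro x S λ v m → dv v (trans (sym (mem-sum (C ⧺ N) v)) m))))))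
          where
          dv : ∀ v → inSp ((C ⧺ N) ⧺ E) v ≡ true → dot x v ≡ T₁ S v
          dv = lin-agree ((C ⧺ N) ⧺ E) (T₁ S) (λ u v p p' → proj₁ (hT₁ (C ⧺ N) i) u v (trans (mem-sum (C ⧺ N) u) p) (trans (mem-sum (C ⧺ N) v) p')) x
            (trans (==v-sound q) (trans (cong (vals Vec.++_) (sym (proj₂ (hT₁ (C ⧺ N) i)))) (sym (VP.map-++ (T₁ S) (C ⧺ N) E))))
          rx : restr x ≡ true
          rx = restr-complete x (trans (sp-map (dot x) (T₁ S) E λ v m → dv v (inSp-⧺ʳ (C ⧺ N) E v m)) (proj₂ (hT₁ (C ⧺ N) i)))
          ag : agT x (spS N) ≡ true
          ag = agree-intro (spS N) (dot x) (T₂ (spS N)) λ v m → trans (dv v (inSp-⧺ˡ (C ⧺ N) E v (inSp-⧺ʳ C N v (trans (sym (mem-spS N v)) m)))) (agree-elim (spS N) (T₁ S) (T₂ (spS N)) pr v m)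

    acceptGood accept badMass : M N₀ D → ℚ
    acceptGood N = hp (t ℕ.* N₀) * ∑[ C ∈ allM N₀ t ] ⟦ Gᵇ C N ⟧
    accept N = hp (t ℕ.* N₀) * ∑[ C ∈ allM N₀ t ] ⟦ ind E (C ⧺ N) ∧ Pr (spS N) (spS (C ⧺ N)) ⟧
    badMass N = hp (t ℕ.* N₀) * ∑[ C ∈ allM N₀ t ] ⟦ ind E (C ⧺ N) ∧ bad (spS (C ⧺ N)) ⟧

    acceptGood≥0 : ∀ N → 0ℚ ≤ acceptGood N
    acceptGood≥0 N = *-≥0 (hp≥0 (t ℕ.* N₀)) (∑-≥0 (allM N₀ t) λ C → ⟦⟧≥0 (Gᵇ C N))

    avgs≥0 : ∀ x N → 0ℚ ≤ avgs t (λ (X : M N₀ (t ℕ.+ D)) → g x X) N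
    avgs≥0 x N = ≤-trans (*-≥0 (hp≥0 (t ℕ.* N₀)) (∑-≥0 (allM N₀ t) λ C → gₓ≥0 x (C ⧺ N))) (≤≡ (sym (avgs-eq t (g x) N)))

    mean-low : ∀ N → hp (t ℕ.+ D) * acceptGood N ≤ ∑[ x ∈ xs ] (γ * a x N * avgs t (λ (X : M N₀ (t ℕ.+ D)) → g x X) N)
    mean-low N = begin
      hp (t ℕ.+ D) * (hp (t ℕ.* N₀) * ∑[ C ∈ allM N₀ t ] ⟦ Gᵇ C N ⟧)
        ≡⟨ trans (*-swap (hp (t ℕ.+ D)) (hp (t ℕ.* N₀)) _) (cong (hp (t ℕ.* N₀) *_) (sym (∑-*ˡ (allM N₀ t) (hp (t ℕ.+ D)) (λ C → ⟦ Gᵇ C N ⟧)))) ⟩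
      hp (t ℕ.* N₀) * ∑[ C ∈ allM N₀ t ] (hp (t ℕ.+ D) * ⟦ Gᵇ C N ⟧)
        ≤⟨ *-monoˡ (hp (t ℕ.* N₀)) (hp≥0 (t ℕ.* N₀)) (∑-mono (allM N₀ t) λ C → G-low C N) ⟩
      hp (t ℕ.* N₀) * ∑[ C ∈ allM N₀ t ] ∑[ x ∈ xs ] (γ * a x N * g x (C ⧺ N))
        ≡⟨ cong (hp (t ℕ.* N₀) *_) (trans (∑-swap (allM N₀ t) xs _) (∑-cong xs λ x → ∑-*ˡ (allM N₀ t) (γ * a x N) (λ C → g x (C ⧺ N)))) ⟩
      hp (t ℕ.* N₀) * ∑[ x ∈ xs ] (γ * a x N * ∑[ C ∈ allM N₀ t ] g x (C ⧺ N))
        ≡⟨ trans (sym (∑-*ˡ xs (hp (t ℕ.* N₀)) (λ x → γ * a x N * ∑[ C ∈ allM N₀ t ] g x (C ⧺ N)))) (∑-cong xs λ x → trans (*-swap (hp (t ℕ.* N₀)) (γ * a x N) _) (cong (γ * a x N *_) (sym (avgs-eq t (g x) N)))) ⟩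
      ∑[ x ∈ xs ] (γ * a x N * avgs t (λ (X : M N₀ (t ℕ.+ D)) → g x X) N) ∎
      where open QP.≤-Reasoning

    -- `power-mean` with total weight at most `2^(-D)`. Of the factor `2^(-(t+D)(m+1))` on the left,
    -- the power `2^(-D m)` cancels, and only one factor `2^(-D)` is paid.
    jensen : ∀ N m → hp (t ℕ.* suc m) * hp D * acceptGood N ^ℚ suc m ≤ ∑[ x ∈ xs ] (γ * a x N * avgs t (λ (X : M N₀ (t ℕ.+ D)) → g x X) N ^ℚ suc m)
    jensen N m = *-cancelˡ-≤ (hp D ^ℚ m) h>0 (begin
      hp D ^ℚ m * (hp (t ℕ.* suc m) * hp D * acceptGood N ^ℚ suc m)
        ≡⟨ trans (lem (hp D ^ℚ m) (hp (t ℕ.* suc m)) (hp D) (acceptGood N ^ℚ suc m)) (cong (_* acceptGood N ^ℚ suc m) (sym hpow)) ⟩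
      hp (t ℕ.+ D) ^ℚ suc m * acceptGood N ^ℚ suc m
        ≡⟨ sym (^-* (hp (t ℕ.+ D)) (acceptGood N) (suc m)) ⟩
      (hp (t ℕ.+ D) * acceptGood N) ^ℚ suc m
        ≤⟨ ^-mono (*-≥0 (hp≥0 (t ℕ.+ D)) (acceptGood≥0 N)) (mean-low N) (suc m) ⟩
      (∑[ x ∈ xs ] (γ * a x N * avgs t (λ (X : M N₀ (t ℕ.+ D)) → g x X) N)) ^ℚ suc m
        ≤⟨ power-mean xs (λ x → γ * a x N) (λ x → avgs t (λ (X : M N₀ (t ℕ.+ D)) → g x X) N) (hp D) (λ x → *-≥0 γ≥0 (⟦⟧≥0 (ind E N ∧ agT x (spS N)))) (λ x → avgs≥0 x N) (a-sum N) m ⟩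
      hp D ^ℚ m * ∑[ x ∈ xs ] (γ * a x N * avgs t (λ (X : M N₀ (t ℕ.+ D)) → g x X) N ^ℚ suc m) ∎)
      where
      open QP.≤-Reasoning
      h>0 : 0ℚ < hp D ^ℚ m
      h>0 = subst (0ℚ <_) (^-^ ½ D m) (hp>0 (D ℕ.* m))
      lem : ∀ u a b p → u * (a * b * p) ≡ a * (b * u) * p
      lem = solve-∀ ℚring
      hpow : hp (t ℕ.+ D) ^ℚ suc m ≡ hp (t ℕ.* suc m) * (hp D * hp D ^ℚ m)
      hpow = trans (cong (_^ℚ suc m) (hp-+ t D)) (trans (^-* (hp t) (hp D) (suc m)) (cong (_* hp D ^ℚ suc m) (sym (^-^ ½ t (suc m)))))

    -- `accept` and `acceptGood` differ by at most `badMass`, and the `m`-th power is `m`-Lipschitz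
    -- on [0,1]. Bad L thus enter linearly, through their total mass alone.
    accept-diff : ∀ N m → accept N ^ℚ m ≤ acceptGood N ^ℚ m + ι m * badMass N
    accept-diff N m = ≤-trans (pow-diff (acceptGood≥0 N) le₁ le₂ m) (QP.+-monoʳ-≤ (acceptGood N ^ℚ m) (*-monoˡ (ι m) (ι≥0 m) le₃))
      where
      h = hp (t ℕ.* N₀)
      le₁ : acceptGood N ≤ accept N
      le₁ = *-monoˡ h (hp≥0 (t ℕ.* N₀)) (∑-mono (allM N₀ t) λ C → ⟦⟧-mono λ e → let (i , q) = ∧-true {ind E (C ⧺ N)} e in ∧-intro i (proj₂ (∧-true {not (bad (spS (C ⧺ N)))} q)))
      le₂ : accept N ≤ 1ℚ
      le₂ = ≤-trans (*-monoˡ h (hp≥0 (t ℕ.* N₀)) (∑-mono (allM N₀ t) λ C → ⟦⟧≤1 (ind E (C ⧺ N) ∧ Pr (spS N) (spS (C ⧺ N))))) (≤≡ (trans (cong (h *_) (∑M-1 N₀ t)) (hp*pw (t ℕ.* N₀))))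
      cases : ∀ i b p → ⟦ i ∧ p ⟧ ≤ ⟦ i ∧ (not b ∧ p) ⟧ + ⟦ i ∧ b ⟧
      cases false b p = ≤-refl
      cases true false p = ≤≡ (sym (QP.+-identityʳ ⟦ p ⟧))
      cases true true p = ≤-trans (⟦⟧≤1 p) ≤-refl
      lem : ∀ x y → x + y - x ≡ y
      lem = solve-∀ ℚring
      le₃ : accept N - acceptGood N ≤ badMass N
      le₃ = ≤-trans (QP.+-monoˡ-≤ (- acceptGood N) (≤-trans (*-monoˡ h (hp≥0 (t ℕ.* N₀)) (≤-trans (∑-mono (allM N₀ t) λ C → cases (ind E (C ⧺ N)) (bad (spS (C ⧺ N))) (Pr (spS N) (spS (C ⧺ N)))) (≤≡ (∑-+ (allM N₀ t) _ _)))) (≤≡ (QP.*-distribˡ-+ h _ _)))) (≤≡ (lem (acceptGood N) (badMass N)))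

    tests-low : ∀ m (X : ℚ) → ∑[ x ∈ xs ] ∑[ N ∈ allM N₀ D ] (γ * hp (D ℕ.* N₀) * a x N * avgs t (λ (Y : M N₀ (t ℕ.+ D)) → g x Y) N ^ℚ suc m) ≤ X →
      hp (t ℕ.* suc m) * hp D * (hp (D ℕ.* N₀) * ∑[ N ∈ allM N₀ D ] (accept N ^ℚ suc m)) ≤
        X + hp (t ℕ.* suc m) * hp D * (ι (suc m) * (hp (D ℕ.* N₀) * ∑[ N ∈ allM N₀ D ] badMass N))
    tests-low m X le = begin
      l * (h * ∑[ N ∈ allM N₀ D ] (accept N ^ℚ K))
        ≤⟨ *-monoˡ l l≥0 (*-monoˡ h (hp≥0 (D ℕ.* N₀)) (≤-trans (∑-mono (allM N₀ D) λ N → accept-diff N K) (≤≡ (trans (∑-+ (allM N₀ D) _ _) (cong (∑[ N ∈ allM N₀ D ] (acceptGood N ^ℚ K) +_) (∑-*ˡ (allM N₀ D) (ι K) badMass)))))) ⟩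
      l * (h * (∑[ N ∈ allM N₀ D ] (acceptGood N ^ℚ K) + ι K * ∑ (allM N₀ D) badMass))
        ≡⟨ lem l h (∑[ N ∈ allM N₀ D ] (acceptGood N ^ℚ K)) (ι K) (∑ (allM N₀ D) badMass) ⟩
      h * (l * ∑[ N ∈ allM N₀ D ] (acceptGood N ^ℚ K)) + l * (ι K * (h * ∑ (allM N₀ D) badMass))
        ≤⟨ QP.+-monoˡ-≤ (l * (ι K * (h * ∑ (allM N₀ D) badMass))) (≤-trans (*-monoˡ h (hp≥0 (D ℕ.* N₀)) (≤-trans (≤≡ (sym (∑-*ˡ (allM N₀ D) l (λ N → acceptGood N ^ℚ K)))) (∑-mono (allM N₀ D) λ N → jensen N m))) (≤-trans (≤≡ back) le)) ⟩
      X + l * (ι K * (h * ∑ (allM N₀ D) badMass)) ∎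
      where
      open QP.≤-Reasoning
      K = suc m
      h = hp (D ℕ.* N₀)
      l = hp (t ℕ.* K) * hp D
      l≥0 : 0ℚ ≤ l
      l≥0 = *-≥0 (hp≥0 (t ℕ.* K)) (hp≥0 D)
      lem : ∀ l h p i b → l * (h * (p + i * b)) ≡ h * (l * p) + l * (i * (h * b))
      lem = solve-∀ ℚring
      lem₂ : ∀ c h a v → h * (c * a * v) ≡ c * h * a * v
      lem₂ = solve-∀ ℚring
      av : V N₀ → M N₀ D → ℚ
      av x N = avgs t (λ (X : M N₀ (t ℕ.+ D)) → g x X) N ^ℚ K
      back : h * ∑[ N ∈ allM N₀ D ] ∑[ x ∈ xs ] (γ * a x N * av x N) ≡ ∑[ x ∈ xs ] ∑[ N ∈ allM N₀ D ] (γ * h * a x N * av x N)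
      back = trans (sym (∑-*ˡ (allM N₀ D) h (λ N → ∑[ x ∈ xs ] (γ * a x N * av x N)))) (trans (∑-cong (allM N₀ D) λ N → trans (sym (∑-*ˡ xs h (λ x → γ * a x N * av x N))) (∑-cong xs λ x → lem₂ γ h (a x N) (av x N))) (∑-swap (allM N₀ D) xs _))

  module RareBad (s : ℕ) (sparse : ∀ r₁ r₂ → r₁ ℕ.≤ r → r₂ ℕ.≤ r → ∑[ Q ∈ allSets N₀ ] ⟦ good r₁ r₂ Q ⟧ ≤ hp s * ∑[ Q ∈ allSets N₀ ] ⟦ isGrass r₁ Q ⟧)
    (fits : d₀ ℕ.+ rk E ℕ.≤ N₀) where

    -- At most `2^(-s) 2^(r₁ N₀)` bases `B` are good, and each lies in the span of a random `N` with
    -- probability at most `4 · 2^(r₁(d₀ - N₀))`. The powers of `2^(r₁ N₀)` cancel, so the bound is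
    -- free of the ambient dimension.
    rare : ∀ r₁ r₂ → r₁ ℕ.≤ r → r₂ ℕ.≤ r → hp (d₀ ℕ.* N₀) * ∑[ N ∈ allM N₀ d₀ ] ∑[ B ∈ allM N₀ r₁ ] (⟦ ind E N ⟧ * ⟦ badB r₁ r₂ (spS N) B ⟧) ≤ pw 2 * (pw (r ℕ.* d₀) * hp s)
    rare r₁ r₂ p₁ p₂ = begin
      hp (d₀ ℕ.* N₀) * ∑[ N ∈ allM N₀ d₀ ] ∑[ B ∈ allM N₀ r₁ ] (⟦ ind E N ⟧ * ⟦ badB r₁ r₂ (spS N) B ⟧)
        ≡⟨ cong (hp (d₀ ℕ.* N₀) *_) (trans (∑-swap (allM N₀ d₀) (allM N₀ r₁) _) (∑-cong (allM N₀ r₁) λ B → trans (∑-cong (allM N₀ d₀) λ N → re (ind E N) (colsIn (spS N) B) (ind E B) (good r₁ r₂ (spS B))) (∑-*ˡ (allM N₀ d₀) (w B) (λ N → ⟦ ind E N ⟧ * ⟦ colsIn (spS N) B ⟧)))) ⟩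
      hp (d₀ ℕ.* N₀) * ∑[ B ∈ allM N₀ r₁ ] (w B * ∑[ N ∈ allM N₀ d₀ ] (⟦ ind E N ⟧ * ⟦ colsIn (spS N) B ⟧))
        ≤⟨ *-monoˡ (hp (d₀ ℕ.* N₀)) (hp≥0 (d₀ ℕ.* N₀)) (≤-trans (∑-mono (allM N₀ r₁) each) (≤-trans (≤≡ (∑-*ʳ (allM N₀ r₁) c w)) (*-monoʳ c c≥0 (count-bases E r₁ (good r₁ r₂) (hp s) (hp≥0 s) r₁≤n (sparse r₁ r₂ p₁ p₂))))) ⟩
      hp (d₀ ℕ.* N₀) * (hp s * pw (r₁ ℕ.* N₀) * (pw 2 * (pw (r₁ ℕ.* d₀) * pw (d' ℕ.* N₀))))
        ≡⟨ lem (hp (d₀ ℕ.* N₀)) (hp s) (pw (r₁ ℕ.* N₀)) (pw 2) (pw (r₁ ℕ.* d₀)) (pw (d' ℕ.* N₀)) ⟩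
      hp (d₀ ℕ.* N₀) * (pw (d' ℕ.* N₀) * pw (r₁ ℕ.* N₀)) * (pw 2 * (pw (r₁ ℕ.* d₀) * hp s))
        ≡⟨ trans (cong (_* (pw 2 * (pw (r₁ ℕ.* d₀) * hp s))) one) (QP.*-identityˡ (pw 2 * (pw (r₁ ℕ.* d₀) * hp s))) ⟩
      pw 2 * (pw (r₁ ℕ.* d₀) * hp s)
        ≤⟨ *-monoˡ (pw 2) (pw≥0 2) (*-monoʳ (hp s) (hp≥0 s) (pw-mono (NP.*-monoˡ-≤ d₀ p₁))) ⟩
      pw 2 * (pw (r ℕ.* d₀) * hp s) ∎
      where
      open QP.≤-Reasoning
      d' = d₀ ℕ.∸ r₁
      de : d' ℕ.+ r₁ ≡ d₀
      de = NP.m∸n+n≡m (NP.≤-trans p₁ r≤d)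
      r₁≤n : r₁ ℕ.≤ N₀
      r₁≤n = NP.≤-trans (NP.≤-trans p₁ r≤d) (NP.≤-trans (NP.m≤m+n d₀ (rk E)) fits)
      w : M N₀ r₁ → ℚ
      w B = ⟦ ind E B ⟧ * ⟦ good r₁ r₂ (spS B) ⟧
      w≥0 : ∀ B → 0ℚ ≤ w B
      w≥0 B = *-≥0 (⟦⟧≥0 (ind E B)) (⟦⟧≥0 (good r₁ r₂ (spS B)))
      c = pw 2 * (pw (r₁ ℕ.* d₀) * pw (d' ℕ.* N₀))
      c≥0 : 0ℚ ≤ c
      c≥0 = *-≥0 (pw≥0 2) (*-≥0 (pw≥0 (r₁ ℕ.* d₀)) (pw≥0 (d' ℕ.* N₀)))
      lem : ∀ h s a f b e → h * (s * a * (f * (b * e))) ≡ h * (e * a) * (f * (b * s))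
      lem = solve-∀ ℚring
      one : hp (d₀ ℕ.* N₀) * (pw (d' ℕ.* N₀) * pw (r₁ ℕ.* N₀)) ≡ 1ℚ
      one = trans (cong (hp (d₀ ℕ.* N₀) *_) (trans (sym (pw-+ (d' ℕ.* N₀) (r₁ ℕ.* N₀))) (cong pw (trans (sym (NP.*-distribʳ-+ N₀ d' r₁)) (cong (ℕ._* N₀) de))))) (hp*pw (d₀ ℕ.* N₀))
      lem₁ : ∀ a b c e → a * (b * (c * e)) ≡ c * e * (a * b)
      lem₁ = solve-∀ ℚring
      re : ∀ a b c e → ⟦ a ⟧ * ⟦ b ∧ (c ∧ e) ⟧ ≡ ⟦ c ⟧ * ⟦ e ⟧ * (⟦ a ⟧ * ⟦ b ⟧)
      re a b c e = trans (cong (⟦ a ⟧ *_) (trans (⟦∧⟧ b (c ∧ e)) (cong (⟦ b ⟧ *_) (⟦∧⟧ c e)))) (lem₁ ⟦ a ⟧ ⟦ b ⟧ ⟦ c ⟧ ⟦ e ⟧)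
      cc : ∀ B → ind E B ≡ true → ∑[ N ∈ allM N₀ d₀ ] (⟦ ind E N ⟧ * ⟦ colsIn (spS N) B ⟧) ≤ c
      cc B iB = subst (λ z → ∑[ N ∈ allM N₀ z ] (⟦ ind E N ⟧ * ⟦ colsIn (spS N) B ⟧) ≤ pw 2 * (pw (r₁ ℕ.* z) * pw (d' ℕ.* N₀))) de
        (count-containing E B iB d' (NP.≤-trans (NP.≤-reflexive (trans (sym (NP.+-assoc d' r₁ (rk E))) (cong (ℕ._+ rk E) de))) fits))
      each : ∀ B → w B * ∑[ N ∈ allM N₀ d₀ ] (⟦ ind E N ⟧ * ⟦ colsIn (spS N) B ⟧) ≤ w B * c
      each B = bool-cases (ind E B) (λ i → *-monoˡ (w B) (w≥0 B) (cc B i))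
        (λ i → ≤≡ (trans (z i (∑[ N ∈ allM N₀ d₀ ] (⟦ ind E N ⟧ * ⟦ colsIn (spS N) B ⟧))) (sym (z i c))))
        where
        z₀ : ∀ x y → 0ℚ * x * y ≡ 0ℚ
        z₀ = solve-∀ ℚring
        z : ind E B ≡ false → ∀ y → w B * y ≡ 0ℚ
        z i y = trans (cong (λ q → ⟦ q ⟧ * ⟦ good r₁ r₂ (spS B) ⟧ * y) i) (z₀ ⟦ good r₁ r₂ (spS B) ⟧ y)

    bad-sum : hp (d₀ ℕ.* N₀) * ∑[ N ∈ allM N₀ d₀ ] ⟦ ind E N ∧ bad (spS N) ⟧ ≤ ι (suc r) * (ι (suc r) * (pw 2 * (pw (r ℕ.* d₀) * hp s)))
    bad-sum = begin
      h * ∑[ N ∈ allM N₀ d₀ ] ⟦ ind E N ∧ bad (spS N) ⟧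
        ≤⟨ *-monoˡ h (hp≥0 (d₀ ℕ.* N₀)) (≤-trans (∑-mono (allM N₀ d₀) union) (≤≡ (trans (∑-swap (allM N₀ d₀) rs _) (∑-cong rs λ r₁ → ∑-swap (allM N₀ d₀) rs _)))) ⟩
      h * ∑[ r₁ ∈ rs ] ∑[ r₂ ∈ rs ] X r₁ r₂
        ≡⟨ trans (sym (∑-*ˡ rs h _)) (∑-cong rs λ r₁ → sym (∑-*ˡ rs h (X r₁))) ⟩
      ∑[ r₁ ∈ rs ] ∑[ r₂ ∈ rs ] (h * X r₁ r₂)
        ≤⟨ ∑-mono-∈ rs (λ r₁ m₁ → ∑-mono-∈ rs λ r₂ m₂ → rare r₁ r₂ (NP.≤-pred (∈-upTo⁻ m₁)) (NP.≤-pred (∈-upTo⁻ m₂))) ⟩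
      ∑[ r₁ ∈ rs ] ∑[ r₂ ∈ rs ] y
        ≡⟨ trans (∑-cong rs λ _ → trans (∑-list-const rs y) (cong (λ z → ι z * y) (LP.length-upTo (suc r)))) (trans (∑-list-const rs (ι (suc r) * y)) (cong (λ z → ι z * (ι (suc r) * y)) (LP.length-upTo (suc r)))) ⟩
      ι (suc r) * (ι (suc r) * y) ∎
      where
      open QP.≤-Reasoning
      h = hp (d₀ ℕ.* N₀)
      y = pw 2 * (pw (r ℕ.* d₀) * hp s)
      X : ℕ → ℕ → ℚ
      X r₁ r₂ = ∑[ N ∈ allM N₀ d₀ ] ∑[ B ∈ allM N₀ r₁ ] (⟦ ind E N ⟧ * ⟦ badB r₁ r₂ (spS N) B ⟧)
      union : ∀ N → ⟦ ind E N ∧ bad (spS N) ⟧ ≤ ∑[ r₁ ∈ rs ] ∑[ r₂ ∈ rs ] ∑[ B ∈ allM N₀ r₁ ] (⟦ ind E N ⟧ * ⟦ badB r₁ r₂ (spS N) B ⟧)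
      union N = ≤-trans (≤≡ (⟦∧⟧ (ind E N) (bad (spS N)))) (≤-trans (*-monoˡ ⟦ ind E N ⟧ (⟦⟧≥0 (ind E N))
          (≤-trans (any-≤-∑ (badS (spS N)) rs) (∑-mono rs λ r₁ → ≤-trans (any-≤-∑ (badR r₁ (spS N)) rs) (∑-mono rs λ r₂ → any-≤-∑ (badB r₁ r₂ (spS N)) (allM N₀ r₁)))))
        (≤≡ (trans (sym (∑-*ˡ rs ⟦ ind E N ⟧ _)) (∑-cong rs λ r₁ → trans (sym (∑-*ˡ rs ⟦ ind E N ⟧ _)) (∑-cong rs λ r₂ → sym (∑-*ˡ (allM N₀ r₁) ⟦ ind E N ⟧ (λ B → ⟦ badB r₁ r₂ (spS N) B ⟧)))))))

  module Combine (T₁ T₂ : VSet N₀ → V N₀ → Bool) (ψ : V J)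
    (A-intro : ∀ x S → (∀ v → mem S v ≡ true → dot x v ≡ T₁ S v) → A x S ≡ true)
    (restr-sound : ∀ x → restr x ≡ true → Vec.map (dot x) E ≡ ψ) (restr-complete : ∀ x → Vec.map (dot x) E ≡ ψ → restr x ≡ true)
    (rkE : rk E ≡ J)
    (hT₁ : ∀ (N : M N₀ (t ℕ.+ D)) → ind E N ≡ true → LinearOn (sumS (spS N) H) (T₁ (sumS (spS N) H)) × Vec.map (T₁ (sumS (spS N) H)) E ≡ ψ)
    (fits : d₀ ℕ.+ rk E ℕ.≤ N₀) (s : ℕ)
    (sparse : ∀ r₁ r₂ → r₁ ℕ.≤ r → r₂ ℕ.≤ r → ∑[ Q ∈ allSets N₀ ] ⟦ good r₁ r₂ Q ⟧ ≤ hp s * ∑[ Q ∈ allSets N₀ ] ⟦ isGrass r₁ Q ⟧) where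

    fits' : t ℕ.+ (D ℕ.+ J) ℕ.≤ N₀
    fits' = NP.≤-trans (NP.≤-reflexive (trans (sym (NP.+-assoc t D J)) (cong₂ ℕ._+_ td (sym rkE)))) fits

    open Acceptance T₁ T₂ ψ A-intro restr-sound restr-complete rkE hT₁
    open RareBad s sparse fits
    open Test d₀ D E H H≡ T₁ T₂

    -- `pA` averages over the `C` for which `C ⧺ N` is independent modulo H, `accept` over all `C`;
    -- the former make up at least a quarter.
    accept≥¼ : ∀ N → ind E N ≡ true → ¼ * pA (spS N) ≤ accept N
    accept≥¼ N i = begin
      ¼ * pA (spS N)
        ≡⟨ cong (_* pA (spS N)) (sym (trans (*-swap (hp (t ℕ.* N₀)) ¼ (pw (t ℕ.* N₀))) (trans (cong (¼ *_) (hp*pw (t ℕ.* N₀))) (QP.*-identityʳ ¼)))) ⟩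
      hp (t ℕ.* N₀) * (¼ * pw (t ℕ.* N₀)) * pA (spS N)
        ≤⟨ *-monoʳ (pA (spS N)) (pA≥0 (spS N)) (*-monoˡ (hp (t ℕ.* N₀)) (hp≥0 (t ℕ.* N₀)) (cnt≥¼ N₀ t (D ℕ.+ rk E) (subst (λ z → t ℕ.+ (D ℕ.+ z) ℕ.≤ N₀) (sym rkE) fits'))) ⟩
      hp (t ℕ.* N₀) * cnt N₀ t (D ℕ.+ rk E) * pA (spS N)
        ≡⟨ trans (QP.*-assoc (hp (t ℕ.* N₀)) (cnt N₀ t (D ℕ.+ rk E)) (pA (spS N))) (cong (hp (t ℕ.* N₀) *_) (pA-eq t td N i)) ⟩
      accept N ∎
      where open QP.≤-Reasoning

    badMass-sum : hp (D ℕ.* N₀) * ∑ (allM N₀ D) badMass ≤ ι (suc r) * (ι (suc r) * (pw 2 * (pw (r ℕ.* (t ℕ.+ D)) * hp s)))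
    badMass-sum = ≤-trans (≤≡ (begin
      hp (D ℕ.* N₀) * ∑ (allM N₀ D) badMass
        ≡⟨ cong (hp (D ℕ.* N₀) *_) (∑-*ˡ (allM N₀ D) (hp (t ℕ.* N₀)) (λ N → ∑[ C ∈ allM N₀ t ] ⟦ ind E (C ⧺ N) ∧ bad (spS (C ⧺ N)) ⟧)) ⟩
      hp (D ℕ.* N₀) * (hp (t ℕ.* N₀) * ∑[ N ∈ allM N₀ D ] ∑[ C ∈ allM N₀ t ] ⟦ ind E (C ⧺ N) ∧ bad (spS (C ⧺ N)) ⟧)
        ≡⟨ trans (*-swap (hp (D ℕ.* N₀)) (hp (t ℕ.* N₀)) S) (trans (sym (QP.*-assoc (hp (t ℕ.* N₀)) (hp (D ℕ.* N₀)) S)) (cong (_* S) (trans (sym (hp-+ (t ℕ.* N₀) (D ℕ.* N₀))) (cong hp (sym (NP.*-distribʳ-+ N₀ t D)))))) ⟩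
      hp ((t ℕ.+ D) ℕ.* N₀) * S
        ≡⟨ cong (hp ((t ℕ.+ D) ℕ.* N₀) *_) (sym (∑-allM-⧺ t (λ (X : M N₀ (t ℕ.+ D)) → ⟦ ind E X ∧ bad (spS X) ⟧))) ⟩
      hp ((t ℕ.+ D) ℕ.* N₀) * ∑[ X ∈ allM N₀ (t ℕ.+ D) ] ⟦ ind E X ∧ bad (spS X) ⟧
        ≡⟨ cong (λ z → hp (z ℕ.* N₀) * ∑[ X ∈ allM N₀ z ] ⟦ ind E X ∧ bad (spS X) ⟧) td ⟩
      hp (d₀ ℕ.* N₀) * ∑[ X ∈ allM N₀ d₀ ] ⟦ ind E X ∧ bad (spS X) ⟧ ∎))
      (≤-trans bad-sum (≤≡ (cong (λ z → ι (suc r) * (ι (suc r) * (pw 2 * (pw (r ℕ.* z) * hp s)))) (sym td))))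
      where
      open ≡-Reasoning
      S = ∑[ N ∈ allM N₀ D ] ∑[ C ∈ allM N₀ t ] ⟦ ind E (C ⧺ N) ∧ bad (spS (C ⧺ N)) ⟧

    contradiction : ∀ k' v I m x → let c = proj₁ (core r k' v I) in D ≡ t ℕ.+ (c ℕ.+ m) → c ℕ.< t → D ℕ.≤ 2 ℕ.^ v ℕ.* t → 2 ℕ.* D ℕ.≤ 2 ℕ.^ I ℕ.* t →
      x ℕ.+ 1000 ℕ.* (t ℕ.* suc k') ≡ (t ℕ.+ D) ℕ.* suc k' → 2 ℕ.* suc k' ℕ.* (t ℕ.+ D) ℕ.≤ t ℕ.* r → (8 ℕ.* suc k' ℕ.+ 3 ℕ.* r ℕ.+ 8) ℕ.* (t ℕ.+ D) ℕ.≤ s →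
      hp x ≤ εT (suc k') → ⊥
    contradiction k' v I m x Deq c<t vle Ile xeq tr sb hx = numeric-⊥ k' r t c m x s D Deq c<t xeq tr sb hx
      (ε-low E D (suc k') (λ N → pA (spS N)) accept (εT (suc k')) (λ N → pA≥0 (spS N)) accept≥0 accept≥¼ D+J≤n (εT-eq D+J≤n (suc k')))
      badMass-sum
      -- The exponent `2 * suc k'` computes to the successor of this number.
      (tests-low (k' ℕ.+ suc (k' ℕ.+ 0)) _ (proj₂ (core r k' v I) xs γ γ≥0 γ-sum N₀ t D (λ x N → g x N) a Inv-g Glob-g (λ x N → ⟦⟧≥0 (ind E N ∧ agT x (spS N))) (λ x N → ⟦⟧≤1 (ind E N ∧ agT x (spS N))) a-total vle Ile cle tle))
      where
      c = proj₁ (core r k' v I)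
      accept≥0 : ∀ N → 0ℚ ≤ accept N
      accept≥0 N = *-≥0 (hp≥0 (t ℕ.* N₀)) (∑-≥0 (allM N₀ t) λ C → ⟦⟧≥0 (ind E (C ⧺ N) ∧ Pr (spS N) (spS (C ⧺ N))))
      D+J≤n : D ℕ.+ rk E ℕ.≤ N₀
      D+J≤n = NP.≤-trans (NP.+-monoˡ-≤ (rk E) (NP.≤-trans (NP.m≤n+m D t) (NP.≤-reflexive td))) fits
      tle : t ℕ.≤ D
      tle = NP.≤-trans (NP.m≤m+n t (c ℕ.+ m)) (NP.≤-reflexive (sym Deq))
      tc : t ℕ.+ c ℕ.≤ D
      tc = NP.≤-trans (NP.+-monoʳ-≤ t (NP.m≤m+n c m)) (NP.≤-reflexive (sym Deq))
      cle : t ℕ.+ c ℕ.+ t ℕ.+ c ℕ.≤ 2 ℕ.* D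
      cle = NP.≤-trans (NP.≤-reflexive (NP.+-assoc (t ℕ.+ c) t c)) (NP.≤-trans (NP.+-mono-≤ tc tc) (NP.≤-reflexive (cong (D ℕ.+_) (sym (NP.+-identityʳ D)))))

-- Instantiation with the given equations and tables

module Concrete (ℓ D t J : ℕ) (td : t ℕ.+ D ≡ 2 ℕ.* ℓ) (e : Fin J → V (3 ℕ.* J)) (b : Fin J → Bool)
  (wt3 : ∀ i → weight (e i) ≡ 3) (dj : ∀ i j → i ≢ j → disjointᵇ (e i) (e j) ≡ true)
  (T₁ T₂ : VSet (3 ℕ.* J) → V (3 ℕ.* J) → Bool)
  (hT₁ : ∀ L → isGrass (2 ℕ.* ℓ) L ≡ true → trivInter (HU e) L ≡ true → LinearOn (sumS L (HU e)) (T₁ (sumS L (HU e))) × RestrictsToψ e b (T₁ (sumS L (HU e))))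
  (r : ℕ) (r≤d : r ℕ.≤ 2 ℕ.* ℓ) (ξ : ℚ) (thr : ∀ q → 0ℚ ≤ q → ¬ TwoPowNeg≤ ξ (fromℕ 5 * q) → q ≤ hp D) where

  N₀ : ℕ
  N₀ = 3 ℕ.* J

  E : M N₀ J
  E = mat e

  H : VSet N₀
  H = HU e

  H≡ : H ≡ spS E
  H≡ = HU-spS e

  rkE : rk E ≡ J
  rkE = rk-indep E λ c p → comb-indep e (λ i → subst (0 ℕ.<_) (sym (wt3 i)) (ℕ.s≤s ℕ.z≤n)) dj c (trans (sym (mat-comb e c)) p)

  A : V N₀ → VSet N₀ → Bool
  A x S = agreeOnᵇ S (dot x) (T₁ S)

  ψ : V J
  ψ = Vec.tabulate b

  restr : V N₀ → Bool
  restr x = Vec.map (dot x) E ==v ψ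

  condᵇ : VSet N₀ → VSet N₀ → VSet N₀ → Bool
  condᵇ Q W L = trivInter H L ∧ (Q ⊆ᵇ L) ∧ (L ⊆ᵇ W)

  condL : VSet N₀ → VSet N₀ → List (VSet N₀)
  condL Q W = filter (λ L → condᵇ Q W L Data.Bool.≟ true) (Grass N₀ (2 ℕ.* ℓ))

  num den : VSet N₀ → VSet N₀ → V N₀ → ℕ
  num Q W x = length (filter (λ L → A x (sumS L H) Data.Bool.≟ true) (condL Q W))
  den Q W x = length (condL Q W)

  num≤den : ∀ Q W x → num Q W x ℕ.≤ den Q W x
  num≤den Q W x = LP.length-filter (λ L → A x (sumS L H) Data.Bool.≟ true) (condL Q W)

  num-len : ∀ Q W x → ι (num Q W x) ≡ ∑[ L ∈ allSets N₀ ] (⟦ isGrass (2 ℕ.* ℓ) L ⟧ * (⟦ trivInter H L ∧ (Q ⊆ᵇ L) ∧ (L ⊆ᵇ W) ⟧ * ⟦ A x (sumS L H) ⟧))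
  num-len Q W x = len-filter³ (λ L → A x (sumS L H)) (condᵇ Q W) (isGrass (2 ℕ.* ℓ)) (λ L → A x (sumS L H) Data.Bool.≟ true) (λ L → condᵇ Q W L Data.Bool.≟ true) (λ L → isGrass (2 ℕ.* ℓ) L Data.Bool.≟ true) (allSets N₀)

  den-len : ∀ Q W x → ι (den Q W x) ≡ ∑[ L ∈ allSets N₀ ] (⟦ isGrass (2 ℕ.* ℓ) L ⟧ * ⟦ trivInter H L ∧ (Q ⊆ᵇ L) ∧ (L ⊆ᵇ W) ⟧)
  den-len Q W x = len-filter² (condᵇ Q W) (isGrass (2 ℕ.* ℓ)) (λ L → condᵇ Q W L Data.Bool.≟ true) (λ L → isGrass (2 ℕ.* ℓ) L Data.Bool.≟ true) (allSets N₀)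

  big : ℚ → Bool
  big q = decB (TwoPowNeg≤? ξ (fromℕ 5 * q))

  big-thr : ∀ q → 0ℚ ≤ q → big q ≡ false → q ≤ hp D
  big-thr q q≥0 h = thr q q≥0 (decB-false (TwoPowNeg≤? ξ (fromℕ 5 * q)) h)

  module S = Decoding N₀ (2 ℕ.* ℓ) D t J td E H H≡ A restr num den num≤den num-len den-len r r≤d big big-thr

  good : ℕ → ℕ → VSet N₀ → Bool
  good = S.good

  decoded : ℕ → ℕ → List (VSet N₀)
  decoded r₁ r₂ = filter (λ Q → good r₁ r₂ Q Data.Bool.≟ true) (allSets N₀)

  decoded-unique : ∀ r₁ r₂ → Unique (decoded r₁ r₂)
  decoded-unique r₁ r₂ = UniqueP.filter⁺ (λ Q → good r₁ r₂ Q Data.Bool.≟ true) (allSets-unique N₀)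

  decoded-all : ∀ r₁ r₂ → All (λ Q → good r₁ r₂ Q ≡ true) (decoded r₁ r₂)
  decoded-all r₁ r₂ = AllP.all-filter (λ Q → good r₁ r₂ Q Data.Bool.≟ true) (allSets N₀)

  good-decode : ∀ r₁ r₂ {Q} → good r₁ r₂ Q ≡ true → ∃ λ W → r₂ ℕ.≤ 3 ℕ.* J × isGrass (3 ℕ.* J ℕ.∸ r₂) W ≡ true ×
    ((sumS Q (HU e) ⊆ᵇ W) ≡ true) × ∃ λ g → LinearOn W g × RestrictsToψ e b g × TwoPowNeg≤ ξ (fromℕ 5 * pDecode ℓ D e T₁ T₂ Q W g)
  good-decode r₁ r₂ {Q} g = G.W , G.r₂≤ , G.gW , G.QW , dot G.x , (λ u v _ _ → dot-⊕ʳ G.x u v) , restricts , decB-sound (TwoPowNeg≤? ξ (fromℕ 5 * S.pD Q G.W G.x)) G.tp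
    where
    module G = S.Good (S.good-sound r₁ r₂ Q g)
    on-basis : ∀ i → dot G.x (e i) ≡ b i
    on-basis i = trans (sym (VP.lookup∘tabulate (λ i → dot G.x (e i)) i)) (trans (cong (λ z → Vec.lookup z i) (trans (VP.tabulate-∘ (dot G.x) e) (==v-sound G.rx))) (VP.lookup∘tabulate b i))
    restricts : RestrictsToψ e b (dot G.x)
    restricts = dot-comb e b G.x on-basis

  density : ℕ → ℕ → ℚ
  density r₁ r₂ = frac (length (decoded r₁ r₂)) (length (Grass N₀ r₁))

  sparse : ∀ r₁ r₂ s → ¬ (hp s ≤ density r₁ r₂) → ∑[ Q ∈ allSets N₀ ] ⟦ good r₁ r₂ Q ⟧ ≤ hp s * ∑[ Q ∈ allSets N₀ ] ⟦ isGrass r₁ Q ⟧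
  sparse r₁ r₂ s ns = subst₂ _≤_ gd (cong (hp s *_) gr) (≤-trans (≤≡ (sym (frac-mul (length (decoded r₁ r₂)) (length (Grass N₀ r₁)) le))) (*-monoʳ (ι (length (Grass N₀ r₁))) (ι≥0 (length (Grass N₀ r₁))) (QP.<⇒≤ (QP.≰⇒> ns))))
    where
    gd : ι (length (decoded r₁ r₂)) ≡ ∑[ Q ∈ allSets N₀ ] ⟦ good r₁ r₂ Q ⟧
    gd = len-filter (good r₁ r₂) (λ Q → good r₁ r₂ Q Data.Bool.≟ true) (allSets N₀)
    gr : ι (length (Grass N₀ r₁)) ≡ ∑[ Q ∈ allSets N₀ ] ⟦ isGrass r₁ Q ⟧
    gr = len-filter (isGrass r₁) (λ Q → isGrass r₁ Q Data.Bool.≟ true) (allSets N₀)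
    le : length (decoded r₁ r₂) ℕ.≤ length (Grass N₀ r₁)
    le = ι-cancel (subst₂ _≤_ (sym gd) (sym gr) (∑-mono (allSets N₀) λ Q → ⟦⟧-mono λ p → S.Good.gQ (S.good-sound r₁ r₂ Q p)))

  module T = Test {3 ℕ.* J} {J} (2 ℕ.* ℓ) D E H H≡ T₁ T₂

  hT₁' : ∀ (N : M N₀ (t ℕ.+ D)) → ind E N ≡ true → LinearOn (sumS (spS N) H) (T₁ (sumS (spS N) H)) × Vec.map (T₁ (sumS (spS N) H)) E ≡ ψ
  hT₁' N i = proj₁ h , trans (sym (VP.tabulate-∘ (T₁ (sumS (spS N) H)) e)) (VP.tabulate-cong (restrict-basis e b (T₁ (sumS (spS N) H)) (proj₂ h)))
    where
    h = hT₁ (spS N) (subst (λ z → isGrass z (spS N) ≡ true) td (grass-spS E N i)) (subst (λ z → trivInter z (spS N) ≡ true) (sym H≡) (triv-spS E N i))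

  all-sparse-⊥ : ∀ k' v I m x → let c = proj₁ (core r k' v I) in D ≡ t ℕ.+ (c ℕ.+ m) → c ℕ.< t → D ℕ.≤ 2 ℕ.^ v ℕ.* t → 2 ℕ.* D ℕ.≤ 2 ℕ.^ I ℕ.* t →
    x ℕ.+ 1000 ℕ.* (t ℕ.* suc k') ≡ (t ℕ.+ D) ℕ.* suc k' → 2 ℕ.* suc k' ℕ.* (t ℕ.+ D) ℕ.≤ t ℕ.* r → ∀ s → (8 ℕ.* suc k' ℕ.+ 3 ℕ.* r ℕ.+ 8) ℕ.* (t ℕ.+ D) ℕ.≤ s →
    hp x ≤ εTest ℓ D e T₁ T₂ (suc k') → (∀ r₁ r₂ → r₁ ℕ.≤ r → r₂ ℕ.≤ r → ¬ (hp s ≤ density r₁ r₂)) → ⊥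
  all-sparse-⊥ k' v I m x p₁ p₂ p₃ p₄ p₅ p₆ s p₇ hx ns = S.Combine.contradiction T₁ T₂ ψ (λ x S → agree-intro S (dot x) (T₁ S)) (λ x → ==v-sound) (λ x → eq-complete (VE J)) rkE hT₁'
    (T.room k' (QP.<-≤-trans (hp>0 x) hx)) s (λ r₁ r₂ q₁ q₂ → sparse r₁ r₂ s (ns r₁ r₂ q₁ q₂))
    k' v I m x p₁ p₂ p₃ p₄ p₅ p₆ p₇ hx

-- Choice of parameters and conclusion

search : (Q : ℕ → ℕ → Set) → (∀ a b → Dec (Q a b)) → ∀ r →
  (∃ λ a → ∃ λ b → a ℕ.≤ r × b ℕ.≤ r × Q a b) ⊎ (∀ a b → a ℕ.≤ r → b ℕ.≤ r → ¬ Q a b)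
search Q Q? r with NP.anyUpTo? (λ a → NP.anyUpTo? (Q? a) (suc r)) (suc r)
... | yes (a , p , b , q , h) = inj₁ (a , b , NP.≤-pred p , NP.≤-pred q , h)
... | no ¬h = inj₂ λ a b p q h → ¬h (a , ℕ.s≤s p , b , ℕ.s≤s q , h)

module Dimensions (δ : ℚ) (ℓ D p q : ℕ) (δq : δ * ι (suc q) ≡ ι (suc p)) (δ≥0 : 0ℚ ≤ δ) (ℓ>0 : 0 ℕ.< ℓ)
  (dim : fromℕ D ≡ fromℕ 2 * (1ℚ - δ) * fromℕ ℓ) where

  d₁ t : ℕ
  d₁ = 2 ℕ.* ℓ
  t = d₁ ℕ.∸ D

  ιd : ι d₁ ≡ fromℕ 2 * fromℕ ℓ
  ιd = trans (ι-* 2 ℓ) (cong₂ _*_ (ι-int 2) (ι-int ℓ))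

  ιD : ι D ≡ ι d₁ - δ * ι d₁
  ιD = trans (ι-int D) (trans dim (trans (lem (fromℕ 2) δ (fromℕ ℓ)) (cong (λ z → z - δ * z) (sym ιd))))
    where
    lem : ∀ a δ l → a * (1ℚ - δ) * l ≡ a * l - δ * (a * l)
    lem = solve-∀ ℚring

  D≤d : D ℕ.≤ d₁
  D≤d = ι-cancel (diff≤ (δ * ι d₁) (*-≥0 δ≥0 (ι≥0 d₁)) (trans (lem (ι d₁) (δ * ι d₁)) (cong (_+ δ * ι d₁) (sym ιD))))
    where
    lem : ∀ a b → a ≡ a - b + b
    lem = solve-∀ ℚring

  td : t ℕ.+ D ≡ d₁
  td = NP.m∸n+n≡m D≤d

  ιt : ι t ≡ δ * ι d₁
  ιt = trans (sym (ι-sub D≤d)) (trans (cong (λ z → ι d₁ - z) ιD) (lem (ι d₁) (δ * ι d₁)))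
    where
    lem : ∀ a b → a - (a - b) ≡ b
    lem = solve-∀ ℚring

  tq : t ℕ.* suc q ≡ d₁ ℕ.* suc p
  tq = ι-inj (trans (ι-* t (suc q)) (trans (cong (_* ι (suc q)) ιt) (trans (lem δ (ι d₁) (ι (suc q))) (trans (cong (ι d₁ *_) δq) (sym (ι-* d₁ (suc p)))))))
    where
    lem : ∀ δ a b → δ * a * b ≡ a * (δ * b)
    lem = solve-∀ ℚring

  d≤qt : d₁ ℕ.≤ suc q ℕ.* t
  d≤qt = NP.≤-trans (NP.m≤m*n d₁ (suc p)) (NP.≤-reflexive (trans (sym tq) (NP.*-comm t (suc q))))

  d>0 : 0 ℕ.< d₁
  d>0 = NP.≤-trans ℓ>0 (NP.m≤n*m ℓ 2)

  -- That is `δ ≤ 1`: otherwise `t = δ d₁` would exceed `d₁`.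
  p≤q : suc p ℕ.≤ suc q
  p≤q = NP.*-cancelˡ-≤ d₁ {{ℕ.>-nonZero d>0}} (NP.≤-trans (NP.≤-reflexive (sym tq)) (NP.*-monoˡ-≤ (suc q) (NP.m∸n≤m d₁ D)))

  exponent : ∀ k → fromℕ 2 * (1ℚ - fromℕ 1000 * δ) * fromℕ ℓ * fromℕ k ≡ ι (d₁ ℕ.* k) - ι (1000 ℕ.* (t ℕ.* k))
  exponent k = trans (lem (fromℕ 2) δ (fromℕ ℓ) (fromℕ k) (fromℕ 1000)) (cong₂ _-_ (trans (cong₂ _*_ (sym ιd) (sym (ι-int k))) (sym (ι-* d₁ k)))
    (trans (cong₂ _*_ (sym (ι-int 1000)) (trans (cong₂ _*_ (trans (cong (δ *_) (sym ιd)) (sym ιt)) (sym (ι-int k))) (sym (ι-* t k)))) (sym (ι-* 1000 (t ℕ.* k)))))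
    where
    lem : ∀ a δ l k c → a * (1ℚ - c * δ) * l * k ≡ a * l * k - c * (δ * (a * l) * k)
    lem = solve-∀ ℚring

  -- The difference of the two sides is `t (1 - 1000 δ)`, and the hypothesis says `1000 δ ≤ 1`. So
  -- missing the decoding threshold forces a probability of at most `2^(-D)`, the density required
  -- for globalness.
  threshold : 1000 ℕ.* t ℕ.≤ d₁ → ι D ≤ fromℕ 2 * (1ℚ - fromℕ 1000 * (δ * δ)) * fromℕ ℓ
  threshold le = diff≤ (ι t * (1ℚ - ι 1000 * δ)) (*-≥0 (ι≥0 t) (≤⇒0≤- small)) (trans (lem (fromℕ 2) δ (fromℕ ℓ) (fromℕ 1000))
    (trans (cong₂ (λ a c → a - c * (δ * (δ * a))) (sym ιd) (sym (ι-int 1000))) (trans (lem₂ (ι d₁) (δ * ι d₁) δ (ι 1000)) (cong₂ (λ a b → a + b * (1ℚ - ι 1000 * δ)) (sym ιD) (sym ιt)))))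
    where
    lem : ∀ a δ l c → a * (1ℚ - c * (δ * δ)) * l ≡ a * l - c * (δ * (δ * (a * l)))
    lem = solve-∀ ℚring
    lem₂ : ∀ a b δ c → a - c * (δ * b) ≡ a - b + b * (1ℚ - c * δ)
    lem₂ = solve-∀ ℚring
    lem₃ : ∀ a δ c → a * (c * δ) ≡ c * (δ * a)
    lem₃ = solve-∀ ℚring
    small : ι 1000 * δ ≤ 1ℚ
    small = *-cancelˡ-≤ (ι d₁) (≤∧≢⇒< (ι≥0 d₁) λ z → NP.<⇒≢ d>0 (ι-inj z))
      (≤-trans (≤≡ (trans (lem₃ (ι d₁) δ (ι 1000)) (trans (cong (ι 1000 *_) (sym ιt)) (sym (ι-* 1000 t))))) (≤-trans (ι-mono le) (≤≡ (sym (QP.*-identityʳ (ι d₁))))))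

theorem4p2 :
  (k : ℕ) → 1 ℕ.≤ k →
  (δ : ℚ) (δpos : Positive δ) →
  ∃[ ℓ₀ ] ((ℓ : ℕ) → ℓ₀ ℕ.≤ ℓ →
    -- dR = 2(1-δ)ℓ, the dimension of R
    (dR : ℕ) → fromℕ dR ≡ fromℕ 2 ℚ.* (1ℚ ℚ.- δ) ℚ.* fromℕ ℓ →
    -- J pairwise variable-disjoint equations ⟨x, x_e_i⟩ = b_i on U = [3J]
    (J : ℕ) (e : Fin J → V (3 ℕ.* J)) (b : Fin J → Bool) →
    (∀ i → weight (e i) ≡ 3) →
    (∀ i j → i ≢ j → disjointᵇ (e i) (e j) ≡ true) →
    (T₁ T₂ : VSet (3 ℕ.* J) → V (3 ℕ.* J) → Bool) →
    (∀ L → isGrass (2 ℕ.* ℓ) L ≡ true → trivInter (HU e) L ≡ true →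
      LinearOn (sumS L (HU e)) (T₁ (sumS L (HU e)))
        × RestrictsToψ e b (T₁ (sumS L (HU e)))) →
    (∀ R → isGrass dR R ≡ true → trivInter (HU e) R ≡ true → LinearOn R (T₂ R)) →
    -- ε ≥ 2^(-2(1-1000δ)ℓk)
    TwoPowNeg≤ (fromℕ 2 ℚ.* (1ℚ ℚ.- fromℕ 1000 ℚ.* δ) ℚ.* fromℕ ℓ ℚ.* fromℕ k)
               (εTest ℓ dR e T₁ T₂ k) →
    ∃₂ λ r₁ r₂ → (fromℕ (r₁ ℕ.+ r₂) ℚ.≤ rStar k δ δpos) ×
      -- a set S of distinct r₁-dimensional subspaces Q, of density ≥ 2^(-6ℓ²)
      ∃ λ (S : List (VSet (3 ℕ.* J))) → Unique S × All (λ Q → isGrass r₁ Q ≡ true) S ×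
        TwoPowNeg≤ (fromℕ (6 ℕ.* ℓ ℕ.* ℓ)) (frac (length S) (length (Grass (3 ℕ.* J) r₁))) ×
        All (λ Q → ∃ λ W → r₂ ℕ.≤ 3 ℕ.* J × isGrass (3 ℕ.* J ℕ.∸ r₂) W ≡ true ×
                     ((sumS Q (HU e) ⊆ᵇ W) ≡ true) ×
                     ∃ λ g → LinearOn W g × RestrictsToψ e b g ×
                       TwoPowNeg≤ (fromℕ 2 ℚ.* (1ℚ ℚ.- fromℕ 1000 ℚ.* (δ ℚ.* δ)) ℚ.* fromℕ ℓ)
                                  (fromℕ 5 ℚ.* pDecode ℓ dR e T₁ T₂ Q W g)) S)
theorem4p2 (suc k') _ δ δpos = ℓ₀ , main
  where
  k = suc k'
  nd = numden δ δpos
  p = proj₁ nd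
  q = proj₁ (proj₂ nd)
  δq = proj₂ (proj₂ nd)
  -- The integer part of `2k/δ`. With `r = r₀ + 1` the gain `2^(-t r)` on high ranks is at most
  -- `2^(-2kd)`.
  r₀ = 2 ℕ.* k ℕ.* suc q ℕ./ suc p
  r = suc r₀
  -- Since `1/δ ≤ q + 1 ≤ 2^(q+1)`, the dimension `d` is at most `2^v t`, with `v` independent of
  -- `ℓ`.
  v = suc q
  c = proj₁ (core r k' v (suc v))
  -- The first summand makes `t` exceed the constant `c`; the second makes `(8k + 3r + 8) · 2ℓ` at
  -- most `6 ℓ²`.
  ℓ₀ = suc q ℕ.* suc c ℕ.+ (8 ℕ.* k ℕ.+ 3 ℕ.* r ℕ.+ 8)
  δ≥0 : 0ℚ ≤ δ
  δ≥0 = QP.<⇒≤ (QP.positive⁻¹ δ {{δpos}})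
  r-low : 2 ℕ.* k ℕ.* suc q ℕ.≤ r ℕ.* suc p
  r-low = NP.≤-trans (NP.≤-reflexive (DM.m≡m%n+[m/n]*n (2 ℕ.* k ℕ.* suc q) (suc p))) (NP.+-monoˡ-≤ (r₀ ℕ.* suc p) (NP.<⇒≤ (DM.m%n<n (2 ℕ.* k ℕ.* suc q) (suc p))))
  r-high : r₀ ℕ.* suc p ℕ.≤ 2 ℕ.* k ℕ.* suc q
  r-high = DM.m/n*n≤m (2 ℕ.* k ℕ.* suc q) (suc p)
  main : _
  main ℓ ℓ₀≤ℓ dR dim J e b wt3 dj T₁ T₂ hT₁ hT₂ hε = finish (search (λ r₁ r₂ → hp (6 ℕ.* ℓ ℕ.* ℓ) ≤ C.density r₁ r₂) (λ r₁ r₂ → hp (6 ℕ.* ℓ ℕ.* ℓ) QP.≤? C.density r₁ r₂) r)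
    where
    8k≤ℓ : 8 ℕ.* k ℕ.+ 3 ℕ.* r ℕ.+ 8 ℕ.≤ ℓ
    8k≤ℓ = NP.≤-trans (NP.m≤n+m _ (suc q ℕ.* suc c)) ℓ₀≤ℓ
    ℓ>0 : 0 ℕ.< ℓ
    ℓ>0 = NP.≤-trans (NP.≤-trans (ℕ.s≤s ℕ.z≤n) (NP.m≤n+m 8 (8 ℕ.* k ℕ.+ 3 ℕ.* r))) 8k≤ℓ
    open Dimensions δ ℓ dR p q δq δ≥0 ℓ>0 dim
    r≤d : r ℕ.≤ 2 ℕ.* ℓ
    r≤d = NP.≤-trans (NP.m≤n*m r 3) (NP.≤-trans (NP.m≤n+m (3 ℕ.* r) (8 ℕ.* k)) (NP.≤-trans (NP.m≤m+n _ 8) (NP.≤-trans 8k≤ℓ (NP.m≤n*m ℓ 2))))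
    ε≤1 : εTest ℓ dR e T₁ T₂ k ≤ 1ℚ
    ε≤1 = Test.εT≤1 {3 ℕ.* J} {J} (2 ℕ.* ℓ) dR (mat e) (HU e) (HU-spS e) T₁ T₂ k
    a₁ = d₁ ℕ.* k
    b₁ = 1000 ℕ.* (t ℕ.* k)
    hε' : TwoPowNeg≤ (ι a₁ - ι b₁) (εTest ℓ dR e T₁ T₂ k)
    hε' = subst (λ z → TwoPowNeg≤ z (εTest ℓ dR e T₁ T₂ k)) (exponent k) hε
    b₁≤a₁ : b₁ ℕ.≤ a₁
    -- For `1000 δ > 1` the assumed lower bound on ε would be a positive power of two, but ε is at
    -- most 1.
    b₁≤a₁ = NP.≮⇒≥ λ lt → too-big (b₁ ℕ.∸ suc a₁) (trans (lem (ι a₁) (ι b₁)) (cong -_ (trans (ι-sub (NP.<⇒≤ lt)) (cong ι (NP.+-∸-assoc 1 lt)))))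
      where
      lem : ∀ a b → a - b ≡ - (b - a)
      lem = solve-∀ ℚring
      too-big : ∀ m → ι a₁ - ι b₁ ≡ - ι (suc m) → ⊥
      too-big m eq = <⇒≱ (QP.<-≤-trans (QP.<-≤-trans (QP.+-monoʳ-< 1ℚ (QP.positive⁻¹ 1ℚ)) (≤≡ (sym (QP.*-identityʳ two)))) (pw-mono {1} {suc m} (ℕ.s≤s ℕ.z≤n))) (≤-trans (TwoPowNeg-neg m _ (subst (λ z → TwoPowNeg≤ z (εTest ℓ dR e T₁ T₂ k)) eq hε')) ε≤1)
    x = a₁ ℕ.∸ b₁
    hx : hp x ≤ εTest ℓ dR e T₁ T₂ k
    hx = TwoPowNeg-ι x _ (subst (λ z → TwoPowNeg≤ z (εTest ℓ dR e T₁ T₂ k)) (ι-sub b₁≤a₁) hε')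
    xeq : x ℕ.+ 1000 ℕ.* (t ℕ.* k) ≡ (t ℕ.+ dR) ℕ.* k
    xeq = trans (NP.m∸n+n≡m b₁≤a₁) (cong (ℕ._* k) (sym td))
    1000t≤d : 1000 ℕ.* t ℕ.≤ d₁
    1000t≤d = NP.*-cancelʳ-≤ (1000 ℕ.* t) d₁ k (NP.≤-trans (NP.≤-reflexive (NP.*-assoc 1000 t k)) b₁≤a₁)
    c<t : c ℕ.< t
    c<t = NP.*-cancelˡ-≤ (suc q) (NP.≤-trans (NP.≤-trans (NP.m≤m+n (suc q ℕ.* suc c) _) ℓ₀≤ℓ) (NP.≤-trans (NP.m≤n*m ℓ 2) d≤qt))
    tc≤D : t ℕ.+ c ℕ.≤ dR
    tc≤D = NP.+-cancelˡ-≤ t (t ℕ.+ c) dR (NP.≤-trans (NP.+-monoʳ-≤ t (NP.+-monoʳ-≤ t (NP.<⇒≤ c<t))) (NP.≤-trans (NP.≤-trans (NP.m≤m+n (t ℕ.+ (t ℕ.+ t)) (997 ℕ.* t)) (NP.≤-reflexive (lem t))) (NP.≤-trans 1000t≤d (NP.≤-reflexive (sym td)))))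
      where
      lem : ∀ t → t ℕ.+ (t ℕ.+ t) ℕ.+ 997 ℕ.* t ≡ 1000 ℕ.* t
      lem = NS.solve-∀
    m = dR ℕ.∸ (t ℕ.+ c)
    Deq : dR ≡ t ℕ.+ (c ℕ.+ m)
    Deq = trans (sym (NP.m+[n∸m]≡n tc≤D)) (NP.+-assoc t c m)
    D≤2^v : dR ℕ.≤ 2 ℕ.^ v ℕ.* t
    D≤2^v = NP.≤-trans D≤d (NP.≤-trans d≤qt (NP.*-monoˡ-≤ t (n≤2^n v)))
    2D≤ : 2 ℕ.* dR ℕ.≤ 2 ℕ.^ suc v ℕ.* t
    2D≤ = NP.≤-trans (NP.*-monoʳ-≤ 2 D≤2^v) (NP.≤-reflexive (sym (NP.*-assoc 2 (2 ℕ.^ v) t)))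
    tr : 2 ℕ.* k ℕ.* (t ℕ.+ dR) ℕ.≤ t ℕ.* r
    tr = NP.≤-trans (NP.≤-reflexive (cong (2 ℕ.* k ℕ.*_) td)) (NP.*-cancelʳ-≤ (2 ℕ.* k ℕ.* d₁) (t ℕ.* r) (suc q) (begin
      2 ℕ.* k ℕ.* d₁ ℕ.* suc q     ≡⟨ lem₁ (2 ℕ.* k) d₁ (suc q) ⟩
      d₁ ℕ.* (2 ℕ.* k ℕ.* suc q)   ≤⟨ NP.*-monoʳ-≤ d₁ r-low ⟩
      d₁ ℕ.* (r ℕ.* suc p)         ≡⟨ lem₂ d₁ r (suc p) ⟩
      d₁ ℕ.* suc p ℕ.* r           ≡⟨ cong (ℕ._* r) (sym tq) ⟩
      t ℕ.* suc q ℕ.* r           ≡⟨ lem₃ t (suc q) r ⟩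
      t ℕ.* r ℕ.* suc q ∎))
      where
      open NP.≤-Reasoning
      lem₁ : ∀ a b c → a ℕ.* b ℕ.* c ≡ b ℕ.* (a ℕ.* c)
      lem₁ = NS.solve-∀
      lem₂ : ∀ a b c → a ℕ.* (b ℕ.* c) ≡ a ℕ.* c ℕ.* b
      lem₂ = NS.solve-∀
      lem₃ : ∀ a b c → a ℕ.* b ℕ.* c ≡ a ℕ.* c ℕ.* b
      lem₃ = NS.solve-∀
    s-big : (8 ℕ.* k ℕ.+ 3 ℕ.* r ℕ.+ 8) ℕ.* (t ℕ.+ dR) ℕ.≤ 6 ℕ.* ℓ ℕ.* ℓ
    s-big = NP.≤-trans (NP.≤-reflexive (cong ((8 ℕ.* k ℕ.+ 3 ℕ.* r ℕ.+ 8) ℕ.*_) td)) (NP.≤-trans (NP.*-monoˡ-≤ (2 ℕ.* ℓ) 8k≤ℓ) (NP.≤-trans (NP.m≤m+n _ (4 ℕ.* ℓ ℕ.* ℓ)) (NP.≤-reflexive (lem ℓ))))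
      where
      lem : ∀ l → l ℕ.* (2 ℕ.* l) ℕ.+ 4 ℕ.* l ℕ.* l ≡ 6 ℕ.* l ℕ.* l
      lem = NS.solve-∀
    rstar : ∀ r₁ r₂ → r₁ ℕ.≤ r → r₂ ℕ.≤ r → fromℕ (r₁ ℕ.+ r₂) ≤ rStar k δ δpos
    rstar r₁ r₂ h₁ h₂ = ≤-trans (≤≡ (trans (sym (QP.*-identityʳ (fromℕ (r₁ ℕ.+ r₂)))) (trans (cong (fromℕ (r₁ ℕ.+ r₂) *_) (sym (QP.*-inverseʳ δ {{nz}}))) (sym (QP.*-assoc (fromℕ (r₁ ℕ.+ r₂)) δ δ⁻¹)))))
      (*-monoʳ δ⁻¹ δ⁻¹≥0 (*-cancelˡ-≤ (ι (suc q)) (ι>0 q) (≤-trans (≤≡ left) (≤-trans (ι-mono bound) (≤≡ right)))))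
      where
      nz = QP.pos⇒nonZero δ {{δpos}}
      δ⁻¹ = (ℚ.1/ δ) {{nz}}
      δ⁻¹≥0 : 0ℚ ≤ δ⁻¹
      δ⁻¹≥0 = QP.<⇒≤ (QP.positive⁻¹ δ⁻¹ {{QP.1/pos⇒pos δ {{δpos}}}})
      lem : ∀ a b δ → a * (b * δ) ≡ b * (δ * a)
      lem = solve-∀ ℚring
      left : ι (suc q) * (fromℕ (r₁ ℕ.+ r₂) * δ) ≡ ι ((r₁ ℕ.+ r₂) ℕ.* suc p)
      left = trans (lem (ι (suc q)) (fromℕ (r₁ ℕ.+ r₂)) δ) (trans (cong₂ _*_ (sym (ι-int (r₁ ℕ.+ r₂))) δq) (sym (ι-* (r₁ ℕ.+ r₂) (suc p))))
      right : ι (10 ℕ.* k ℕ.* suc q) ≡ ι (suc q) * fromℕ (10 ℕ.* k)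
      right = trans (ι-* (10 ℕ.* k) (suc q)) (trans (QP.*-comm (ι (10 ℕ.* k)) (ι (suc q))) (cong (ι (suc q) *_) (ι-int (10 ℕ.* k))))
      -- `r₁ + r₂ ≤ 2 r₀ + 2 ≤ 4k/δ + 2 ≤ 6k/δ`, the last step by `δ ≤ 1` and `k ≥ 1`.
      bound : (r₁ ℕ.+ r₂) ℕ.* suc p ℕ.≤ 10 ℕ.* k ℕ.* suc q
      bound = begin
        (r₁ ℕ.+ r₂) ℕ.* suc p
          ≤⟨ NP.*-monoˡ-≤ (suc p) (NP.+-mono-≤ h₁ h₂) ⟩
        (r ℕ.+ r) ℕ.* suc p
          ≡⟨ lem₁ r₀ (suc p) ⟩
        2 ℕ.* suc p ℕ.+ 2 ℕ.* (r₀ ℕ.* suc p)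
          ≤⟨ NP.+-mono-≤ (NP.*-monoʳ-≤ 2 (NP.≤-trans p≤q (NP.m≤n*m (suc q) k))) (NP.*-monoʳ-≤ 2 r-high) ⟩
        2 ℕ.* (k ℕ.* suc q) ℕ.+ 2 ℕ.* (2 ℕ.* k ℕ.* suc q)
          ≤⟨ NP.m≤m+n _ (4 ℕ.* (k ℕ.* suc q)) ⟩
        2 ℕ.* (k ℕ.* suc q) ℕ.+ 2 ℕ.* (2 ℕ.* k ℕ.* suc q) ℕ.+ 4 ℕ.* (k ℕ.* suc q)
          ≡⟨ lem₂ k (suc q) ⟩
        10 ℕ.* k ℕ.* suc q ∎
        where
        open NP.≤-Reasoning
        lem₁ : ∀ r p → (suc r ℕ.+ suc r) ℕ.* p ≡ 2 ℕ.* p ℕ.+ 2 ℕ.* (r ℕ.* p)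
        lem₁ = NS.solve-∀
        lem₂ : ∀ k q → 2 ℕ.* (k ℕ.* q) ℕ.+ 2 ℕ.* (2 ℕ.* k ℕ.* q) ℕ.+ 4 ℕ.* (k ℕ.* q) ≡ 10 ℕ.* k ℕ.* q
        lem₂ = NS.solve-∀
    ξ : ℚ
    ξ = fromℕ 2 * (1ℚ - fromℕ 1000 * (δ * δ)) * fromℕ ℓ
    thr : ∀ y → 0ℚ ≤ y → ¬ TwoPowNeg≤ ξ (fromℕ 5 * y) → y ≤ hp dR
    thr y y≥0 nt = ≤-trans (≤-trans (≤≡ (sym (QP.*-identityˡ y))) (*-monoʳ y y≥0 1≤5)) (below-threshold ξ dR (fromℕ 5 * y) (threshold 1000t≤d) (*-≥0 (≤-trans 0≤1 1≤5) y≥0) nt)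
      where
      1≤5 : 1ℚ ≤ fromℕ 5
      1≤5 = ≤-trans (ι-mono {1} {5} (ℕ.s≤s ℕ.z≤n)) (≤≡ (ι-int 5))
    module C = Concrete ℓ dR t J td e b wt3 dj T₁ T₂ hT₁ r r≤d ξ thr
    finish : (∃ λ r₁ → ∃ λ r₂ → r₁ ℕ.≤ r × r₂ ℕ.≤ r × hp (6 ℕ.* ℓ ℕ.* ℓ) ≤ C.density r₁ r₂) ⊎ (∀ r₁ r₂ → r₁ ℕ.≤ r → r₂ ℕ.≤ r → ¬ (hp (6 ℕ.* ℓ ℕ.* ℓ) ≤ C.density r₁ r₂)) → _
    finish (inj₁ (r₁ , r₂ , h₁ , h₂ , h)) = r₁ , r₂ , rstar r₁ r₂ h₁ h₂ , C.decoded r₁ r₂ , C.decoded-unique r₁ r₂ ,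
      All.map (λ {Q} g → C.S.Good.gQ (C.S.good-sound r₁ r₂ Q g)) (C.decoded-all r₁ r₂) ,
      subst (λ z → TwoPowNeg≤ z (C.density r₁ r₂)) (ι-int (6 ℕ.* ℓ ℕ.* ℓ)) (ι-TwoPowNeg (6 ℕ.* ℓ ℕ.* ℓ) (C.density r₁ r₂) h) ,
      All.map (λ g → C.good-decode r₁ r₂ g) (C.decoded-all r₁ r₂)
    finish (inj₂ none) = ⊥-elim (C.all-sparse-⊥ k' v (suc v) m x Deq c<t D≤2^v 2D≤ xeq tr (6 ℕ.* ℓ ℕ.* ℓ) s-big hx none)
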